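{- Let $u\in S_{p+1}$, $p\ge 1$, be an indecomposable vexillary permutation of shape $\lambda\vdash n-1$. Let $\epsilon_u$ be a signature on $\lambda$ and $N_u$ a nonnegative integer such that $\phi(u)=\phi_{\epsilon_u,N_u}$ and $N_u=\max_{1\le q\le r}\bigl(F_{p_q}(\epsilon_u)+E_{M_q}(\epsilon_u)\bigr)$, and let $\omega_u$ be an $\epsilon_u$-compatible labeling of $\lambda$. Then $$\sum_{j\ge 0}\nu_u(j)t^j=\frac{\displaystyle\sum_{T\in \mathrm{SYT}(\lambda)}t^{\mathrm{des}(T;\omega_u)-N_u}}{(1-t)^n}.$$
   Context: Permutations. $u\in S_{p+1}$ is indecomposable if $u(\{1,\dots,i\})\ne\{1,\dots,i\}$ for $i=1,\dots,p$; it is vexillary if it avoids the pattern $2143$. The code of $u$ is $(c_1,c_2,\dots)$ with $c_i=|\{j>i : u(j)<u(i)\}|$; the shape $\lambda=\lambda(u)$ is the partition obtained by sorting the nonzero entries of the code in nonincreasing order. For $i$ with $c_i>0$ let $e_i$ be the maximal $j$ with $c_j\ge c_i$; the flag $\phi(u)$ is the sequence of these $e_i$ sorted in nondecreasing order. Schubert polynomials: in $S_m$, with $w_o=m(m-1)\cdots1$, $\mathfrak{S}_{w_o}=x_1^{m-1}x_2^{m-2}\cdots x_{m-1}$, and $\mathfrak{S}_{ws_i}=\partial_i\mathfrak{S}_w$ whenever $w(i)>w(i+1)$, where $s_i=(i,i+1)$ and $\partial_i f=(f-s_i\cdot f)/(x_i-x_{i+1})$. For $j\ge0$, $1^j\times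 u$ fixes $1,\dots,j$ and sends $j+i\mapsto j+u(i)$, and $\nu_u(j)=\mathfrak{S}_{1^j\times u}(1,1,\dots)$. Signatures. Let $\lambda$ be a nonempty partition with $l$ parts, written $\lambda=(p_1^{m_1},\dots,p_r^{m_r})$ with $p_1>\cdots>p_r>0$ and $m_q\geq 1$, and let $M_q=m_1+\cdots+m_q$ (the $p_q$ are unrelated to the $p$ in $S_{p+1}$). A signature on $\lambda$ is a pair $\epsilon=(e,f)\in\{0,1\}^{l-1}\times\{0,1\}^{\lambda_1-1}$. Put $E_i=E_i(\epsilon)=\sum_{k=1}^{i-1}e_k$ for $1\le i\le l$, $F_j=F_j(\epsilon)=\sum_{k=1}^{j-1}f_k$ for $1\le j\le\lambda_1$, and $\bar E_i=i-1-E_i$. For an integer $N$, $\phi_{\epsilon,N}=(\phi_1^{m_1},\dots,\phi_r^{m_r})$ (meaning $\phi_q$ repeated $m_q$ times) where $\phi_q=N+1-F_{p_q}+\bar E_{M_q}$. Labelings. A labeling of $\lambda$ is a bijection $\omega$ from the cells $(i,j)$ (row $i$, column $j$) of its Young diagram to $\{1,\dots,|\lambda|\}$. It is $\epsilon$-compatible if, for all pairs of adjacent cells of $\lambda$, $\omega(i,j)>\omega(i+1,j)$ if and only if $e_i=1$, and $\omega(i,j)>\omega(i,j+1)$ if and only if $f_j=1$. $\mathrm{SYT}(\lambda)$ is the set of standard Young tableaux of shape $\lambda$; $\mathrm{des}(T;\omega)$ is the number of $k<|\lambda|$ with $\omega(T^{ -1}(k))>\omega(T^{ -1}(k+1))$,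 where $T^{ -1}(k)$ is the cell of $T$ containing $k$. -}

module Defs where

open import Data.Nat as ℕ using (ℕ; zero; suc; z≤n; s≤s; _∸_)
import Data.Nat.Properties as ℕₚ
open import Data.Nat.Induction using (<-wellFounded)
open import Data.Integer as ℤ using (ℤ; +_; -[1+_]; 0ℤ; 1ℤ; -1ℤ)
import Data.Integer.Properties as ℤₚ
open import Data.Integer.Tactic.RingSolver using (solve-∀)
open import Data.Bool using (true; false; if_then_else_)
open import Data.Sum using (inj₁; inj₂)
open import Data.Fin using (Fin; zero; suc; toℕ; inject₁; opposite)
import Data.Fin.Properties as Finₚ
open import Data.Fin.Permutation as Perm
  using (Permutation′; _⟨$⟩ʳ_; transpose; _∘ₚ_; lift₀)
import Data.Fin.Permutation.Components as PC
open import Data.List as List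
  using (List; []; _∷_; _++_; map; concatMap; filter; length; take; lookup
        ; allFin; cartesianProduct; cartesianProductWith; replicate; derun; reverse)
open import Data.Nat.ListAction using (sum)
open import Data.List.Extrema.Nat using (max)
open import Data.List.Relation.Unary.All using (All; []; _∷_)
open import Data.List.Sort.InsertionSort ℕₚ.≤-decTotalOrder using (sort)
open import Data.Vec as Vec using (Vec; []; _∷_)
import Data.Vec.Properties as Vecₚ
open import Data.Product as Product using (∃; Σ; _×_; _,_; proj₁; proj₂)
import Data.Product.Properties as Productₚ
open import Function using (_∘_; _⇔_; _↔_; Inverse)
open import Function.Definitions using (Injective; StrictlySurjective)
open import Induction.WellFounded using (Acc; acc)
open import Relation.Nullary using (¬_; Dec; yes; no; does)
open import Relation.Nullary.Decidable using (map′; _×-dec_; _→-dec_)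
open import Relation.Nullary.Negation using (contradiction)
open import Relation.Unary using (Decidable; Pred)
open import Level using (0ℓ)
open import Relation.Binary.PropositionalEquality
  using (_≡_; _≢_; refl; sym; trans; cong; cong₂; subst; module ≡-Reasoning)

-- Positions and values are counted from 0, so position i of the usual
-- one-line notation is the element of Fin with toℕ equal to i - 1.

Indecomposable : ∀ {p} → Permutation′ (suc p) → Set
Indecomposable {p} u =
  ∀ i → 1 ℕ.≤ i → i ℕ.≤ p →
  ¬ (∀ k → (∃ λ l → toℕ l ℕ.< i × u ⟨$⟩ʳ l ≡ k) ⇔ (toℕ k ℕ.< i))

Vexillary : ∀ {m} → Permutation′ m → Set
Vexillary u =
  ∀ {a b c d} → toℕ a ℕ.< toℕ b → toℕ b ℕ.< toℕ c → toℕ c ℕ.< toℕ d →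
  ¬ (toℕ (u ⟨$⟩ʳ b) ℕ.< toℕ (u ⟨$⟩ʳ a)
     × toℕ (u ⟨$⟩ʳ a) ℕ.< toℕ (u ⟨$⟩ʳ d)
     × toℕ (u ⟨$⟩ʳ d) ℕ.< toℕ (u ⟨$⟩ʳ c))

code : ∀ {m} → Permutation′ m → Fin m → ℕ
code u i =
  length (filter (λ j → (toℕ i ℕ.<? toℕ j) ×-dec (toℕ (u ⟨$⟩ʳ j) ℕ.<? toℕ (u ⟨$⟩ʳ i)))
                 (allFin _))

-- Partitions are nonincreasing lists of positive numbers.
shape : ∀ {m} → Permutation′ m → List ℕ
shape u = reverse (sort (filter (0 ℕ.<?_) (map (code u) (allFin _))))

lastAtLeast : ∀ {m} → Permutation′ m → Fin m → ℕ
lastAtLeast u i =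
  max 0 (map (suc ∘ toℕ) (filter (λ j → code u i ℕ.≤? code u j) (allFin _)))

flag : ∀ {m} → Permutation′ m → List ℕ
flag u = sort (map (lastAtLeast u) (filter (λ i → 0 ℕ.<? code u i) (allFin _)))

1^_×_ : ∀ j {p} → Permutation′ (suc p) → Permutation′ (suc (j ℕ.+ p))
1^ zero  × u = u
1^ suc j × u = lift₀ (1^ j × u)

-- Integer polynomials in k variables, as lists of terms (c , a), each
-- standing for c x₁^a₁ ⋯ x_k^a_k; two lists are the same polynomial when
-- they are related by _≈ₚ_.
Poly : ℕ → Set
Poly k = List (ℤ × Vec ℕ k)

_≟ᵐ_ : ∀ {k} (a b : Vec ℕ k) → Dec (a ≡ b)
_≟ᵐ_ = Vecₚ.≡-dec ℕ._≟_

coeff : ∀ {k} → Poly k → Vec ℕ k → ℤ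
coeff []            a = 0ℤ
coeff ((c , b) ∷ f) a = (if does (b ≟ᵐ a) then c else 0ℤ) ℤ.+ coeff f a

infix 4 _≈ₚ_
_≈ₚ_ : ∀ {k} → Poly k → Poly k → Set
f ≈ₚ g = ∀ a → coeff f a ≡ coeff g a

mono : ∀ {k} → Vec ℕ k → Poly k
mono a = (1ℤ , a) ∷ []

unit : ∀ {k} → Fin k → Vec ℕ k
unit {k} i = Vec.replicate k 0 Vec.[ i ]≔ 1

var : ∀ {k} → Fin k → Poly k
var i = mono (unit i)

scale : ∀ {k} → ℤ → Poly k → Poly k
scale c = map (Product.map₁ (c ℤ.*_))

infixl 6 _-ₚ_
infixl 7 _*ₚ_

_-ₚ_ : ∀ {k} → Poly k → Poly k → Poly k
f -ₚ g = f ++ scale -1ℤ g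

_*ₚ_ : ∀ {k} → Poly k → Poly k → Poly k
_*ₚ_ = cartesianProductWith (λ (c , a) (d , b) → c ℤ.* d , Vec.zipWith ℕ._+_ a b)

swapᵐ : ∀ {n} → Fin n → Vec ℕ (suc n) → Vec ℕ (suc n)
swapᵐ zero    (a ∷ b ∷ v) = b ∷ a ∷ v
swapᵐ (suc i) (a ∷ v)     = a ∷ swapᵐ i v

-- The action of sᵢ on polynomials.
swapVars : ∀ {n} → Fin n → Poly (suc n) → Poly (suc n)
swapVars i = map (Product.map₂ (swapᵐ i))

eval : ∀ {k} → Vec ℤ k → Poly k → ℤ
eval ρ []            = 0ℤ
eval ρ ((c , a) ∷ f) =
  c ℤ.* Vec.foldr′ ℤ._*_ 1ℤ (Vec.zipWith ℤ._^_ ρ a) ℤ.+ eval ρ f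

-- geo d a b v = Σ_{t<d} x^(a+d-1-t) y^(b+t) z^v, so that
-- (x - y) · geo d a b v = (x^(a+d) y^b - x^a y^(b+d)) z^v.
geo : ∀ {k} → ℕ → ℕ → ℕ → Vec ℕ k → Poly (suc (suc k))
geo zero    a b v = []
geo (suc d) a b v = (1ℤ , (d ℕ.+ a) ∷ b ∷ v) ∷ geo d a (suc b) v

∂ᵐ : ∀ {n} → Fin n → Vec ℕ (suc n) → Poly (suc n)
∂ᵐ zero    (a ∷ b ∷ v) = geo (a ∸ b) b b v -ₚ geo (b ∸ a) a a v
∂ᵐ (suc i) (a ∷ v)     = map (Product.map₂ (a ∷_)) (∂ᵐ i v)

-- Divided difference; see ∂-quotient below.
∂ : ∀ {n} → Fin n → Poly (suc n) → Poly (suc n)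
∂ i = concatMap (λ (c , a) → scale c (∂ᵐ i a))

private
  -- Linear extension of h from monomials to polynomials.
  L : ∀ {k} → (Vec ℕ k → ℤ) → Poly k → ℤ
  L h []            = 0ℤ
  L h ((c , a) ∷ f) = c ℤ.* h a ℤ.+ L h f

  δ : ∀ {k} → Vec ℕ k → Vec ℕ k → ℤ
  δ a b = if does (b ≟ᵐ a) then 1ℤ else 0ℤ

  coeff-L : ∀ {k} (f : Poly k) a → coeff f a ≡ L (δ a) f
  coeff-L []            a = refl
  coeff-L ((c , b) ∷ f) a with does (b ≟ᵐ a)
  ... | true  = cong₂ ℤ._+_ (sym (ℤₚ.*-identityʳ c)) (coeff-L f a)
  ... | false = cong₂ ℤ._+_ (sym (ℤₚ.*-zeroʳ c)) (coeff-L f a)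

  L-++ : ∀ {k} (h : Vec ℕ k → ℤ) f g → L h (f ++ g) ≡ L h f ℤ.+ L h g
  L-++ h []            g = sym (ℤₚ.+-identityˡ _)
  L-++ h ((c , a) ∷ f) g =
    trans (cong (ℤ._+_ (c ℤ.* h a)) (L-++ h f g)) (sym (ℤₚ.+-assoc (c ℤ.* h a) _ _))

  L-scale : ∀ {k} (h : Vec ℕ k → ℤ) c f → L h (scale c f) ≡ c ℤ.* L h f
  L-scale h c []            = sym (ℤₚ.*-zeroʳ c)
  L-scale h c ((d , a) ∷ f) =
    trans (cong (ℤ._+_ (c ℤ.* d ℤ.* h a)) (L-scale h c f)) (lem c d (h a) (L h f))
    where
    lem : ∀ c d x y → c ℤ.* d ℤ.* x ℤ.+ c ℤ.* y ≡ c ℤ.* (d ℤ.* x ℤ.+ y)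
    lem = solve-∀

  L-- : ∀ {k} (h : Vec ℕ k → ℤ) f g → L h (f -ₚ g) ≡ L h f ℤ.- L h g
  L-- h f g = trans (L-++ h f _) (cong (ℤ._+_ (L h f))
                (trans (L-scale h -1ℤ g) (ℤₚ.-1*i≡-i (L h g))))

  L-map : ∀ {k l} (h : Vec ℕ l → ℤ) (φ : Vec ℕ k → Vec ℕ l) f →
          L h (map (Product.map₂ φ) f) ≡ L (h ∘ φ) f
  L-map h φ []            = refl
  L-map h φ ((c , a) ∷ f) = cong (ℤ._+_ (c ℤ.* h (φ a))) (L-map h φ f)

  module _ {n} (i : Fin n) (h : Vec ℕ (suc n) → ℤ) where
    twist : Vec ℕ (suc n) → ℤ
    twist a = h (Vec.zipWith ℕ._+_ (unit (inject₁ i)) a)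
              ℤ.- h (Vec.zipWith ℕ._+_ (unit (suc i)) a)

    L-mulVar : ∀ f → L h ((var (inject₁ i) -ₚ var (suc i)) *ₚ f) ≡ L twist f
    L-mulVar f = trans (L-++ h (map _ f) _) (trans
      (cong (ℤ._+_ (L h (map _ f))) (trans (L-++ h (map _ f) []) (ℤₚ.+-identityʳ _)))
      (go f))
      where
      lem : ∀ c x y r s →
            (1ℤ ℤ.* c) ℤ.* x ℤ.+ r ℤ.+ ((-1ℤ ℤ.* 1ℤ ℤ.* c) ℤ.* y ℤ.+ s)
            ≡ c ℤ.* (x ℤ.- y) ℤ.+ (r ℤ.+ s)
      lem = solve-∀
      go : ∀ f →
        L h (map (λ (d , b) → 1ℤ ℤ.* d , Vec.zipWith ℕ._+_ (unit (inject₁ i)) b) f)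
        ℤ.+ L h (map (λ (d , b) → -1ℤ ℤ.* 1ℤ ℤ.* d , Vec.zipWith ℕ._+_ (unit (suc i)) b) f)
        ≡ L twist f
      go []            = refl
      go ((c , a) ∷ f) = trans (lem c _ _ _ _) (cong (ℤ._+_ (c ℤ.* twist a)) (go f))

  module _ {k} (h : Vec ℕ (suc (suc k)) → ℤ) where
    L-geo : ∀ d a b v →
            L (twist zero h) (geo d a b v)
            ≡ h ((d ℕ.+ a) ∷ b ∷ v) ℤ.- h (a ∷ (d ℕ.+ b) ∷ v)
    L-geo zero    a b v = sym (ℤₚ.+-inverseʳ (h (a ∷ b ∷ v)))
    L-geo (suc d) a b v
      rewrite L-geo d a (suc b) v
            | ℕₚ.+-suc d b
            | Vecₚ.zipWith-identityˡ {f = ℕ._+_} {e = 0} (λ _ → refl) v =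
      lem (h (suc (d ℕ.+ a) ∷ b ∷ v)) (h ((d ℕ.+ a) ∷ suc b ∷ v)) (h (a ∷ suc (d ℕ.+ b) ∷ v))
      where
      lem : ∀ x y z → 1ℤ ℤ.* (x ℤ.- y) ℤ.+ (y ℤ.- z) ≡ x ℤ.- z
      lem = solve-∀

  L-∂ᵐ : ∀ {n} (i : Fin n) h a →
         L (twist i h) (∂ᵐ i a) ≡ h a ℤ.- h (swapᵐ i a)
  L-∂ᵐ zero h (a ∷ b ∷ v) with ℕₚ.≤-total a b
  ... | inj₁ a≤b
        rewrite L-- (twist zero h) (geo (a ∸ b) b b v) (geo (b ∸ a) a a v)
              | ℕₚ.m≤n⇒m∸n≡0 a≤b | L-geo h (b ∸ a) a a v | ℕₚ.m∸n+n≡m a≤b =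
          lem (h (b ∷ a ∷ v)) (h (a ∷ b ∷ v))
    where
    lem : ∀ x y → 0ℤ ℤ.- (x ℤ.- y) ≡ y ℤ.- x
    lem = solve-∀
  ... | inj₂ b≤a
        rewrite L-- (twist zero h) (geo (a ∸ b) b b v) (geo (b ∸ a) a a v)
              | ℕₚ.m≤n⇒m∸n≡0 b≤a | L-geo h (a ∸ b) b b v | ℕₚ.m∸n+n≡m b≤a = ℤₚ.+-identityʳ _
  L-∂ᵐ (suc i) h (a ∷ v) =
    trans (L-map (twist (suc i) h) (a ∷_) (∂ᵐ i v)) (L-∂ᵐ i (h ∘ (a ∷_)) v)

  L-∂ : ∀ {n} (i : Fin n) h f →
        L (twist i h) (∂ i f) ≡ L h f ℤ.- L h (swapVars i f)
  L-∂ i h []            = refl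
  L-∂ i h ((c , a) ∷ f)
    rewrite L-++ (twist i h) (scale c (∂ᵐ i a)) (∂ i f)
          | L-scale (twist i h) c (∂ᵐ i a)
          | L-∂ᵐ i h a | L-∂ i h f =
    lem c (h a) (h (swapᵐ i a)) (L h f) (L h (swapVars i f))
    where
    lem : ∀ c x y r s →
          c ℤ.* (x ℤ.- y) ℤ.+ (r ℤ.- s) ≡ (c ℤ.* x ℤ.+ r) ℤ.- (c ℤ.* y ℤ.+ s)
    lem = solve-∀

∂-quotient : ∀ {n} (i : Fin n) (f : Poly (suc n)) →
             (var (inject₁ i) -ₚ var (suc i)) *ₚ ∂ i f ≈ₚ f -ₚ swapVars i f
∂-quotient i f a = begin
  coeff ((var (inject₁ i) -ₚ var (suc i)) *ₚ ∂ i f) a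
    ≡⟨ coeff-L ((var (inject₁ i) -ₚ var (suc i)) *ₚ ∂ i f) a ⟩
  L (δ a) ((var (inject₁ i) -ₚ var (suc i)) *ₚ ∂ i f)
    ≡⟨ L-mulVar i (δ a) (∂ i f) ⟩
  L (twist i (δ a)) (∂ i f)
    ≡⟨ L-∂ i (δ a) f ⟩
  L (δ a) f ℤ.- L (δ a) (swapVars i f)
    ≡⟨ L-- (δ a) f (swapVars i f) ⟨
  L (δ a) (f -ₚ swapVars i f)
    ≡⟨ coeff-L (f -ₚ swapVars i f) a ⟨
  coeff (f -ₚ swapVars i f) a ∎
  where open ≡-Reasoning

-- Product w s_i in the convention (w s_i)(k) = w(s_i(k)): composition
-- _∘ₚ_ applies its left argument first.
_·s_ : ∀ {n} → Permutation′ (suc n) → Fin n → Permutation′ (suc n)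
w ·s i = transpose (inject₁ i) (suc i) ∘ₚ w

staircase : ∀ {n} → Vec ℕ (suc n)
staircase = Vec.tabulate (toℕ ∘ opposite)

-- In step, the last hypothesis says that g is the divided difference of f.
data IsSchubert {n} : Permutation′ (suc n) → Poly (suc n) → Set where
  top  : ∀ {w f} → w Perm.≈ Perm.reverse → f ≈ₚ mono staircase → IsSchubert w f
  step : ∀ {v w f g} i → IsSchubert w f →
         toℕ (w ⟨$⟩ʳ suc i) ℕ.< toℕ (w ⟨$⟩ʳ inject₁ i) →
         v Perm.≈ (w ·s i) →
         (var (inject₁ i) -ₚ var (suc i)) *ₚ g ≈ₚ f -ₚ swapVars i f →
         IsSchubert v g

private
  τ : ∀ {n} → Fin n → Fin (suc n) → Fin (suc n)
  τ i = PC.transpose (inject₁ i) (suc i)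

  τ-suc : ∀ {n} (i : Fin n) k → τ (suc i) (suc k) ≡ suc (τ i k)
  τ-suc i k with does (k Finₚ.≟ inject₁ i)
  ... | true = refl
  ... | false with does (k Finₚ.≟ suc i)
  ...   | true  = refl
  ...   | false = refl

  τ-left : ∀ {n} (i : Fin n) → τ i (inject₁ i) ≡ suc i
  τ-left zero    = refl
  τ-left (suc i) = trans (τ-suc i (inject₁ i)) (cong suc (τ-left i))

  τ-right : ∀ {n} (i : Fin n) → τ i (suc i) ≡ inject₁ i
  τ-right zero    = refl
  τ-right (suc i) = trans (τ-suc i (suc i)) (cong suc (τ-right i))

  τ-involutive : ∀ {n} (i : Fin n) k → τ i (τ i k) ≡ k
  τ-involutive zero    zero          = refl
  τ-involutive zero    (suc zero)    = refl
  τ-involutive zero    (suc (suc k)) = refl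
  τ-involutive (suc i) zero          = refl
  τ-involutive (suc i) (suc k)       =
    trans (cong (τ (suc i)) (τ-suc i k))
          (trans (τ-suc i (τ i k)) (cong suc (τ-involutive i k)))

  total weight : ∀ {m} → (Fin m → ℕ) → ℕ
  total {zero}  g = 0
  total {suc m} g = g zero ℕ.+ total (g ∘ suc)
  -- weight g = Σ_k k · g(k)
  weight {zero}  g = 0
  weight {suc m} g = total (g ∘ suc) ℕ.+ weight (g ∘ suc)

  total-cong : ∀ {m} {g h : Fin m → ℕ} → (∀ k → g k ≡ h k) → total g ≡ total h
  total-cong {zero}  eq = refl
  total-cong {suc m} eq = cong₂ ℕ._+_ (eq zero) (total-cong (eq ∘ suc))

  weight-cong : ∀ {m} {g h : Fin m → ℕ} → (∀ k → g k ≡ h k) → weight g ≡ weight h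
  weight-cong {zero}  eq = refl
  weight-cong {suc m} eq = cong₂ ℕ._+_ (total-cong (eq ∘ suc)) (weight-cong (eq ∘ suc))

  total-τ : ∀ {n} (i : Fin n) (g : Fin (suc n) → ℕ) → total (g ∘ τ i) ≡ total g
  total-τ {suc n} zero    g = swap₃ (g (suc zero)) (g zero) _
    where
    swap₃ : ∀ x y z → x ℕ.+ (y ℕ.+ z) ≡ y ℕ.+ (x ℕ.+ z)
    swap₃ x y z = trans (sym (ℕₚ.+-assoc x y z))
                        (trans (cong (ℕ._+ z) (ℕₚ.+-comm x y)) (ℕₚ.+-assoc y x z))
  total-τ {suc n} (suc i) g = cong (g zero ℕ.+_)
    (trans (total-cong (λ k → cong g (τ-suc i k))) (total-τ i (g ∘ suc)))

  weight-τ : ∀ {n} (i : Fin n) (g : Fin (suc n) → ℕ) →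
             g (inject₁ i) ℕ.< g (suc i) → weight (g ∘ τ i) ℕ.< weight g
  weight-τ {suc n} zero    g lt = ℕₚ.+-monoˡ-< _ (ℕₚ.+-monoˡ-< _ lt)
  weight-τ {suc n} (suc i) g lt = ℕₚ.+-mono-≤-<
    (ℕₚ.≤-reflexive (trans (total-cong (λ k → cong g (τ-suc i k))) (total-τ i (g ∘ suc))))
    (subst (ℕ._< weight (g ∘ suc)) (sym (weight-cong (λ k → cong g (τ-suc i k))))
           (weight-τ i (g ∘ suc) lt))

  Decreasing : ∀ {n} → (Fin (suc n) → ℕ) → Set
  Decreasing g = ∀ i → g (suc i) ℕ.< g (inject₁ i)

  decreasing-lower : ∀ {n} (g : Fin (suc n) → ℕ) → Decreasing g →
                     ∀ k → n ℕ.≤ g k ℕ.+ toℕ k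
  decreasing-lower {zero}  g dec k       = z≤n
  decreasing-lower {suc n} g dec zero    =
    ℕₚ.≤-trans (s≤s (decreasing-lower (g ∘ suc) (dec ∘ suc) zero))
               (ℕₚ.+-monoˡ-< 0 (dec zero))
  decreasing-lower {suc n} g dec (suc k) =
    subst (suc n ℕ.≤_) (sym (ℕₚ.+-suc _ _))
          (s≤s (decreasing-lower (g ∘ suc) (dec ∘ suc) k))

  decreasing-upper : ∀ {n} (g : Fin (suc n) → ℕ) → Decreasing g →
                     ∀ k → g k ℕ.+ toℕ k ℕ.≤ g zero
  decreasing-upper         g dec zero    = ℕₚ.≤-reflexive (ℕₚ.+-identityʳ _)
  decreasing-upper {suc n} g dec (suc k) =
    subst (ℕ._≤ g zero) (sym (ℕₚ.+-suc _ _))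
          (ℕₚ.≤-<-trans (decreasing-upper (g ∘ suc) (dec ∘ suc) k) (dec zero))

  no-ascent⇒reverse : ∀ {n} (w : Permutation′ (suc n)) →
    ¬ (∃ λ i → toℕ (w ⟨$⟩ʳ inject₁ i) ℕ.< toℕ (w ⟨$⟩ʳ suc i)) →
    w Perm.≈ Perm.reverse
  no-ascent⇒reverse {n} w none k = Finₚ.toℕ-injective (begin
    g k                       ≡⟨ ℕₚ.m+n∸n≡m (g k) (toℕ k) ⟨
    g k ℕ.+ toℕ k ∸ toℕ k     ≡⟨ cong (_∸ toℕ k) exact ⟩
    n ∸ toℕ k                 ≡⟨ Finₚ.opposite-prop k ⟨
    toℕ (opposite k)          ∎)
    where
    open ≡-Reasoning
    g : Fin (suc n) → ℕ
    g = toℕ ∘ (w ⟨$⟩ʳ_)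
    distinct : ∀ i → suc i ≢ inject₁ i
    distinct i eq = ℕₚ.1+n≢n (trans (cong toℕ eq) (Finₚ.toℕ-inject₁ i))
    dec : Decreasing g
    dec i = ℕₚ.≤∧≢⇒< (ℕₚ.≮⇒≥ (λ lt → none (i , lt)))
      (λ eq → distinct i (trans (sym (Perm.inverseˡ w))
        (trans (cong (Inverse.from w) (Finₚ.toℕ-injective eq)) (Perm.inverseˡ w))))
    exact : g k ℕ.+ toℕ k ≡ n
    exact = ℕₚ.≤-antisym
      (ℕₚ.≤-trans (decreasing-upper g dec k) (ℕₚ.≤-pred (Finₚ.toℕ<n (w ⟨$⟩ʳ zero))))
      (decreasing-lower g dec k)

  schubert-acc : ∀ {n} (w : Permutation′ (suc n)) →
                 Acc ℕ._<_ (weight (toℕ ∘ (w ⟨$⟩ʳ_))) → ∃ (IsSchubert w)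
  schubert-acc w (acc rec)
    with Finₚ.any? (λ i → toℕ (w ⟨$⟩ʳ inject₁ i) ℕ.<? toℕ (w ⟨$⟩ʳ suc i))
  ... | no none = mono staircase , top (no-ascent⇒reverse w none) (λ _ → refl)
  ... | yes (i , ascent) =
    let f , isSchubert = schubert-acc (w ·s i) (rec (weight-τ i (toℕ ∘ (w ⟨$⟩ʳ_)) ascent))
    in ∂ i f , step i isSchubert
         (subst (λ k → toℕ (w ⟨$⟩ʳ τ i (suc i)) ℕ.< toℕ (w ⟨$⟩ʳ k)) (sym (τ-left i))
           (subst (λ k → toℕ (w ⟨$⟩ʳ k) ℕ.< toℕ (w ⟨$⟩ʳ suc i)) (sym (τ-right i)) ascent))
         (λ k → cong (w ⟨$⟩ʳ_) (sym (τ-involutive i k)))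
         (∂-quotient i f)

schubert : ∀ {n} (w : Permutation′ (suc n)) → ∃ (IsSchubert w)
schubert w = schubert-acc w (<-wellFounded _)

-- The rules determine the polynomial up to _≈ₚ_, because the operators ∂
-- satisfy the braid relations.
𝔖 : ∀ {n} → Permutation′ (suc n) → Poly (suc n)
𝔖 w = proj₁ (schubert w)

ν : ∀ {p} → Permutation′ (suc p) → ℕ → ℤ
ν u j = eval (Vec.replicate _ 1ℤ) (𝔖 (1^ j × u))

firstPart : List ℕ → ℕ
firstPart []      = 0
firstPart (x ∷ _) = x

record Signature (lam : List ℕ) : Set where
  field
    e : Vec (Fin 2) (length lam ∸ 1)
    f : Vec (Fin 2) (firstPart lam ∸ 1)

  -- The arguments of E, F and Ē count from 1.
  E F : ℕ → ℕ
  E i = sum (take (i ∸ 1) (map toℕ (Vec.toList e)))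
  F j = sum (take (j ∸ 1) (map toℕ (Vec.toList f)))

  Ē : ℕ → ℤ
  Ē i = + i ℤ.- 1ℤ ℤ.- + E i

-- The exponential notation lam = (p₁^m₁ , … , p_r^m_r).
module Blocks (lam : List ℕ) where
  parts : List ℕ
  parts = derun ℕ._≟_ lam

  r : ℕ
  r = length parts

  mult : ℕ → ℕ
  mult x = length (filter (x ℕ.≟_) lam)

  part : Fin r → ℕ
  part = lookup parts

  M : Fin r → ℕ
  M q = sum (map mult (take (suc (toℕ q)) parts))

module _ {lam : List ℕ} (ε : Signature lam) where
  open Signature ε
  open Blocks lam

  signatureFlag : ℤ → List ℤ
  signatureFlag N =
    concatMap (λ q → replicate (mult (part q)) (N ℤ.+ 1ℤ ℤ.- + F (part q) ℤ.+ Ē (M q)))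
              (allFin r)

  maxFE : ℕ
  maxFE = max 0 (map (λ q → F (part q) ℕ.+ E (M q)) (allFin r))

-- Cells, labels and entries are all counted from 0.
record Cell (lam : List ℕ) : Set where
  constructor cell
  field
    i : Fin (length lam)
    j : Fin (lookup lam i)

  row col : ℕ
  row = toℕ i
  col = toℕ j

open Cell using (row; col)

_≟ᶜ_ : ∀ {lam} (c d : Cell lam) → Dec (c ≡ d)
cell i j ≟ᶜ cell k l =
  map′ (λ { refl → refl }) (λ { refl → refl })
       (Productₚ.≡-dec Finₚ._≟_ Finₚ._≟_ (i , j) (k , l))

Labeling : List ℕ → Set
Labeling lam = Cell lam ↔ Fin (sum lam)

label : ∀ {lam} → Labeling lam → Cell lam → ℕ
label ω c = toℕ (Inverse.to ω c)

record Compatible {lam} (ε : Signature lam) (ω : Labeling lam) : Set where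
  open Signature ε
  field
    vertical   : ∀ i (c d : Cell lam) →
                 row c ≡ toℕ i → row d ≡ suc (toℕ i) → col c ≡ col d →
                 (label ω d ℕ.< label ω c) ⇔ (Vec.lookup e i ≡ suc zero)
    horizontal : ∀ j (c d : Cell lam) →
                 row c ≡ row d → col c ≡ toℕ j → col d ≡ suc (toℕ j) →
                 (label ω d ℕ.< label ω c) ⇔ (Vec.lookup f j ≡ suc zero)

Filling : ℕ → List ℕ → Set
Filling N = All (Vec (Fin N))

entry : ∀ {N lam} → Filling N lam → Cell lam → Fin N
entry (xs ∷ T) (cell zero    j) = Vec.lookup xs j
entry (xs ∷ T) (cell (suc i) j) = entry T (cell i j)

allVecs : ∀ {A : Set} → List A → ∀ k → List (Vec A k)
allVecs xs zero    = [] ∷ []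
allVecs xs (suc k) = cartesianProductWith _∷_ xs (allVecs xs k)

allFillings : ∀ N lam → List (Filling N lam)
allFillings N []        = [] ∷ []
allFillings N (k ∷ lam) = cartesianProductWith _∷_ (allVecs (allFin N) k) (allFillings N lam)

record IsStandard {lam} (T : Filling (sum lam) lam) : Set where
  field
    injective  : Injective _≡_ _≡_ (entry T)
    surjective : StrictlySurjective _≡_ (entry T)
    rows       : ∀ c d → row c ≡ row d → col c ℕ.< col d →
                 toℕ (entry T c) ℕ.< toℕ (entry T d)
    columns    : ∀ c d → col c ≡ col d → row c ℕ.< row d →
                 toℕ (entry T c) ℕ.< toℕ (entry T d)

module _ {lam : List ℕ} {P : Pred (Cell lam) 0ℓ} (P? : Decidable P) where
  allCells? : Dec (∀ c → P c)
  allCells? = map′ (λ h (cell i j) → h i j) (λ h i j → h (cell i j))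
                   (Finₚ.all? λ i → Finₚ.all? λ j → P? (cell i j))

  anyCell? : Dec (∃ P)
  anyCell? = map′ (λ (i , j , p) → cell i j , p) (λ (cell i j , p) → i , j , p)
                  (Finₚ.any? λ i → Finₚ.any? λ j → P? (cell i j))

isStandard? : ∀ {lam} → Decidable (IsStandard {lam})
isStandard? T =
  map′ (λ (inj , sur , rs , cs) → record
          { injective = inj _ _ ; surjective = sur ; rows = rs ; columns = cs })
       (λ S → let open IsStandard S in (λ _ _ → injective) , surjective , rows , columns)
       ((allCells? λ c → allCells? λ d →
           (entry T c Finₚ.≟ entry T d) →-dec (c ≟ᶜ d))
        ×-dec (Finₚ.all? λ k → anyCell? λ c → entry T c Finₚ.≟ k)
        ×-dec (allCells? λ c → allCells? λ d →
           (row c ℕ.≟ row d) →-dec (col c ℕ.<? col d) →-dec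
           (toℕ (entry T c) ℕ.<? toℕ (entry T d)))
        ×-dec (allCells? λ c → allCells? λ d →
           (col c ℕ.≟ col d) →-dec (row c ℕ.<? row d) →-dec
           (toℕ (entry T c) ℕ.<? toℕ (entry T d))))

record SYT (lam : List ℕ) : Set where
  constructor mkSYT
  field
    filling    : Filling (sum lam) lam
    isStandard : IsStandard filling

  T⁻¹ : Fin (sum lam) → Cell lam
  T⁻¹ k = proj₁ (IsStandard.surjective isStandard k)

-- Every standard Young tableau exactly once.
allSYT : ∀ lam → List (SYT lam)
allSYT lam = concatMap select (allFillings (sum lam) lam)
  where
  select : Filling (sum lam) lam → List (SYT lam)
  select T with isStandard? T
  ... | yes S = mkSYT T S ∷ []
  ... | no  _ = []

des : ∀ {lam} → SYT lam → Labeling lam → ℕ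
des {lam} T ω =
  length (filter (λ (k , k′) → (toℕ k′ ℕ.≟ suc (toℕ k))
                               ×-dec (label ω (T⁻¹ k′) ℕ.<? label ω (T⁻¹ k)))
                 (cartesianProduct (allFin (sum lam)) (allFin (sum lam))))
  where open SYT T

-- Formal Laurent series in t, given by the coefficients of t^k for k : ℤ.
Laurent : Set
Laurent = ℤ → ℤ

-- Σ_{j ≥ 0} a(j) t^j
powerSeries : (ℕ → ℤ) → Laurent
powerSeries a (+ j)    = a j
powerSeries a -[1+ _ ] = 0ℤ

-- Σ_{d ∈ ds} t^d
sumOfPowers : List ℤ → Laurent
sumOfPowers ds k = + length (filter (k ℤ.≟_) ds)

[1-t]·_ : Laurent → Laurent
([1-t]· a) k = a k ℤ.- a (k ℤ.- 1ℤ)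

[1-t]^_·_ : ℕ → Laurent → Laurent
[1-t]^ zero  · a = a
[1-t]^ suc n · a = [1-t]· ([1-t]^ n · a)

-- A = B / (1 - t)^n; the quotient is unique among series with only
-- finitely many terms of negative degree.
_≗_/[1-t]^_ : Laurent → Laurent → ℕ → Set
A ≗ B /[1-t]^ n = ∀ k → ([1-t]^ n · A) k ≡ B k

{-# OPTIONS --safe #-}
module Submission where

-- At points with distinct integer coordinates a divided difference is determined by the values
-- of the polynomial, so Schubert polynomials are compared there. Wachs's theorem identifies
-- 𝔖_w, for w vexillary, with a sum over chains of horizontal strips in which each row is
-- required to be complete as soon as the flag forbids it to grow. It is proved by descending
-- from the longest permutation along ascents that keep the permutation vexillary: the exchange
-- removes one cell of the shape, and only the two exchanged letters matter. Congruences modulo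
-- arbitrarily large integers then give the value at (1, 1, …), which counts the column-strict
-- tableaux whose row bounds are the flag φ(u) + j.
--
-- Subtracting the partial sums E and F of the signature from the entries turns these tableaux
-- into (P, ω)-partitions with entries in {0, …, N + j}; the flag bounds of the other rows and
-- columns follow from those at the corners of the shape. As N is the maximum of F + E over the
-- corners, there are no (P, ω)-partitions with entries in {0, …, N - 1}, so that the series in j
-- is the full generating function divided by t^(N + 1). Sorting the cells of a (P, ω)-partition
-- by entries, then by labels, gives a standard tableau T, and the partitions sorted by T
-- contribute t^(des T + 1) / (1 - t)^n.

open import Defs
open import Data.Nat using (ℕ; zero; suc; pred; _+_; _*_; _∸_; _⊔_; _⊓_; _≤_; _<_; _≥_; z≤n; s≤s; _≤?_; _<?_)
import Data.Nat.Properties as ℕₚ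
open import Data.Nat.ListAction using (sum)
open import Data.Nat.Tactic.RingSolver using () renaming (solve-∀ to solve-∀ℕ)
open import Data.Integer as ℤ using (ℤ; +_; -[1+_]; _-_; _^_; 0ℤ; 1ℤ; -1ℤ) renaming (_+_ to _⊕_; _*_ to _⊗_)
import Data.Integer.Properties as ℤₚ
open import Data.Integer.Divisibility.Signed as Div using (_∣_; divides)
open import Data.Integer.Tactic.RingSolver using (solve-∀)
open import Data.Bool using (true; false; if_then_else_)
open import Data.Empty using (⊥-elim)
open import Data.Unit using (⊤; tt)
open import Data.Sum using (_⊎_; inj₁; inj₂)
open import Data.Product using (∃; _×_; _,_; proj₁; proj₂)
open import Data.Fin as Fin using (Fin; zero; suc; toℕ; inject₁; opposite; fromℕ<)
import Data.Fin.Properties as Finₚ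
open import Data.Fin.Permutation as Perm using (Permutation′; _⟨$⟩ʳ_; lift₀)
import Data.Fin.Permutation.Components as PC
open import Data.List as List
  using (List; []; _∷_; map; _++_; length; filter; upTo; downFrom; applyUpTo; allFin; concatMap; cartesianProduct; cartesianProductWith; replicate; derun; reverse)
import Data.List.Properties as Listₚ
import Data.List.Extrema.Nat as Extrema
open import Data.List.Membership.Propositional using (_∈_)
import Data.List.Membership.Propositional.Properties as ∈ₚ
open import Data.List.Relation.Binary.Permutation.Propositional using (_↭_; ↭-refl; ↭-trans)
import Data.List.Relation.Binary.Permutation.Propositional.Properties as ↭ₚ
open import Data.List.Relation.Binary.Sublist.Propositional as Sublist using (_⊆_; []; _∷_; _∷ʳ_; ⊆-trans)
import Data.List.Relation.Binary.Sublist.Propositional.Properties as Subₚ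
open import Data.List.Relation.Unary.All as All using (All; []; _∷_)
import Data.List.Relation.Unary.All.Properties as Allₚ
open import Data.List.Relation.Unary.AllPairs as AllPairs using (AllPairs; []; _∷_)
import Data.List.Relation.Unary.AllPairs.Properties as AllPairsₚ
open import Data.List.Relation.Unary.Any as Any using (Any; here; there; any?)
open import Data.List.Relation.Unary.Linked.Properties using (Linked⇒AllPairs)
open import Data.List.Relation.Unary.Unique.Propositional using () renaming (Unique to Distinct)
import Data.List.Relation.Unary.Unique.Propositional.Properties as Distinctₚ
open import Data.List.Sort.InsertionSort.Base ℕₚ.≤-decTotalOrder using (sort)
open import Data.List.Sort.InsertionSort.Properties ℕₚ.≤-decTotalOrder using (sort-↭; sort-↗)
open import Data.Vec as Vec using (Vec; []; _∷_)
import Data.Vec.Properties as Vecₚ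
open import Data.Vec.Relation.Unary.All as VAll using ([]; _∷_)
import Data.Vec.Relation.Unary.All.Properties as VAllₚ
open import Function using (_∘_; id; Inverse; Equivalence; mk⇔)
open import Function.Definitions using (Injective)
open import Level using (0ℓ)
open import Relation.Binary using (tri<; tri≈; tri>)
open import Relation.Binary.PropositionalEquality
  using (_≡_; _≢_; refl; sym; trans; cong; cong₂; subst; subst₂; module ≡-Reasoning)
open import Relation.Nullary using (¬_; Dec; yes; no; does)
open import Relation.Nullary.Decidable using (_×-dec_; _⊎-dec_; _→-dec_; map′)
open import Relation.Nullary.Negation using (contradiction)
open import Relation.Unary using (Pred; Decidable)

-- Horizontal strips in two letters

-- The construction of `𝔖 w` follows ascents of its own choice, and these may leave the vexillary
-- permutations. Uniqueness at generic points, from the commutation and braid relations, permits a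
-- switch to ascents that stay vexillary. Along such an ascent, w = v sᵢ, one would like to compare
-- chain sums at the letters i and i + 1 alone; but the flag conditions of v and w may differ at
-- other letters too. This obstacle is removed by slack: at each stage the number of rows demanded
-- complete may lie anywhere between `weak` and `strong` without changing the sum, because the next
-- strip squeezes the rows in between. One sequence of demands, `strong` up to the descent and
-- `weak` beyond it, is admissible for v, and after a single change at i + 1 it is admissible for w.
-- The exchange then concerns one pair of strips, where the divided difference takes away one cell.
-- At the other end, `weak` is the flag condition itself: the number of flag entries that are at
-- most k is `weak` of the code at k.

opaque
  ∑ : {A : Set} → List A → (A → ℤ) → ℤ
  ∑ []       f = 0ℤ
  ∑ (x ∷ xs) f = f x ⊕ ∑ xs f

  ∑-[] : {A : Set} (f : A → ℤ) → ∑ [] f ≡ 0ℤ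
  ∑-[] f = refl

  ∑-∷ : ∀ {A : Set} x (xs : List A) (f : A → ℤ) → ∑ (x ∷ xs) f ≡ f x ⊕ ∑ xs f
  ∑-∷ x xs f = refl

opaque
  unfolding ∑

  ∑-cong : {A : Set} (xs : List A) {f g : A → ℤ} → (∀ x → f x ≡ g x) → ∑ xs f ≡ ∑ xs g
  ∑-cong []       eq = refl
  ∑-cong (x ∷ xs) eq = cong₂ _⊕_ (eq x) (∑-cong xs eq)

  ∑-zero : {A : Set} (xs : List A) {f : A → ℤ} → (∀ x → f x ≡ 0ℤ) → ∑ xs f ≡ 0ℤ
  ∑-zero []       eq = refl
  ∑-zero (x ∷ xs) eq = cong₂ _⊕_ (eq x) (∑-zero xs eq)

  ∑-⊗ : ∀ {A : Set} (xs : List A) c (f : A → ℤ) → ∑ xs (λ x → c ⊗ f x) ≡ c ⊗ ∑ xs f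
  ∑-⊗ []       c f = sym (ℤₚ.*-zeroʳ c)
  ∑-⊗ (x ∷ xs) c f = trans (cong (c ⊗ f x ⊕_) (∑-⊗ xs c f)) (sym (ℤₚ.*-distribˡ-+ c _ _))

  ∑-⊗ʳ : ∀ {A : Set} (xs : List A) c (f : A → ℤ) → ∑ xs (λ x → f x ⊗ c) ≡ ∑ xs f ⊗ c
  ∑-⊗ʳ xs c f = trans (∑-cong xs (λ x → ℤₚ.*-comm (f x) c))
                  (trans (∑-⊗ xs c f) (ℤₚ.*-comm c _))

  ∑-⊕ : {A : Set} (xs : List A) (f g : A → ℤ) → ∑ xs (λ x → f x ⊕ g x) ≡ ∑ xs f ⊕ ∑ xs g
  ∑-⊕ []       f g = refl
  ∑-⊕ (x ∷ xs) f g = trans (cong (f x ⊕ g x ⊕_) (∑-⊕ xs f g)) (interchange (f x) (g x) _ _)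
    where
    interchange : ∀ a b c d → a ⊕ b ⊕ (c ⊕ d) ≡ (a ⊕ c) ⊕ (b ⊕ d)
    interchange = solve-∀

  ∑-minus : {A : Set} (xs : List A) (f g : A → ℤ) → ∑ xs (λ x → f x - g x) ≡ ∑ xs f - ∑ xs g
  ∑-minus []       f g = refl
  ∑-minus (x ∷ xs) f g = trans (cong (f x - g x ⊕_) (∑-minus xs f g)) (interchange (f x) (g x) _ _)
    where
    interchange : ∀ a b c d → a - b ⊕ (c - d) ≡ (a ⊕ c) - (b ⊕ d)
    interchange = solve-∀

  ∑-swap : {A B : Set} (xs : List A) (ys : List B) (f : A → B → ℤ) →
           ∑ xs (λ x → ∑ ys (f x)) ≡ ∑ ys (λ y → ∑ xs (λ x → f x y))
  ∑-swap []       ys f = sym (∑-zero ys (λ _ → refl))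
  ∑-swap (x ∷ xs) ys f = trans (cong (∑ ys (f x) ⊕_) (∑-swap xs ys f)) (sym (∑-⊕ ys (f x) _))

  ∑-++ : {A : Set} (xs ys : List A) (f : A → ℤ) → ∑ (xs ++ ys) f ≡ ∑ xs f ⊕ ∑ ys f
  ∑-++ []       ys f = sym (ℤₚ.+-identityˡ _)
  ∑-++ (x ∷ xs) ys f = trans (cong (f x ⊕_) (∑-++ xs ys f)) (sym (ℤₚ.+-assoc (f x) _ _))

  ∑-map : {A B : Set} (g : A → B) (xs : List A) (f : B → ℤ) → ∑ (map g xs) f ≡ ∑ xs (f ∘ g)
  ∑-map g []       f = refl
  ∑-map g (x ∷ xs) f = cong (f (g x) ⊕_) (∑-map g xs f)

∑-cartesian : {A B C : Set} (h : A → B → C) (xs : List A) (ys : List B) (f : C → ℤ) →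
              ∑ (cartesianProductWith h xs ys) f ≡ ∑ xs (λ x → ∑ ys (λ y → f (h x y)))
∑-cartesian h []       ys f = trans (∑-[] f) (sym (∑-[] _))
∑-cartesian h (x ∷ xs) ys f =
  trans (∑-++ (map (h x) ys) _ f)
    (trans (cong₂ _⊕_ (∑-map (h x) ys f) (∑-cartesian h xs ys f)) (sym (∑-∷ x xs _)))

∑-upTo : ∀ b (f : ℕ → ℤ) → ∑ (upTo (suc b)) f ≡ f 0 ⊕ ∑ (upTo b) (f ∘ suc)
∑-upTo b f = trans (∑-∷ 0 (List.applyUpTo suc b) f) (cong (f 0 ⊕_)
  (trans (cong (λ xs → ∑ xs f) (sym (Listₚ.map-upTo suc b))) (∑-map suc (upTo b) f)))

box : ℕ → ∀ l → List (Vec ℕ l)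
box b l = allVecs (upTo b) l

∑-box : ∀ b l (f : Vec ℕ (suc l) → ℤ) →
        ∑ (box b (suc l)) f ≡ ∑ (upTo b) (λ t → ∑ (box b l) (λ κ → f (t ∷ κ)))
∑-box b l f = ∑-cartesian _∷_ (upTo b) (box b l) f

𝟙 : {P : Set} → Dec P → ℤ
𝟙 d = if does d then 1ℤ else 0ℤ

𝟙-yes : {P : Set} (d : Dec P) → P → 𝟙 d ≡ 1ℤ
𝟙-yes (yes _) p = refl
𝟙-yes (no ¬p) p = contradiction p ¬p

𝟙-no : {P : Set} (d : Dec P) → ¬ P → 𝟙 d ≡ 0ℤ
𝟙-no (yes p) ¬p = contradiction p ¬p
𝟙-no (no _)  ¬p = refl

𝟙-⇔ : {P Q : Set} (d : Dec P) (e : Dec Q) → (P → Q) → (Q → P) → 𝟙 d ≡ 𝟙 e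
𝟙-⇔ (yes p) e f g = sym (𝟙-yes e (f p))
𝟙-⇔ (no ¬p) e f g = sym (𝟙-no e (¬p ∘ g))

𝟙-× : {P Q : Set} (d : Dec P) (e : Dec Q) → 𝟙 (d ×-dec e) ≡ 𝟙 d ⊗ 𝟙 e
𝟙-× (yes _) (yes _) = refl
𝟙-× (yes _) (no _)  = refl
𝟙-× (no _)  e       = refl

𝟙-guard : {P : Set} (d : Dec P) {x y : ℤ} → (P → x ≡ y) → 𝟙 d ⊗ x ≡ 𝟙 d ⊗ y
𝟙-guard (yes p) eq = cong (1ℤ ⊗_) (eq p)
𝟙-guard (no _)  eq = refl

𝟙-kill : {P : Set} (d : Dec P) {x : ℤ} → ¬ P → 𝟙 d ⊗ x ≡ 0ℤ
𝟙-kill d {x} ¬p = cong (_⊗ x) (𝟙-no d ¬p)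

𝟙-absorb : {P : Set} (d : Dec P) (x : ℤ) → (¬ P → x ≡ 0ℤ) → 𝟙 d ⊗ x ≡ x
𝟙-absorb (yes _) x eq = ℤₚ.*-identityˡ x
𝟙-absorb (no ¬p) x eq = sym (eq ¬p)

∑-pick : ∀ b c (f : ℕ → ℤ) → c < b → ∑ (upTo b) (λ t → 𝟙 (t ℕₚ.≟ c) ⊗ f t) ≡ f c
∑-pick (suc b) zero    f _         = begin
  ∑ (upTo (suc b)) (λ t → 𝟙 (t ℕₚ.≟ 0) ⊗ f t)        ≡⟨ ∑-upTo b _ ⟩
  1ℤ ⊗ f 0 ⊕ ∑ (upTo b) (λ t → 0ℤ ⊗ f (suc t))       ≡⟨ cong₂ _⊕_ (ℤₚ.*-identityˡ (f 0)) (∑-zero (upTo b) (λ _ → refl)) ⟩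
  f 0 ⊕ 0ℤ                                           ≡⟨ ℤₚ.+-identityʳ (f 0) ⟩
  f 0                                                ∎
  where open ≡-Reasoning
∑-pick (suc b) (suc c) f (s≤s c<b) = begin
  ∑ (upTo (suc b)) (λ t → 𝟙 (t ℕₚ.≟ suc c) ⊗ f t)             ≡⟨ ∑-upTo b _ ⟩
  0ℤ ⊕ ∑ (upTo b) (λ t → 𝟙 (suc t ℕₚ.≟ suc c) ⊗ f (suc t))    ≡⟨ ℤₚ.+-identityˡ _ ⟩
  ∑ (upTo b) (λ t → 𝟙 (suc t ℕₚ.≟ suc c) ⊗ f (suc t))         ≡⟨ ∑-cong (upTo b) (λ t → cong (_⊗ f (suc t))
                                                                   (𝟙-⇔ (suc t ℕₚ.≟ suc c) (t ℕₚ.≟ c) ℕₚ.suc-injective (cong suc))) ⟩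
  ∑ (upTo b) (λ t → 𝟙 (t ℕₚ.≟ c) ⊗ f (suc t))                 ≡⟨ ∑-pick b c (f ∘ suc) c<b ⟩
  f (suc c)                                                   ∎
  where open ≡-Reasoning

-- The complete homogeneous polynomial of degree d - 1 in x and y, and 0 for d = 0.
geom : ℤ → ℤ → ℕ → ℤ
geom x y zero    = 0ℤ
geom x y (suc d) = y ^ d ⊕ x ⊗ geom x y d

geom-identity : ∀ x y d → (x - y) ⊗ geom x y d ≡ x ^ d - y ^ d
geom-identity x y zero    = ℤₚ.*-zeroʳ (x - y)
geom-identity x y (suc d) = begin
  (x - y) ⊗ (y ^ d ⊕ x ⊗ geom x y d)             ≡⟨ expand x y (y ^ d) (geom x y d) ⟩
  (x - y) ⊗ y ^ d ⊕ x ⊗ ((x - y) ⊗ geom x y d)   ≡⟨ cong (λ z → (x - y) ⊗ y ^ d ⊕ x ⊗ z) (geom-identity x y d) ⟩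
  (x - y) ⊗ y ^ d ⊕ x ⊗ (x ^ d - y ^ d)          ≡⟨ collect x y (x ^ d) (y ^ d) ⟩
  x ⊗ x ^ d - y ⊗ y ^ d                          ∎
  where
  open ≡-Reasoning
  expand : ∀ x y p g → (x - y) ⊗ (p ⊕ x ⊗ g) ≡ (x - y) ⊗ p ⊕ x ⊗ ((x - y) ⊗ g)
  expand = solve-∀
  collect : ∀ x y p q → (x - y) ⊗ q ⊕ x ⊗ (p - q) ≡ x ⊗ p - y ⊗ q
  collect = solve-∀

-- Cancelling x - y would exclude x = y. Instead, the induction hypothesis turns the difference of
-- the two recursions into (x - y) times `geom x y d` minus x^d - y^d, which is 0 by
-- `geom-identity`.
geom-sym : ∀ x y d → geom x y d ≡ geom y x d
geom-sym x y zero    = refl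
geom-sym x y (suc d) = ℤₚ.i-j≡0⇒i≡j _ _ (begin
  (y ^ d ⊕ x ⊗ geom x y d) - (x ^ d ⊕ y ⊗ geom y x d)
    ≡⟨ cong (λ g → (y ^ d ⊕ x ⊗ geom x y d) - (x ^ d ⊕ y ⊗ g)) (geom-sym x y d) ⟨
  (y ^ d ⊕ x ⊗ geom x y d) - (x ^ d ⊕ y ⊗ geom x y d)
    ≡⟨ regroup x y (x ^ d) (y ^ d) (geom x y d) ⟩
  (x - y) ⊗ geom x y d - (x ^ d - y ^ d)
    ≡⟨ cong (_- (x ^ d - y ^ d)) (geom-identity x y d) ⟩
  (x ^ d - y ^ d) - (x ^ d - y ^ d)
    ≡⟨ ℤₚ.+-inverseʳ (x ^ d - y ^ d) ⟩
  0ℤ ∎)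
  where
  open ≡-Reasoning
  regroup : ∀ x y p q g → (q ⊕ x ⊗ g) - (p ⊕ y ⊗ g) ≡ (x - y) ⊗ g - (p - q)
  regroup = solve-∀

-- An empty range, hi < lo, has `suc hi ∸ lo` = 0, so the same formula covers it.
∑-range : ∀ x y b lo hi → hi < b →
          ∑ (upTo b) (λ t → 𝟙 ((lo ≤? t) ×-dec (t ≤? hi)) ⊗ (x ^ (t ∸ lo) ⊗ y ^ (hi ∸ t)))
          ≡ geom x y (suc hi ∸ lo)
∑-range x y (suc b) zero zero _ = begin
  _  ≡⟨ ∑-upTo b _ ⟩
  _  ≡⟨ cong (1ℤ ⊕_) (∑-zero (upTo b) (λ _ → refl)) ⟩
  1ℤ ≡⟨ cong (1ℤ ⊕_) (ℤₚ.*-zeroʳ x) ⟨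
  1ℤ ⊕ x ⊗ 0ℤ ∎
  where open ≡-Reasoning
∑-range x y (suc b) zero (suc hi) (s≤s lt) = begin
  _ ≡⟨ ∑-upTo b _ ⟩
  1ℤ ⊗ (1ℤ ⊗ y ^ suc hi) ⊕ ∑ (upTo b) (λ t → 𝟙 ((0 ≤? suc t) ×-dec (suc t ≤? suc hi)) ⊗ (x ^ suc t ⊗ y ^ (hi ∸ t)))
    ≡⟨ cong₂ _⊕_ (trans (ℤₚ.*-identityˡ (1ℤ ⊗ y ^ suc hi)) (ℤₚ.*-identityˡ (y ^ suc hi))) (trans
         (∑-cong (upTo b) (λ t → trans
           (cong (_⊗ (x ^ suc t ⊗ y ^ (hi ∸ t)))
             (𝟙-⇔ ((0 ≤? suc t) ×-dec (suc t ≤? suc hi)) ((0 ≤? t) ×-dec (t ≤? hi))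
               (λ (_ , le) → z≤n , ℕₚ.≤-pred le) (λ (_ , le) → z≤n , s≤s le)))
           (move x (𝟙 ((0 ≤? t) ×-dec (t ≤? hi))) (x ^ t) (y ^ (hi ∸ t)))))
         (trans (∑-⊗ (upTo b) x (λ t → 𝟙 ((0 ≤? t) ×-dec (t ≤? hi)) ⊗ (x ^ t ⊗ y ^ (hi ∸ t))))
           (cong (x ⊗_) (∑-range x y b zero hi lt)))) ⟩
  y ^ suc hi ⊕ x ⊗ geom x y (suc hi) ∎
  where
  open ≡-Reasoning
  move : ∀ x i p q → i ⊗ (x ⊗ p ⊗ q) ≡ x ⊗ (i ⊗ (p ⊗ q))
  move = solve-∀
∑-range x y (suc b) (suc lo) zero _ = begin
  _ ≡⟨ ∑-zero (upTo (suc b)) (λ t → 𝟙-kill ((suc lo ≤? t) ×-dec (t ≤? 0)) {x ^ (t ∸ suc lo) ⊗ y ^ (0 ∸ t)}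
         (λ (p , q) → contradiction (ℕₚ.≤-trans p q) λ ())) ⟩
  0ℤ ≡⟨ cong (geom x y) (ℕₚ.0∸n≡0 lo) ⟨
  geom x y (0 ∸ lo) ∎
  where open ≡-Reasoning
∑-range x y (suc b) (suc lo) (suc hi) (s≤s lt) = begin
  _ ≡⟨ ∑-upTo b _ ⟩
  0ℤ ⊕ ∑ (upTo b) (λ t → 𝟙 ((suc lo ≤? suc t) ×-dec (suc t ≤? suc hi)) ⊗ (x ^ (t ∸ lo) ⊗ y ^ (hi ∸ t)))
    ≡⟨ ℤₚ.+-identityˡ _ ⟩
  _ ≡⟨ ∑-cong (upTo b) (λ t → cong (_⊗ (x ^ (t ∸ lo) ⊗ y ^ (hi ∸ t)))
         (𝟙-⇔ ((suc lo ≤? suc t) ×-dec (suc t ≤? suc hi)) ((lo ≤? t) ×-dec (t ≤? hi))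
           (λ (p , q) → ℕₚ.≤-pred p , ℕₚ.≤-pred q) (λ (p , q) → s≤s p , s≤s q))) ⟩
  _ ≡⟨ ∑-range x y b lo hi lt ⟩
  geom x y (suc hi ∸ lo) ∎
  where open ≡-Reasoning

hd : ∀ {l} → Vec ℕ l → ℕ
hd []      = 0
hd (a ∷ _) = a

-- μ / κ is a horizontal strip.
Strip : ∀ {l} → Vec ℕ l → Vec ℕ l → Set
Strip []      []      = ⊤
Strip (a ∷ μ) (t ∷ κ) = (hd μ ≤ t × t ≤ a) × Strip μ κ

Strip? : ∀ {l} (μ κ : Vec ℕ l) → Dec (Strip μ κ)
Strip? []      []      = yes tt
Strip? (a ∷ μ) (t ∷ κ) = ((hd μ ≤? t) ×-dec (t ≤? a)) ×-dec Strip? μ κ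

Strip-hd : ∀ {l} (μ κ : Vec ℕ l) → Strip μ κ → hd κ ≤ hd μ
Strip-hd []      []      _             = z≤n
Strip-hd (a ∷ μ) (t ∷ κ) ((_ , t≤a) , _) = t≤a

-- The monomial x^|μ / κ|; on horizontal strips no subtraction is truncated.
weight : ∀ {l} → ℤ → Vec ℕ l → Vec ℕ l → ℤ
weight x []      []      = 1ℤ
weight x (a ∷ μ) (t ∷ κ) = x ^ (a ∸ t) ⊗ weight x μ κ

strip : ∀ {l} → ℤ → Vec ℕ l → Vec ℕ l → ℤ
strip x μ κ = 𝟙 (Strip? μ κ) ⊗ weight x μ κ

strip-∷ : ∀ {l} x a (μ : Vec ℕ l) t κ →
          strip x (a ∷ μ) (t ∷ κ) ≡ 𝟙 ((hd μ ≤? t) ×-dec (t ≤? a)) ⊗ x ^ (a ∸ t) ⊗ strip x μ κ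
strip-∷ x a μ t κ = trans
  (cong (_⊗ (x ^ (a ∸ t) ⊗ weight x μ κ)) (𝟙-× ((hd μ ≤? t) ×-dec (t ≤? a)) (Strip? μ κ)))
  (shuffle (𝟙 ((hd μ ≤? t) ×-dec (t ≤? a))) (𝟙 (Strip? μ κ)) (x ^ (a ∸ t)) (weight x μ κ))
  where
  shuffle : ∀ i j p q → i ⊗ j ⊗ (p ⊗ q) ≡ i ⊗ p ⊗ (j ⊗ q)
  shuffle = solve-∀

-- Two-letter generating function between ν and μ, where the row above the first
-- one already stops at B before the second letter.
pair : ∀ {l} → ℕ → ℤ → ℤ → ℕ → Vec ℕ l → Vec ℕ l → ℤ
pair {l} b x y B μ ν = ∑ (box b l) (λ κ → 𝟙 (hd κ ≤? B) ⊗ (strip y μ κ ⊗ strip x κ ν))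

-- The factor of `pair` that belongs to one row: a, t and n are its lengths in the outer, middle and
-- inner partition, and m is the length of the next outer row.
row-sum : ℕ → ℤ → ℤ → ℕ → ℕ → ℕ → ℕ → ℤ
row-sum b x y B a m n =
  ∑ (upTo b) (λ t → 𝟙 (t ≤? B) ⊗ (𝟙 ((m ≤? t) ×-dec (t ≤? a)) ⊗ y ^ (a ∸ t)) ⊗ (𝟙 (n ≤? t) ⊗ x ^ (t ∸ n)))

^-split : ∀ x {m n k} → m ≡ n + k → x ^ m ≡ x ^ n ⊗ x ^ k
^-split x {n = n} {k} refl = ℤₚ.^-distribˡ-+-* x n k

-- The conditions on t say max(m, n) ≤ t ≤ min(a, B). There a - t and t - n split into the fixed
-- parts `a ∸ B` and `m ∸ n` and the distances to the two ends of the range, whose monomials sum to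
-- a symmetric polynomial. Only the fixed parts distinguish x from y.
row-geom : ∀ b x y B a m n → a < b →
           row-sum b x y B a m n ≡ y ^ (a ∸ B) ⊗ x ^ (m ∸ n) ⊗ geom x y (suc (a ⊓ B) ∸ (m ⊔ n))
row-geom b x y B a m n a<b = begin
  row-sum b x y B a m n
    ≡⟨ ∑-cong (upTo b) termwise ⟩
  ∑ (upTo b) (λ t → y ^ (a ∸ B) ⊗ x ^ (m ∸ n) ⊗
       clipped t)
    ≡⟨ ∑-⊗ (upTo b) (y ^ (a ∸ B) ⊗ x ^ (m ∸ n)) clipped ⟩
  _ ≡⟨ cong (y ^ (a ∸ B) ⊗ x ^ (m ∸ n) ⊗_) (∑-range x y b (m ⊔ n) (a ⊓ B) (ℕₚ.≤-<-trans (ℕₚ.m⊓n≤m a B) a<b)) ⟩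
  _ ∎
  where
  open ≡-Reasoning
  shuffle : ∀ i j k p q → i ⊗ (j ⊗ p) ⊗ (k ⊗ q) ≡ i ⊗ j ⊗ k ⊗ (p ⊗ q)
  shuffle = solve-∀
  reorder : ∀ p q r s → p ⊗ q ⊗ (r ⊗ s) ≡ p ⊗ r ⊗ (s ⊗ q)
  reorder = solve-∀
  pull : ∀ i c d → i ⊗ (c ⊗ d) ≡ c ⊗ (i ⊗ d)
  pull = solve-∀
  exp-y : ∀ t → t ≤ a ⊓ B → a ∸ t ≡ (a ∸ B) + ((a ⊓ B) ∸ t)
  exp-y t le = begin
    a ∸ t                     ≡⟨ cong (_∸ t) (ℕₚ.m∸n+n≡m (ℕₚ.m⊓n≤m a B)) ⟨
    (a ∸ a ⊓ B + a ⊓ B) ∸ t   ≡⟨ ℕₚ.+-∸-assoc (a ∸ a ⊓ B) le ⟩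
    (a ∸ a ⊓ B) + (a ⊓ B ∸ t) ≡⟨ cong (_+ (a ⊓ B ∸ t)) (trans (ℕₚ.∸-distribˡ-⊓-⊔ a a B) (cong (_⊔ (a ∸ B)) (ℕₚ.n∸n≡0 a))) ⟩
    (a ∸ B) + (a ⊓ B ∸ t)     ∎
  exp-x : ∀ t → m ⊔ n ≤ t → t ∸ n ≡ (m ∸ n) + (t ∸ (m ⊔ n))
  exp-x t le = begin
    t ∸ n                                ≡⟨ cong (_∸ n) (ℕₚ.m∸n+n≡m le) ⟨
    (t ∸ (m ⊔ n) + (m ⊔ n)) ∸ n          ≡⟨ ℕₚ.+-∸-assoc (t ∸ (m ⊔ n)) (ℕₚ.m≤n⊔m m n) ⟩
    (t ∸ (m ⊔ n)) + (m ⊔ n ∸ n)          ≡⟨ cong (λ z → (t ∸ (m ⊔ n)) + z) (trans (ℕₚ.∸-distribʳ-⊔ n m n) (trans (cong ((m ∸ n) ⊔_) (ℕₚ.n∸n≡0 n)) (ℕₚ.⊔-identityʳ _))) ⟩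
    (t ∸ (m ⊔ n)) + (m ∸ n)              ≡⟨ ℕₚ.+-comm (t ∸ (m ⊔ n)) _ ⟩
    (m ∸ n) + (t ∸ (m ⊔ n))              ∎
  clipped : ℕ → ℤ
  clipped t = 𝟙 (((m ⊔ n) ≤? t) ×-dec (t ≤? (a ⊓ B))) ⊗ (x ^ (t ∸ (m ⊔ n)) ⊗ y ^ ((a ⊓ B) ∸ t))
  range? : ∀ t → Dec (m ⊔ n ≤ t × t ≤ a ⊓ B)
  range? t = ((m ⊔ n) ≤? t) ×-dec (t ≤? (a ⊓ B))
  all? : ∀ t → Dec ((t ≤ B × (m ≤ t × t ≤ a)) × n ≤ t)
  all? t = ((t ≤? B) ×-dec ((m ≤? t) ×-dec (t ≤? a))) ×-dec (n ≤? t)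
  termwise : ∀ t → 𝟙 (t ≤? B) ⊗ (𝟙 ((m ≤? t) ×-dec (t ≤? a)) ⊗ y ^ (a ∸ t)) ⊗ (𝟙 (n ≤? t) ⊗ x ^ (t ∸ n))
             ≡ y ^ (a ∸ B) ⊗ x ^ (m ∸ n) ⊗ (𝟙 (range? t) ⊗ (x ^ (t ∸ (m ⊔ n)) ⊗ y ^ ((a ⊓ B) ∸ t)))
  termwise t = begin
    𝟙 (t ≤? B) ⊗ (𝟙 ((m ≤? t) ×-dec (t ≤? a)) ⊗ y ^ (a ∸ t)) ⊗ (𝟙 (n ≤? t) ⊗ x ^ (t ∸ n))
      ≡⟨ shuffle (𝟙 (t ≤? B)) (𝟙 ((m ≤? t) ×-dec (t ≤? a))) (𝟙 (n ≤? t)) (y ^ (a ∸ t)) (x ^ (t ∸ n)) ⟩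
    𝟙 (t ≤? B) ⊗ 𝟙 ((m ≤? t) ×-dec (t ≤? a)) ⊗ 𝟙 (n ≤? t) ⊗ (y ^ (a ∸ t) ⊗ x ^ (t ∸ n))
      ≡⟨ cong (_⊗ (y ^ (a ∸ t) ⊗ x ^ (t ∸ n)))
           (trans (cong (_⊗ 𝟙 (n ≤? t)) (sym (𝟙-× (t ≤? B) ((m ≤? t) ×-dec (t ≤? a)))))
             (trans (sym (𝟙-× ((t ≤? B) ×-dec ((m ≤? t) ×-dec (t ≤? a))) (n ≤? t)))
               (𝟙-⇔ (all? t) (range? t)
                 (λ ((tB , (mt , ta)) , nt) → ℕₚ.⊔-lub mt nt , ℕₚ.⊓-glb ta tB)
                 (λ (lo , hi) → (ℕₚ.≤-trans hi (ℕₚ.m⊓n≤n a B) , (ℕₚ.m⊔n≤o⇒m≤o m n lo , ℕₚ.≤-trans hi (ℕₚ.m⊓n≤m a B)))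
                                , ℕₚ.m⊔n≤o⇒n≤o m n lo)))) ⟩
    𝟙 (range? t) ⊗ (y ^ (a ∸ t) ⊗ x ^ (t ∸ n))
      ≡⟨ 𝟙-guard (range? t) (λ (lo , hi) → trans
           (cong₂ _⊗_ (^-split y {n = a ∸ B} {(a ⊓ B) ∸ t} (exp-y t hi))
                      (^-split x {n = m ∸ n} {t ∸ (m ⊔ n)} (exp-x t lo)))
           (reorder (y ^ (a ∸ B)) (y ^ ((a ⊓ B) ∸ t)) (x ^ (m ∸ n)) (x ^ (t ∸ (m ⊔ n))))) ⟩
    𝟙 (range? t) ⊗ (y ^ (a ∸ B) ⊗ x ^ (m ∸ n) ⊗ (x ^ (t ∸ (m ⊔ n)) ⊗ y ^ ((a ⊓ B) ∸ t)))
      ≡⟨ pull (𝟙 (range? t)) (y ^ (a ∸ B) ⊗ x ^ (m ∸ n)) (x ^ (t ∸ (m ⊔ n)) ⊗ y ^ ((a ⊓ B) ∸ t)) ⟩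
    _ ∎

-- The strip from ν to κ bounds row 1 of κ by n, and neither strip compares that row with t. So the
-- sum factors into rows, and n takes the place of B for the rest.
pair-∷ : ∀ {l} b x y B a (μ : Vec ℕ l) n ν →
         pair b x y B (a ∷ μ) (n ∷ ν) ≡ row-sum b x y B a (hd μ) n ⊗ pair b x y n μ ν
pair-∷ {l} b x y B a μ n ν = begin
  _ ≡⟨ ∑-box b l _ ⟩
  _ ≡⟨ ∑-cong (upTo b) (λ t → trans (∑-cong (box b l) (split t)) (∑-⊗ (box b l) (R t) _)) ⟩
  ∑ (upTo b) (λ t → R t ⊗ pair b x y n μ ν)
    ≡⟨ ∑-⊗ʳ (upTo b) (pair b x y n μ ν) R ⟩
  _ ∎
  where
  open ≡-Reasoning
  R : ℕ → ℤ
  R t = 𝟙 (t ≤? B) ⊗ (𝟙 ((hd μ ≤? t) ×-dec (t ≤? a)) ⊗ y ^ (a ∸ t)) ⊗ (𝟙 (n ≤? t) ⊗ x ^ (t ∸ n))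
  shuffle : ∀ i p q j k r s → i ⊗ ((p ⊗ q) ⊗ (j ⊗ k ⊗ r ⊗ s)) ≡ i ⊗ p ⊗ (k ⊗ r) ⊗ (j ⊗ (q ⊗ s))
  shuffle = solve-∀
  split : ∀ t κ → 𝟙 (t ≤? B) ⊗ (strip y (a ∷ μ) (t ∷ κ) ⊗ strip x (t ∷ κ) (n ∷ ν))
          ≡ R t ⊗ (𝟙 (hd κ ≤? n) ⊗ (strip y μ κ ⊗ strip x κ ν))
  split t κ = begin
    𝟙 (t ≤? B) ⊗ (strip y (a ∷ μ) (t ∷ κ) ⊗ strip x (t ∷ κ) (n ∷ ν))
      ≡⟨ cong (𝟙 (t ≤? B) ⊗_) (cong₂ _⊗_ (strip-∷ y a μ t κ)
           (trans (strip-∷ x t κ n ν) (cong (λ z → z ⊗ x ^ (t ∸ n) ⊗ strip x κ ν) (𝟙-× (hd κ ≤? n) (n ≤? t))))) ⟩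
    _ ≡⟨ shuffle (𝟙 (t ≤? B)) (𝟙 ((hd μ ≤? t) ×-dec (t ≤? a)) ⊗ y ^ (a ∸ t)) (strip y μ κ) (𝟙 (hd κ ≤? n)) (𝟙 (n ≤? t)) (x ^ (t ∸ n)) (strip x κ ν) ⟩
    _ ∎

-- By `row-geom` each row leaves the asymmetric factors y^(a ∸ B) and x^(m ∸ n). The first is
-- balanced by the power of x in front; the second is exactly the power that the induction
-- hypothesis wants in front of the remaining rows, whose bound is n.
pair-sym : ∀ {l} b x y B (μ ν : Vec ℕ l) → VAll.All (_< b) μ →
           x ^ (hd μ ∸ B) ⊗ pair b x y B μ ν ≡ y ^ (hd μ ∸ B) ⊗ pair b y x B μ ν
pair-sym b x y B [] [] _ rewrite ℕₚ.0∸n≡0 B =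
  cong (1ℤ ⊗_) (∑-cong (box b 0) (λ { [] → refl }))
pair-sym b x y B (a ∷ μ) (n ∷ ν) (a<b ∷ μ<b) = begin
  x ^ (a ∸ B) ⊗ pair b x y B (a ∷ μ) (n ∷ ν)
    ≡⟨ cong (x ^ (a ∸ B) ⊗_) (trans (pair-∷ b x y B a μ n ν)
         (cong (_⊗ pair b x y n μ ν) (row-geom b x y B a (hd μ) n a<b))) ⟩
  _ ≡⟨ shuffle (x ^ (a ∸ B)) (y ^ (a ∸ B)) (x ^ (hd μ ∸ n)) (geom x y d) (pair b x y n μ ν) ⟩
  x ^ (a ∸ B) ⊗ y ^ (a ∸ B) ⊗ geom x y d ⊗ (x ^ (hd μ ∸ n) ⊗ pair b x y n μ ν)
    ≡⟨ cong₂ _⊗_ (cong₂ _⊗_ (ℤₚ.*-comm (x ^ (a ∸ B)) _) (geom-sym x y d)) (pair-sym b x y n μ ν μ<b) ⟩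
  y ^ (a ∸ B) ⊗ x ^ (a ∸ B) ⊗ geom y x d ⊗ (y ^ (hd μ ∸ n) ⊗ pair b y x n μ ν)
    ≡⟨ shuffle (y ^ (a ∸ B)) (x ^ (a ∸ B)) (y ^ (hd μ ∸ n)) (geom y x d) (pair b y x n μ ν) ⟨
  _ ≡⟨ cong (y ^ (a ∸ B) ⊗_) (trans (pair-∷ b y x B a μ n ν)
         (cong (_⊗ pair b y x n μ ν) (row-geom b y x B a (hd μ) n a<b))) ⟨
  y ^ (a ∸ B) ⊗ pair b y x B (a ∷ μ) (n ∷ ν) ∎
  where
  open ≡-Reasoning
  d : ℕ
  d = suc (a ⊓ B) ∸ (hd μ ⊔ n)
  shuffle : ∀ p q r g s → p ⊗ (q ⊗ r ⊗ g ⊗ s) ≡ p ⊗ q ⊗ g ⊗ (r ⊗ s)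
  shuffle = solve-∀

Agree : ∀ {l} → ℕ → (ℕ → ℕ) → Vec ℕ l → Set
Agree zero    lam κ       = ⊤
Agree (suc R) lam []      = ⊤
Agree (suc R) lam (t ∷ κ) = t ≡ lam 0 × Agree R (lam ∘ suc) κ

Agree? : ∀ {l} R lam (κ : Vec ℕ l) → Dec (Agree R lam κ)
Agree? zero    lam κ       = yes tt
Agree? (suc R) lam []      = yes tt
Agree? (suc R) lam (t ∷ κ) = (t ℕₚ.≟ lam 0) ×-dec Agree? R (lam ∘ suc) κ

-- Passing from μ to μ⁻ removes a cell from row r of a partition that agrees
-- with lam in the first r + 1 rows.
data Drop : ∀ {l} → ℕ → (ℕ → ℕ) → Vec ℕ l → Vec ℕ l → Set where
  drop-here  : ∀ {l lam a} {μ : Vec ℕ l} → lam 0 ≡ suc a → hd μ ≤ a →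
          Drop 0 lam (suc a ∷ μ) (a ∷ μ)
  drop-there : ∀ {l r lam a} {μ μ⁻ : Vec ℕ l} → a ≡ lam 0 → hd μ ≤ a → hd μ⁻ ≤ a →
          Drop r (lam ∘ suc) μ μ⁻ → Drop (suc r) lam (a ∷ μ) (a ∷ μ⁻)

-- Two-letter generating function between ν and μ, with R and R′ the numbers of
-- complete rows before and after the first of the two letters.
two : ∀ {l} → ℕ → ℤ → ℤ → ℕ → ℕ → (ℕ → ℕ) → Vec ℕ l → Vec ℕ l → ℤ
two {l} b x y R R′ lam μ ν =
  ∑ (box b l) (λ κ → 𝟙 (Agree? R lam κ) ⊗ strip y μ κ ⊗ (𝟙 (Agree? R′ lam ν) ⊗ strip x κ ν))

-- Row 0 is complete after the first letter, so its whole growth x^(suc a ∸ n) comes from that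
-- letter. Below it remains `pair` with bound n.
two-here : ∀ {l} b x y lam a (μ : Vec ℕ l) n ν → lam 0 ≡ suc a → hd μ ≤ a → suc a < b →
           two b x y 1 0 lam (suc a ∷ μ) (n ∷ ν) ≡ 𝟙 (n ≤? suc a) ⊗ x ^ (suc a ∸ n) ⊗ pair b x y n μ ν
two-here {l} b x y lam a μ n ν eq m≤a a<b = begin
  _ ≡⟨ ∑-box b l _ ⟩
  _ ≡⟨ ∑-cong (upTo b) (λ t → trans (∑-cong (box b l) (split t)) (∑-⊗ (box b l) (𝟙 (t ℕₚ.≟ suc a)) (F t))) ⟩
  ∑ (upTo b) (λ t → 𝟙 (t ℕₚ.≟ suc a) ⊗ ∑ (box b l) (F t))
    ≡⟨ ∑-pick b (suc a) (λ t → ∑ (box b l) (F t)) a<b ⟩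
  ∑ (box b l) (F (suc a))
    ≡⟨ ∑-cong (box b l) simplify ⟩
  ∑ (box b l) (λ κ → C ⊗ P κ)
    ≡⟨ ∑-⊗ (box b l) C P ⟩
  C ⊗ pair b x y n μ ν ∎
  where
  open ≡-Reasoning
  C : ℤ
  C = 𝟙 (n ≤? suc a) ⊗ x ^ (suc a ∸ n)
  P : Vec ℕ l → ℤ
  P κ = 𝟙 (hd κ ≤? n) ⊗ (strip y μ κ ⊗ strip x κ ν)
  F : ℕ → Vec ℕ l → ℤ
  F t κ = strip y (suc a ∷ μ) (t ∷ κ) ⊗ strip x (t ∷ κ) (n ∷ ν)
  assoc : ∀ i j k → (i ⊗ 1ℤ) ⊗ j ⊗ (1ℤ ⊗ k) ≡ i ⊗ (j ⊗ k)
  assoc = solve-∀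
  shuffle : ∀ s j k r s′ → 1ℤ ⊗ 1ℤ ⊗ s ⊗ (j ⊗ k ⊗ r ⊗ s′) ≡ k ⊗ r ⊗ (j ⊗ (s ⊗ s′))
  shuffle = solve-∀
  split : ∀ t κ → 𝟙 (Agree? 1 lam (t ∷ κ)) ⊗ strip y (suc a ∷ μ) (t ∷ κ) ⊗ (1ℤ ⊗ strip x (t ∷ κ) (n ∷ ν))
                  ≡ 𝟙 (t ℕₚ.≟ suc a) ⊗ F t κ
  split t κ rewrite eq = trans
    (cong (λ z → z ⊗ strip y (suc a ∷ μ) (t ∷ κ) ⊗ (1ℤ ⊗ strip x (t ∷ κ) (n ∷ ν))) (𝟙-× (t ℕₚ.≟ suc a) (yes tt)))
    (assoc (𝟙 (t ℕₚ.≟ suc a)) (strip y (suc a ∷ μ) (t ∷ κ)) (strip x (t ∷ κ) (n ∷ ν)))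
  simplify : ∀ κ → F (suc a) κ ≡ C ⊗ P κ
  simplify κ = begin
    F (suc a) κ
      ≡⟨ cong₂ _⊗_ (strip-∷ y (suc a) μ (suc a) κ) (strip-∷ x (suc a) κ n ν) ⟩
    𝟙 ((hd μ ≤? suc a) ×-dec (suc a ≤? suc a)) ⊗ y ^ (suc a ∸ suc a) ⊗ strip y μ κ
      ⊗ (𝟙 ((hd κ ≤? n) ×-dec (n ≤? suc a)) ⊗ x ^ (suc a ∸ n) ⊗ strip x κ ν)
      ≡⟨ cong₂ (λ i j → i ⊗ strip y μ κ ⊗ (j ⊗ x ^ (suc a ∸ n) ⊗ strip x κ ν))
           (cong₂ _⊗_ (𝟙-yes ((hd μ ≤? suc a) ×-dec (suc a ≤? suc a)) (ℕₚ.m≤n⇒m≤1+n m≤a , ℕₚ.≤-refl))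
                      (cong (y ^_) (ℕₚ.n∸n≡0 (suc a))))
           (𝟙-× (hd κ ≤? n) (n ≤? suc a)) ⟩
    1ℤ ⊗ 1ℤ ⊗ strip y μ κ ⊗ (𝟙 (hd κ ≤? n) ⊗ 𝟙 (n ≤? suc a) ⊗ x ^ (suc a ∸ n) ⊗ strip x κ ν)
      ≡⟨ shuffle (strip y μ κ) (𝟙 (hd κ ≤? n)) (𝟙 (n ≤? suc a)) (x ^ (suc a ∸ n)) (strip x κ ν) ⟩
    C ⊗ P κ ∎

-- With no row demanded complete this is `pair` at B = a, since the strip below μ gives t ≤ a.
two-here⁻ : ∀ {l} b x y lam a (μ : Vec ℕ l) n ν → a < b →
            two b x y 0 0 lam (a ∷ μ) (n ∷ ν) ≡ x ^ (hd μ ∸ n) ⊗ geom x y (suc a ∸ (hd μ ⊔ n)) ⊗ pair b x y n μ ν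
two-here⁻ {l} b x y lam a μ n ν a<b = begin
  two b x y 0 0 lam (a ∷ μ) (n ∷ ν)
    ≡⟨ ∑-cong (box b (suc l)) (λ { (t ∷ κ) → trans (unit₁ (strip y (a ∷ μ) (t ∷ κ)) (strip x (t ∷ κ) (n ∷ ν))) (below t κ) }) ⟩
  pair b x y a (a ∷ μ) (n ∷ ν)
    ≡⟨ pair-∷ b x y a a μ n ν ⟩
  row-sum b x y a a (hd μ) n ⊗ pair b x y n μ ν
    ≡⟨ cong (_⊗ pair b x y n μ ν) (row-geom b x y a a (hd μ) n a<b) ⟩
  y ^ (a ∸ a) ⊗ x ^ (hd μ ∸ n) ⊗ geom x y (suc (a ⊓ a) ∸ (hd μ ⊔ n)) ⊗ pair b x y n μ ν
    ≡⟨ cong₂ (λ e c → y ^ e ⊗ x ^ (hd μ ∸ n) ⊗ geom x y (suc c ∸ (hd μ ⊔ n)) ⊗ pair b x y n μ ν) (ℕₚ.n∸n≡0 a) (ℕₚ.⊓-idem a) ⟩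
  1ℤ ⊗ x ^ (hd μ ∸ n) ⊗ geom x y (suc a ∸ (hd μ ⊔ n)) ⊗ pair b x y n μ ν
    ≡⟨ cong (λ z → z ⊗ geom x y (suc a ∸ (hd μ ⊔ n)) ⊗ pair b x y n μ ν) (ℤₚ.*-identityˡ (x ^ (hd μ ∸ n))) ⟩
  _ ∎
  where
  open ≡-Reasoning
  unit₁ : ∀ p q → 1ℤ ⊗ p ⊗ (1ℤ ⊗ q) ≡ p ⊗ q
  unit₁ = solve-∀
  below : ∀ t κ → strip y (a ∷ μ) (t ∷ κ) ⊗ strip x (t ∷ κ) (n ∷ ν)
                  ≡ 𝟙 (t ≤? a) ⊗ (strip y (a ∷ μ) (t ∷ κ) ⊗ strip x (t ∷ κ) (n ∷ ν))
  below t κ = sym (𝟙-absorb (t ≤? a) (strip y (a ∷ μ) (t ∷ κ) ⊗ strip x (t ∷ κ) (n ∷ ν)) (λ t≰a →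
    cong (λ z → z ⊗ weight y (a ∷ μ) (t ∷ κ) ⊗ strip x (t ∷ κ) (n ∷ ν))
      (𝟙-no (Strip? (a ∷ μ) (t ∷ κ)) (λ ((_ , t≤a) , _) → t≰a t≤a))))

-- Rows above r are complete in all three partitions and peel off. In row r the two orders of the
-- letters give x^s Q and y^s Q′ with s = `suc a ∸ n`. Splitting off from s the part `hd μ ∸ n` that
-- `pair-sym` balances leaves x^d - y^d times a common factor, and its quotient by x - y is the sum
-- over the free row of the smaller partition.
two-drop : ∀ {l} b x y r lam {μ μ⁻ : Vec ℕ l} ν → VAll.All (_< b) μ → Drop r lam μ μ⁻ →
           two b x y (suc r) r lam μ ν - two b y x (suc r) r lam μ ν ≡ (x - y) ⊗ two b x y r r lam μ⁻ ν
two-drop b x y .0 lam {suc a ∷ μ} (n ∷ ν) (a<b ∷ μ<b) (drop-here eq m≤a) = begin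
  two b x y 1 0 lam (suc a ∷ μ) (n ∷ ν) - two b y x 1 0 lam (suc a ∷ μ) (n ∷ ν)
    ≡⟨ cong₂ _-_ (two-here b x y lam a μ n ν eq m≤a a<b) (two-here b y x lam a μ n ν eq m≤a a<b) ⟩
  𝟙 (n ≤? suc a) ⊗ x ^ (suc a ∸ n) ⊗ Q - 𝟙 (n ≤? suc a) ⊗ y ^ (suc a ∸ n) ⊗ Q′
    ≡⟨ factor (𝟙 (n ≤? suc a)) (x ^ (suc a ∸ n)) Q (y ^ (suc a ∸ n)) Q′ ⟩
  𝟙 (n ≤? suc a) ⊗ (x ^ (suc a ∸ n) ⊗ Q - y ^ (suc a ∸ n) ⊗ Q′)
    ≡⟨ 𝟙-guard (n ≤? suc a) core ⟩
  𝟙 (n ≤? suc a) ⊗ ((x - y) ⊗ (x ^ (hd μ ∸ n) ⊗ geom x y d ⊗ Q))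
    ≡⟨ drop-guard ⟩
  (x - y) ⊗ (x ^ (hd μ ∸ n) ⊗ geom x y d ⊗ Q)
    ≡⟨ cong ((x - y) ⊗_) (two-here⁻ b x y lam a μ n ν (ℕₚ.<-trans (ℕₚ.n<1+n a) a<b)) ⟨
  (x - y) ⊗ two b x y 0 0 lam (a ∷ μ) (n ∷ ν) ∎
  where
  open ≡-Reasoning
  d : ℕ
  d = suc a ∸ (hd μ ⊔ n)
  Q Q′ : ℤ
  Q = pair b x y n μ ν
  Q′ = pair b y x n μ ν
  factor : ∀ i p q r s → i ⊗ p ⊗ q - i ⊗ r ⊗ s ≡ i ⊗ (p ⊗ q - r ⊗ s)
  factor = solve-∀
  distrib : ∀ p q r s → p ⊗ q ⊗ r - s ⊗ (q ⊗ r) ≡ (p - s) ⊗ (q ⊗ r)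
  distrib = solve-∀
  final : ∀ x y g p q → (x - y) ⊗ g ⊗ (p ⊗ q) ≡ (x - y) ⊗ (p ⊗ g ⊗ q)
  final = solve-∀
  exponent : n ≤ suc a → suc a ∸ n ≡ d + (hd μ ∸ n)
  exponent n≤ = begin
    suc a ∸ n                 ≡⟨ cong (_∸ n) (ℕₚ.m∸n+n≡m (ℕₚ.⊔-lub (ℕₚ.m≤n⇒m≤1+n m≤a) n≤)) ⟨
    (d + (hd μ ⊔ n)) ∸ n      ≡⟨ ℕₚ.+-∸-assoc d (ℕₚ.m≤n⊔m (hd μ) n) ⟩
    d + (hd μ ⊔ n ∸ n)        ≡⟨ cong (λ z → d + z) (trans (ℕₚ.∸-distribʳ-⊔ n (hd μ) n)
                                   (trans (cong ((hd μ ∸ n) ⊔_) (ℕₚ.n∸n≡0 n)) (ℕₚ.⊔-identityʳ _))) ⟩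
    d + (hd μ ∸ n)            ∎
  core : n ≤ suc a → x ^ (suc a ∸ n) ⊗ Q - y ^ (suc a ∸ n) ⊗ Q′ ≡ (x - y) ⊗ (x ^ (hd μ ∸ n) ⊗ geom x y d ⊗ Q)
  core n≤ = begin
    x ^ (suc a ∸ n) ⊗ Q - y ^ (suc a ∸ n) ⊗ Q′
      ≡⟨ cong₂ (λ p q → p ⊗ Q - q ⊗ Q′) (^-split x {n = d} {hd μ ∸ n} (exponent n≤)) (^-split y {n = d} {hd μ ∸ n} (exponent n≤)) ⟩
    x ^ d ⊗ x ^ (hd μ ∸ n) ⊗ Q - y ^ d ⊗ y ^ (hd μ ∸ n) ⊗ Q′
      ≡⟨ cong (λ z → x ^ d ⊗ x ^ (hd μ ∸ n) ⊗ Q - z)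
           (trans (ℤₚ.*-assoc (y ^ d) (y ^ (hd μ ∸ n)) Q′) (cong (y ^ d ⊗_) (sym (pair-sym b x y n μ ν μ<b)))) ⟩
    x ^ d ⊗ x ^ (hd μ ∸ n) ⊗ Q - y ^ d ⊗ (x ^ (hd μ ∸ n) ⊗ Q)
      ≡⟨ distrib (x ^ d) (x ^ (hd μ ∸ n)) Q (y ^ d) ⟩
    (x ^ d - y ^ d) ⊗ (x ^ (hd μ ∸ n) ⊗ Q)
      ≡⟨ cong (_⊗ (x ^ (hd μ ∸ n) ⊗ Q)) (geom-identity x y d) ⟨
    (x - y) ⊗ geom x y d ⊗ (x ^ (hd μ ∸ n) ⊗ Q)
      ≡⟨ final x y (geom x y d) (x ^ (hd μ ∸ n)) Q ⟩
    _ ∎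
  -- For n > suc a, d = 0 and `geom x y 0` = 0 make the right side vanish as well.
  drop-guard : 𝟙 (n ≤? suc a) ⊗ ((x - y) ⊗ (x ^ (hd μ ∸ n) ⊗ geom x y d ⊗ Q)) ≡ (x - y) ⊗ (x ^ (hd μ ∸ n) ⊗ geom x y d ⊗ Q)
  drop-guard = 𝟙-absorb (n ≤? suc a) _ (λ n≰ → trans
    (cong (λ e → (x - y) ⊗ (x ^ (hd μ ∸ n) ⊗ geom x y e ⊗ Q))
      (ℕₚ.m≤n⇒m∸n≡0 (ℕₚ.≤-trans (ℕₚ.<⇒≤ (ℕₚ.≰⇒> n≰)) (ℕₚ.m≤n⊔m (hd μ) n))))
    (vanish x y (x ^ (hd μ ∸ n)) Q))
    where
    vanish : ∀ x y p q → (x - y) ⊗ (p ⊗ 0ℤ ⊗ q) ≡ 0ℤ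
    vanish = solve-∀
two-drop {suc l} b x y (suc r) lam {a ∷ μ} {a ∷ μ⁻} (n ∷ ν) (a<b ∷ μ<b) (drop-there eq m≤ m⁻≤ drop) = begin
  two b x y (suc (suc r)) (suc r) lam (a ∷ μ) (n ∷ ν) - two b y x (suc (suc r)) (suc r) lam (a ∷ μ) (n ∷ ν)
    ≡⟨ cong₂ _-_ (peel x y (suc r) μ m≤) (peel y x (suc r) μ m≤) ⟩
  𝟙 (n ℕₚ.≟ a) ⊗ two b x y (suc r) r (lam ∘ suc) μ ν - 𝟙 (n ℕₚ.≟ a) ⊗ two b y x (suc r) r (lam ∘ suc) μ ν
    ≡⟨ factor (𝟙 (n ℕₚ.≟ a)) (two b x y (suc r) r (lam ∘ suc) μ ν) (two b y x (suc r) r (lam ∘ suc) μ ν) ⟩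
  𝟙 (n ℕₚ.≟ a) ⊗ (two b x y (suc r) r (lam ∘ suc) μ ν - two b y x (suc r) r (lam ∘ suc) μ ν)
    ≡⟨ cong (𝟙 (n ℕₚ.≟ a) ⊗_) (two-drop b x y r (lam ∘ suc) ν μ<b drop) ⟩
  𝟙 (n ℕₚ.≟ a) ⊗ ((x - y) ⊗ two b x y r r (lam ∘ suc) μ⁻ ν)
    ≡⟨ pull (𝟙 (n ℕₚ.≟ a)) (x - y) (two b x y r r (lam ∘ suc) μ⁻ ν) ⟩
  (x - y) ⊗ (𝟙 (n ℕₚ.≟ a) ⊗ two b x y r r (lam ∘ suc) μ⁻ ν)
    ≡⟨ cong ((x - y) ⊗_) (peel x y r μ⁻ m⁻≤) ⟨
  _ ∎
  where
  open ≡-Reasoning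
  factor : ∀ i p q → i ⊗ p - i ⊗ q ≡ i ⊗ (p - q)
  factor = solve-∀
  pull : ∀ i c d → i ⊗ (c ⊗ d) ≡ c ⊗ (i ⊗ d)
  pull = solve-∀
  peel : ∀ x y R (μ : Vec ℕ l) → hd μ ≤ a →
         two b x y (suc R) (suc r) lam (a ∷ μ) (n ∷ ν) ≡ 𝟙 (n ℕₚ.≟ a) ⊗ two b x y R r (lam ∘ suc) μ ν
  peel x y R μ m≤ = begin
    _ ≡⟨ ∑-box b l _ ⟩
    _ ≡⟨ ∑-cong (upTo b) (λ t → trans (∑-cong (box b l) (split t)) (∑-⊗ (box b l) (𝟙 (t ℕₚ.≟ a)) (F t))) ⟩
    ∑ (upTo b) (λ t → 𝟙 (t ℕₚ.≟ a) ⊗ ∑ (box b l) (F t))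
      ≡⟨ ∑-pick b a (λ t → ∑ (box b l) (F t)) a<b ⟩
    ∑ (box b l) (F a)
      ≡⟨ ∑-cong (box b l) simplify ⟩
    ∑ (box b l) (λ κ → 𝟙 (n ℕₚ.≟ a) ⊗ T κ)
      ≡⟨ ∑-⊗ (box b l) (𝟙 (n ℕₚ.≟ a)) T ⟩
    _ ∎
    where
    T : Vec ℕ l → ℤ
    T κ = 𝟙 (Agree? R (lam ∘ suc) κ) ⊗ strip y μ κ ⊗ (𝟙 (Agree? r (lam ∘ suc) ν) ⊗ strip x κ ν)
    F : ℕ → Vec ℕ l → ℤ
    F t κ = 𝟙 (n ℕₚ.≟ a) ⊗ (𝟙 (Agree? R (lam ∘ suc) κ) ⊗ strip y (a ∷ μ) (t ∷ κ)
                             ⊗ (𝟙 (Agree? r (lam ∘ suc) ν) ⊗ strip x (t ∷ κ) (n ∷ ν)))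
    shuffle : ∀ i j s p q r → (i ⊗ j) ⊗ s ⊗ (p ⊗ q ⊗ r) ≡ i ⊗ (p ⊗ (j ⊗ s ⊗ (q ⊗ r)))
    shuffle = solve-∀
    assemble : ∀ g s h s′ w → g ⊗ (1ℤ ⊗ 1ℤ ⊗ s) ⊗ (h ⊗ (w ⊗ 1ℤ ⊗ s′)) ≡ w ⊗ (g ⊗ s ⊗ (h ⊗ s′))
    assemble = solve-∀
    split : ∀ t κ → 𝟙 (Agree? (suc R) lam (t ∷ κ)) ⊗ strip y (a ∷ μ) (t ∷ κ)
                    ⊗ (𝟙 (Agree? (suc r) lam (n ∷ ν)) ⊗ strip x (t ∷ κ) (n ∷ ν))
                    ≡ 𝟙 (t ℕₚ.≟ a) ⊗ F t κ
    split t κ rewrite sym eq = trans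
      (cong₂ (λ i j → i ⊗ strip y (a ∷ μ) (t ∷ κ) ⊗ (j ⊗ strip x (t ∷ κ) (n ∷ ν)))
        (𝟙-× (t ℕₚ.≟ a) (Agree? R (lam ∘ suc) κ)) (𝟙-× (n ℕₚ.≟ a) (Agree? r (lam ∘ suc) ν)))
      (shuffle (𝟙 (t ℕₚ.≟ a)) (𝟙 (Agree? R (lam ∘ suc) κ)) (strip y (a ∷ μ) (t ∷ κ))
        (𝟙 (n ℕₚ.≟ a)) (𝟙 (Agree? r (lam ∘ suc) ν)) (strip x (t ∷ κ) (n ∷ ν)))
    simplify : ∀ κ → F a κ ≡ 𝟙 (n ℕₚ.≟ a) ⊗ T κ
    simplify κ = 𝟙-guard (n ℕₚ.≟ a) (λ { refl → trans
      (cong₂ (λ i j → 𝟙 (Agree? R (lam ∘ suc) κ) ⊗ i ⊗ (𝟙 (Agree? r (lam ∘ suc) ν) ⊗ j))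
        (trans (strip-∷ y a μ a κ) (cong₂ (λ i j → i ⊗ j ⊗ strip y μ κ)
          (𝟙-yes ((hd μ ≤? a) ×-dec (a ≤? a)) (m≤ , ℕₚ.≤-refl)) (cong (y ^_) (ℕₚ.n∸n≡0 a))))
        (trans (strip-∷ x a κ a ν) (cong₂ (λ i j → i ⊗ j ⊗ strip x κ ν)
          (𝟙-⇔ ((hd κ ≤? a) ×-dec (a ≤? a)) (hd κ ≤? a) proj₁ (_, ℕₚ.≤-refl)) (cong (x ^_) (ℕₚ.n∸n≡0 a)))))
      (trans (assemble (𝟙 (Agree? R (lam ∘ suc) κ)) (strip y μ κ) (𝟙 (Agree? r (lam ∘ suc) ν)) (strip x κ ν) (𝟙 (hd κ ≤? a)))
        -- The strip from ν demands hd κ ≤ a; the strip below μ gives it, as hd κ ≤ hd μ ≤ a.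
        (𝟙-absorb (hd κ ≤? a) (T κ) (λ h≰a → trans
          (cong (λ i → 𝟙 (Agree? R (lam ∘ suc) κ) ⊗ (i ⊗ weight y μ κ) ⊗ (𝟙 (Agree? r (lam ∘ suc) ν) ⊗ strip x κ ν))
            (𝟙-no (Strip? μ κ) (λ s → h≰a (ℕₚ.≤-trans (Strip-hd μ κ s) m≤))))
          (cong (_⊗ (𝟙 (Agree? r (lam ∘ suc) ν) ⊗ strip x κ ν)) (ℤₚ.*-zeroʳ (𝟙 (Agree? R (lam ∘ suc) κ)))))))
      })

-- Gelfand–Tsetlin sums

stage : ∀ {l} → ℕ → ℤ → ℕ → (ℕ → ℕ) → Vec ℕ l → (Vec ℕ l → ℤ) → ℤ
stage {l} b y R lam μ G = ∑ (box b l) (λ κ → 𝟙 (Agree? R lam κ) ⊗ strip y μ κ ⊗ G κ)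

-- Gelfand–Tsetlin sum over chains of k horizontal strips from 0 to μ, in which the
-- first R j rows of the j-th partition are complete, that is, agree with lam.
Z : ∀ {l} → ℕ → (ℕ → ℕ) → (ℕ → ℕ) → (ℕ → ℤ) → ℕ → Vec ℕ l → ℤ
Z b R lam x zero    μ = 𝟙 (μ ≟ᵐ Vec.replicate _ 0)
Z b R lam x (suc k) μ = stage b (x k) (R k) lam μ (Z b R lam x k)

Agree-cong : ∀ {l} R {lam lam′ : ℕ → ℕ} (κ : Vec ℕ l) → (∀ q → q < R → lam q ≡ lam′ q) →
             Agree R lam κ → Agree R lam′ κ
Agree-cong zero    κ       eq A        = tt
Agree-cong (suc R) []      eq A        = tt
Agree-cong (suc R) (t ∷ κ) eq (e , A) =
  trans e (eq 0 (s≤s z≤n)) , Agree-cong R κ (λ q lt → eq (suc q) (s≤s lt)) A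

𝟙-Agree-cong : ∀ {l} R {lam lam′ : ℕ → ℕ} (κ : Vec ℕ l) → (∀ q → q < R → lam q ≡ lam′ q) →
               𝟙 (Agree? R lam κ) ≡ 𝟙 (Agree? R lam′ κ)
𝟙-Agree-cong R κ eq = 𝟙-⇔ (Agree? R _ κ) (Agree? R _ κ)
  (Agree-cong R κ eq) (Agree-cong R κ (λ q lt → sym (eq q lt)))

Z-cong : ∀ {l} b {R R′ lam lam′ x x′} k (μ : Vec ℕ l) →
         (∀ j → j < k → R j ≡ R′ j) → (∀ j → j < k → ∀ q → q < R j → lam q ≡ lam′ q) →
         (∀ j → j < k → x j ≡ x′ j) → Z b R lam x k μ ≡ Z b R′ lam′ x′ k μ
Z-cong b zero μ _ _ _ = refl
Z-cong {l} b {R} {R′} {lam} {lam′} {x} {x′} (suc k) μ eqR eqlam eqx = ∑-cong (box b l) (λ κ →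
  cong₂ _⊗_
    (cong₂ (λ i y → i ⊗ strip y μ κ)
      (trans (𝟙-Agree-cong (R k) κ (eqlam k (ℕₚ.n<1+n k)))
             (cong (λ n → 𝟙 (Agree? n lam′ κ)) (eqR k (ℕₚ.n<1+n k))))
      (eqx k (ℕₚ.n<1+n k)))
    (Z-cong b {R} {R′} {lam} {lam′} {x} {x′} k κ (λ j lt → eqR j (ℕₚ.m<n⇒m<1+n lt))
      (λ j lt → eqlam j (ℕₚ.m<n⇒m<1+n lt)) (λ j lt → eqx j (ℕₚ.m<n⇒m<1+n lt))))

Z-two : ∀ {l} b R lam x k (μ : Vec ℕ l) →
        Z b R lam x (suc (suc k)) μ
        ≡ ∑ (box b l) (λ ν → two b (x k) (x (suc k)) (R (suc k)) (R k) lam μ ν ⊗ Z b R lam x k ν)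
Z-two {l} b R lam x k μ = begin
  _ ≡⟨ ∑-cong (box b l) (λ κ → trans (sym (∑-⊗ (box b l) (A κ) (λ ν → B κ ν ⊗ z ν)))
         (∑-cong (box b l) (λ ν → sym (ℤₚ.*-assoc (A κ) (B κ ν) (z ν))))) ⟩
  ∑ (box b l) (λ κ → ∑ (box b l) (λ ν → A κ ⊗ B κ ν ⊗ z ν))
    ≡⟨ ∑-swap (box b l) (box b l) (λ κ ν → A κ ⊗ B κ ν ⊗ z ν) ⟩
  ∑ (box b l) (λ ν → ∑ (box b l) (λ κ → A κ ⊗ B κ ν ⊗ z ν))
    ≡⟨ ∑-cong (box b l) (λ ν → ∑-⊗ʳ (box b l) (z ν) (λ κ → A κ ⊗ B κ ν)) ⟩
  _ ∎
  where
  open ≡-Reasoning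
  A : Vec ℕ l → ℤ
  A κ = 𝟙 (Agree? (R (suc k)) lam κ) ⊗ strip (x (suc k)) μ κ
  B : Vec ℕ l → Vec ℕ l → ℤ
  B κ ν = 𝟙 (Agree? (R k) lam ν) ⊗ strip (x k) κ ν
  z : Vec ℕ l → ℤ
  z = Z b R lam x k

Strip-bound : ∀ {l b} (μ κ : Vec ℕ l) → Strip μ κ → VAll.All (_< b) μ → VAll.All (_< b) κ
Strip-bound []      []      _               []        = []
Strip-bound (a ∷ μ) (t ∷ κ) ((_ , t≤a) , s) (lt ∷ lts) = ℕₚ.≤-<-trans t≤a lt ∷ Strip-bound μ κ s lts

stage-guard : ∀ {l} b y R lam (μ : Vec ℕ l) {G G′ : Vec ℕ l → ℤ} →
              (∀ κ → Agree R lam κ → Strip μ κ → G κ ≡ G′ κ) →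
              stage b y R lam μ G ≡ stage b y R lam μ G′
stage-guard {l} b y R lam μ {G} {G′} eq = ∑-cong (box b l) (λ κ → begin
  𝟙 (Agree? R lam κ) ⊗ strip y μ κ ⊗ G κ
    ≡⟨ regroup (𝟙 (Agree? R lam κ)) (𝟙 (Strip? μ κ)) (weight y μ κ) (G κ) ⟩
  𝟙 (Agree? R lam κ) ⊗ (𝟙 (Strip? μ κ) ⊗ (weight y μ κ ⊗ G κ))
    ≡⟨ 𝟙-guard (Agree? R lam κ) (λ A → 𝟙-guard (Strip? μ κ) (λ s → cong (weight y μ κ ⊗_) (eq κ A s))) ⟩
  𝟙 (Agree? R lam κ) ⊗ (𝟙 (Strip? μ κ) ⊗ (weight y μ κ ⊗ G′ κ))
    ≡⟨ regroup (𝟙 (Agree? R lam κ)) (𝟙 (Strip? μ κ)) (weight y μ κ) (G′ κ) ⟨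
  𝟙 (Agree? R lam κ) ⊗ strip y μ κ ⊗ G′ κ ∎)
  where
  open ≡-Reasoning
  regroup : ∀ i j w g → i ⊗ (j ⊗ w) ⊗ g ≡ i ⊗ (j ⊗ (w ⊗ g))
  regroup = solve-∀

stage-⊗ : ∀ {l} b y R lam (μ : Vec ℕ l) c (G : Vec ℕ l → ℤ) →
          stage b y R lam μ (λ κ → c ⊗ G κ) ≡ c ⊗ stage b y R lam μ G
stage-⊗ {l} b y R lam μ c G = trans
  (∑-cong (box b l) (λ κ → pull (𝟙 (Agree? R lam κ) ⊗ strip y μ κ) c (G κ)))
  (∑-⊗ (box b l) c (λ κ → 𝟙 (Agree? R lam κ) ⊗ strip y μ κ ⊗ G κ))
  where
  pull : ∀ i c g → i ⊗ (c ⊗ g) ≡ c ⊗ (i ⊗ g)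
  pull = solve-∀

stage-minus : ∀ {l} b y R lam (μ : Vec ℕ l) (G G′ : Vec ℕ l → ℤ) →
              stage b y R lam μ (λ κ → G κ - G′ κ) ≡ stage b y R lam μ G - stage b y R lam μ G′
stage-minus {l} b y R lam μ G G′ = trans
  (∑-cong (box b l) (λ κ → distrib (𝟙 (Agree? R lam κ) ⊗ strip y μ κ) (G κ) (G′ κ)))
  (∑-minus (box b l) (λ κ → 𝟙 (Agree? R lam κ) ⊗ strip y μ κ ⊗ G κ) (λ κ → 𝟙 (Agree? R lam κ) ⊗ strip y μ κ ⊗ G′ κ))
  where
  distrib : ∀ i g h → i ⊗ (g - h) ≡ i ⊗ g - i ⊗ h
  distrib = solve-∀

stage-forced : ∀ {l} b y R lam a (μ : Vec ℕ l) G → a ≡ lam 0 → hd μ ≤ a → a < b →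
               stage b y (suc R) lam (a ∷ μ) G ≡ stage b y R (lam ∘ suc) μ (λ κ → G (a ∷ κ))
stage-forced {l} b y R lam a μ G eq m≤a a<b = begin
  _ ≡⟨ ∑-box b l _ ⟩
  _ ≡⟨ ∑-cong (upTo b) (λ t → trans (∑-cong (box b l) (split t)) (∑-⊗ (box b l) (𝟙 (t ℕₚ.≟ a)) (F t))) ⟩
  ∑ (upTo b) (λ t → 𝟙 (t ℕₚ.≟ a) ⊗ ∑ (box b l) (F t))
    ≡⟨ ∑-pick b a (λ t → ∑ (box b l) (F t)) a<b ⟩
  ∑ (box b l) (F a)
    ≡⟨ ∑-cong (box b l) (λ κ → cong (λ z → 𝟙 (Agree? R (lam ∘ suc) κ) ⊗ z ⊗ G (a ∷ κ))
         (trans (strip-∷ y a μ a κ) (trans (cong₂ (λ i j → i ⊗ j ⊗ strip y μ κ)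
          (𝟙-yes ((hd μ ≤? a) ×-dec (a ≤? a)) (m≤a , ℕₚ.≤-refl)) (cong (y ^_) (ℕₚ.n∸n≡0 a)))
          (one (strip y μ κ))))) ⟩
  _ ∎
  where
  open ≡-Reasoning
  F : ℕ → Vec ℕ l → ℤ
  F t κ = 𝟙 (Agree? R (lam ∘ suc) κ) ⊗ strip y (a ∷ μ) (t ∷ κ) ⊗ G (t ∷ κ)
  one : ∀ s → 1ℤ ⊗ 1ℤ ⊗ s ≡ s
  one = solve-∀
  regroup : ∀ i j s g → i ⊗ j ⊗ s ⊗ g ≡ i ⊗ (j ⊗ s ⊗ g)
  regroup = solve-∀
  split : ∀ t κ → 𝟙 (Agree? (suc R) lam (t ∷ κ)) ⊗ strip y (a ∷ μ) (t ∷ κ) ⊗ G (t ∷ κ) ≡ 𝟙 (t ℕₚ.≟ a) ⊗ F t κ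
  split t κ rewrite sym eq = trans
    (cong (λ i → i ⊗ strip y (a ∷ μ) (t ∷ κ) ⊗ G (t ∷ κ)) (𝟙-× (t ℕₚ.≟ a) (Agree? R (lam ∘ suc) κ)))
    (regroup (𝟙 (t ℕₚ.≟ a)) (𝟙 (Agree? R (lam ∘ suc) κ)) (strip y (a ∷ μ) (t ∷ κ)) (G (t ∷ κ)))

record Lower (r : ℕ) (lam lam⁻ : ℕ → ℕ) : Set where
  field
    at-r      : lam r ≡ suc (lam⁻ r)
    elsewhere : ∀ q → q ≢ r → lam⁻ q ≡ lam q

Lower-suc : ∀ {r lam lam⁻} → Lower (suc r) lam lam⁻ → Lower r (lam ∘ suc) (lam⁻ ∘ suc)
Lower-suc L = record
  { at-r = Lower.at-r L
  ; elsewhere = λ q ne → Lower.elsewhere L (suc q) (ne ∘ ℕₚ.suc-injective) }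

-- Rows up to r are complete before this letter as well as after it, so the letter acts only below
-- row r and the missing cell passes unchanged from μ to κ.
stage-drop : ∀ {l} b y R r c {lam lam⁻} {μ μ⁻ : Vec ℕ l} (G G⁻ : Vec ℕ l → ℤ) →
             Lower r lam lam⁻ → VAll.All (_< b) μ → Drop r lam μ μ⁻ → suc r ≤ R →
             (∀ κ κ⁻ → VAll.All (_< b) κ → hd κ ≤ hd μ → hd κ⁻ ≤ hd μ⁻ → Drop r lam κ κ⁻ → G κ ≡ c ⊗ G⁻ κ⁻) →
             stage b y R lam μ G ≡ c ⊗ stage b y R lam⁻ μ⁻ G⁻
stage-drop {suc l} b y (suc R) .0 c {lam} {lam⁻} {suc a ∷ μ} G G⁻ L (a<b ∷ μ<b) (drop-here eq m≤a) r<R hyp = begin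
  stage b y (suc R) lam (suc a ∷ μ) G
    ≡⟨ stage-forced b y R lam (suc a) μ G (sym eq) (ℕₚ.m≤n⇒m≤1+n m≤a) a<b ⟩
  stage b y R (lam ∘ suc) μ (λ κ → G (suc a ∷ κ))
    ≡⟨ stage-guard b y R (lam ∘ suc) μ (λ κ _ s → hyp (suc a ∷ κ) (a ∷ κ)
         (a<b ∷ Strip-bound μ κ s μ<b) ℕₚ.≤-refl ℕₚ.≤-refl (drop-here eq (ℕₚ.≤-trans (Strip-hd μ κ s) m≤a))) ⟩
  stage b y R (lam ∘ suc) μ (λ κ → c ⊗ G⁻ (a ∷ κ))
    ≡⟨ stage-⊗ b y R (lam ∘ suc) μ c (λ κ → G⁻ (a ∷ κ)) ⟩
  c ⊗ stage b y R (lam ∘ suc) μ (λ κ → G⁻ (a ∷ κ))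
    ≡⟨ cong (c ⊗_) (∑-cong (box b l) (λ κ → cong (λ i → i ⊗ strip y μ κ ⊗ G⁻ (a ∷ κ))
         (𝟙-Agree-cong R κ (λ q _ → sym (Lower.elsewhere L (suc q) λ ()))))) ⟩
  c ⊗ stage b y R (lam⁻ ∘ suc) μ (λ κ → G⁻ (a ∷ κ))
    ≡⟨ cong (c ⊗_) (stage-forced b y R lam⁻ a μ G⁻ (ℕₚ.suc-injective (trans (sym eq) (Lower.at-r L))) m≤a (ℕₚ.<-trans (ℕₚ.n<1+n a) a<b)) ⟨
  _ ∎
  where open ≡-Reasoning
stage-drop b y (suc R) (suc r) c {lam} {lam⁻} {a ∷ μ} {a ∷ μ⁻} G G⁻ L (a<b ∷ μ<b) (drop-there eq m≤ m⁻≤ drop) (s≤s r<R) hyp = begin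
  stage b y (suc R) lam (a ∷ μ) G
    ≡⟨ stage-forced b y R lam a μ G eq m≤ a<b ⟩
  stage b y R (lam ∘ suc) μ (λ κ → G (a ∷ κ))
    ≡⟨ stage-drop b y R r c (λ κ → G (a ∷ κ)) (λ κ → G⁻ (a ∷ κ)) (Lower-suc L) μ<b drop r<R
         (λ κ κ⁻ κ<b h h⁻ d → hyp (a ∷ κ) (a ∷ κ⁻) (a<b ∷ κ<b) ℕₚ.≤-refl ℕₚ.≤-refl
            (drop-there eq (ℕₚ.≤-trans h m≤) (ℕₚ.≤-trans h⁻ m⁻≤) d)) ⟩
  c ⊗ stage b y R (lam⁻ ∘ suc) μ⁻ (λ κ → G⁻ (a ∷ κ))
    ≡⟨ cong (c ⊗_) (stage-forced b y R lam⁻ a μ⁻ G⁻ (trans eq (sym (Lower.elsewhere L 0 λ ()))) m⁻≤ a<b) ⟨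
  _ ∎
  where open ≡-Reasoning

-- R counts the rows demanded complete at each stage for v: row r is among them for the first time
-- at stage i + 1, and at all later stages. R⁻ differs only in dropping this demand at stage i + 1.
record Descent (r i : ℕ) (R R⁻ : ℕ → ℕ) : Set where
  field
    R-i    : R i ≡ r
    R-si   : R (suc i) ≡ suc r
    R⁻-si  : R⁻ (suc i) ≡ r
    below  : ∀ j → j < i → R j ≤ r
    above  : ∀ j → suc i < j → suc r ≤ R j
    R⁻-eq  : ∀ j → j ≢ suc i → R⁻ j ≡ R j

-- Induction on the letters after the exchanged pair, through which `stage-drop` carries the missing
-- cell. For k = 0 the pair comes last and `two-drop` applies; the letters before it look at no more
-- than r rows, where lam and lam⁻ coincide.
Z-drop : ∀ {l} b r i {R R⁻ lam lam⁻ x x′} → Descent r i R R⁻ → Lower r lam lam⁻ →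
         x′ i ≡ x (suc i) → x′ (suc i) ≡ x i → (∀ j → j ≢ i → j ≢ suc i → x′ j ≡ x j) →
         ∀ k {μ μ⁻ : Vec ℕ l} → VAll.All (_< b) μ → Drop r lam μ μ⁻ →
         Z b R lam x (suc (suc i) + k) μ - Z b R lam x′ (suc (suc i) + k) μ
         ≡ (x i - x (suc i)) ⊗ Z b R⁻ lam⁻ x (suc (suc i) + k) μ⁻
Z-drop {l} b r i {R} {R⁻} {lam} {lam⁻} {x} {x′} D L eq₀ eq₁ eq zero {μ} {μ⁻} μ<b drop
  rewrite ℕₚ.+-identityʳ i = begin
  Z b R lam x (suc (suc i)) μ - Z b R lam x′ (suc (suc i)) μ
    ≡⟨ cong₂ _-_ (Z-two b R lam x i μ) (Z-two b R lam x′ i μ) ⟩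
  ∑ (box b l) (λ ν → two b (x i) (x (suc i)) (R (suc i)) (R i) lam μ ν ⊗ z ν)
  - ∑ (box b l) (λ ν → two b (x′ i) (x′ (suc i)) (R (suc i)) (R i) lam μ ν ⊗ Z b R lam x′ i ν)
    ≡⟨ cong₂ _-_ (∑-cong (box b l) (λ ν → cong₂ (λ p q → two b (x i) (x (suc i)) p q lam μ ν ⊗ z ν) R-si R-i))
         (∑-cong (box b l) (λ ν → cong₂ _⊗_
           (trans (cong₂ (λ p q → two b p q (R (suc i)) (R i) lam μ ν) eq₀ eq₁)
                  (cong₂ (λ p q → two b (x (suc i)) (x i) p q lam μ ν) R-si R-i))
           (Z-cong b {R} {R} {lam} {lam} {x′} {x} i ν (λ _ _ → refl) (λ _ _ _ _ → refl)
             (λ j j<i → eq j (ℕₚ.<⇒≢ j<i) (ℕₚ.<⇒≢ (ℕₚ.m<n⇒m<1+n j<i)))))) ⟩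
  ∑ (box b l) (λ ν → T ν ⊗ z ν) - ∑ (box b l) (λ ν → T′ ν ⊗ z ν)
    ≡⟨ ∑-minus (box b l) (λ ν → T ν ⊗ z ν) (λ ν → T′ ν ⊗ z ν) ⟨
  ∑ (box b l) (λ ν → T ν ⊗ z ν - T′ ν ⊗ z ν)
    ≡⟨ ∑-cong (box b l) (λ ν → trans (factor (T ν) (T′ ν) (z ν))
         (trans (cong (_⊗ z ν) (two-drop b (x i) (x (suc i)) r lam ν μ<b drop))
                (ℤₚ.*-assoc (x i - x (suc i)) (T⁻ ν) (z ν)))) ⟩
  ∑ (box b l) (λ ν → (x i - x (suc i)) ⊗ (T⁻ ν ⊗ z ν))
    ≡⟨ ∑-⊗ (box b l) (x i - x (suc i)) (λ ν → T⁻ ν ⊗ z ν) ⟩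
  (x i - x (suc i)) ⊗ ∑ (box b l) (λ ν → T⁻ ν ⊗ z ν)
    ≡⟨ cong ((x i - x (suc i)) ⊗_) (∑-cong (box b l) (λ ν → cong₂ _⊗_
         (trans (two-lam (x i) (x (suc i)) ν) (cong₂ (λ p q → two b (x i) (x (suc i)) p q lam⁻ μ⁻ ν) (sym R⁻-si) (sym (trans (R⁻-eq i (ℕₚ.1+n≢n ∘ sym)) R-i))))
         (Z-cong b {R} {R⁻} {lam} {lam⁻} {x} {x} i ν
           (λ j j<i → sym (R⁻-eq j (ℕₚ.<⇒≢ (ℕₚ.m<n⇒m<1+n j<i))))
           (λ j j<i q q<R → sym (Lower.elsewhere L q (ℕₚ.<⇒≢ (ℕₚ.<-≤-trans q<R (below j j<i)))))
           (λ _ _ → refl)))) ⟩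
  (x i - x (suc i)) ⊗ ∑ (box b l) (λ ν → two b (x i) (x (suc i)) (R⁻ (suc i)) (R⁻ i) lam⁻ μ⁻ ν ⊗ Z b R⁻ lam⁻ x i ν)
    ≡⟨ cong ((x i - x (suc i)) ⊗_) (Z-two b R⁻ lam⁻ x i μ⁻) ⟨
  (x i - x (suc i)) ⊗ Z b R⁻ lam⁻ x (suc (suc i)) μ⁻ ∎
  where
  open ≡-Reasoning
  open Descent D
  z T T′ T⁻ : Vec ℕ l → ℤ
  z = Z b R lam x i
  T = two b (x i) (x (suc i)) (suc r) r lam μ
  T′ = two b (x (suc i)) (x i) (suc r) r lam μ
  T⁻ = two b (x i) (x (suc i)) r r lam μ⁻
  factor : ∀ p q s → p ⊗ s - q ⊗ s ≡ (p - q) ⊗ s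
  factor = solve-∀
  agree : ∀ (κ : Vec ℕ l) → 𝟙 (Agree? r lam κ) ≡ 𝟙 (Agree? r lam⁻ κ)
  agree κ = 𝟙-Agree-cong r κ (λ q q<r → sym (Lower.elsewhere L q (ℕₚ.<⇒≢ q<r)))
  two-lam : ∀ p q ν → two b p q r r lam μ⁻ ν ≡ two b p q r r lam⁻ μ⁻ ν
  two-lam p q ν = ∑-cong (box b l) (λ κ →
    cong₂ (λ i j → i ⊗ strip q μ⁻ κ ⊗ (j ⊗ strip p κ ν)) (agree κ) (agree ν))
Z-drop {l} b r i {R} {R⁻} {lam} {lam⁻} {x} {x′} D L eq₀ eq₁ eq (suc k) {μ} {μ⁻} μ<b drop
  rewrite ℕₚ.+-suc i k = begin
  stage b (x n) (R n) lam μ (z x) - stage b (x′ n) (R n) lam μ (z x′)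
    ≡⟨ cong (λ p → stage b (x n) (R n) lam μ (z x) - stage b p (R n) lam μ (z x′))
         (eq n (ℕₚ.<⇒≢ (ℕₚ.<-trans (ℕₚ.n<1+n i) i<n) ∘ sym) (ℕₚ.<⇒≢ i<n ∘ sym)) ⟩
  stage b (x n) (R n) lam μ (z x) - stage b (x n) (R n) lam μ (z x′)
    ≡⟨ stage-minus b (x n) (R n) lam μ (z x) (z x′) ⟨
  stage b (x n) (R n) lam μ (λ κ → z x κ - z x′ κ)
    ≡⟨ stage-drop b (x n) (R n) r (x i - x (suc i)) (λ κ → z x κ - z x′ κ) (Z b R⁻ lam⁻ x n) L μ<b drop (above n i<n)
         (λ κ κ⁻ κ<b _ _ d → Z-drop b r i D L eq₀ eq₁ eq k κ<b d) ⟩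
  (x i - x (suc i)) ⊗ stage b (x n) (R n) lam⁻ μ⁻ (Z b R⁻ lam⁻ x n)
    ≡⟨ cong (λ p → (x i - x (suc i)) ⊗ stage b (x n) p lam⁻ μ⁻ (Z b R⁻ lam⁻ x n)) (R⁻-eq n (ℕₚ.<⇒≢ i<n ∘ sym)) ⟨
  _ ∎
  where
  open ≡-Reasoning
  open Descent D
  n : ℕ
  n = suc (suc (i + k))
  i<n : suc i < n
  i<n = s≤s (s≤s (ℕₚ.m≤m+n i k))
  z : (ℕ → ℤ) → Vec ℕ l → ℤ
  z x = Z b R lam x n

-- Row q of κ is squeezed between rows q + 1 and q of μ. When both are complete and have the same
-- final length, row q of κ is complete too, without being asked.
fill : ∀ {l} R S S′ lam (μ κ : Vec ℕ l) →
       (∀ q → R ≤ q → q < S → lam (suc q) ≡ lam q × suc q < S′ × suc q < l) →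
       Agree S′ lam μ → Strip μ κ → Agree R lam κ → Agree S lam κ
fill R zero    S′ lam μ       κ       h A s B = tt
fill R (suc S) S′ lam []      []      h A s B = tt
fill {suc l} R (suc S) S′ lam (a ∷ μ) (t ∷ κ) h A ((lo , hi) , s) B =
  head R S′ μ h A lo B , fill (pred R) S (pred S′) (lam ∘ suc) μ κ tail-h (tail-A S′ A) s (tail-B R B)
  where
  head : ∀ {l} R S′ (μ : Vec ℕ l) → (∀ q → R ≤ q → q < suc S → lam (suc q) ≡ lam q × suc q < S′ × suc q < suc l) →
         Agree S′ lam (a ∷ μ) → hd μ ≤ t → Agree R lam (t ∷ κ) → t ≡ lam 0
  head (suc R) S′ μ h A lo (e , _) = e
  head zero S′ μ h A lo B with h 0 z≤n (s≤s z≤n)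
  head zero (suc (suc S′)) (a′ ∷ μ) h (e , e′ , _) lo B | eq , s≤s (s≤s _) , s≤s (s≤s _) =
    ℕₚ.≤-antisym (ℕₚ.≤-trans hi (ℕₚ.≤-reflexive e)) (ℕₚ.≤-trans (ℕₚ.≤-reflexive (sym (trans e′ eq))) lo)
  tail-A : ∀ S′ → Agree S′ lam (a ∷ μ) → Agree (pred S′) (lam ∘ suc) μ
  tail-A zero     A       = tt
  tail-A (suc S′) (_ , A) = A
  tail-B : ∀ R → Agree R lam (t ∷ κ) → Agree (pred R) (lam ∘ suc) κ
  tail-B zero    B       = tt
  tail-B (suc R) (_ , B) = B
  tail-h : ∀ q → pred R ≤ q → q < S → lam (suc (suc q)) ≡ lam (suc q) × suc q < pred S′ × suc q < l
  tail-h q R≤q q<S with h (suc q) (ℕₚ.≤-trans (pred-≤ R) (s≤s R≤q)) (s≤s q<S)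
    where
    pred-≤ : ∀ R → R ≤ suc (pred R)
    pred-≤ zero    = z≤n
    pred-≤ (suc R) = ℕₚ.≤-refl
  ... | eq , lt , lt′ = eq , ℕₚ.pred-mono-≤ lt , ℕₚ.≤-pred lt′

Agree-weaken : ∀ {l} {R S} lam (κ : Vec ℕ l) → R ≤ S → Agree S lam κ → Agree R lam κ
Agree-weaken lam κ       z≤n       A       = tt
Agree-weaken lam []      (s≤s R≤S) A       = tt
Agree-weaken lam (t ∷ κ) (s≤s R≤S) (e , A) = e , Agree-weaken (lam ∘ suc) κ R≤S A

-- From the top downwards: once the partition at stage k + 1 satisfies S, `fill` shows that R and S
-- select the same partitions at stage k. The topmost μ satisfies S by hypothesis.
Z-indep : ∀ {l} b m {R S} lam x → (∀ k → k < m → R k ≤ S k) →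
          (∀ k → k < m → ∀ q → R k ≤ q → q < S k → lam (suc q) ≡ lam q × suc q < S (suc k) × suc q < l) →
          ∀ k → k ≤ m → (μ : Vec ℕ l) → Agree (S k) lam μ → Z b R lam x k μ ≡ Z b S lam x k μ
Z-indep b m lam x R≤S h zero _ μ A = refl
Z-indep {l} b m {R} {S} lam x R≤S h (suc k) k<m μ A = ∑-cong (box b l) (λ κ → begin
  𝟙 (Agree? (R k) lam κ) ⊗ strip (x k) μ κ ⊗ Z b R lam x k κ
    ≡⟨ regroup (𝟙 (Agree? (R k) lam κ)) (𝟙 (Strip? μ κ)) (weight (x k) μ κ) (Z b R lam x k κ) ⟩
  𝟙 (Agree? (R k) lam κ) ⊗ 𝟙 (Strip? μ κ) ⊗ (weight (x k) μ κ ⊗ Z b R lam x k κ)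
    ≡⟨ cong (_⊗ (weight (x k) μ κ ⊗ Z b R lam x k κ)) (trans (sym (𝟙-× (Agree? (R k) lam κ) (Strip? μ κ)))
         (trans (𝟙-⇔ (Agree? (R k) lam κ ×-dec Strip? μ κ) (Agree? (S k) lam κ ×-dec Strip? μ κ)
                  (λ (B , s) → fill (R k) (S k) (S (suc k)) lam μ κ (h k k<m) A s B , s)
                  (λ (B , s) → Agree-weaken lam κ (R≤S k k<m) B , s))
           (𝟙-× (Agree? (S k) lam κ) (Strip? μ κ)))) ⟩
  𝟙 (Agree? (S k) lam κ) ⊗ 𝟙 (Strip? μ κ) ⊗ (weight (x k) μ κ ⊗ Z b R lam x k κ)
    ≡⟨ regroup (𝟙 (Agree? (S k) lam κ)) (𝟙 (Strip? μ κ)) (weight (x k) μ κ) (Z b R lam x k κ) ⟨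
  𝟙 (Agree? (S k) lam κ) ⊗ strip (x k) μ κ ⊗ Z b R lam x k κ
    ≡⟨ regroup′ (𝟙 (Agree? (S k) lam κ)) (strip (x k) μ κ) (Z b R lam x k κ) ⟩
  𝟙 (Agree? (S k) lam κ) ⊗ (strip (x k) μ κ ⊗ Z b R lam x k κ)
    ≡⟨ 𝟙-guard (Agree? (S k) lam κ) (λ B → cong (strip (x k) μ κ ⊗_)
         (Z-indep b m lam x R≤S h k (ℕₚ.<⇒≤ k<m) κ B)) ⟩
  𝟙 (Agree? (S k) lam κ) ⊗ (strip (x k) μ κ ⊗ Z b S lam x k κ)
    ≡⟨ regroup′ (𝟙 (Agree? (S k) lam κ)) (strip (x k) μ κ) (Z b S lam x k κ) ⟨
  _ ∎)
  where
  open ≡-Reasoning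
  regroup : ∀ i j w g → i ⊗ (j ⊗ w) ⊗ g ≡ i ⊗ j ⊗ (w ⊗ g)
  regroup = solve-∀
  regroup′ : ∀ i j g → i ⊗ j ⊗ g ≡ i ⊗ (j ⊗ g)
  regroup′ = solve-∀

Zeros : ∀ {l} → ℕ → Vec ℕ l → Set
Zeros k       []      = ⊤
Zeros zero    (t ∷ κ) = t ≡ 0 × Zeros zero κ
Zeros (suc k) (t ∷ κ) = Zeros k κ

Zeros? : ∀ {l} k (κ : Vec ℕ l) → Dec (Zeros k κ)
Zeros? k       []      = yes tt
Zeros? zero    (t ∷ κ) = (t ℕₚ.≟ 0) ×-dec Zeros? zero κ
Zeros? (suc k) (t ∷ κ) = Zeros? k κ

Zeros-replicate : ∀ l → Zeros 0 (Vec.replicate l 0)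
Zeros-replicate zero    = tt
Zeros-replicate (suc l) = refl , Zeros-replicate l

Zeros-Strip : ∀ {l} k (μ κ : Vec ℕ l) → Strip μ κ → Zeros k κ → Zeros (suc k) μ
Zeros-Strip k       []      []      s              z       = tt
Zeros-Strip zero    (a ∷ μ) (t ∷ κ) ((le , _) , s) (e , z) = below μ κ le s z
  where
  below : ∀ {l} (μ κ : Vec ℕ l) → hd μ ≤ t → Strip μ κ → Zeros 0 κ → Zeros 0 μ
  below []      []       le s               z        = tt
  below (a ∷ μ) (t′ ∷ κ) le ((le′ , _) , s) (e′ , z) =
    ℕₚ.n≤0⇒n≡0 (ℕₚ.≤-trans le (ℕₚ.≤-reflexive e)) ,
    below μ κ (ℕₚ.≤-trans (ℕₚ.≤-trans le′ (ℕₚ.≤-reflexive e′)) z≤n) s z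
Zeros-Strip (suc k) (a ∷ μ) (t ∷ κ) (_ , s)        z       = Zeros-Strip k μ κ s z

-- A horizontal strip creates at most one new nonzero row, so k strips from 0 reach at most k of
-- them.
Z-zero : ∀ {l} b R lam x k (μ : Vec ℕ l) → ¬ Zeros k μ → Z b R lam x k μ ≡ 0ℤ
Z-zero {l} b R lam x zero μ nz = 𝟙-no (μ ≟ᵐ Vec.replicate _ 0) (λ { refl → nz (Zeros-replicate l) })
Z-zero {l} b R lam x (suc k) μ nz = ∑-zero (box b l) term
  where
  term : ∀ κ → 𝟙 (Agree? (R k) lam κ) ⊗ strip (x k) μ κ ⊗ Z b R lam x k κ ≡ 0ℤ
  term κ with Zeros? k κ
  ... | no nz′ = trans (cong (𝟙 (Agree? (R k) lam κ) ⊗ strip (x k) μ κ ⊗_) (Z-zero b R lam x k κ nz′))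
                   (ℤₚ.*-zeroʳ (𝟙 (Agree? (R k) lam κ) ⊗ strip (x k) μ κ))
  ... | yes z = trans
    (cong (λ i → 𝟙 (Agree? (R k) lam κ) ⊗ (i ⊗ weight (x k) μ κ) ⊗ Z b R lam x k κ)
      (𝟙-no (Strip? μ κ) (λ s → nz (Zeros-Strip k μ κ s z))))
    (vanish (𝟙 (Agree? (R k) lam κ)) (weight (x k) μ κ) (Z b R lam x k κ))
    where
    vanish : ∀ i w g → i ⊗ (0ℤ ⊗ w) ⊗ g ≡ 0ℤ
    vanish = solve-∀

trunc : ℕ → (ℕ → ℕ) → ∀ l → Vec ℕ l
trunc k       lam zero    = []
trunc zero    lam (suc l) = 0 ∷ trunc zero lam l
trunc (suc k) lam (suc l) = lam 0 ∷ trunc k (lam ∘ suc) l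

Agree-trunc : ∀ k lam l → Agree k lam (trunc k lam l)
Agree-trunc zero    lam l       = tt
Agree-trunc (suc k) lam zero    = tt
Agree-trunc (suc k) lam (suc l) = refl , Agree-trunc k (lam ∘ suc) l

Zeros⇒trunc : ∀ {l} k lam (κ : Vec ℕ l) → Agree k lam κ → Zeros k κ → κ ≡ trunc k lam l
Zeros⇒trunc k       lam []      A       z       = refl
Zeros⇒trunc zero    lam (t ∷ κ) A       (e , z) = cong₂ _∷_ e (Zeros⇒trunc zero lam κ tt z)
Zeros⇒trunc (suc k) lam (t ∷ κ) (e , A) z       = cong₂ _∷_ e (Zeros⇒trunc k (lam ∘ suc) κ A z)

trunc-bound : ∀ {b} k lam l → (∀ q → q < l → lam q < b) → 0 < b → VAll.All (_< b) (trunc k lam l)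
trunc-bound k       lam zero    lt b>0 = []
trunc-bound zero    lam (suc l) lt b>0 = b>0 ∷ trunc-bound zero lam l (λ q q<l → lt q (ℕₚ.m<n⇒m<1+n q<l)) b>0
trunc-bound (suc k) lam (suc l) lt b>0 = lt 0 (s≤s z≤n) ∷ trunc-bound k (lam ∘ suc) l (λ q q<l → lt (suc q) (s≤s q<l)) b>0

trunc-zero : ∀ lam l → trunc 0 lam l ≡ Vec.replicate l 0
trunc-zero lam zero    = refl
trunc-zero lam (suc l) = cong (0 ∷_) (trunc-zero lam l)

strip-zero : ∀ x lam lam′ l → strip x (trunc 0 lam l) (trunc 0 lam′ l) ≡ 1ℤ
strip-zero x lam lam′ zero    = refl
strip-zero x lam lam′ (suc l) = trans (strip-∷ x 0 (trunc 0 lam l) 0 (trunc 0 lam′ l))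
  (cong₂ (λ i s → i ⊗ 1ℤ ⊗ s)
    (𝟙-yes ((hd (trunc 0 lam l) ≤? 0) ×-dec (0 ≤? 0)) (ℕₚ.≤-reflexive (hd-zero l) , z≤n)) (strip-zero x lam lam′ l))
  where
  hd-zero : ∀ l → hd (trunc 0 lam l) ≡ 0
  hd-zero zero    = refl
  hd-zero (suc l) = refl

strip-trunc : ∀ x k lam l → k < l → (∀ q → lam (suc q) ≤ lam q) →
              strip x (trunc (suc k) lam l) (trunc k lam l) ≡ x ^ lam k
strip-trunc x zero lam (suc l) _ dec = trans (strip-∷ x (lam 0) (trunc 0 (lam ∘ suc) l) 0 (trunc 0 lam l))
  (trans (cong₂ (λ i s → i ⊗ x ^ lam 0 ⊗ s)
      (𝟙-yes ((hd (trunc 0 (lam ∘ suc) l) ≤? 0) ×-dec (0 ≤? lam 0))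
        (ℕₚ.≤-reflexive (trans (cong hd (trunc-zero (lam ∘ suc) l)) (hd-replicate l)) , z≤n))
      (strip-zero x (lam ∘ suc) lam l))
    (one (x ^ lam 0)))
  where
  one : ∀ p → 1ℤ ⊗ p ⊗ 1ℤ ≡ p
  one = solve-∀
  hd-replicate : ∀ l → hd (Vec.replicate l 0) ≡ 0
  hd-replicate zero    = refl
  hd-replicate (suc l) = refl
strip-trunc x (suc k) lam (suc l) (s≤s k<l) dec =
  trans (strip-∷ x (lam 0) (trunc (suc k) (lam ∘ suc) l) (lam 0) (trunc k (lam ∘ suc) l))
  (trans (cong₂ (λ i j → i ⊗ j ⊗ strip x (trunc (suc k) (lam ∘ suc) l) (trunc k (lam ∘ suc) l))
      (𝟙-yes ((hd (trunc (suc k) (lam ∘ suc) l) ≤? lam 0) ×-dec (lam 0 ≤? lam 0)) (hd-le l , ℕₚ.≤-refl))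
      (cong (x ^_) (ℕₚ.n∸n≡0 (lam 0))))
    (trans (one (strip x (trunc (suc k) (lam ∘ suc) l) (trunc k (lam ∘ suc) l)))
      (strip-trunc x k (lam ∘ suc) l k<l (dec ∘ suc))))
  where
  one : ∀ p → 1ℤ ⊗ 1ℤ ⊗ p ≡ p
  one = solve-∀
  hd-le : ∀ l → hd (trunc (suc k) (lam ∘ suc) l) ≤ lam 0
  hd-le zero    = z≤n
  hd-le (suc l) = dec 0

∑-box-pick : ∀ {l} b (c : Vec ℕ l) (F : Vec ℕ l → ℤ) → VAll.All (_< b) c →
             ∑ (box b l) (λ κ → 𝟙 (κ ≟ᵐ c) ⊗ F κ) ≡ F c
∑-box-pick b [] F _ = trans (∑-∷ [] [] (λ κ → 𝟙 (κ ≟ᵐ []) ⊗ F κ))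
  (trans (cong (1ℤ ⊗ F [] ⊕_) (∑-[] (λ κ → 𝟙 (κ ≟ᵐ []) ⊗ F κ))) (one (F [])))
  where
  one : ∀ p → 1ℤ ⊗ p ⊕ 0ℤ ≡ p
  one = solve-∀
∑-box-pick {suc l} b (a ∷ c) F (a<b ∷ c<b) = begin
  ∑ (box b (suc l)) (λ κ → 𝟙 (κ ≟ᵐ (a ∷ c)) ⊗ F κ)
    ≡⟨ ∑-box b l (λ κ → 𝟙 (κ ≟ᵐ (a ∷ c)) ⊗ F κ) ⟩
  ∑ (upTo b) (λ t → ∑ (box b l) (λ κ → 𝟙 ((t ∷ κ) ≟ᵐ (a ∷ c)) ⊗ F (t ∷ κ)))
    ≡⟨ ∑-cong (upTo b) (λ t → trans (∑-cong (box b l) (split t))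
         (trans (∑-⊗ (box b l) (𝟙 (t ℕₚ.≟ a)) (λ κ → 𝟙 (κ ≟ᵐ c) ⊗ F (t ∷ κ)))
           (cong (𝟙 (t ℕₚ.≟ a) ⊗_) (∑-box-pick b c (λ κ → F (t ∷ κ)) c<b)))) ⟩
  ∑ (upTo b) (λ t → 𝟙 (t ℕₚ.≟ a) ⊗ F (t ∷ c))
    ≡⟨ ∑-pick b a (λ t → F (t ∷ c)) a<b ⟩
  F (a ∷ c) ∎
  where
  open ≡-Reasoning
  split : ∀ t κ → 𝟙 ((t ∷ κ) ≟ᵐ (a ∷ c)) ⊗ F (t ∷ κ) ≡ 𝟙 (t ℕₚ.≟ a) ⊗ (𝟙 (κ ≟ᵐ c) ⊗ F (t ∷ κ))
  split t κ = trans
    (cong (_⊗ F (t ∷ κ)) (trans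
      (𝟙-⇔ ((t ∷ κ) ≟ᵐ (a ∷ c)) ((t ℕₚ.≟ a) ×-dec (κ ≟ᵐ c)) (λ { refl → refl , refl }) (λ { (refl , refl) → refl }))
      (𝟙-× (t ℕₚ.≟ a) (κ ≟ᵐ c))))
    (ℤₚ.*-assoc (𝟙 (t ℕₚ.≟ a)) (𝟙 (κ ≟ᵐ c)) (F (t ∷ κ)))

∏< : ℕ → (ℕ → ℤ) → ℤ
∏< zero    f = 1ℤ
∏< (suc k) f = f 0 ⊗ ∏< k (f ∘ suc)

∏<-snoc : ∀ k f → ∏< (suc k) f ≡ f k ⊗ ∏< k f
∏<-snoc zero    f = refl
∏<-snoc (suc k) f = trans (cong (f 0 ⊗_) (∏<-snoc k (f ∘ suc))) (swap (f 0) (f (suc k)) (∏< k (f ∘ suc)))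
  where
  swap : ∀ p q r → p ⊗ (q ⊗ r) ≡ q ⊗ (p ⊗ r)
  swap = solve-∀

-- With the first k rows complete after k letters and, by `Z-zero`, no other row nonzero, the chain
-- is forced: letter k adds the whole row k.
Z-dominant : ∀ b lam x l → (∀ q → q < l → lam q < b) → 0 < b → (∀ q → lam (suc q) ≤ lam q) →
             ∀ k → k ≤ l → Z b id lam x k (trunc k lam l) ≡ ∏< k (λ j → x j ^ lam j)
Z-dominant b lam x l lt b>0 dec zero _ = 𝟙-yes (trunc 0 lam l ≟ᵐ Vec.replicate l 0) (trunc-zero lam l)
Z-dominant b lam x l lt b>0 dec (suc k) k<l = begin
  stage b (x k) k lam μ (Z b id lam x k)
    ≡⟨ ∑-cong (box b l) term ⟩
  ∑ (box b l) (λ κ → 𝟙 (κ ≟ᵐ trunc k lam l) ⊗ (strip (x k) μ κ ⊗ Z b id lam x k κ))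
    ≡⟨ ∑-box-pick b (trunc k lam l) (λ κ → strip (x k) μ κ ⊗ Z b id lam x k κ) (trunc-bound k lam l lt b>0) ⟩
  strip (x k) μ (trunc k lam l) ⊗ Z b id lam x k (trunc k lam l)
    ≡⟨ cong₂ _⊗_ (strip-trunc (x k) k lam l k<l dec) (Z-dominant b lam x l lt b>0 dec k (ℕₚ.<⇒≤ k<l)) ⟩
  x k ^ lam k ⊗ ∏< k (λ j → x j ^ lam j)
    ≡⟨ ∏<-snoc k (λ j → x j ^ lam j) ⟨
  ∏< (suc k) (λ j → x j ^ lam j) ∎
  where
  open ≡-Reasoning
  μ : Vec ℕ l
  μ = trunc (suc k) lam l
  term : ∀ κ → 𝟙 (Agree? k lam κ) ⊗ strip (x k) μ κ ⊗ Z b id lam x k κ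
               ≡ 𝟙 (κ ≟ᵐ trunc k lam l) ⊗ (strip (x k) μ κ ⊗ Z b id lam x k κ)
  term κ with Zeros? k κ
  ... | no nz = trans (cong (𝟙 (Agree? k lam κ) ⊗ strip (x k) μ κ ⊗_) (Z-zero b id lam x k κ nz))
    (trans (zero₁ (𝟙 (Agree? k lam κ)) (strip (x k) μ κ) (𝟙 (κ ≟ᵐ trunc k lam l)))
      (cong (λ z → 𝟙 (κ ≟ᵐ trunc k lam l) ⊗ (strip (x k) μ κ ⊗ z)) (sym (Z-zero b id lam x k κ nz))))
    where
    zero₁ : ∀ i s j → i ⊗ s ⊗ 0ℤ ≡ j ⊗ (s ⊗ 0ℤ)
    zero₁ = solve-∀
  ... | yes z = trans (ℤₚ.*-assoc (𝟙 (Agree? k lam κ)) (strip (x k) μ κ) (Z b id lam x k κ))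
    (cong (_⊗ (strip (x k) μ κ ⊗ Z b id lam x k κ)) (𝟙-⇔ (Agree? k lam κ) (κ ≟ᵐ trunc k lam l)
      (λ A → Zeros⇒trunc k lam κ A z) (λ { refl → Agree-trunc k lam l })))

-- Congruences between chain sums

infix 4 _≡_[mod_]
_≡_[mod_] : ℤ → ℤ → ℤ → Set
a ≡ b [mod t ] = t ∣ a - b

mod-refl : ∀ {t} a → a ≡ a [mod t ]
mod-refl {t} a = subst (t ∣_) (sym (ℤₚ.+-inverseʳ a)) (divides 0ℤ refl)

mod-⊕ : ∀ {t} a b c d → a ≡ b [mod t ] → c ≡ d [mod t ] → a ⊕ c ≡ b ⊕ d [mod t ]
mod-⊕ {t} a b c d p q = subst (t ∣_) (regroup a b c d) (Div.∣m∣n⇒∣m+n p q)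
  where
  regroup : ∀ a b c d → (a - b) ⊕ (c - d) ≡ (a ⊕ c) - (b ⊕ d)
  regroup = solve-∀

mod-⊗ : ∀ {t} a b c d → a ≡ b [mod t ] → c ≡ d [mod t ] → a ⊗ c ≡ b ⊗ d [mod t ]
mod-⊗ {t} a b c d p q = subst (t ∣_) (regroup a b c d)
  (Div.∣m∣n⇒∣m+n (Div.∣m⇒∣m*n c p) (Div.∣n⇒∣m*n b q))
  where
  regroup : ∀ a b c d → (a - b) ⊗ c ⊕ b ⊗ (c - d) ≡ a ⊗ c - b ⊗ d
  regroup = solve-∀

mod-^ : ∀ {t} a b n → a ≡ b [mod t ] → a ^ n ≡ b ^ n [mod t ]
mod-^ a b zero    p = mod-refl 1ℤ
mod-^ a b (suc n) p = mod-⊗ a b (a ^ n) (b ^ n) p (mod-^ a b n p)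

mod-∑ : ∀ {t} {A : Set} (xs : List A) (f g : A → ℤ) → (∀ x → f x ≡ g x [mod t ]) → ∑ xs f ≡ ∑ xs g [mod t ]
mod-∑ {t} xs f g p = subst (t ∣_) (∑-minus xs f g) (all xs)
  where
  all : ∀ xs → t ∣ ∑ xs (λ x → f x - g x)
  all []       = subst (t ∣_) (sym (∑-[] _)) (divides 0ℤ refl)
  all (x ∷ xs) = subst (t ∣_) (sym (∑-∷ x xs _)) (Div.∣m∣n⇒∣m+n (p x) (all xs))

mod-weight : ∀ {t l} x y (μ κ : Vec ℕ l) → x ≡ y [mod t ] → weight x μ κ ≡ weight y μ κ [mod t ]
mod-weight x y []      []      p = mod-refl 1ℤ
mod-weight x y (a ∷ μ) (c ∷ κ) p = mod-⊗ (x ^ (a ∸ c)) (y ^ (a ∸ c)) (weight x μ κ) (weight y μ κ)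
  (mod-^ x y (a ∸ c) p) (mod-weight x y μ κ p)

mod-Z : ∀ {t l} b R lam x y → (∀ j → x j ≡ y j [mod t ]) → ∀ k (μ : Vec ℕ l) →
        Z b R lam x k μ ≡ Z b R lam y k μ [mod t ]
mod-Z b R lam x y p zero    μ = mod-refl (Z b R lam x 0 μ)
mod-Z {l = l} b R lam x y p (suc k) μ = mod-∑ (box b l) _ _ (λ κ →
  mod-⊗ (𝟙 (Agree? (R k) lam κ) ⊗ strip (x k) μ κ) (𝟙 (Agree? (R k) lam κ) ⊗ strip (y k) μ κ) (Z b R lam x k κ) (Z b R lam y k κ)
    (mod-⊗ (𝟙 (Agree? (R k) lam κ)) (𝟙 (Agree? (R k) lam κ)) (strip (x k) μ κ) (strip (y k) μ κ)
      (mod-refl (𝟙 (Agree? (R k) lam κ)))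
      (mod-⊗ (𝟙 (Strip? μ κ)) (𝟙 (Strip? μ κ)) (weight (x k) μ κ) (weight (y k) μ κ)
        (mod-refl (𝟙 (Strip? μ κ))) (mod-weight (x k) (y k) μ κ (p k))))
    (mod-Z b R lam x y p k κ))

-- The modulus |a - b| + 1 divides a - b and exceeds it in size, which forces a - b = 0.
mod-all : ∀ a b → (∀ n → a ≡ b [mod + suc n ]) → a ≡ b
mod-all a b p with p ℤ.∣ a - b ∣
... | divides q eq = ℤₚ.i-j≡0⇒i≡j a b (ℤₚ.∣i∣≡0⇒i≡0
        (collapse ℤ.∣ a - b ∣ ℤ.∣ q ∣ (trans (cong ℤ.∣_∣ eq) (ℤₚ.abs-* q (+ suc ℤ.∣ a - b ∣)))))
  where
  collapse : ∀ m k → m ≡ k * suc m → m ≡ 0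
  collapse m zero    eq = eq
  collapse m (suc k) eq = contradiction (ℕₚ.m≤m+n (suc m) (k * suc m)) (ℕₚ.<⇒≱ (s≤s (ℕₚ.≤-reflexive (sym eq))))

-- Evaluation of polynomials

at : ∀ {A : Set} {n} → A → Vec A n → ℕ → A
at d []      k       = d
at d (x ∷ v) zero    = x
at d (x ∷ v) (suc k) = at d v k

swapV : ∀ {A : Set} {n} → ℕ → Vec A n → Vec A n
swapV i       []          = []
swapV zero    (x ∷ [])    = x ∷ []
swapV zero    (x ∷ y ∷ v) = y ∷ x ∷ v
swapV (suc i) (x ∷ v)     = x ∷ swapV i v

σ : ℕ → ℕ → ℕ
σ zero    zero          = 1
σ zero    (suc zero)    = 0
σ zero    (suc (suc j)) = suc (suc j)
σ (suc i) zero          = 0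
σ (suc i) (suc j)       = suc (σ i j)

σ-left : ∀ i → σ i i ≡ suc i
σ-left zero    = refl
σ-left (suc i) = cong suc (σ-left i)

σ-right : ∀ i → σ i (suc i) ≡ i
σ-right zero    = refl
σ-right (suc i) = cong suc (σ-right i)

σ-other : ∀ i j → j ≢ i → j ≢ suc i → σ i j ≡ j
σ-other zero    zero          p q = contradiction refl p
σ-other zero    (suc zero)    p q = contradiction refl q
σ-other zero    (suc (suc j)) p q = refl
σ-other (suc i) zero          p q = refl
σ-other (suc i) (suc j)       p q = cong suc (σ-other i j (p ∘ cong suc) (q ∘ cong suc))

σ-involutive : ∀ i j → σ i (σ i j) ≡ j
σ-involutive zero    zero          = refl
σ-involutive zero    (suc zero)    = refl
σ-involutive zero    (suc (suc j)) = refl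
σ-involutive (suc i) zero          = refl
σ-involutive (suc i) (suc j)       = cong suc (σ-involutive i j)

σ-< : ∀ {n} i j → suc i < n → j < n → σ i j < n
σ-< zero    zero          lt       _        = lt
σ-< zero    (suc zero)    lt       _        = ℕₚ.<-trans (s≤s z≤n) lt
σ-< zero    (suc (suc j)) lt       lt′      = lt′
σ-< (suc i) zero          lt       lt′      = lt′
σ-< (suc i) (suc j)       (s≤s lt) (s≤s lt′) = s≤s (σ-< i j lt lt′)

at-swap : ∀ {A : Set} {n} (d : A) i (v : Vec A n) j → suc i < n → at d (swapV i v) j ≡ at d v (σ i j)
at-swap d zero    (x ∷ [])    j             (s≤s ())
at-swap d zero    (x ∷ y ∷ v) zero          _        = refl
at-swap d zero    (x ∷ y ∷ v) (suc zero)    _        = refl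
at-swap d zero    (x ∷ y ∷ v) (suc (suc j)) _        = refl
at-swap d (suc i) (x ∷ v)     zero          _        = refl
at-swap d (suc i) (x ∷ v)     (suc j)       (s≤s lt) = at-swap d i v j lt

swapV-involutive : ∀ {A : Set} {n} i (v : Vec A n) → swapV i (swapV i v) ≡ v
swapV-involutive i       []          = refl
swapV-involutive zero    (x ∷ [])    = refl
swapV-involutive zero    (x ∷ y ∷ v) = refl
swapV-involutive (suc i) (x ∷ v)     = cong (x ∷_) (swapV-involutive i v)

swapV-comm : ∀ {A : Set} {n} i j (v : Vec A n) → suc i < j → swapV i (swapV j v) ≡ swapV j (swapV i v)
swapV-comm i       j             []          _        = refl
swapV-comm zero    (suc (suc j)) (x ∷ [])    _        = refl
swapV-comm zero    (suc (suc j)) (x ∷ y ∷ v) _        = refl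
swapV-comm zero    (suc zero)    (x ∷ v)     (s≤s ())
swapV-comm (suc i) (suc j)       (x ∷ v)     (s≤s lt) = cong (x ∷_) (swapV-comm i j v lt)

swapV-braid : ∀ {A : Set} {n} i (v : Vec A n) → suc (suc i) < n →
              swapV i (swapV (suc i) (swapV i v)) ≡ swapV (suc i) (swapV i (swapV (suc i) v))
swapV-braid zero    (x ∷ [])        (s≤s ())
swapV-braid zero    (x ∷ y ∷ [])    (s≤s (s≤s ()))
swapV-braid zero    (x ∷ y ∷ z ∷ v) _        = refl
swapV-braid (suc i) (x ∷ v)         (s≤s lt) = cong (x ∷_) (swapV-braid i v lt)

monomial : ∀ {k} → Vec ℤ k → Vec ℕ k → ℤ
monomial ρ a = Vec.foldr′ _⊗_ 1ℤ (Vec.zipWith _^_ ρ a)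

monomial-zero : ∀ {k} (ρ : Vec ℤ k) → monomial ρ (Vec.replicate k 0) ≡ 1ℤ
monomial-zero []      = refl
monomial-zero (x ∷ ρ) = cong (1ℤ ⊗_) (monomial-zero ρ)

monomial-unit : ∀ {k} (ρ : Vec ℤ k) i → monomial ρ (unit i) ≡ at 0ℤ ρ (toℕ i)
monomial-unit (x ∷ ρ) zero    = trans (cong (x ⊗ 1ℤ ⊗_) (monomial-zero ρ)) (ones x)
  where
  ones : ∀ x → x ⊗ 1ℤ ⊗ 1ℤ ≡ x
  ones = solve-∀
monomial-unit (x ∷ ρ) (suc i) = trans (ℤₚ.*-identityˡ (monomial ρ (unit i))) (monomial-unit ρ i)

monomial-+ : ∀ {k} (ρ : Vec ℤ k) a b → monomial ρ (Vec.zipWith _+_ a b) ≡ monomial ρ a ⊗ monomial ρ b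
monomial-+ []      []      []      = refl
monomial-+ (x ∷ ρ) (m ∷ a) (n ∷ b) = trans
  (cong₂ _⊗_ (ℤₚ.^-distribˡ-+-* x m n) (monomial-+ ρ a b))
  (interchange (x ^ m) (x ^ n) (monomial ρ a) (monomial ρ b))
  where
  interchange : ∀ p q r s → p ⊗ q ⊗ (r ⊗ s) ≡ p ⊗ r ⊗ (q ⊗ s)
  interchange = solve-∀

monomial-swap : ∀ {n} (ρ : Vec ℤ (suc n)) i a → monomial ρ (swapᵐ i a) ≡ monomial (swapV (toℕ i) ρ) a
monomial-swap (x ∷ y ∷ ρ) zero    (m ∷ n ∷ a) = swap (x ^ n) (y ^ m) (monomial ρ a)
  where
  swap : ∀ p q r → p ⊗ (q ⊗ r) ≡ q ⊗ (p ⊗ r)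
  swap = solve-∀
monomial-swap (x ∷ ρ)     (suc i) (m ∷ a)     = cong (x ^ m ⊗_) (monomial-swap ρ i a)

module _ {k} (ρ : Vec ℤ k) where
  eval-++ : ∀ f g → eval ρ (f ++ g) ≡ eval ρ f ⊕ eval ρ g
  eval-++ []            g = sym (ℤₚ.+-identityˡ _)
  eval-++ ((c , a) ∷ f) g = trans (cong (c ⊗ monomial ρ a ⊕_) (eval-++ f g)) (sym (ℤₚ.+-assoc (c ⊗ monomial ρ a) _ _))

  eval-scale : ∀ c f → eval ρ (scale c f) ≡ c ⊗ eval ρ f
  eval-scale c []            = sym (ℤₚ.*-zeroʳ c)
  eval-scale c ((d , a) ∷ f) = trans (cong (c ⊗ d ⊗ monomial ρ a ⊕_) (eval-scale c f))
    (distrib c d (monomial ρ a) (eval ρ f))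
    where
    distrib : ∀ c d x y → c ⊗ d ⊗ x ⊕ c ⊗ y ≡ c ⊗ (d ⊗ x ⊕ y)
    distrib = solve-∀

  eval-minus : ∀ f g → eval ρ (f -ₚ g) ≡ eval ρ f - eval ρ g
  eval-minus f g = trans (eval-++ f (scale -1ℤ g)) (cong (eval ρ f ⊕_)
    (trans (eval-scale -1ℤ g) (ℤₚ.-1*i≡-i (eval ρ g))))

  eval-⊗ : ∀ f g → eval ρ (f *ₚ g) ≡ eval ρ f ⊗ eval ρ g
  eval-⊗ []            g = refl
  eval-⊗ ((c , a) ∷ f) g = trans (eval-++ (map (λ (d , b) → c ⊗ d , Vec.zipWith _+_ a b) g) (f *ₚ g))
    (trans (cong₂ _⊕_ (term g) (eval-⊗ f g)) (sym (ℤₚ.*-distribʳ-+ (eval ρ g) (c ⊗ monomial ρ a) (eval ρ f))))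
    where
    distrib : ∀ c d x y z → c ⊗ d ⊗ (x ⊗ y) ⊕ c ⊗ x ⊗ z ≡ c ⊗ x ⊗ (d ⊗ y ⊕ z)
    distrib = solve-∀
    term : ∀ g → eval ρ (map (λ (d , b) → c ⊗ d , Vec.zipWith _+_ a b) g) ≡ c ⊗ monomial ρ a ⊗ eval ρ g
    term []            = sym (ℤₚ.*-zeroʳ (c ⊗ monomial ρ a))
    term ((d , b) ∷ g) = trans (cong₂ (λ p q → c ⊗ d ⊗ p ⊕ q) (monomial-+ ρ a b) (term g))
      (distrib c d (monomial ρ a) (monomial ρ b) (eval ρ g))

  eval-var : ∀ i → eval ρ (var i) ≡ at 0ℤ ρ (toℕ i)
  eval-var i = trans (ones (monomial ρ (unit i))) (monomial-unit ρ i)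
    where
    ones : ∀ x → 1ℤ ⊗ x ⊕ 0ℤ ≡ x
    ones = solve-∀

  without : Vec ℕ k → Poly k → Poly k
  without a []            = []
  without a ((c , b) ∷ f) with b ≟ᵐ a
  ... | yes _ = without a f
  ... | no  _ = (c , b) ∷ without a f

  without-length : ∀ a f → length (without a f) ≤ length f
  without-length a []            = z≤n
  without-length a ((c , b) ∷ f) with b ≟ᵐ a
  ... | yes _ = ℕₚ.m≤n⇒m≤1+n (without-length a f)
  ... | no  _ = s≤s (without-length a f)

  eval-without : ∀ a f → eval ρ f ≡ coeff f a ⊗ monomial ρ a ⊕ eval ρ (without a f)
  eval-without a []            = sym (ℤₚ.+-identityʳ _)
  eval-without a ((c , b) ∷ f) with b ≟ᵐ a
  ... | yes refl = trans (cong (c ⊗ monomial ρ b ⊕_) (eval-without b f))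
          (collect c (coeff f b) (monomial ρ b) (eval ρ (without b f)))
    where
    collect : ∀ c d x r → c ⊗ x ⊕ (d ⊗ x ⊕ r) ≡ (c ⊕ d) ⊗ x ⊕ r
    collect = solve-∀
  ... | no _ = trans (cong (c ⊗ monomial ρ b ⊕_) (eval-without a f))
          (collect (c ⊗ monomial ρ b) (coeff f a) (monomial ρ a) (eval ρ (without a f)))
    where
    collect : ∀ p d x r → p ⊕ (d ⊗ x ⊕ r) ≡ (0ℤ ⊕ d) ⊗ x ⊕ (p ⊕ r)
    collect = solve-∀

  coeff-without : ∀ a f b → coeff f b ≡ 0ℤ → coeff (without a f) b ≡ 0ℤ
  coeff-without a f b eq with a ≟ᵐ b
  ... | yes refl = none f
    where
    none : ∀ f → coeff (without a f) a ≡ 0ℤ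
    none []            = refl
    none ((c , b) ∷ f) with b ≟ᵐ a
    ... | yes _ = none f
    ... | no b≢a with b ≟ᵐ a
    ...   | yes b≡a = contradiction b≡a b≢a
    ...   | no _ = cong (0ℤ ⊕_) (none f)
  ... | no a≢b = trans (sym (same f)) eq
    where
    same : ∀ f → coeff f b ≡ coeff (without a f) b
    same []             = refl
    same ((c , b′) ∷ f) with b′ ≟ᵐ a
    ... | no _ = cong ((if does (b′ ≟ᵐ b) then c else 0ℤ) ⊕_) (same f)
    ... | yes refl with a ≟ᵐ b
    ...   | yes a≡b = contradiction a≡b a≢b
    ...   | no _ = trans (ℤₚ.+-identityˡ _) (same f)

  -- A list of terms may repeat exponents, so vanishing coefficients do not mean vanishing terms.
  -- All terms with the exponent of the head are taken out together; they contribute through their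
  -- coefficient, which is 0, and the remaining list is shorter. The bound n is the measure.
  eval-zero : ∀ n f → length f ≤ n → (∀ a → coeff f a ≡ 0ℤ) → eval ρ f ≡ 0ℤ
  eval-zero n       []            le eq = refl
  eval-zero (suc n) ((c , a) ∷ f) (s≤s le) eq = begin
    eval ρ ((c , a) ∷ f)
      ≡⟨ eval-without a ((c , a) ∷ f) ⟩
    coeff ((c , a) ∷ f) a ⊗ monomial ρ a ⊕ eval ρ (without a ((c , a) ∷ f))
      ≡⟨ cong₂ (λ p q → p ⊗ monomial ρ a ⊕ q) (eq a)
           (eval-zero n (without a ((c , a) ∷ f)) shorter (λ b → coeff-without a ((c , a) ∷ f) b (eq b))) ⟩
    0ℤ ∎
    where
    open ≡-Reasoning
    shorter : length (without a ((c , a) ∷ f)) ≤ n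
    shorter with a ≟ᵐ a
    ... | yes _ = ℕₚ.≤-trans (without-length a f) le
    ... | no a≢a = contradiction refl a≢a

  eval-≈ : ∀ {f g} → f ≈ₚ g → eval ρ f ≡ eval ρ g
  eval-≈ {f} {g} f≈g = ℤₚ.i-j≡0⇒i≡j _ _ (trans (sym (eval-minus f g))
    (eval-zero (length (f -ₚ g)) (f -ₚ g) ℕₚ.≤-refl (λ a → trans (coeff-++ f (scale -1ℤ g) a)
      (trans (cong (coeff f a ⊕_) (coeff-scale -1ℤ g a))
        (trans (cong (λ z → z ⊕ -1ℤ ⊗ coeff g a) (f≈g a)) (cancel (coeff g a)))))))
    where
    cancel : ∀ x → x ⊕ -1ℤ ⊗ x ≡ 0ℤ
    cancel = solve-∀
    coeff-++ : ∀ (f g : Poly k) a → coeff (f ++ g) a ≡ coeff f a ⊕ coeff g a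
    coeff-++ []            g a = sym (ℤₚ.+-identityˡ _)
    coeff-++ ((c , b) ∷ f) g a = trans (cong ((if does (b ≟ᵐ a) then c else 0ℤ) ⊕_) (coeff-++ f g a))
      (sym (ℤₚ.+-assoc (if does (b ≟ᵐ a) then c else 0ℤ) _ _))
    coeff-scale : ∀ c (f : Poly k) a → coeff (scale c f) a ≡ c ⊗ coeff f a
    coeff-scale c []            a = sym (ℤₚ.*-zeroʳ c)
    coeff-scale c ((d , b) ∷ f) a with does (b ≟ᵐ a)
    ... | true  = trans (cong (c ⊗ d ⊕_) (coeff-scale c f a)) (sym (ℤₚ.*-distribˡ-+ c d (coeff f a)))
    ... | false = trans (cong (0ℤ ⊕_) (coeff-scale c f a)) (zero-out c (coeff f a))
      where
      zero-out : ∀ c x → 0ℤ ⊕ c ⊗ x ≡ c ⊗ (0ℤ ⊕ x)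
      zero-out = solve-∀

eval-swapVars : ∀ {n} (ρ : Vec ℤ (suc n)) i f → eval ρ (swapVars i f) ≡ eval (swapV (toℕ i) ρ) f
eval-swapVars ρ i []            = refl
eval-swapVars ρ i ((c , a) ∷ f) = cong₂ (λ p q → c ⊗ p ⊕ q) (monomial-swap ρ i a) (eval-swapVars ρ i f)

eval-quotient : ∀ {n} (ρ : Vec ℤ (suc n)) i {f g} →
                (var (inject₁ i) -ₚ var (suc i)) *ₚ g ≈ₚ f -ₚ swapVars i f →
                (at 0ℤ ρ (toℕ i) - at 0ℤ ρ (suc (toℕ i))) ⊗ eval ρ g ≡ eval ρ f - eval (swapV (toℕ i) ρ) f
eval-quotient ρ i {f} {g} q = begin
  (at 0ℤ ρ (toℕ i) - at 0ℤ ρ (suc (toℕ i))) ⊗ eval ρ g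
    ≡⟨ cong (_⊗ eval ρ g) (trans (eval-minus ρ (var (inject₁ i)) (var (suc i)))
         (cong₂ _-_ (trans (eval-var ρ (inject₁ i)) (cong (at 0ℤ ρ) (Finₚ.toℕ-inject₁ i))) (eval-var ρ (suc i)))) ⟨
  eval ρ (var (inject₁ i) -ₚ var (suc i)) ⊗ eval ρ g
    ≡⟨ eval-⊗ ρ (var (inject₁ i) -ₚ var (suc i)) g ⟨
  eval ρ ((var (inject₁ i) -ₚ var (suc i)) *ₚ g)
    ≡⟨ eval-≈ ρ {(var (inject₁ i) -ₚ var (suc i)) *ₚ g} {f -ₚ swapVars i f} q ⟩
  eval ρ (f -ₚ swapVars i f)
    ≡⟨ eval-minus ρ f (swapVars i f) ⟩
  eval ρ f - eval ρ (swapVars i f)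
    ≡⟨ cong (λ z → eval ρ f - z) (eval-swapVars ρ i f) ⟩
  _ ∎
  where open ≡-Reasoning

-- Divided differences and uniqueness of Schubert polynomials

# : {A : Set} {P : Pred A 0ℓ} → Decidable P → List A → ℕ
# P? xs = length (filter P? xs)

#-↭ : {A : Set} {P : Pred A 0ℓ} (P? : Decidable P) {xs ys : List A} → xs ↭ ys → # P? xs ≡ # P? ys
#-↭ P? p = ↭ₚ.↭-length (↭ₚ.filter-↭ P? p)

line : ∀ {n} → Permutation′ n → Vec ℕ n
line w = Vec.tabulate (toℕ ∘ (w ⟨$⟩ʳ_))

at-tabulate : ∀ {n} (g : Fin n → ℕ) k → at 0 (Vec.tabulate g) (toℕ k) ≡ g k
at-tabulate g zero    = refl
at-tabulate g (suc k) = at-tabulate (g ∘ suc) k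

at-line : ∀ {n} (w : Permutation′ n) k → at 0 (line w) (toℕ k) ≡ toℕ (w ⟨$⟩ʳ k)
at-line w = at-tabulate (toℕ ∘ (w ⟨$⟩ʳ_))

line-cong : ∀ {n} {v w : Permutation′ n} → v Perm.≈ w → line v ≡ line w
line-cong v≈w = Vecₚ.tabulate-cong (cong toℕ ∘ v≈w)

line-injective : ∀ {n} (v w : Permutation′ n) → line v ≡ line w → v Perm.≈ w
line-injective v w eq k = Finₚ.toℕ-injective
  (trans (sym (at-line v k)) (trans (cong (λ l → at 0 l (toℕ k)) eq) (at-line w k)))

tabulate-swap : ∀ {n} {A : Set} (i : Fin n) (g : Fin (suc n) → A) →
                Vec.tabulate (g ∘ PC.transpose (inject₁ i) (suc i)) ≡ swapV (toℕ i) (Vec.tabulate g)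
tabulate-swap zero    g = refl
tabulate-swap (suc i) g = cong (g zero ∷_)
  (trans (Vecₚ.tabulate-cong (cong g ∘ shift i)) (tabulate-swap i (g ∘ suc)))
  where
  shift : ∀ {n} (i : Fin n) k → PC.transpose (inject₁ (suc i)) (suc (suc i)) (suc k)
                                ≡ suc (PC.transpose (inject₁ i) (suc i) k)
  shift i k with does (k Finₚ.≟ inject₁ i)
  ... | true = refl
  ... | false with does (k Finₚ.≟ suc i)
  ...   | true  = refl
  ...   | false = refl

line-·s : ∀ {n} (w : Permutation′ (suc n)) i → line (w ·s i) ≡ swapV (toℕ i) (line w)
line-·s w i = tabulate-swap i (toℕ ∘ (w ⟨$⟩ʳ_))

IsSchubert-resp : ∀ {n} {v w : Permutation′ (suc n)} {f} → v Perm.≈ w → IsSchubert w f → IsSchubert v f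
IsSchubert-resp v≈w (top w≈ f≈)          = top (λ k → trans (v≈w k) (w≈ k)) f≈
IsSchubert-resp v≈w (step i S desc w≈ q) = step i S desc (λ k → trans (v≈w k) (w≈ k)) q

Descending Ascending : ∀ {n} → Vec ℕ n → ℕ → Set
Descending v i = at 0 v (suc i) < at 0 v i
Ascending  v i = at 0 v i < at 0 v (suc i)

descending : ∀ {n} (w : Permutation′ (suc n)) i → toℕ (w ⟨$⟩ʳ suc i) < toℕ (w ⟨$⟩ʳ inject₁ i) → Descending (line w) (toℕ i)
descending w i = subst₂ _<_ (sym (at-line w (suc i)))
  (trans (sym (at-line w (inject₁ i))) (cong (at 0 (line w)) (Finₚ.toℕ-inject₁ i)))

IsSchubert-∂ : ∀ {n} {w : Permutation′ (suc n)} {f} i → IsSchubert w f → Descending (line w) (toℕ i) →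
               IsSchubert (w ·s i) (∂ i f)
IsSchubert-∂ {w = w} {f} i S desc = step i S
  (subst₂ _<_ (at-line w (suc i))
    (trans (cong (at 0 (line w)) (sym (Finₚ.toℕ-inject₁ i))) (at-line w (inject₁ i))) desc)
  (λ _ → refl) (∂-quotient i f)

-- Distinct coordinates: at such points divided differences are determined by their values.
Generic : ∀ {n} → Vec ℤ n → Set
Generic {n} ρ = ∀ j k → j < n → k < n → at 0ℤ ρ j ≡ at 0ℤ ρ k → j ≡ k

Generic-swap : ∀ {n} i (ρ : Vec ℤ n) → suc i < n → Generic ρ → Generic (swapV i ρ)
Generic-swap i ρ lt gen j k j<n k<n eq = trans (sym (σ-involutive i j)) (trans (cong (σ i)
  (gen (σ i j) (σ i k) (σ-< i j lt j<n) (σ-< i k lt k<n)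
    (trans (sym (at-swap 0ℤ i ρ j lt)) (trans eq (at-swap 0ℤ i ρ k lt))))) (σ-involutive i k))

record Divided {n} (i : ℕ) (F G : Vec ℤ n → ℤ) : Set where
  constructor divided
  field quotient : ∀ ρ → Generic ρ → (at 0ℤ ρ i - at 0ℤ ρ (suc i)) ⊗ G ρ ≡ F ρ - F (swapV i ρ)

open Divided

_≗ᵍ_ : ∀ {n} → (Vec ℤ n → ℤ) → (Vec ℤ n → ℤ) → Set
F ≗ᵍ G = ∀ ρ → Generic ρ → F ρ ≡ G ρ

cancel : ∀ x y {p q} → x ≢ y → (x - y) ⊗ p ≡ (x - y) ⊗ q → p ≡ q
cancel x y {p} {q} x≢y = ℤₚ.*-cancelˡ-≡ (x - y) p q {{ℤ.≢-nonZero (x≢y ∘ ℤₚ.i-j≡0⇒i≡j x y)}}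

module _ {n} (ρ : Vec ℤ n) (gen : Generic ρ) where
  distinct : ∀ j k → j < k → k < n → at 0ℤ ρ j ≢ at 0ℤ ρ k
  distinct j k j<k k<n eq = ℕₚ.<⇒≢ j<k (gen j k (ℕₚ.<-trans j<k k<n) k<n eq)

Divided-unique : ∀ {n} i {F F′ G G′ : Vec ℤ n → ℤ} → suc i < n →
                 Divided i F G → Divided i F′ G′ → F ≗ᵍ F′ → G ≗ᵍ G′
Divided-unique i lt d d′ eq ρ gen = cancel (at 0ℤ ρ i) (at 0ℤ ρ (suc i))
  (distinct ρ gen i (suc i) (ℕₚ.n<1+n i) lt)
  (trans (quotient d ρ gen) (trans (cong₂ _-_ (eq ρ gen) (eq (swapV i ρ) (Generic-swap i ρ lt gen))) (sym (quotient d′ ρ gen))))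

-- Each swap fixes the coordinates of the other. So, multiplied by both differences of coordinates,
-- the two composites become the same alternating sum of H over the four points that the swaps
-- produce.
Divided-comm : ∀ {n} i j {H A B F G : Vec ℤ n → ℤ} → suc i < j → suc j < n →
               Divided j H A → Divided i A F → Divided i H B → Divided j B G → F ≗ᵍ G
Divided-comm {n} i j {H} {A} {B} {F} {G} i<j j<n HA AF HB BG ρ gen =
  cancel xi xi′ (distinct ρ gen i (suc i) (ℕₚ.n<1+n i) i<n)
  (cancel xj xj′ (distinct ρ gen j (suc j) (ℕₚ.n<1+n j) j<n) (begin
    v ⊗ (u ⊗ F ρ)
      ≡⟨ cong (v ⊗_) (quotient AF ρ gen) ⟩
    v ⊗ (A ρ - A ρi)
      ≡⟨ distrib v (A ρ) (A ρi) ⟩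
    v ⊗ A ρ - v ⊗ A ρi
      ≡⟨ cong₂ _-_ (quotient HA ρ gen) (subst₂ (λ p q → (p - q) ⊗ A ρi ≡ H ρi - H (swapV j ρi)) j-fixed j′-fixed (quotient HA ρi (Generic-swap i ρ i<n gen))) ⟩
    (H ρ - H ρj) - (H ρi - H (swapV j ρi))
      ≡⟨ cong (λ z → (H ρ - H ρj) - (H ρi - H z)) (sym (swapV-comm i j ρ i<j)) ⟩
    (H ρ - H ρj) - (H ρi - H (swapV i ρj))
      ≡⟨ exchange (H ρ) (H ρj) (H ρi) (H (swapV i ρj)) ⟩
    (H ρ - H ρi) - (H ρj - H (swapV i ρj))
      ≡⟨ cong₂ _-_ (quotient HB ρ gen) (subst₂ (λ p q → (p - q) ⊗ B ρj ≡ H ρj - H (swapV i ρj)) i-fixed i′-fixed (quotient HB ρj (Generic-swap j ρ j<n gen))) ⟨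
    u ⊗ B ρ - u ⊗ B ρj
      ≡⟨ distrib u (B ρ) (B ρj) ⟨
    u ⊗ (B ρ - B ρj)
      ≡⟨ cong (u ⊗_) (quotient BG ρ gen) ⟨
    u ⊗ (v ⊗ G ρ)
      ≡⟨ swap-factors u v (G ρ) ⟩
    v ⊗ (u ⊗ G ρ) ∎))
  where
  open ≡-Reasoning
  i<n : suc i < n
  i<n = ℕₚ.<-trans i<j (ℕₚ.<-trans (ℕₚ.n<1+n j) j<n)
  ρi ρj : Vec ℤ n
  ρi = swapV i ρ
  ρj = swapV j ρ
  xi xi′ xj xj′ u v : ℤ
  xi = at 0ℤ ρ i
  xi′ = at 0ℤ ρ (suc i)
  xj = at 0ℤ ρ j
  xj′ = at 0ℤ ρ (suc j)
  u = xi - xi′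
  v = xj - xj′
  distrib : ∀ v a b → v ⊗ (a - b) ≡ v ⊗ a - v ⊗ b
  distrib = solve-∀
  exchange : ∀ a b c d → (a - b) - (c - d) ≡ (a - c) - (b - d)
  exchange = solve-∀
  swap-factors : ∀ u v g → u ⊗ (v ⊗ g) ≡ v ⊗ (u ⊗ g)
  swap-factors = solve-∀
  fixed : ∀ a b → b ≢ a → b ≢ suc a → suc a < n → at 0ℤ (swapV a ρ) b ≡ at 0ℤ ρ b
  fixed a b p q lt = trans (at-swap 0ℤ a ρ b lt) (cong (at 0ℤ ρ) (σ-other a b p q))
  j-fixed : at 0ℤ ρi j ≡ xj
  j-fixed = fixed i j (ℕₚ.<⇒≢ (ℕₚ.<-trans (ℕₚ.n<1+n i) i<j) ∘ sym) (ℕₚ.<⇒≢ i<j ∘ sym) i<n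
  j′-fixed : at 0ℤ ρi (suc j) ≡ xj′
  j′-fixed = fixed i (suc j) (ℕₚ.<⇒≢ (ℕₚ.m<n⇒m<1+n (ℕₚ.<-trans (ℕₚ.n<1+n i) i<j)) ∘ sym) (ℕₚ.<⇒≢ (ℕₚ.m<n⇒m<1+n i<j) ∘ sym) i<n
  i-fixed : at 0ℤ ρj i ≡ xi
  i-fixed = fixed j i (ℕₚ.<⇒≢ (ℕₚ.<-trans (ℕₚ.n<1+n i) i<j)) (ℕₚ.<⇒≢ (ℕₚ.m<n⇒m<1+n (ℕₚ.<-trans (ℕₚ.n<1+n i) i<j))) j<n
  i′-fixed : at 0ℤ ρj (suc i) ≡ xi′
  i′-fixed = fixed j (suc i) (ℕₚ.<⇒≢ i<j) (ℕₚ.<⇒≢ (ℕₚ.m<n⇒m<1+n i<j)) j<n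

record Triple {A : Set} {n} (d : A) (i : ℕ) (τ : Vec A n) (p q r : A) : Set where
  constructor triple
  field
    first  : at d τ i ≡ p
    second : at d τ (suc i) ≡ q
    third  : at d τ (suc (suc i)) ≡ r

module _ {n} (i : ℕ) (lt : suc (suc i) < n) where
  private
    i<n : suc i < n
    i<n = ℕₚ.<-trans (ℕₚ.n<1+n (suc i)) lt

  Triple-swap : ∀ {A : Set} {d : A} {τ : Vec A n} {p q r} → Triple d i τ p q r → Triple d i (swapV i τ) q p r
  Triple-swap {d = d} {τ} (triple a b c) = triple
    (trans (at-swap d i τ i i<n) (trans (cong (at d τ) (σ-left i)) b))
    (trans (at-swap d i τ (suc i) i<n) (trans (cong (at d τ) (σ-right i)) a))
    (trans (at-swap d i τ (suc (suc i)) i<n)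
      (trans (cong (at d τ) (σ-other i (suc (suc i)) (ℕₚ.<⇒≢ (ℕₚ.m<n⇒m<1+n (ℕₚ.n<1+n i)) ∘ sym) ℕₚ.1+n≢n)) c))

  Triple-swap′ : ∀ {A : Set} {d : A} {τ : Vec A n} {p q r} → Triple d i τ p q r → Triple d i (swapV (suc i) τ) p r q
  Triple-swap′ {d = d} {τ} (triple a b c) = triple
    (trans (at-swap d (suc i) τ i lt)
      (trans (cong (at d τ) (σ-other (suc i) i (ℕₚ.<⇒≢ (ℕₚ.n<1+n i)) (ℕₚ.<⇒≢ (ℕₚ.m<n⇒m<1+n (ℕₚ.n<1+n i))))) a))
    (trans (at-swap d (suc i) τ (suc i) lt) (trans (cong (at d τ) (σ-left (suc i))) c))
    (trans (at-swap d (suc i) τ (suc (suc i)) lt) (trans (cong (at d τ) (σ-right (suc i))) b))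

  Triple-quotient : ∀ {F G : Vec ℤ n → ℤ} {τ p q r} → Divided i F G → Generic τ → Triple 0ℤ i τ p q r →
                    (p - q) ⊗ G τ ≡ F τ - F (swapV i τ)
  Triple-quotient {τ = τ} d g (triple refl refl _) = quotient d τ g

  Triple-quotient′ : ∀ {F G : Vec ℤ n → ℤ} {τ p q r} → Divided (suc i) F G → Generic τ → Triple 0ℤ i τ p q r →
                     (q - r) ⊗ G τ ≡ F τ - F (swapV (suc i) τ)
  Triple-quotient′ {τ = τ} d g (triple _ refl refl) = quotient d τ g

-- Both iterated divided differences are the antisymmetrization divided by the Vandermonde product.
Divided-braid : ∀ {n} i {H A B C A′ B′ C′ : Vec ℤ n → ℤ} → suc (suc i) < n →
                Divided i H A → Divided (suc i) A B → Divided i B C →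
                Divided (suc i) H A′ → Divided i A′ B′ → Divided (suc i) B′ C′ → C ≗ᵍ C′
Divided-braid {n} i {H} {A} {B} {C} {A′} {B′} {C′} lt HA AB BC HA′ AB′ BC′ ρ gen =
  cancel y z y≢z (cancel x z x≢z (cancel x y x≢y (trans
    (cancel x y x≢y left) (sym (cancel y z y≢z right)))))
  where
  open ≡-Reasoning
  j : ℕ
  j = suc i
  i<n : suc i < n
  i<n = ℕₚ.<-trans (ℕₚ.n<1+n (suc i)) lt
  x y z : ℤ
  x = at 0ℤ ρ i
  y = at 0ℤ ρ j
  z = at 0ℤ ρ (suc j)
  x≢y : x ≢ y
  x≢y = distinct ρ gen i j (ℕₚ.n<1+n i) i<n
  y≢z : y ≢ z
  y≢z = distinct ρ gen j (suc j) (ℕₚ.n<1+n j) lt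
  x≢z : x ≢ z
  x≢z = distinct ρ gen i (suc j) (ℕₚ.m<n⇒m<1+n (ℕₚ.n<1+n i)) lt
  yxz xzy yzx zxy zyx : Vec ℤ n
  yxz = swapV i ρ
  xzy = swapV j ρ
  yzx = swapV j yxz
  zxy = swapV i xzy
  zyx = swapV i yzx
  T : Triple 0ℤ i ρ x y z
  T = triple refl refl refl
  g-yxz : Generic yxz
  g-yxz = Generic-swap i ρ i<n gen
  g-xzy : Generic xzy
  g-xzy = Generic-swap j ρ lt gen
  g-yzx : Generic yzx
  g-yzx = Generic-swap j yxz lt g-yxz
  g-zxy : Generic zxy
  g-zxy = Generic-swap i xzy i<n g-xzy
  Alt : ℤ
  Alt = (H ρ - H yxz) - (H xzy - H zxy) ⊕ (H yzx - H zyx)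
  expand₁ : ∀ x y z c → (x - y) ⊗ ((x - y) ⊗ ((x - z) ⊗ ((y - z) ⊗ c))) ≡ (x - y) ⊗ ((x - z) ⊗ ((y - z) ⊗ ((x - y) ⊗ c)))
  expand₁ = solve-∀
  expand₂ : ∀ x y z p q → (x - y) ⊗ ((x - z) ⊗ ((y - z) ⊗ (p - q))) ≡ (x - y) ⊗ ((x - z) ⊗ ((y - z) ⊗ p)) - (x - y) ⊗ ((y - z) ⊗ ((x - z) ⊗ q))
  expand₂ = solve-∀
  expand₃ : ∀ x y z p q r s → (x - y) ⊗ ((x - z) ⊗ (p - q)) - (x - y) ⊗ ((y - z) ⊗ (r - s))
            ≡ (x - z) ⊗ ((x - y) ⊗ p) - (x - y) ⊗ ((x - z) ⊗ q) ⊕ (y - z) ⊗ ((y - x) ⊗ r) ⊕ (x - y) ⊗ ((y - z) ⊗ s)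
  expand₃ = solve-∀
  expand₄ : ∀ x y z a b c d e f →
            (x - z) ⊗ (a - b) - (x - y) ⊗ (c - d) ⊕ (y - z) ⊗ (b - a) ⊕ (x - y) ⊗ (e - f)
            ≡ (x - y) ⊗ ((a - b) - (c - d) ⊕ (e - f))
  expand₄ = solve-∀
  -- Clearing denominators takes one factor x - y beyond the Vandermonde product. It splits off
  -- again when the two occurrences of H ρ - H yxz, with coefficients x - z and -(y - z), are
  -- joined.
  left : (x - y) ⊗ ((x - y) ⊗ ((x - z) ⊗ ((y - z) ⊗ C ρ))) ≡ (x - y) ⊗ Alt
  left = begin
    (x - y) ⊗ ((x - y) ⊗ ((x - z) ⊗ ((y - z) ⊗ C ρ)))
      ≡⟨ expand₁ x y z (C ρ) ⟩
    (x - y) ⊗ ((x - z) ⊗ ((y - z) ⊗ ((x - y) ⊗ C ρ)))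
      ≡⟨ cong (λ t → (x - y) ⊗ ((x - z) ⊗ ((y - z) ⊗ t))) (Triple-quotient i lt BC gen T) ⟩
    (x - y) ⊗ ((x - z) ⊗ ((y - z) ⊗ (B ρ - B yxz)))
      ≡⟨ expand₂ x y z (B ρ) (B yxz) ⟩
    (x - y) ⊗ ((x - z) ⊗ ((y - z) ⊗ B ρ)) - (x - y) ⊗ ((y - z) ⊗ ((x - z) ⊗ B yxz))
      ≡⟨ cong₂ (λ s t → (x - y) ⊗ ((x - z) ⊗ s) - (x - y) ⊗ ((y - z) ⊗ t)) (Triple-quotient′ i lt AB gen T) (Triple-quotient′ i lt AB g-yxz (Triple-swap i lt T)) ⟩
    (x - y) ⊗ ((x - z) ⊗ (A ρ - A xzy)) - (x - y) ⊗ ((y - z) ⊗ (A yxz - A yzx))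
      ≡⟨ expand₃ x y z (A ρ) (A xzy) (A yxz) (A yzx) ⟩
    (x - z) ⊗ ((x - y) ⊗ A ρ) - (x - y) ⊗ ((x - z) ⊗ A xzy) ⊕ (y - z) ⊗ ((y - x) ⊗ A yxz) ⊕ (x - y) ⊗ ((y - z) ⊗ A yzx)
      ≡⟨ cong₂ _⊕_ (cong₂ _⊕_ (cong₂ (λ s t → (x - z) ⊗ s - (x - y) ⊗ t) (Triple-quotient i lt HA gen T) (Triple-quotient i lt HA g-xzy (Triple-swap′ i lt T)))
           (cong ((y - z) ⊗_) (trans (Triple-quotient i lt HA g-yxz (Triple-swap i lt T)) (cong (λ s → H yxz - H s) (swapV-involutive i ρ)))))
           (cong ((x - y) ⊗_) (Triple-quotient i lt HA g-yzx (Triple-swap′ i lt (Triple-swap i lt T)))) ⟩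
    (x - z) ⊗ (H ρ - H yxz) - (x - y) ⊗ (H xzy - H zxy) ⊕ (y - z) ⊗ (H yxz - H ρ) ⊕ (x - y) ⊗ (H yzx - H zyx)
      ≡⟨ expand₄ x y z (H ρ) (H yxz) (H xzy) (H zxy) (H yzx) (H zyx) ⟩
    (x - y) ⊗ Alt ∎
  contract₁ : ∀ x y z c → (y - z) ⊗ ((x - y) ⊗ ((x - z) ⊗ ((y - z) ⊗ c))) ≡ (y - z) ⊗ ((x - z) ⊗ ((x - y) ⊗ ((y - z) ⊗ c)))
  contract₁ = solve-∀
  contract₂ : ∀ x y z p q → (y - z) ⊗ ((x - z) ⊗ ((x - y) ⊗ (p - q))) ≡ (y - z) ⊗ ((x - z) ⊗ ((x - y) ⊗ p)) - (y - z) ⊗ ((x - y) ⊗ ((x - z) ⊗ q))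
  contract₂ = solve-∀
  contract₃ : ∀ x y z p q r s → (y - z) ⊗ ((x - z) ⊗ (p - q)) - (y - z) ⊗ ((x - y) ⊗ (r - s))
            ≡ (x - z) ⊗ ((y - z) ⊗ p) - (y - z) ⊗ ((x - z) ⊗ q) ⊕ (x - y) ⊗ ((z - y) ⊗ r) ⊕ (y - z) ⊗ ((x - y) ⊗ s)
  contract₃ = solve-∀
  contract₄ : ∀ x y z a b c d e f →
            (x - z) ⊗ (a - c) - (y - z) ⊗ (b - e) ⊕ (x - y) ⊗ (c - a) ⊕ (y - z) ⊗ (d - f)
            ≡ (y - z) ⊗ ((a - b) - (c - d) ⊕ (e - f))
  contract₄ = solve-∀
  right : (y - z) ⊗ ((x - y) ⊗ ((x - z) ⊗ ((y - z) ⊗ C′ ρ))) ≡ (y - z) ⊗ Alt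
  right = begin
    (y - z) ⊗ ((x - y) ⊗ ((x - z) ⊗ ((y - z) ⊗ C′ ρ)))
      ≡⟨ contract₁ x y z (C′ ρ) ⟩
    (y - z) ⊗ ((x - z) ⊗ ((x - y) ⊗ ((y - z) ⊗ C′ ρ)))
      ≡⟨ cong (λ t → (y - z) ⊗ ((x - z) ⊗ ((x - y) ⊗ t))) (Triple-quotient′ i lt BC′ gen T) ⟩
    (y - z) ⊗ ((x - z) ⊗ ((x - y) ⊗ (B′ ρ - B′ xzy)))
      ≡⟨ contract₂ x y z (B′ ρ) (B′ xzy) ⟩
    (y - z) ⊗ ((x - z) ⊗ ((x - y) ⊗ B′ ρ)) - (y - z) ⊗ ((x - y) ⊗ ((x - z) ⊗ B′ xzy))
      ≡⟨ cong₂ (λ s t → (y - z) ⊗ ((x - z) ⊗ s) - (y - z) ⊗ ((x - y) ⊗ t)) (Triple-quotient i lt AB′ gen T) (Triple-quotient i lt AB′ g-xzy (Triple-swap′ i lt T)) ⟩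
    (y - z) ⊗ ((x - z) ⊗ (A′ ρ - A′ yxz)) - (y - z) ⊗ ((x - y) ⊗ (A′ xzy - A′ zxy))
      ≡⟨ contract₃ x y z (A′ ρ) (A′ yxz) (A′ xzy) (A′ zxy) ⟩
    (x - z) ⊗ ((y - z) ⊗ A′ ρ) - (y - z) ⊗ ((x - z) ⊗ A′ yxz) ⊕ (x - y) ⊗ ((z - y) ⊗ A′ xzy) ⊕ (y - z) ⊗ ((x - y) ⊗ A′ zxy)
      ≡⟨ cong₂ _⊕_ (cong₂ _⊕_ (cong₂ (λ s t → (x - z) ⊗ s - (y - z) ⊗ t) (Triple-quotient′ i lt HA′ gen T) (Triple-quotient′ i lt HA′ g-yxz (Triple-swap i lt T)))
           (cong ((x - y) ⊗_) (trans (Triple-quotient′ i lt HA′ g-xzy (Triple-swap′ i lt T)) (cong (λ s → H xzy - H s) (swapV-involutive j ρ)))))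
           (cong ((y - z) ⊗_) (trans (Triple-quotient′ i lt HA′ g-zxy (Triple-swap i lt (Triple-swap′ i lt T))) (cong (λ s → H zxy - H s) (sym (swapV-braid i ρ lt))))) ⟩
    (x - z) ⊗ (H ρ - H xzy) - (y - z) ⊗ (H yxz - H yzx) ⊕ (x - y) ⊗ (H xzy - H ρ) ⊕ (y - z) ⊗ (H zxy - H zyx)
      ≡⟨ contract₄ x y z (H ρ) (H yxz) (H xzy) (H zxy) (H yzx) (H zyx) ⟩
    (y - z) ⊗ Alt ∎

-- The number of non-inversions. It falls when an ascent is exchanged, and both inductions up to the
-- longest permutation use it as measure.
ninv : List ℕ → ℕ
ninv []       = 0
ninv (x ∷ xs) = # (x <?_) xs + ninv xs

ninv-swap : ∀ pre x y post → x < y → ninv (pre ++ y ∷ x ∷ post) < ninv (pre ++ x ∷ y ∷ post)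
ninv-swap [] x y post x<y = ℕₚ.≤-reflexive (begin
  suc (# (y <?_) (x ∷ post) + (# (x <?_) post + ninv post))
    ≡⟨ cong (λ l → suc (length l + (# (x <?_) post + ninv post))) (Listₚ.filter-reject (y <?_) (ℕₚ.<-asym x<y)) ⟩
  suc (# (y <?_) post + (# (x <?_) post + ninv post))
    ≡⟨ cong suc (exchange (# (y <?_) post) (# (x <?_) post) (ninv post)) ⟩
  suc (# (x <?_) post + (# (y <?_) post + ninv post))
    ≡⟨ cong (λ l → length l + (# (y <?_) post + ninv post)) (Listₚ.filter-accept (x <?_) x<y) ⟨
  # (x <?_) (y ∷ post) + (# (y <?_) post + ninv post) ∎)
  where
  open ≡-Reasoning
  exchange : ∀ a b c → a + (b + c) ≡ b + (a + c)
  exchange a b c = trans (sym (ℕₚ.+-assoc a b c)) (trans (cong (λ s → s + c) (ℕₚ.+-comm a b)) (ℕₚ.+-assoc b a c))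
ninv-swap (z ∷ pre) x y post x<y = ℕₚ.+-mono-≤-<
  (ℕₚ.≤-reflexive (#-↭ (z <?_) (↭ₚ.++⁺ˡ pre (_↭_.swap y x ↭-refl)))) (ninv-swap pre x y post x<y)

toList-split : ∀ {A : Set} {n} (d : A) i (v : Vec A n) → suc i < n → ∃ λ pre → ∃ λ post →
               Vec.toList v ≡ pre ++ at d v i ∷ at d v (suc i) ∷ post × length pre ≡ i ×
               Vec.toList (swapV i v) ≡ pre ++ at d v (suc i) ∷ at d v i ∷ post
toList-split d zero    (x ∷ [])    (s≤s ())
toList-split d zero    (x ∷ y ∷ v) _        = [] , Vec.toList v , refl , refl , refl
toList-split d (suc i) (x ∷ v)     (s≤s lt) with toList-split d i v lt
... | pre , post , eq , len , eq′ = x ∷ pre , post , cong (x ∷_) eq , cong suc len , cong (x ∷_) eq′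

ninv-swapV : ∀ {n} i (v : Vec ℕ n) → suc i < n → Ascending v i → ninv (Vec.toList (swapV i v)) < ninv (Vec.toList v)
ninv-swapV i v lt asc with toList-split 0 i v lt
... | pre , post , eq , _ , eq′ rewrite eq | eq′ = ninv-swap pre (at 0 v i) (at 0 v (suc i)) post asc

Divided-resp : ∀ {n} i {F F′ G : Vec ℤ n → ℤ} → suc i < n → F ≗ᵍ F′ → Divided i F G → Divided i F′ G
Divided-resp i lt eq d = divided λ ρ gen → trans (Divided.quotient d ρ gen)
  (cong₂ _-_ (eq ρ gen) (eq (swapV i ρ) (Generic-swap i ρ lt gen)))

value : ∀ {n} → Poly n → Vec ℤ n → ℤ
value f ρ = eval ρ f

Divided-∂ : ∀ {n} i (f : Poly (suc n)) → Divided (toℕ i) (value f) (value (∂ i f))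
Divided-∂ i f = divided λ ρ _ → eval-quotient ρ i {f} {∂ i f} (∂-quotient i f)

Descending⇒Ascending : ∀ {n} i (v : Vec ℕ n) → suc i < n → Descending v i → Ascending (swapV i v) i
Descending⇒Ascending i v lt = subst₂ _<_
  (sym (trans (at-swap 0 i v i lt) (cong (at 0 v) (σ-left i))))
  (sym (trans (at-swap 0 i v (suc i) lt) (cong (at 0 v) (σ-right i))))

Ascending⇒Descending : ∀ {n} i (v : Vec ℕ n) → suc i < n → Ascending v i → Descending (swapV i v) i
Ascending⇒Descending i v lt = subst₂ _<_
  (sym (trans (at-swap 0 i v (suc i) lt) (cong (at 0 v) (σ-right i))))
  (sym (trans (at-swap 0 i v i lt) (cong (at 0 v) (σ-left i))))

reverse-not-ascending : ∀ {n} (w : Permutation′ (suc n)) (i : Fin n) → w Perm.≈ Perm.reverse → ¬ Ascending (line w) (toℕ i)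
reverse-not-ascending {n} w i w≈ asc = ℕₚ.<⇒≱ asc
  (subst₂ _≤_ (sym (value-at (suc i)))
    (sym (trans (cong (at 0 (line w)) (sym (Finₚ.toℕ-inject₁ i))) (trans (value-at (inject₁ i)) (cong (n ∸_) (Finₚ.toℕ-inject₁ i)))))
    (ℕₚ.∸-monoʳ-≤ n (ℕₚ.n≤1+n (toℕ i))))
  where
  value-at : ∀ k → at 0 (line w) (toℕ k) ≡ n ∸ toℕ k
  value-at k = trans (at-line w k) (trans (cong toℕ (w≈ k)) (Finₚ.opposite-prop k))

-- The last rule of `IsSchubert` seen from the lower permutation: v is w sᵢ, above w, and of the
-- quotient equation only the values at generic points are kept.
record Step {n} (w : Permutation′ (suc n)) (i : Fin n) (g : Poly (suc n)) : Set where
  constructor mkStep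
  field
    {v}      : Permutation′ (suc n)
    {f}      : Poly (suc n)
    schub    : IsSchubert v f
    line-v   : line v ≡ swapV (toℕ i) (line w)
    asc      : Ascending (line w) (toℕ i)
    div      : Divided (toℕ i) (value f) (value g)

module _ {n : ℕ} where
  suc-toℕ< : ∀ (i : Fin n) → suc (toℕ i) < suc n
  suc-toℕ< i = s≤s (Finₚ.toℕ<n i)

  toStep : ∀ {v w : Permutation′ (suc n)} {f g} i → IsSchubert v f →
           toℕ (v ⟨$⟩ʳ suc i) < toℕ (v ⟨$⟩ʳ inject₁ i) → w Perm.≈ (v ·s i) →
           (var (inject₁ i) -ₚ var (suc i)) *ₚ g ≈ₚ f -ₚ swapVars i f → Step w i g
  toStep {v} {w} {f} {g} i S desc w≈ q = mkStep S
    (sym (trans (cong (swapV (toℕ i)) line-w) (swapV-involutive (toℕ i) (line v))))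
    (subst (λ l → Ascending l (toℕ i)) (sym line-w) (Descending⇒Ascending (toℕ i) (line v) (suc-toℕ< i) (descending v i desc)))
    (divided λ ρ _ → eval-quotient ρ i {f} {g} q)
    where
    line-w : line w ≡ swapV (toℕ i) (line v)
    line-w = trans (line-cong {v = w} {v ·s i} w≈) (line-·s v i)

  Determined : Permutation′ (suc n) → Set
  Determined w = ∀ {f g} → IsSchubert w f → IsSchubert w g → value f ≗ᵍ value g

  fixed-at : ∀ i (v : Vec ℕ (suc n)) b → b ≢ toℕ i → b ≢ suc (toℕ i) → at 0 (swapV (toℕ i) v) b ≡ at 0 v b
  fixed-at i v b p q = trans (at-swap 0 (toℕ i) v b (suc-toℕ< i)) (cong (at 0 v) (σ-other (toℕ i) b p q))

  -- The Schubert polynomial of the permutation above both w sᵢ and w sⱼ, and its divided differences.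
  unique-far : ∀ (w : Permutation′ (suc n)) i j → suc (toℕ i) < toℕ j →
               (∀ k → Ascending (line w) (toℕ k) → Determined (w ·s k)) →
               ∀ {f g} → Step w i f → Step w j g → value f ≗ᵍ value g
  unique-far w i j far IH {f} {g} (mkStep {v} {f′} S lv asc d) (mkStep {v′} {g′} S′ lv′ asc′ d′) =
    Divided-comm (toℕ i) (toℕ j) far (suc-toℕ< j) (Divided-∂ j h)
      (Divided-resp (toℕ i) (suc-toℕ< i) (IH i asc S₁ (IsSchubert-resp (line-injective (w ·s i) (z ·s j)
        (trans (line-·s w i) (sym (trans (line-·s z j) (trans (cong (swapV (toℕ j)) lz) (swapV-involutive (toℕ j) _)))))) (IsSchubert-∂ j Sz desc-j))) d)
      (Divided-∂ i h)
      (Divided-resp (toℕ j) (suc-toℕ< j) (IH j asc′ S₁′ (IsSchubert-resp (line-injective (w ·s j) (z ·s i)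
        (trans (line-·s w j) (sym (trans (line-·s z i) (trans (cong (swapV (toℕ i)) (trans lz (sym (swapV-comm (toℕ i) (toℕ j) (line w) far)))) (swapV-involutive (toℕ i) _)))))) (IsSchubert-∂ i Sz desc-i))) d′)
    where
    S₁ : IsSchubert (w ·s i) f′
    S₁ = IsSchubert-resp (line-injective (w ·s i) v (trans (line-·s w i) (sym lv))) S
    S₁′ : IsSchubert (w ·s j) g′
    S₁′ = IsSchubert-resp (line-injective (w ·s j) v′ (trans (line-·s w j) (sym lv′))) S′
    z : Permutation′ (suc n)
    z = (w ·s i) ·s j
    h : Poly (suc n)
    h = proj₁ (schubert z)
    Sz : IsSchubert z h
    Sz = proj₂ (schubert z)
    lz : line z ≡ swapV (toℕ j) (swapV (toℕ i) (line w))
    lz = trans (line-·s (w ·s i) j) (cong (swapV (toℕ j)) (line-·s w i))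
    i<j : toℕ i < toℕ j
    i<j = ℕₚ.<-trans (ℕₚ.n<1+n (toℕ i)) far
    desc-j : Descending (line z) (toℕ j)
    desc-j = subst (λ l → Descending l (toℕ j)) (sym lz)
      (Ascending⇒Descending (toℕ j) (swapV (toℕ i) (line w)) (suc-toℕ< j)
        (subst₂ _<_ (sym (fixed-at i (line w) (toℕ j) (ℕₚ.<⇒≢ i<j ∘ sym) (ℕₚ.<⇒≢ far ∘ sym)))
                    (sym (fixed-at i (line w) (suc (toℕ j)) (ℕₚ.<⇒≢ (ℕₚ.m<n⇒m<1+n i<j) ∘ sym) (ℕₚ.<⇒≢ (ℕₚ.m<n⇒m<1+n far) ∘ sym)))
                    asc′))
    desc-i : Descending (line z) (toℕ i)
    desc-i = subst (λ l → Descending l (toℕ i)) (sym (trans lz (sym (swapV-comm (toℕ i) (toℕ j) (line w) far))))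
      (Ascending⇒Descending (toℕ i) (swapV (toℕ j) (line w)) (suc-toℕ< i)
        (subst₂ _<_ (sym (fixed-at j (line w) (toℕ i) (ℕₚ.<⇒≢ i<j) (ℕₚ.<⇒≢ (ℕₚ.m<n⇒m<1+n i<j))))
                    (sym (fixed-at j (line w) (suc (toℕ i)) (ℕₚ.<⇒≢ far) (ℕₚ.<⇒≢ (ℕₚ.m<n⇒m<1+n far))))
                    asc))

  -- The common upper permutation is w sᵢ sⱼ sᵢ. It shows the three values a < b < c of w in reverse
  -- order, so every step of both paths down to w starts at a descent.
  unique-near : ∀ (w : Permutation′ (suc n)) i j → toℕ j ≡ suc (toℕ i) →
                (∀ k → Ascending (line w) (toℕ k) → Determined (w ·s k)) →
                ∀ {f g} → Step w i f → Step w j g → value f ≗ᵍ value g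
  unique-near w i j near IH {f} {g} (mkStep {v} {f′} S lv asc d) (mkStep {v′} {g′} S′ lv′ asc′ d′) =
    Divided-braid (toℕ i) lt (Divided-∂ i h) (at-j (Divided-∂ j (∂ i h)))
      (Divided-resp (toℕ i) (suc-toℕ< i) (IH i asc S₁ (IsSchubert-resp (line-injective (w ·s i) ((z ·s i) ·s j)
        (trans (line-·s w i) (sym (trans lij (swapV-involutive (suc (toℕ i)) _)))))
        (IsSchubert-∂ j (IsSchubert-∂ i Sz desc-i) desc-ij))) d)
      (at-j (Divided-∂ j h)) (Divided-∂ i (∂ j h))
      (at-j (Divided-resp (toℕ j) (suc-toℕ< j) (IH j asc′ S₁′ (IsSchubert-resp (line-injective (w ·s j) ((z ·s j) ·s i)
        (trans (line-·s w j) (trans (cong (λ k → swapV k (line w)) near) (sym (trans lji (swapV-involutive (toℕ i) _))))))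
        (IsSchubert-∂ i (IsSchubert-∂ j Sz desc-j) desc-ji))) d′))
    where
    at-j : ∀ {F G : Vec ℤ (suc n) → ℤ} → Divided (toℕ j) F G → Divided (suc (toℕ i)) F G
    at-j = subst (λ k → Divided k _ _) near
    lt : suc (suc (toℕ i)) < suc n
    lt = subst (λ k → suc k < suc n) near (suc-toℕ< j)
    S₁ : IsSchubert (w ·s i) f′
    S₁ = IsSchubert-resp (line-injective (w ·s i) v (trans (line-·s w i) (sym lv))) S
    S₁′ : IsSchubert (w ·s j) g′
    S₁′ = IsSchubert-resp (line-injective (w ·s j) v′ (trans (line-·s w j) (sym lv′))) S′
    z : Permutation′ (suc n)
    z = ((w ·s i) ·s j) ·s i
    h : Poly (suc n)
    h = proj₁ (schubert z)
    Sz : IsSchubert z h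
    Sz = proj₂ (schubert z)
    line-·s-j : ∀ (y : Permutation′ (suc n)) → line (y ·s j) ≡ swapV (suc (toℕ i)) (line y)
    line-·s-j y = trans (line-·s y j) (cong (λ k → swapV k (line y)) near)
    lz : line z ≡ swapV (toℕ i) (swapV (suc (toℕ i)) (swapV (toℕ i) (line w)))
    lz = trans (line-·s ((w ·s i) ·s j) i) (cong (swapV (toℕ i)) (trans (line-·s-j (w ·s i)) (cong (swapV (suc (toℕ i))) (line-·s w i))))
    lz′ : line z ≡ swapV (suc (toℕ i)) (swapV (toℕ i) (swapV (suc (toℕ i)) (line w)))
    lz′ = trans lz (swapV-braid (toℕ i) (line w) lt)
    li : line (z ·s i) ≡ swapV (suc (toℕ i)) (swapV (toℕ i) (line w))
    li = trans (line-·s z i) (trans (cong (swapV (toℕ i)) lz) (swapV-involutive (toℕ i) _))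
    lj : line (z ·s j) ≡ swapV (toℕ i) (swapV (suc (toℕ i)) (line w))
    lj = trans (line-·s-j z) (trans (cong (swapV (suc (toℕ i))) lz′) (swapV-involutive (suc (toℕ i)) _))
    lij : line ((z ·s i) ·s j) ≡ swapV (suc (toℕ i)) (swapV (suc (toℕ i)) (swapV (toℕ i) (line w)))
    lij = trans (line-·s-j (z ·s i)) (cong (swapV (suc (toℕ i))) li)
    lji : line ((z ·s j) ·s i) ≡ swapV (toℕ i) (swapV (toℕ i) (swapV (suc (toℕ i)) (line w)))
    lji = trans (line-·s (z ·s j) i) (cong (swapV (toℕ i)) lj)
    a b c : ℕ
    a = at 0 (line w) (toℕ i)
    b = at 0 (line w) (suc (toℕ i))
    c = at 0 (line w) (suc (suc (toℕ i)))
    a<b : a < b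
    a<b = asc
    b<c : b < c
    b<c = subst (Ascending (line w)) near asc′
    T : Triple 0 (toℕ i) (line w) a b c
    T = triple refl refl refl
    Desc : Fin n → Permutation′ (suc n) → Set
    Desc k y = Descending (line y) (toℕ k)
    first : ∀ y {τ p q r} → line y ≡ τ → Triple 0 (toℕ i) τ p q r → q < p → Desc i y
    first y refl (triple refl refl _) lt = lt
    last : ∀ y {τ p q r} → line y ≡ τ → Triple 0 (toℕ i) τ p q r → r < q → Desc j y
    last y refl (triple _ refl refl) lt = subst (Descending (line y)) (sym near) lt
    sw : ∀ {τ p q r} → Triple 0 (toℕ i) τ p q r → Triple 0 (toℕ i) (swapV (toℕ i) τ) q p r
    sw = Triple-swap (toℕ i) lt
    sw′ : ∀ {τ p q r} → Triple 0 (toℕ i) τ p q r → Triple 0 (toℕ i) (swapV (suc (toℕ i)) τ) p r q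
    sw′ = Triple-swap′ (toℕ i) lt
    desc-i : Desc i z
    desc-i = first z lz (sw (sw′ (sw T))) b<c
    desc-j : Desc j z
    desc-j = last z lz (sw (sw′ (sw T))) a<b
    desc-ij : Desc j (z ·s i)
    desc-ij = last (z ·s i) li (sw′ (sw T)) (ℕₚ.<-trans a<b b<c)
    desc-ji : Desc i (z ·s j)
    desc-ji = first (z ·s j) lj (sw (sw′ T)) (ℕₚ.<-trans a<b b<c)

  unique-step : ∀ (w : Permutation′ (suc n)) i j →
                (∀ k → Ascending (line w) (toℕ k) → Determined (w ·s k)) →
                ∀ {f g} → Step w i f → Step w j g → value f ≗ᵍ value g
  unique-step w i j IH {f} {g} A B with ℕₚ.<-cmp (toℕ i) (toℕ j)
  ... | tri< i<j _ _ with ℕₚ.m≤n⇒m<n∨m≡n i<j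
  ...   | inj₁ far  = unique-far w i j far IH A B
  ...   | inj₂ near = unique-near w i j (sym near) IH A B
  unique-step w i j IH {f} {g} A B | tri> _ _ j<i with ℕₚ.m≤n⇒m<n∨m≡n j<i
  ...   | inj₁ far  = λ ρ gen → sym (unique-far w j i far IH B A ρ gen)
  ...   | inj₂ near = λ ρ gen → sym (unique-near w j i (sym near) IH B A ρ gen)
  unique-step w i j IH {f} {g} (mkStep {v} S lv asc d) (mkStep {v′} S′ lv′ asc′ d′) | tri≈ _ i≡j _
    with refl ← Finₚ.toℕ-injective i≡j = Divided-unique (toℕ i) (suc-toℕ< i) d d′
      (IH i asc (IsSchubert-resp (line-injective (w ·s i) v (trans (line-·s w i) (sym lv))) S)
                (IsSchubert-resp (line-injective (w ·s i) v′ (trans (line-·s w i) (sym lv′))) S′))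

  -- Two derivations may end with different ascents of w, but the permutations above w have fewer
  -- non-inversions. A derivation by `top` excludes one by `step`, since the longest permutation has
  -- no ascent.
  unique-fuel : ∀ k (w : Permutation′ (suc n)) → ninv (Vec.toList (line w)) < k → Determined w
  unique-fuel (suc k) w (s≤s le) {f} {g} (top _ f≈) (top _ g≈) ρ _ = trans (eval-≈ ρ {f} {mono staircase} f≈) (sym (eval-≈ ρ {g} {mono staircase} g≈))
  unique-fuel (suc k) w (s≤s le) {f} {g} (top w≈ _) (step {f = f₁} i S desc v≈ q) =
    contradiction (Step.asc (toStep {w = w} {f₁} {g} i S desc v≈ q)) (reverse-not-ascending w i w≈)
  unique-fuel (suc k) w (s≤s le) {f} {g} (step {f = f₁} i S desc v≈ q) (top w≈ _) =
    contradiction (Step.asc (toStep {w = w} {f₁} {f} i S desc v≈ q)) (reverse-not-ascending w i w≈)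
  unique-fuel (suc k) w (s≤s le) {f} {g} (step {f = f₁} i S desc v≈ q) (step {f = f₂} j S′ desc′ v≈′ q′) =
    unique-step w i j
      (λ l asc → unique-fuel k (w ·s l) (ℕₚ.<-≤-trans
        (subst (λ v → ninv (Vec.toList v) < ninv (Vec.toList (line w))) (sym (line-·s w l))
          (ninv-swapV (toℕ l) (line w) (suc-toℕ< l) asc)) le))
      (toStep {f = f₁} {f} i S desc v≈ q) (toStep {w = w} {f₂} {g} j S′ desc′ v≈′ q′)

  schubert-unique : ∀ (w : Permutation′ (suc n)) → Determined w
  schubert-unique w = unique-fuel (suc (ninv (Vec.toList (line w)))) w ℕₚ.≤-refl

-- Codes of vexillary permutations

#-++ : {A : Set} {P : Pred A 0ℓ} (P? : Decidable P) (xs ys : List A) → # P? (xs ++ ys) ≡ # P? xs + # P? ys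
#-++ P? xs ys = trans (cong length (Listₚ.filter-++ P? xs ys)) (Listₚ.length-++ (filter P? xs))

#-mono : {A : Set} {P Q : Pred A 0ℓ} (P? : Decidable P) (Q? : Decidable Q) (xs : List A) →
         (∀ {x} → x ∈ xs → P x → Q x) → # P? xs ≤ # Q? xs
#-mono P? Q? []       h = z≤n
#-mono P? Q? (x ∷ xs) h with P? x | Q? x
... | yes p | yes q = s≤s (#-mono P? Q? xs (h ∘ there))
... | yes p | no ¬q = contradiction (h (here refl) p) ¬q
... | no ¬p | yes q = ℕₚ.m≤n⇒m≤1+n (#-mono P? Q? xs (h ∘ there))
... | no ¬p | no ¬q = #-mono P? Q? xs (h ∘ there)

#-cong : {A : Set} {P Q : Pred A 0ℓ} (P? : Decidable P) (Q? : Decidable Q) (xs : List A) →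
         (∀ {x} → x ∈ xs → P x → Q x) → (∀ {x} → x ∈ xs → Q x → P x) → # P? xs ≡ # Q? xs
#-cong P? Q? xs h h′ = ℕₚ.≤-antisym (#-mono P? Q? xs h) (#-mono Q? P? xs h′)

#-zero : {A : Set} {P : Pred A 0ℓ} (P? : Decidable P) (xs : List A) → (∀ {x} → x ∈ xs → ¬ P x) → # P? xs ≡ 0
#-zero P? xs h = cong length (Listₚ.filter-none P? (All.tabulate h))

#-pos : {A : Set} {P : Pred A 0ℓ} (P? : Decidable P) {xs : List A} {x : A} → x ∈ xs → P x → 1 ≤ # P? xs
#-pos P? x∈ px = Listₚ.filter-some P? (Any.map (λ { refl → px }) x∈)

#-≤-length : {A : Set} {P : Pred A 0ℓ} (P? : Decidable P) (xs : List A) → # P? xs ≤ length xs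
#-≤-length P? xs = Listₚ.length-filter P? xs

lehmer : List ℕ → List ℕ
lehmer []       = []
lehmer (x ∷ xs) = # (_<? x) xs ∷ lehmer xs

-- The codes at the positions of xs inside xs ++ l. They depend on l only up to order, so an
-- exchange further right leaves them fixed.
lehmer-prefix : List ℕ → List ℕ → List ℕ
lehmer-prefix []       l = []
lehmer-prefix (x ∷ xs) l = # (_<? x) (xs ++ l) ∷ lehmer-prefix xs l

lehmer-++ : ∀ xs l → lehmer (xs ++ l) ≡ lehmer-prefix xs l ++ lehmer l
lehmer-++ []       l = refl
lehmer-++ (x ∷ xs) l = cong (# (_<? x) (xs ++ l) ∷_) (lehmer-++ xs l)

lehmer-prefix-↭ : ∀ xs {l l′} → l ↭ l′ → lehmer-prefix xs l ≡ lehmer-prefix xs l′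
lehmer-prefix-↭ []       p = refl
lehmer-prefix-↭ (x ∷ xs) p = cong₂ _∷_ (#-↭ (_<? x) (↭ₚ.++⁺ˡ xs p)) (lehmer-prefix-↭ xs p)

length-lehmer-prefix : ∀ xs l → length (lehmer-prefix xs l) ≡ length xs
length-lehmer-prefix []       l = refl
length-lehmer-prefix (x ∷ xs) l = cong suc (length-lehmer-prefix xs l)

length-lehmer : ∀ xs → length (lehmer xs) ≡ length xs
length-lehmer []       = refl
length-lehmer (x ∷ xs) = cong suc (length-lehmer xs)

lehmer-< : ∀ xs {q} → q ∈ lehmer xs → q < length xs
lehmer-< (x ∷ xs) (here refl) = s≤s (#-≤-length (_<? x) xs)
lehmer-< (x ∷ xs) (there q∈)  = ℕₚ.m<n⇒m<1+n (lehmer-< xs q∈)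

-- Pattern avoidance and ascents that preserve it

Avoids2143 : List ℕ → Set
Avoids2143 L = ∀ {a b d c} → (a ∷ b ∷ d ∷ c ∷ []) ⊆ L → ¬ (b < a × a < c × c < d)

No21Below : List ℕ → ℕ → Set
No21Below pre x = ∀ {a b} → (a ∷ b ∷ []) ⊆ pre → ¬ (b < a × a < x)

Has43Above : ℕ → List ℕ → Set
Has43Above y zs = ∃ λ d → ∃ λ c → (d ∷ c ∷ []) ⊆ zs × y < c × c < d

has43Above? : ∀ y zs → Dec (Has43Above y zs)
has43Above? y []       = no λ { (_ , _ , () , _) }
has43Above? y (d ∷ zs) = map′ to from (any? (λ c → (y <? c) ×-dec (c <? d)) zs ⊎-dec has43Above? y zs)
  where
  to : Any (λ c → y < c × c < d) zs ⊎ Has43Above y zs → Has43Above y (d ∷ zs)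
  to (inj₁ any) with Data.List.Membership.Propositional.find any
  ... | c , c∈ , y<c , c<d = d , c , refl ∷ Sublist.from∈ c∈ , y<c , c<d
  to (inj₂ (d′ , c , sub , lts)) = d′ , c , d ∷ʳ sub , lts
  from : Has43Above y (d ∷ zs) → Any (λ c → y < c × c < d) zs ⊎ Has43Above y zs
  from (d′ , c , (_ ∷ʳ sub) , lts)  = inj₂ (d′ , c , sub , lts)
  from (_ , c , (refl ∷ sub) , lts) = inj₁ (Any.map (λ { refl → lts }) (Sublist.to∈ sub))

-- A subsequence that misses x or y exists before the exchange as well; one that takes both has them
-- as neighbours.
⊆-swap : ∀ {s} pre {x y : ℕ} {post} → s ⊆ pre ++ y ∷ x ∷ post →
         s ⊆ pre ++ x ∷ y ∷ post ⊎ ∃ λ s₁ → ∃ λ s₂ → s ≡ s₁ ++ y ∷ x ∷ s₂ × s₁ ⊆ pre × s₂ ⊆ post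
⊆-swap []        (y ∷ʳ (x ∷ʳ p))   = inj₁ (x ∷ʳ (y ∷ʳ p))
⊆-swap []        (y ∷ʳ (refl ∷ p)) = inj₁ (refl ∷ (y ∷ʳ p))
⊆-swap []        (refl ∷ (x ∷ʳ p)) = inj₁ (x ∷ʳ (refl ∷ p))
⊆-swap []        (refl ∷ (refl ∷ p)) = inj₂ ([] , _ , refl , [] , p)
⊆-swap (z ∷ pre) (z ∷ʳ p) with ⊆-swap pre p
... | inj₁ q = inj₁ (z ∷ʳ q)
... | inj₂ (s₁ , s₂ , eq , p₁ , p₂) = inj₂ (s₁ , s₂ , eq , z ∷ʳ p₁ , p₂)
⊆-swap (z ∷ pre) (refl ∷ p) with ⊆-swap pre p
... | inj₁ q = inj₁ (refl ∷ q)
... | inj₂ (s₁ , s₂ , refl , p₁ , p₂) = inj₂ (z ∷ s₁ , s₂ , refl , refl ∷ p₁ , p₂)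

-- A new 2143 has to use y x as neighbouring letters in decreasing order: as 21, which needs a 43
-- above y to the right, or as 43, which needs a 21 below x to the left. The two middle letters
-- increase.
avoids-swap : ∀ pre {x y post} → x < y → Avoids2143 (pre ++ x ∷ y ∷ post) →
              No21Below pre x → ¬ Has43Above y post → Avoids2143 (pre ++ y ∷ x ∷ post)
avoids-swap pre x<y av low high sub (b<a , a<c , c<d) with ⊆-swap pre sub
... | inj₁ sub′ = av sub′ (b<a , a<c , c<d)
... | inj₂ ([] , _ , refl , _ , p₂) = high (_ , _ , p₂ , a<c , c<d)
... | inj₂ (_ ∷ [] , _ , refl , _ , _) = ℕₚ.<-asym x<y (ℕₚ.<-trans b<a (ℕₚ.<-trans a<c c<d))
... | inj₂ (_ ∷ _ ∷ [] , _ , refl , p₁ , _) = low p₁ (b<a , a<c)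
... | inj₂ (_ ∷ _ ∷ _ ∷ [] , _ , () , _ , _)
... | inj₂ (_ ∷ _ ∷ _ ∷ _ ∷ [] , _ , () , _ , _)
... | inj₂ (_ ∷ _ ∷ _ ∷ _ ∷ _ ∷ _ , _ , () , _ , _)

data HasAscent : List ℕ → Set where
  ascent-here  : ∀ {x y zs} → x < y → HasAscent (x ∷ y ∷ zs)
  ascent-there : ∀ {x xs} → HasAscent xs → HasAscent (x ∷ xs)

HasAscent-++ : ∀ pre {x y post} → x < y → HasAscent (pre ++ x ∷ y ∷ post)
HasAscent-++ []        lt = ascent-here lt
HasAscent-++ (z ∷ pre) lt = ascent-there (HasAscent-++ pre lt)

-- The induction for Wachs's theorem moves along ascents whose exchange keeps the permutation vexillary.
record GoodAscent (L : List ℕ) : Set where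
  field
    pre post : List ℕ
    x y      : ℕ
    split    : L ≡ pre ++ x ∷ y ∷ post
    ascent   : x < y
    avoids   : Avoids2143 (pre ++ y ∷ x ∷ post)

⊆-snoc : ∀ {a b : ℕ} pre {x} → (a ∷ b ∷ []) ⊆ pre ++ x ∷ [] → (a ∷ b ∷ []) ⊆ pre ⊎ b ≡ x
⊆-snoc []        (_ ∷ʳ ())
⊆-snoc []        (refl ∷ ())
⊆-snoc (z ∷ pre) (z ∷ʳ p) with ⊆-snoc pre p
... | inj₁ q = inj₁ (z ∷ʳ q)
... | inj₂ e = inj₂ e
⊆-snoc (z ∷ pre) (refl ∷ p) = last pre p
  where
  last : ∀ {b} pre {x} → (b ∷ []) ⊆ pre ++ x ∷ [] → (z ∷ b ∷ []) ⊆ z ∷ pre ⊎ b ≡ x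
  last []         (_ ∷ʳ ())
  last []         (refl ∷ _) = inj₂ refl
  last (z′ ∷ pre) (z′ ∷ʳ p) with last pre p
  ... | inj₁ (_ ∷ʳ q)   = inj₁ (refl ∷ (z′ ∷ʳ Subₚ.∷ˡ⁻ q))
  ... | inj₁ (refl ∷ q) = inj₁ (refl ∷ (z′ ∷ʳ q))
  ... | inj₂ e = inj₂ e
  last (z′ ∷ pre) (refl ∷ p) = inj₁ (refl ∷ (refl ∷ Sublist.minimum pre))

no21-descent : ∀ pre {x y} → No21Below pre x → y ≤ x → No21Below (pre ++ x ∷ []) y
no21-descent pre low y≤x sub (b<a , a<y) with ⊆-snoc pre sub
... | inj₁ sub′ = low sub′ (b<a , ℕₚ.<-≤-trans a<y y≤x)
... | inj₂ refl = ℕₚ.<⇒≱ (ℕₚ.<-trans b<a a<y) y≤x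

-- Scanning from the left, the entries before the current one never contain a pattern 21
-- below it, so the first ascent with no pattern 43 above it to its right is good.
good-found : ∀ pre x rest → Avoids2143 (pre ++ x ∷ rest) → No21Below pre x → Any (x <_) rest →
             GoodAscent (pre ++ x ∷ rest)
good-found pre x (y ∷ zs) av low larger with y ≤? x
... | yes y≤x = subst GoodAscent (Listₚ.++-assoc pre (x ∷ []) (y ∷ zs))
    (good-found (pre ++ x ∷ []) y zs (subst Avoids2143 (sym (Listₚ.++-assoc pre (x ∷ []) (y ∷ zs))) av)
      (no21-descent pre low y≤x) (Any.map (ℕₚ.≤-<-trans y≤x) (later larger)))
  where
  later : Any (x <_) (y ∷ zs) → Any (x <_) zs
  later (here x<y) = contradiction y≤x (ℕₚ.<⇒≱ x<y)
  later (there a)  = a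
... | no y≰x with has43Above? y zs
...   | no none = record { pre = pre ; post = zs ; x = x ; y = y ; split = refl ; ascent = ℕₚ.≰⇒> y≰x
                         ; avoids = avoids-swap pre (ℕₚ.≰⇒> y≰x) av low none }
-- A 21 below y in the prefix would form a 2143 with this 43, so the scan may pass on to y; the 43
-- also provides a larger entry after y.
...   | yes (d , c , sub , y<c , c<d) = subst GoodAscent (Listₚ.++-assoc pre (x ∷ []) (y ∷ zs))
    (good-found (pre ++ x ∷ []) y zs av′
      (λ s (b<a , a<y) → av′ (Subₚ.++⁺ s (y ∷ʳ sub)) (b<a , ℕₚ.<-trans a<y y<c , c<d))
      (Any.map (λ { refl → ℕₚ.<-trans y<c c<d }) (Sublist.to∈ (⊆-trans (refl ∷ Sublist.minimum (c ∷ [])) sub))))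
  where
  av′ : Avoids2143 ((pre ++ x ∷ []) ++ y ∷ zs)
  av′ = subst Avoids2143 (sym (Listₚ.++-assoc pre (x ∷ []) (y ∷ zs))) av

good-scan : ∀ pre x rest → Avoids2143 (pre ++ x ∷ rest) → No21Below pre x → HasAscent (x ∷ rest) →
            GoodAscent (pre ++ x ∷ rest)
good-scan pre x (y ∷ zs) av low (ascent-here x<y) = good-found pre x (y ∷ zs) av low (here x<y)
good-scan pre x (y ∷ zs) av low (ascent-there asc) with y ≤? x
... | no y≰x = good-found pre x (y ∷ zs) av low (here (ℕₚ.≰⇒> y≰x))
... | yes y≤x = subst GoodAscent (Listₚ.++-assoc pre (x ∷ []) (y ∷ zs))
    (good-scan (pre ++ x ∷ []) y zs (subst Avoids2143 (sym (Listₚ.++-assoc pre (x ∷ []) (y ∷ zs))) av)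
      (no21-descent pre low y≤x) asc)

good-ascent : ∀ L → Avoids2143 L → HasAscent L → GoodAscent L
good-ascent (x ∷ xs) av asc = good-scan [] x xs av (λ { () }) asc

-- The property of vexillary codes: between two positions with c_i ≤ c_k all entries are at least c_i.
Vexcode : List ℕ → Set
Vexcode c = ∀ pre x post → c ≡ pre ++ x ∷ post → ∀ {p q} → p ∈ pre → q ∈ post → p ≤ q → p ≤ x

lehmer-split : ∀ L pre x post → lehmer L ≡ pre ++ x ∷ post → ∃ λ P → ∃ λ z → ∃ λ Q →
               L ≡ P ++ z ∷ Q × pre ≡ lehmer-prefix P (z ∷ Q) × x ≡ # (_<? z) Q × post ≡ lehmer Q
lehmer-split (z ∷ L) []        x post refl = [] , z , L , refl , refl , refl , refl
lehmer-split (z ∷ L) (p ∷ pre) x post eq with lehmer-split L pre x post (Listₚ.∷-injectiveʳ eq)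
... | P , z′ , Q , refl , eq₁ , eq₂ , eq₃ =
  z ∷ P , z′ , Q , refl , cong₂ _∷_ (sym (Listₚ.∷-injectiveˡ eq)) eq₁ , eq₂ , eq₃

∈-lehmer-prefix : ∀ P l {p} → p ∈ lehmer-prefix P l →
                  ∃ λ P₁ → ∃ λ z → ∃ λ P₂ → P ≡ P₁ ++ z ∷ P₂ × p ≡ # (_<? z) (P₂ ++ l)
∈-lehmer-prefix (z ∷ P) l (here eq) = [] , z , P , refl , eq
∈-lehmer-prefix (z ∷ P) l (there p∈) with ∈-lehmer-prefix P l p∈
... | P₁ , z′ , P₂ , refl , eq = z ∷ P₁ , z′ , P₂ , refl , eq

∈-lehmer : ∀ Q {q} → q ∈ lehmer Q → ∃ λ Q₁ → ∃ λ z → ∃ λ Q₂ → Q ≡ Q₁ ++ z ∷ Q₂ × q ≡ # (_<? z) Q₂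
∈-lehmer (z ∷ Q) (here eq) = [] , z , Q , refl , eq
∈-lehmer (z ∷ Q) (there q∈) with ∈-lehmer Q q∈
... | Q₁ , z′ , Q₂ , refl , eq = z ∷ Q₁ , z′ , Q₂ , refl , eq

unique-tail : ∀ pre {z : ℕ} {post} → Distinct (pre ++ z ∷ post) → ∀ {c} → c ∈ post → c ≢ z
unique-tail []        (z∉ ∷ _) c∈ refl = All.lookup z∉ c∈ refl
unique-tail (x ∷ pre) (_ ∷ u)  c∈      = unique-tail pre u c∈

-- Let z₁, z, z₂ be the values at the three positions. If nothing between z₁ and z, z included, lies
-- below z₁, then all entries counted by p stand after z and lie below z₁ ≤ z, so p ≤ x. Otherwise
-- some b < z₁ stands there. An entry c after z₂ with z₁ < c < z₂ would complete the pattern z₁ b z₂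
-- c; without one, p counts every entry that q counts, and b in addition, so q < p.
vexillary⇒vexcode : ∀ L → Distinct L → Avoids2143 L → Vexcode (lehmer L)
vexillary⇒vexcode L u av pre x post eq {p} {q} p∈ q∈ p≤q with lehmer-split L pre x post eq
... | P , z , Q , refl , refl , refl , refl with ∈-lehmer-prefix P (z ∷ Q) p∈ | ∈-lehmer Q q∈
... | P₁ , z₁ , P₂ , refl , refl | Q₁ , z₂ , Q₂ , refl , refl
  with any? (_<? z₁) (P₂ ++ z ∷ []) | any? (λ c → (z₁ <? c) ×-dec (c <? z₂)) Q₂
... | no none | _ = begin
    # (_<? z₁) (P₂ ++ z ∷ Q)
      ≡⟨ cong (# (_<? z₁)) (sym (Listₚ.++-assoc P₂ (z ∷ []) Q)) ⟩
    # (_<? z₁) ((P₂ ++ z ∷ []) ++ Q)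
      ≡⟨ #-++ (_<? z₁) (P₂ ++ z ∷ []) Q ⟩
    # (_<? z₁) (P₂ ++ z ∷ []) + # (_<? z₁) Q
      ≡⟨ cong (λ n → n + # (_<? z₁) Q) (#-zero (_<? z₁) (P₂ ++ z ∷ []) (λ b∈ b<z → none (Any.map (λ { refl → b<z }) b∈))) ⟩
    # (_<? z₁) Q
      ≤⟨ #-mono (_<? z₁) (_<? z) Q (λ _ c<z₁ → ℕₚ.<-≤-trans c<z₁
           (ℕₚ.≮⇒≥ (λ z<z₁ → none (Any.map (λ { refl → z<z₁ }) (∈ₚ.∈-++⁺ʳ P₂ (here refl)))))) ⟩
    # (_<? z) Q ∎
  where open ℕₚ.≤-Reasoning
... | yes below | yes between with Data.List.Membership.Propositional.find below | Data.List.Membership.Propositional.find between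
...   | b , b∈ , b<z₁ | c , c∈ , z₁<c , c<z₂ = contradiction (b<z₁ , z₁<c , c<z₂) (av pattern2143)
  where
  pattern2143 : (z₁ ∷ b ∷ z₂ ∷ c ∷ []) ⊆ (P₁ ++ z₁ ∷ P₂) ++ z ∷ Q₁ ++ z₂ ∷ Q₂
  pattern2143 = subst ((z₁ ∷ b ∷ z₂ ∷ c ∷ []) ⊆_)
    (trans (cong (λ l → P₁ ++ z₁ ∷ l) (Listₚ.++-assoc P₂ (z ∷ []) (Q₁ ++ z₂ ∷ Q₂))) (sym (Listₚ.++-assoc P₁ (z₁ ∷ P₂) (z ∷ Q₁ ++ z₂ ∷ Q₂))))
    (Subₚ.++⁺ˡ P₁ (refl ∷ Subₚ.++⁺ (Sublist.from∈ b∈) (Subₚ.++⁺ˡ Q₁ (refl ∷ Sublist.from∈ c∈))))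
vexillary⇒vexcode L u av pre x post eq {p} {q} p∈ q∈ p≤q
    | P , z , Q , refl , refl , refl , refl | P₁ , z₁ , P₂ , refl , refl | Q₁ , z₂ , Q₂ , refl , refl
    | yes below | no none with Data.List.Membership.Propositional.find below
... | b , b∈ , b<z₁ = contradiction p≤q (ℕₚ.<⇒≱ (begin-strict
    # (_<? z₂) Q₂
      ≤⟨ #-mono (_<? z₂) (_<? z₁) Q₂ smaller ⟩
    # (_<? z₁) Q₂
      <⟨ ℕₚ.+-mono-≤ (#-pos (_<? z₁) b∈ b<z₁) (ℕₚ.≤-trans (ℕₚ.m≤n+m (# (_<? z₁) Q₂) (# (_<? z₁) (Q₁ ++ z₂ ∷ []))) ℕₚ.≤-refl) ⟩
    # (_<? z₁) (P₂ ++ z ∷ []) + (# (_<? z₁) (Q₁ ++ z₂ ∷ []) + # (_<? z₁) Q₂)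
      ≡⟨ cong (λ n → # (_<? z₁) (P₂ ++ z ∷ []) + n) (trans (sym (#-++ (_<? z₁) (Q₁ ++ z₂ ∷ []) Q₂)) (cong (# (_<? z₁)) (Listₚ.++-assoc Q₁ (z₂ ∷ []) Q₂))) ⟩
    # (_<? z₁) (P₂ ++ z ∷ []) + # (_<? z₁) (Q₁ ++ z₂ ∷ Q₂)
      ≡⟨ trans (sym (#-++ (_<? z₁) (P₂ ++ z ∷ []) (Q₁ ++ z₂ ∷ Q₂))) (cong (# (_<? z₁)) (Listₚ.++-assoc P₂ (z ∷ []) (Q₁ ++ z₂ ∷ Q₂))) ⟩
    # (_<? z₁) (P₂ ++ z ∷ Q₁ ++ z₂ ∷ Q₂) ∎))
  where
  open ℕₚ.≤-Reasoning
  smaller : ∀ {c} → c ∈ Q₂ → c < z₂ → c < z₁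
  smaller {c} c∈ c<z₂ = ℕₚ.≤∧≢⇒< (ℕₚ.≮⇒≥ (λ z₁<c → none (Any.map (λ { refl → z₁<c , c<z₂ }) c∈)))
    (unique-tail P₁ (subst Distinct (Listₚ.++-assoc P₁ (z₁ ∷ P₂) (z ∷ Q₁ ++ z₂ ∷ Q₂)) u)
      (∈ₚ.∈-++⁺ʳ P₂ (there (∈ₚ.∈-++⁺ʳ Q₁ (there c∈)))))

-- Numbers of complete rows allowed by a code

opaque
  -- For p > 0 and a code this is the p-th column length of its shape, that is, a part of the
  -- conjugate partition.
  cge : ℕ → List ℕ → ℕ
  cge p = # (p ≤?_)

  cge-# : ∀ p xs → cge p xs ≡ # (p ≤?_) xs
  cge-# p xs = refl

  cge-++ : ∀ p xs ys → cge p (xs ++ ys) ≡ cge p xs + cge p ys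
  cge-++ p = #-++ (p ≤?_)

  cge-mono : ∀ p p′ xs → (∀ {x} → x ∈ xs → p ≤ x → p′ ≤ x) → cge p xs ≤ cge p′ xs
  cge-mono p p′ = #-mono (p ≤?_) (p′ ≤?_)

  cge-↭ : ∀ p {xs ys} → xs ↭ ys → cge p xs ≡ cge p ys
  cge-↭ p = #-↭ (p ≤?_)

  cge-pos : ∀ p {xs x} → x ∈ xs → p ≤ x → 1 ≤ cge p xs
  cge-pos p = #-pos (p ≤?_)

  cge-≤-length : ∀ p xs → cge p xs ≤ length xs
  cge-≤-length p = #-≤-length (p ≤?_)

  cge-yes : ∀ {p x} xs → p ≤ x → cge p (x ∷ xs) ≡ suc (cge p xs)
  cge-yes {p} xs p≤x = cong length (Listₚ.filter-accept (p ≤?_) p≤x)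

  cge-no : ∀ {p x} xs → x < p → cge p (x ∷ xs) ≡ cge p xs
  cge-no {p} xs x<p = cong length (Listₚ.filter-reject (p ≤?_) (ℕₚ.<⇒≱ x<p))

  cge-none : ∀ p xs → (∀ {q} → q ∈ xs → q < p) → cge p xs ≡ 0
  cge-none p xs h = #-zero (p ≤?_) xs (ℕₚ.<⇒≱ ∘ h)

cge-cong : ∀ p p′ xs → (∀ {x} → x ∈ xs → p ≤ x → p′ ≤ x) → (∀ {x} → x ∈ xs → p′ ≤ x → p ≤ x) → cge p xs ≡ cge p′ xs
cge-cong p p′ xs h h′ = ℕₚ.≤-antisym (cge-mono p p′ xs h) (cge-mono p′ p xs h′)

cge-antitone : ∀ {p p′} xs → p ≤ p′ → cge p′ xs ≤ cge p xs
cge-antitone {p} {p′} xs p≤p′ = cge-mono p′ p xs (λ _ → ℕₚ.≤-trans p≤p′)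

mx : List ℕ → ℕ
mx []       = 0
mx (x ∷ xs) = x ⊔ mx xs

∈⇒≤mx : ∀ xs {q} → q ∈ xs → q ≤ mx xs
∈⇒≤mx (x ∷ xs) (here refl) = ℕₚ.m≤m⊔n x (mx xs)
∈⇒≤mx (x ∷ xs) (there q∈)  = ℕₚ.≤-trans (∈⇒≤mx xs q∈) (ℕₚ.m≤n⊔m x (mx xs))

mx-lub : ∀ xs {a} → (∀ {q} → q ∈ xs → q ≤ a) → mx xs ≤ a
mx-lub []       h = z≤n
mx-lub (x ∷ xs) h = ℕₚ.⊔-lub (h (here refl)) (mx-lub xs (h ∘ there))

mx-∈ : ∀ x xs → mx (x ∷ xs) ∈ x ∷ xs
mx-∈ x []       = here (ℕₚ.⊔-identityʳ x)
mx-∈ x (y ∷ xs) with ℕₚ.⊔-sel x (mx (y ∷ xs))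
... | inj₁ e = here e
... | inj₂ e = there (subst (_∈ y ∷ xs) (sym e) (mx-∈ y xs))

mx-++ : ∀ xs ys → mx (xs ++ ys) ≡ mx xs ⊔ mx ys
mx-++ []       ys = refl
mx-++ (x ∷ xs) ys = trans (cong (x ⊔_) (mx-++ xs ys)) (sym (ℕₚ.⊔-assoc x (mx xs) (mx ys)))

-- The largest and the smallest number of rows that one may require to be complete once the
-- first k letters are used.
strong weak : List ℕ → ℕ → ℕ
strong c k = cge (mx (List.drop k c)) (List.take k c)
weak   c k = cge (suc (mx (List.drop k c))) c

weak-take : ∀ c k → weak c k ≡ cge (suc (mx (List.drop k c))) (List.take k c)
weak-take c k = begin
  cge M c
    ≡⟨ cong (cge M) (Listₚ.take++drop≡id k c) ⟨
  cge M (List.take k c ++ List.drop k c)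
    ≡⟨ cge-++ M (List.take k c) (List.drop k c) ⟩
  cge M (List.take k c) + cge M (List.drop k c)
    ≡⟨ cong (λ n → cge M (List.take k c) + n) (cge-none M (List.drop k c) (λ q∈ → s≤s (∈⇒≤mx (List.drop k c) q∈))) ⟩
  cge M (List.take k c) + 0
    ≡⟨ ℕₚ.+-identityʳ _ ⟩
  cge M (List.take k c) ∎
  where
  open ≡-Reasoning
  M : ℕ
  M = suc (mx (List.drop k c))

weak≤strong : ∀ c k → weak c k ≤ strong c k
weak≤strong c k = ℕₚ.≤-trans (ℕₚ.≤-reflexive (weak-take c k)) (cge-antitone (List.take k c) (ℕₚ.n≤1+n _))

-- lam lists the entries of c in nonincreasing order.
Sorts : (ℕ → ℕ) → List ℕ → Set
Sorts lam c = ∀ p q → (suc p ≤ lam q → q < cge (suc p) c) × (q < cge (suc p) c → suc p ≤ lam q)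

module _ {lam c} (sorts : Sorts lam c) where
  Sorts-antitone : ∀ q → lam (suc q) ≤ lam q
  Sorts-antitone q with lam (suc q) in eq
  ... | zero  = z≤n
  ... | suc p = proj₂ (sorts p q) (ℕₚ.<-trans (ℕₚ.n<1+n q) (proj₁ (sorts p (suc q)) (ℕₚ.≤-reflexive (sym eq))))

  Sorts-bound : ∀ {b} → 0 < b → (∀ {q} → q ∈ c → q < b) → ∀ q → lam q < b
  Sorts-bound {b} b>0 h q with lam q in eq
  ... | zero  = b>0
  ... | suc p with any? (suc p ≤?_) c
  ...   | yes a with Data.List.Membership.Propositional.find a
  ...     | x , x∈ , p<x = ℕₚ.≤-<-trans p<x (h x∈)
  Sorts-bound {b} b>0 h q | suc p | no none = contradiction (proj₁ (sorts p q) (ℕₚ.≤-reflexive (sym eq)))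
    (λ lt → ℕₚ.n≮0 (subst (q <_) (cge-none (suc p) c (λ x∈ → ℕₚ.≰⇒> (λ le → none (Any.map (λ { refl → le }) x∈)))) lt))

  Sorts-≥ : ∀ {q} m → q < cge m c → m ≤ lam q
  Sorts-≥ zero    lt = z≤n
  Sorts-≥ (suc p) lt = proj₂ (sorts p _) lt

  Sorts-≤ : ∀ {q} m → cge (suc m) c ≤ q → lam q ≤ m
  Sorts-≤ {q} m le = ℕₚ.≮⇒≥ (λ lt → ℕₚ.<⇒≱ (proj₁ (sorts m q) lt) le)

drop-nonempty : ∀ {A : Set} k (c : List A) → k < length c → ∃ λ y → List.drop k c ≡ y ∷ List.drop (suc k) c × List.take (suc k) c ≡ List.take k c ++ y ∷ []
drop-nonempty zero    (x ∷ c) _        = x , refl , refl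
drop-nonempty (suc k) (x ∷ c) (s≤s lt) with drop-nonempty k c lt
... | y , eq , eq′ = y , eq , cong (x ∷_) eq′

-- Let m be the largest entry from k on. Rows from `weak` up to `strong` have length m, and so has
-- the one after each, because m occurs once more from k on. If there is such a row, m also occurs
-- among the first k entries; the vexillary property then makes y, the entry at k, at least the
-- maximum m′ of the later ones. So y is a further entry counted by `strong` at k + 1.
fill-conditions : ∀ c {lam} → Vexcode c → Sorts lam c → ∀ k → k < length c → ∀ q → weak c k ≤ q → q < strong c k →
                  lam (suc q) ≡ lam q × suc q < strong c (suc k) × suc q < length c
fill-conditions c {lam} vex sorts k k< q W≤q q<S with drop-nonempty k c k<
... | y , eq , eq′ = trans (lam-m (suc q) (ℕₚ.m≤n⇒m≤1+n W≤q) q+1<m) (sym (lam-m q W≤q (ℕₚ.<-trans (ℕₚ.n<1+n q) q+1<m))) ,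
    q+1<S , ℕₚ.<-≤-trans q+1<S (ℕₚ.≤-trans (cge-≤-length m′ (List.take (suc k) c))
      (ℕₚ.≤-trans (ℕₚ.≤-reflexive (Listₚ.length-take (suc k) c)) (ℕₚ.m⊓n≤n (suc k) (length c))))
  where
  D : List ℕ
  D = List.drop (suc k) c
  m m′ : ℕ
  m = mx (List.drop k c)
  m′ = mx D
  m-eq : m ≡ y ⊔ m′
  m-eq = cong mx eq
  lam-m : ∀ q → weak c k ≤ q → q < cge m c → lam q ≡ m
  lam-m q le lt = ℕₚ.≤-antisym (Sorts-≤ sorts m le) (Sorts-≥ sorts m lt)
  m∈ : m ∈ List.drop k c
  m∈ = subst (λ l → mx l ∈ l) (sym eq) (mx-∈ y D)
  q+1<m : suc q < cge m c
  q+1<m = ℕₚ.<-≤-trans (s≤s q<S) (ℕₚ.≤-trans (ℕₚ.≤-reflexive (ℕₚ.+-comm 1 (strong c k)))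
    (ℕₚ.≤-trans (ℕₚ.+-monoʳ-≤ (strong c k) (cge-pos m m∈ ℕₚ.≤-refl))
      (ℕₚ.≤-reflexive (trans (sym (cge-++ m (List.take k c) (List.drop k c))) (cong (cge m) (Listₚ.take++drop≡id k c))))))
  m′≤y : m′ ≤ y
  m′≤y with m′ ≤? y
  ... | yes le = le
  ... | no y<m′ with any? (ℕₚ._≟ m) (List.take k c)
  ...   | no none = contradiction q<S (ℕₚ.≤⇒≯ (ℕₚ.≤-trans (ℕₚ.≤-trans
            (cge-mono m (suc m) (List.take k c) (λ p∈ m≤p → ℕₚ.≤∧≢⇒< m≤p (λ { refl → none (Any.map sym p∈) })))
            (ℕₚ.≤-reflexive (sym (weak-take c k)))) W≤q))
  ...   | yes a with Data.List.Membership.Propositional.find a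
  ...     | p , p∈ , p≡m = contradiction (ℕₚ.≤-trans (ℕₚ.≤-reflexive m′≡p) p≤y) y<m′
    where
    m≡m′ : m ≡ m′
    m≡m′ = trans m-eq (ℕₚ.m≤n⇒m⊔n≡n (ℕₚ.<⇒≤ (ℕₚ.≰⇒> y<m′)))
    m′≡p : m′ ≡ p
    m′≡p = trans (sym m≡m′) (sym p≡m)
    m′∈D : m′ ∈ D
    m′∈D with subst (m ∈_) eq m∈
    ... | there h = subst (_∈ D) m≡m′ h
    ... | here e  = contradiction (ℕₚ.≤-reflexive (trans (sym m≡m′) e)) y<m′
    p≤y : p ≤ y
    p≤y = vex (List.take k c) y D (trans (sym (Listₚ.take++drop≡id k c)) (cong (List.take k c ++_) eq)) p∈ m′∈D (ℕₚ.≤-reflexive (sym m′≡p))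
  q+1<S : suc q < strong c (suc k)
  q+1<S = ℕₚ.<-≤-trans (s≤s q<S) (begin
    suc (cge m (List.take k c))
      ≤⟨ s≤s (cge-antitone (List.take k c) (ℕₚ.≤-trans (ℕₚ.m≤n⊔m y m′) (ℕₚ.≤-reflexive (sym m-eq)))) ⟩
    suc (cge m′ (List.take k c))
      ≡⟨ ℕₚ.+-comm 1 _ ⟩
    cge m′ (List.take k c) + 1
      ≡⟨ cong (λ n → cge m′ (List.take k c) + n) (trans (cge-yes [] m′≤y) (cong suc (cge-none m′ [] (λ ())))) ⟨
    cge m′ (List.take k c) + cge m′ (y ∷ [])
      ≡⟨ cge-++ m′ (List.take k c) (y ∷ []) ⟨
    cge m′ (List.take k c ++ y ∷ [])
      ≡⟨ cong (cge m′) eq′ ⟨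
    strong c (suc k) ∎)
    where open ℕₚ.≤-Reasoning

take-++ˡ : ∀ {A : Set} k (xs ys : List A) → k ≤ length xs → List.take k (xs ++ ys) ≡ List.take k xs
take-++ˡ zero    xs       ys _        = refl
take-++ˡ (suc k) (x ∷ xs) ys (s≤s le) = cong (x ∷_) (take-++ˡ k xs ys le)

drop-++ˡ : ∀ {A : Set} k (xs ys : List A) → k ≤ length xs → List.drop k (xs ++ ys) ≡ List.drop k xs ++ ys
drop-++ˡ zero    xs       ys _        = refl
drop-++ˡ (suc k) (x ∷ xs) ys (s≤s le) = drop-++ˡ k xs ys le

take-++ʳ : ∀ {A : Set} (xs ys : List A) n → List.take (length xs + n) (xs ++ ys) ≡ xs ++ List.take n ys
take-++ʳ []       ys n = refl
take-++ʳ (x ∷ xs) ys n = cong (x ∷_) (take-++ʳ xs ys n)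

drop-++ʳ : ∀ {A : Set} (xs ys : List A) n → List.drop (length xs + n) (xs ++ ys) ≡ List.drop n ys
drop-++ʳ []       ys n = refl
drop-++ʳ (x ∷ xs) ys n = drop-++ʳ xs ys n

∈-drop : ∀ {A : Set} k {xs : List A} {x} → x ∈ List.drop k xs → x ∈ xs
∈-drop zero            x∈ = x∈
∈-drop (suc k) {y ∷ _} x∈ = there (∈-drop k x∈)

data Place (i : ℕ) : ℕ → Set where
  before : ∀ {k} → k < i → Place i k
  first  : Place i i
  second : Place i (suc i)
  after  : ∀ n → Place i (suc (suc (i + n)))

place : ∀ i k → Place i k
place zero    zero          = first
place zero    (suc zero)    = second
place zero    (suc (suc k)) = after k
place (suc i) zero          = before (s≤s z≤n)
place (suc i) (suc k) with place i k
... | before lt = before (s≤s lt)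
... | first     = first
... | second    = second
... | after n   = after n

-- The codes of v and v sᵢ, where i = length A is a descent of v.
module Exchange (A : List ℕ) (a b : ℕ) (C : List ℕ) (b≤a : b ≤ a)
                (vex : Vexcode (A ++ suc a ∷ b ∷ C)) (vex⁻ : Vexcode (A ++ b ∷ a ∷ C)) where
  cᵥ c⁻ : List ℕ
  cᵥ = A ++ suc a ∷ b ∷ C
  c⁻ = A ++ b ∷ a ∷ C

  -- r is the row of the shape that loses a cell: exactly r entries of A exceed a, so the part
  -- `suc a` of v can be placed in row r, the last of its length.
  i r : ℕ
  i = length A
  r = cge (suc a) A

  -- An entry of C above a would force `suc a` ≤ b by the vexillary property of the code of v.
  C≤a : ∀ {q} → q ∈ C → q ≤ a
  C≤a {q} q∈ = ℕₚ.≮⇒≥ (λ a<q → ℕₚ.<⇒≱ (s≤s b≤a) (vex (A ++ suc a ∷ []) b C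
    (sym (Listₚ.++-assoc A (suc a ∷ []) (b ∷ C))) (∈ₚ.∈-++⁺ʳ A (here refl)) q∈ a<q))

  bC≤a : ∀ {q} → q ∈ b ∷ C → q ≤ a
  bC≤a (here refl) = b≤a
  bC≤a (there q∈)  = C≤a q∈

  cge-C : ∀ {p} → a < p → cge p C ≡ 0
  cge-C a<p = cge-none _ C (λ q∈ → ℕₚ.≤-<-trans (C≤a q∈) a<p)

  cge-cᵥ : ∀ p → cge p cᵥ ≡ cge p A + cge p (suc a ∷ b ∷ C)
  cge-cᵥ p = cge-++ p A _

  cge-c⁻ : ∀ p → cge p c⁻ ≡ cge p A + cge p (b ∷ a ∷ C)
  cge-c⁻ p = cge-++ p A _

  cge-swap : ∀ p → cge p (b ∷ a ∷ C) ≡ cge p (a ∷ b ∷ C)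
  cge-swap p = cge-↭ p (_↭_.swap b a ↭-refl)

  cge-step : ∀ p C′ → cge p (a ∷ C′) ≤ cge p (suc a ∷ C′)
  cge-step p C′ with p ≤? a
  ... | yes le = ℕₚ.≤-trans (ℕₚ.≤-reflexive (cge-yes C′ le)) (ℕₚ.≤-reflexive (sym (cge-yes C′ (ℕₚ.m≤n⇒m≤1+n le))))
  ... | no gt  = ℕₚ.≤-trans (ℕₚ.≤-reflexive (cge-no C′ (ℕₚ.≰⇒> gt))) (ℕₚ.≤-trans (ℕₚ.m≤n+m (cge p C′) (cge p (suc a ∷ [])))
                   (ℕₚ.≤-reflexive (sym (cge-++ p (suc a ∷ []) C′))))

  cge-same : ∀ p → p ≢ suc a → cge p cᵥ ≡ cge p c⁻
  cge-same p p≢ = trans (cge-cᵥ p) (trans (cong (λ n → cge p A + n) (trans same (sym (cge-swap p)))) (sym (cge-c⁻ p)))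
    where
    same : cge p (suc a ∷ b ∷ C) ≡ cge p (a ∷ b ∷ C)
    same with p ≤? a
    ... | yes le = trans (cge-yes (b ∷ C) (ℕₚ.m≤n⇒m≤1+n le)) (sym (cge-yes (b ∷ C) le))
    ... | no gt  = trans (cge-no (b ∷ C) (ℕₚ.≤∧≢⇒< (ℕₚ.≰⇒> gt) (p≢ ∘ sym))) (sym (cge-no (b ∷ C) (ℕₚ.≰⇒> gt)))

  cge-top⁻ : cge (suc a) c⁻ ≡ r
  cge-top⁻ = trans (cge-c⁻ (suc a)) (trans (cong (λ n → r + n)
    (trans (cge-no (a ∷ C) (s≤s b≤a)) (trans (cge-no C ℕₚ.≤-refl) (cge-C ℕₚ.≤-refl)))) (ℕₚ.+-identityʳ r))

  cge-top : cge (suc a) cᵥ ≡ suc r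
  cge-top = trans (cge-cᵥ (suc a)) (trans (cong (λ n → r + n)
    (trans (cge-yes (b ∷ C) ℕₚ.≤-refl) (cong suc (trans (cge-no C (s≤s b≤a)) (cge-C ℕₚ.≤-refl))))) (ℕₚ.+-comm r 1))

  r<length : r < length cᵥ
  r<length = subst (_≤ length cᵥ) cge-top (cge-≤-length (suc a) cᵥ)

  -- Up to stage i the strongest demand, after it the weakest. `strong` at i is r because `suc a` is
  -- still to come; `weak` at i + 1 is r + 1 because `suc a` has just been read and exceeds all that
  -- follows.
  R R⁻ : ℕ → ℕ
  R k with k ≤? i
  ... | yes _ = strong cᵥ k
  ... | no  _ = weak cᵥ k
  R⁻ k with k ℕₚ.≟ suc i
  ... | yes _ = r
  ... | no  _ = R k

  R-low : ∀ {k} → k ≤ i → R k ≡ strong cᵥ k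
  R-low {k} le with k ≤? i
  ... | yes _ = refl
  ... | no gt = contradiction le gt

  R-high : ∀ {k} → i < k → R k ≡ weak cᵥ k
  R-high {k} lt with k ≤? i
  ... | yes le = contradiction lt (ℕₚ.≤⇒≯ le)
  ... | no _ = refl

  R⁻-at : R⁻ (suc i) ≡ r
  R⁻-at with suc i ℕₚ.≟ suc i
  ... | yes _ = refl
  ... | no ne = contradiction refl ne

  R⁻-off : ∀ k → k ≢ suc i → R⁻ k ≡ R k
  R⁻-off k ne with k ℕₚ.≟ suc i
  ... | yes e = contradiction e ne
  ... | no _ = refl

  drop-before : ∀ {k} x y → k ≤ i → List.drop k (A ++ x ∷ y ∷ C) ≡ List.drop k A ++ x ∷ y ∷ C
  drop-before x y le = drop-++ˡ _ A _ le

  take-before : ∀ {k} x y → k ≤ i → List.take k (A ++ x ∷ y ∷ C) ≡ List.take k A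
  take-before x y le = take-++ˡ _ A _ le

  drop-first : ∀ x y → List.drop i (A ++ x ∷ y ∷ C) ≡ x ∷ y ∷ C
  drop-first x y = trans (cong (λ k → List.drop k (A ++ x ∷ y ∷ C)) (sym (ℕₚ.+-identityʳ i))) (drop-++ʳ A (x ∷ y ∷ C) 0)

  take-first : ∀ x y → List.take i (A ++ x ∷ y ∷ C) ≡ A
  take-first x y = trans (cong (λ k → List.take k (A ++ x ∷ y ∷ C)) (sym (ℕₚ.+-identityʳ i)))
    (trans (take-++ʳ A (x ∷ y ∷ C) 0) (Listₚ.++-identityʳ A))

  drop-second : ∀ x y → List.drop (suc i) (A ++ x ∷ y ∷ C) ≡ y ∷ C
  drop-second x y = trans (cong (λ k → List.drop k (A ++ x ∷ y ∷ C)) (ℕₚ.+-comm 1 i)) (drop-++ʳ A (x ∷ y ∷ C) 1)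

  take-second : ∀ x y → List.take (suc i) (A ++ x ∷ y ∷ C) ≡ A ++ x ∷ []
  take-second x y = trans (cong (λ k → List.take k (A ++ x ∷ y ∷ C)) (ℕₚ.+-comm 1 i)) (take-++ʳ A (x ∷ y ∷ C) 1)

  i+2+n : ∀ n → suc (suc (i + n)) ≡ i + suc (suc n)
  i+2+n n = sym (trans (ℕₚ.+-suc i (suc n)) (cong suc (ℕₚ.+-suc i n)))

  drop-after : ∀ x y n → List.drop (suc (suc (i + n))) (A ++ x ∷ y ∷ C) ≡ List.drop n C
  drop-after x y n = trans (cong (λ k → List.drop k (A ++ x ∷ y ∷ C)) (i+2+n n)) (drop-++ʳ A (x ∷ y ∷ C) (suc (suc n)))

  take-after : ∀ x y n → List.take (suc (suc (i + n))) (A ++ x ∷ y ∷ C) ≡ A ++ x ∷ y ∷ List.take n C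
  take-after x y n = trans (cong (λ k → List.take k (A ++ x ∷ y ∷ C)) (i+2+n n)) (take-++ʳ A (x ∷ y ∷ C) (suc (suc n)))

  mxC≤a : mx C ≤ a
  mxC≤a = mx-lub C C≤a

  mx-first : mx (suc a ∷ b ∷ C) ≡ suc a
  mx-first = ℕₚ.m≥n⇒m⊔n≡m (ℕₚ.m≤n⇒m≤1+n (mx-lub (b ∷ C) bC≤a))

  mx-first⁻ : mx (b ∷ a ∷ C) ≡ a
  mx-first⁻ = trans (cong (b ⊔_) (ℕₚ.m≥n⇒m⊔n≡m mxC≤a)) (ℕₚ.m≤n⇒m⊔n≡n b≤a)

  strong-first : strong cᵥ i ≡ r
  strong-first = cong₂ cge (trans (cong mx (drop-first (suc a) b)) mx-first) (take-first (suc a) b)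

  strong-before : ∀ k → k ≤ i → strong cᵥ k ≡ cge (mx (List.drop k A) ⊔ suc a) (List.take k A)
  strong-before k le = cong₂ cge
    (trans (cong mx (drop-before (suc a) b le)) (trans (mx-++ (List.drop k A) (suc a ∷ b ∷ C)) (cong (mx (List.drop k A) ⊔_) mx-first)))
    (take-before (suc a) b le)

  weak-second : weak cᵥ (suc i) ≡ suc r
  weak-second = trans (cong (λ l → cge (suc (mx l)) cᵥ) (drop-second (suc a) b)) (trans (cge-cᵥ (suc m))
    (trans (cong₂ _+_ below-A (trans (cge-yes (b ∷ C) (s≤s m≤a)) (cong suc (cge-none (suc m) (b ∷ C) (λ q∈ → s≤s (∈⇒≤mx (b ∷ C) q∈))))))
      (ℕₚ.+-comm r 1)))
    where
    m : ℕ
    m = mx (b ∷ C)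
    m≤a : m ≤ a
    m≤a = mx-lub (b ∷ C) bC≤a
    -- No entry p of A satisfies m < p ≤ a: in the code of v sᵢ, p stands before b and a after it,
    -- so p ≤ a would give p ≤ b ≤ m.
    below-A : cge (suc m) A ≡ r
    below-A = cge-cong (suc m) (suc a) A
      (λ {p} p∈ m<p → ℕₚ.≰⇒> (λ p≤a → ℕₚ.<⇒≱ m<p (ℕₚ.≤-trans (vex⁻ A b (a ∷ C) refl p∈ (here refl) p≤a) (ℕₚ.m≤m⊔n b (mx C)))))
      (λ _ → ℕₚ.≤-trans (s≤s m≤a))

  descent : Descent r i R R⁻
  descent = record
    { R-i    = trans (R-low ℕₚ.≤-refl) strong-first
    ; R-si   = trans (R-high (ℕₚ.n<1+n i)) weak-second
    ; R⁻-si  = R⁻-at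
    ; below  = λ j j<i → ℕₚ.≤-trans (ℕₚ.≤-reflexive (trans (R-low (ℕₚ.<⇒≤ j<i)) (strong-before j (ℕₚ.<⇒≤ j<i))))
                 (ℕₚ.≤-trans (cge-antitone (List.take j A) (ℕₚ.m≤n⊔m (mx (List.drop j A)) (suc a)))
                   (ℕₚ.≤-trans (ℕₚ.m≤m+n _ _) (ℕₚ.≤-reflexive (trans (sym (cge-++ (suc a) (List.take j A) (List.drop j A)))
                     (cong (cge (suc a)) (Listₚ.take++drop≡id j A))))))
    ; above  = λ j lt → ℕₚ.≤-trans (ℕₚ.≤-reflexive (sym cge-top)) (ℕₚ.≤-trans (high j lt)
                 (ℕₚ.≤-reflexive (sym (R-high (ℕₚ.<-trans (ℕₚ.n<1+n i) lt)))))
    ; R⁻-eq  = R⁻-off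
    }
    where
    high : ∀ j → suc i < j → cge (suc a) cᵥ ≤ weak cᵥ j
    high j lt with place i j
    ... | before j<i = contradiction lt (ℕₚ.<-asym (ℕₚ.<-trans j<i (ℕₚ.n<1+n i)))
    ... | first      = contradiction lt (ℕₚ.<-asym (ℕₚ.n<1+n i))
    ... | second     = contradiction lt (ℕₚ.<-irrefl refl)
    ... | after n    = cge-antitone cᵥ (s≤s (ℕₚ.≤-trans (ℕₚ.≤-reflexive (cong mx (drop-after (suc a) b n)))
                         (mx-lub (List.drop n C) (C≤a ∘ ∈-drop n))))

  weak≤R : ∀ k → weak cᵥ k ≤ R k
  weak≤R k with k ≤? i
  ... | yes _ = weak≤strong cᵥ k
  ... | no  _ = ℕₚ.≤-refl

  R≤strong : ∀ k → R k ≤ strong cᵥ k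
  R≤strong k with k ≤? i
  ... | yes _ = ℕₚ.≤-refl
  ... | no  _ = weak≤strong cᵥ k

  -- Before i, compare the largest entry of A from k on with a. If it exceeds a, both codes have the
  -- same maximum ahead and equal `strong`; if not, the maxima ahead are a + 1 and a, so `strong`
  -- for v equals `weak` for v sᵢ. After the pair, replacing a + 1 by a can only lower `weak`, and
  -- an entry above m remains at least m, as `strong` asks.
  between⁻ : ∀ k → weak c⁻ k ≤ R⁻ k × R⁻ k ≤ strong c⁻ k
  between⁻ k with place i k
  ... | second = ℕₚ.≤-reflexive (trans (trans (cong (λ l → cge (suc (mx l)) c⁻) (drop-second b a))
                   (trans (cong (λ m → cge (suc m) c⁻) (ℕₚ.m≥n⇒m⊔n≡m mxC≤a)) cge-top⁻)) (sym R⁻-at)) ,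
      ℕₚ.≤-trans (ℕₚ.≤-reflexive R⁻-at) (ℕₚ.≤-trans (cge-antitone A (ℕₚ.n≤1+n a))
        (ℕₚ.≤-trans (ℕₚ.m≤m+n (cge a A) (cge a (b ∷ []))) (ℕₚ.≤-reflexive (sym (trans
          (cong₂ cge (trans (cong mx (drop-second b a)) (ℕₚ.m≥n⇒m⊔n≡m mxC≤a)) (take-second b a)) (cge-++ a A (b ∷ [])))))))
  ... | first = ℕₚ.≤-reflexive (trans (trans (cong (λ l → cge (suc (mx l)) c⁻) (drop-first b a))
                  (trans (cong (λ m → cge (suc m) c⁻) mx-first⁻) cge-top⁻)) (sym R⁻-i)) ,
      ℕₚ.≤-trans (ℕₚ.≤-reflexive R⁻-i) (ℕₚ.≤-trans (cge-antitone A (ℕₚ.n≤1+n a))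
        (ℕₚ.≤-reflexive (sym (cong₂ cge (trans (cong mx (drop-first b a)) mx-first⁻) (take-first b a)))))
    where
    R⁻-i : R⁻ i ≡ r
    R⁻-i = trans (R⁻-off i (ℕₚ.1+n≢n ∘ sym)) (trans (R-low ℕₚ.≤-refl) strong-first)
  ... | after n = ℕₚ.≤-trans
      (ℕₚ.≤-trans (ℕₚ.≤-reflexive (cong (λ l → cge (suc (mx l)) c⁻) (drop-after b a n)))
        (ℕₚ.≤-trans (smaller (suc m))
          (ℕₚ.≤-reflexive (cong (λ l → cge (suc (mx l)) cᵥ) (sym (drop-after (suc a) b n))))))
      (ℕₚ.≤-reflexive (sym R⁻-k)) ,
      ℕₚ.≤-trans (ℕₚ.≤-reflexive (trans R⁻-k (trans (weak-take cᵥ k)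
        (trans (cong₂ (λ l l′ → cge (suc (mx l)) l′) (drop-after (suc a) b n) (take-after (suc a) b n)) (cge-++ (suc m) A _)))))
      (ℕₚ.≤-trans (ℕₚ.+-mono-≤ (cge-antitone A (ℕₚ.n≤1+n m)) above-m)
      (ℕₚ.≤-reflexive (sym (trans (cong₂ (λ l l′ → cge (mx l) l′) (drop-after b a n) (take-after b a n)) (cge-++ m A _)))))
    where
    m : ℕ
    m = mx (List.drop n C)
    R⁻-k : R⁻ (suc (suc (i + n))) ≡ weak cᵥ (suc (suc (i + n)))
    R⁻-k = trans (R⁻-off _ (ℕₚ.<⇒≢ (s≤s (s≤s (ℕₚ.m≤m+n i n))) ∘ sym)) (R-high (s≤s (ℕₚ.m≤n⇒m≤1+n (ℕₚ.m≤m+n i n))))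
    smaller : ∀ p → cge p c⁻ ≤ cge p cᵥ
    smaller p = ℕₚ.≤-trans (ℕₚ.≤-reflexive (cge-c⁻ p)) (ℕₚ.≤-trans (ℕₚ.+-monoʳ-≤ (cge p A)
      (ℕₚ.≤-trans (ℕₚ.≤-reflexive (cge-swap p)) (cge-step p (b ∷ C)))) (ℕₚ.≤-reflexive (sym (cge-cᵥ p))))
    above-m : cge (suc m) (suc a ∷ b ∷ List.take n C) ≤ cge m (b ∷ a ∷ List.take n C)
    above-m = ℕₚ.≤-trans (ℕₚ.≤-reflexive (cge-↭ (suc m) (_↭_.swap (suc a) b ↭-refl))) (ℕₚ.≤-trans
      (ℕₚ.≤-reflexive (cge-++ (suc m) (b ∷ []) (suc a ∷ List.take n C))) (ℕₚ.≤-trans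
        (ℕₚ.+-mono-≤ (cge-antitone (b ∷ []) (ℕₚ.n≤1+n m)) shift)
        (ℕₚ.≤-reflexive (sym (cge-++ m (b ∷ []) (a ∷ List.take n C))))))
      where
      m≤a : m ≤ a
      m≤a = mx-lub (List.drop n C) (C≤a ∘ ∈-drop n)
      shift : cge (suc m) (suc a ∷ List.take n C) ≤ cge m (a ∷ List.take n C)
      shift = ℕₚ.≤-trans (ℕₚ.≤-reflexive (cge-yes (List.take n C) (s≤s m≤a))) (ℕₚ.≤-trans
        (s≤s (cge-antitone (List.take n C) (ℕₚ.n≤1+n m))) (ℕₚ.≤-reflexive (sym (cge-yes (List.take n C) m≤a))))
  ... | before k<i with suc a ≤? mx (List.drop k A)
  ...   | yes a<m = ℕₚ.≤-trans (weak≤strong c⁻ k) (ℕₚ.≤-reflexive (sym R⁻-k)) , ℕₚ.≤-reflexive R⁻-k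
    where
    R⁻-k : R⁻ k ≡ strong c⁻ k
    R⁻-k = trans (R⁻-off k (ℕₚ.<⇒≢ (ℕₚ.m<n⇒m<1+n k<i))) (trans (R-low (ℕₚ.<⇒≤ k<i)) (trans (strong-before k (ℕₚ.<⇒≤ k<i))
      (sym (cong₂ cge (trans (cong mx (drop-before b a (ℕₚ.<⇒≤ k<i))) (trans (mx-++ (List.drop k A) (b ∷ a ∷ C))
        (trans (cong (mx (List.drop k A) ⊔_) mx-first⁻) (trans (ℕₚ.m≥n⇒m⊔n≡m (ℕₚ.<⇒≤ a<m)) (sym (ℕₚ.m≥n⇒m⊔n≡m a<m))))))
        (take-before b a (ℕₚ.<⇒≤ k<i))))))
  ...   | no m≤a = ℕₚ.≤-reflexive (trans weak-k (sym R⁻-k)) ,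
      ℕₚ.≤-trans (ℕₚ.≤-reflexive R⁻-k) (ℕₚ.≤-trans (cge-antitone (List.take k A) (ℕₚ.n≤1+n a))
        (ℕₚ.≤-reflexive (sym (cong₂ cge mx-k (take-before b a (ℕₚ.<⇒≤ k<i))))))
    where
    m≤a′ : mx (List.drop k A) ≤ a
    m≤a′ = ℕₚ.≤-pred (ℕₚ.≰⇒> m≤a)
    mx-k : mx (List.drop k c⁻) ≡ a
    mx-k = trans (cong mx (drop-before b a (ℕₚ.<⇒≤ k<i))) (trans (mx-++ (List.drop k A) (b ∷ a ∷ C))
      (trans (cong (mx (List.drop k A) ⊔_) mx-first⁻) (ℕₚ.m≤n⇒m⊔n≡n m≤a′)))
    weak-k : weak c⁻ k ≡ cge (suc a) (List.take k A)
    weak-k = trans (weak-take c⁻ k) (cong₂ (λ m l → cge (suc m) l) mx-k (take-before b a (ℕₚ.<⇒≤ k<i)))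
    R⁻-k : R⁻ k ≡ cge (suc a) (List.take k A)
    R⁻-k = trans (R⁻-off k (ℕₚ.<⇒≢ (ℕₚ.m<n⇒m<1+n k<i))) (trans (R-low (ℕₚ.<⇒≤ k<i)) (trans (strong-before k (ℕₚ.<⇒≤ k<i))
      (cong (λ m → cge m (List.take k A)) (ℕₚ.m≤n⇒m⊔n≡n (ℕₚ.m≤n⇒m≤1+n m≤a′)))))

  -- The induction is given the shape of w = v sᵢ; that of v is made from it by restoring the cell
  -- in row r.
  raise : (ℕ → ℕ) → ℕ → ℕ
  raise lam⁻ q with q ℕₚ.≟ r
  ... | yes _ = suc (lam⁻ q)
  ... | no  _ = lam⁻ q

  raise-at : ∀ lam⁻ → raise lam⁻ r ≡ suc (lam⁻ r)
  raise-at lam⁻ with r ℕₚ.≟ r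
  ... | yes _ = refl
  ... | no ne = contradiction refl ne

  raise-off : ∀ lam⁻ q → q ≢ r → raise lam⁻ q ≡ lam⁻ q
  raise-off lam⁻ q ne with q ℕₚ.≟ r
  ... | yes e = contradiction e ne
  ... | no _ = refl

  raise-lower : ∀ lam⁻ → Lower r (raise lam⁻) lam⁻
  raise-lower lam⁻ = record { at-r = raise-at lam⁻ ; elsewhere = λ q ne → sym (raise-off lam⁻ q ne) }

  module _ {lam⁻} (sorts : Sorts lam⁻ c⁻) where
    -- Exactly r entries of c⁻ exceed a, and a itself occurs in c⁻.
    lam⁻-r : lam⁻ r ≡ a
    lam⁻-r = ℕₚ.≤-antisym (Sorts-≤ sorts a (ℕₚ.≤-reflexive cge-top⁻)) (Sorts-≥ sorts a (begin-strict
      r                                   ≤⟨ cge-antitone A (ℕₚ.n≤1+n a) ⟩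
      cge a A                             <⟨ ℕₚ.m<m+n (cge a A) (cge-pos a {b ∷ a ∷ C} (there (here refl)) ℕₚ.≤-refl) ⟩
      cge a A + cge a (b ∷ a ∷ C)         ≡⟨ cge-c⁻ a ⟨
      cge a c⁻                            ∎))
      where open ℕₚ.≤-Reasoning

    raise-sorts : Sorts (raise lam⁻) cᵥ
    raise-sorts p q with q ℕₚ.≟ r | p ℕₚ.≟ a
    ... | yes refl | _ rewrite lam⁻-r =
      (λ le → ℕₚ.<-≤-trans (ℕₚ.≤-reflexive (sym cge-top)) (cge-antitone cᵥ le)) ,
      (λ lt → s≤s (ℕₚ.≮⇒≥ (λ a<p → ℕₚ.<⇒≱ lt (ℕₚ.≤-trans (ℕₚ.≤-reflexive (cge-same (suc p) (λ { refl → ℕₚ.<-irrefl refl a<p })))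
        (ℕₚ.≤-trans (cge-antitone c⁻ (ℕₚ.m≤n⇒m≤1+n a<p)) (ℕₚ.≤-reflexive cge-top⁻))))))
    ... | no q≢r | no p≢a =
      (λ le → subst (q <_) (sym (cge-same (suc p) (p≢a ∘ ℕₚ.suc-injective))) (proj₁ (sorts p q) le)) ,
      (λ lt → proj₂ (sorts p q) (subst (q <_) (cge-same (suc p) (p≢a ∘ ℕₚ.suc-injective)) lt))
    ... | no q≢r | yes refl =
      (λ le → subst (q <_) (sym cge-top) (ℕₚ.m<n⇒m<1+n (subst (q <_) cge-top⁻ (proj₁ (sorts p q) le)))) ,
      (λ lt → proj₂ (sorts p q) (subst (q <_) (sym cge-top⁻) (ℕₚ.≤∧≢⇒< (ℕₚ.≤-pred (subst (q <_) cge-top lt)) q≢r)))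

-- Schubert polynomials as flagged Schur functions

full : (ℕ → ℕ) → ∀ l → Vec ℕ l
full lam l = trunc l lam l

Agree-full : ∀ R lam l → Agree R lam (full lam l)
Agree-full zero    lam l       = tt
Agree-full (suc R) lam zero    = tt
Agree-full (suc R) lam (suc l) = refl , Agree-full R (lam ∘ suc) l

full-cong : ∀ {lam lam′ : ℕ → ℕ} l → (∀ q → lam q ≡ lam′ q) → full lam l ≡ full lam′ l
full-cong zero    eq = refl
full-cong (suc l) eq = cong₂ _∷_ (eq 0) (full-cong l (eq ∘ suc))

hd-full : ∀ lam l → (∀ q → lam (suc q) ≤ lam q) → hd (full (lam ∘ suc) l) ≤ lam 0
hd-full lam zero    dec = z≤n
hd-full lam (suc l) dec = dec 0

Drop-full : ∀ {r lam lam⁻} l → Lower r lam lam⁻ → (∀ q → lam (suc q) ≤ lam q) → (∀ q → lam⁻ (suc q) ≤ lam⁻ q) →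
            r < l → Drop r lam (full lam l) (full lam⁻ l)
Drop-full {zero} {lam} {lam⁻} (suc l) L dec dec⁻ _ =
  subst₂ (λ a μ → Drop 0 lam (a ∷ full (lam ∘ suc) l) (lam⁻ 0 ∷ μ)) (sym (Lower.at-r L)) (sym same)
    (drop-here (Lower.at-r L) (subst (λ μ → hd μ ≤ lam⁻ 0) same (hd-full lam⁻ l dec⁻)))
  where
  same : full (lam⁻ ∘ suc) l ≡ full (lam ∘ suc) l
  same = full-cong l (λ q → Lower.elsewhere L (suc q) λ ())
Drop-full {suc r} {lam} {lam⁻} (suc l) L dec dec⁻ (s≤s r<l) =
  subst (λ a → Drop (suc r) lam (lam 0 ∷ full (lam ∘ suc) l) (a ∷ full (lam⁻ ∘ suc) l)) (sym same)
    (drop-there refl (hd-full lam l dec) (subst (hd (full (lam⁻ ∘ suc) l) ≤_) same (hd-full lam⁻ l dec⁻))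
      (Drop-full l (Lower-suc L) (dec ∘ suc) (dec⁻ ∘ suc) r<l))
  where
  same : lam⁻ 0 ≡ lam 0
  same = Lower.elsewhere L 0 λ ()

-- When c is the code of a vexillary permutation of shape lam, this is its flagged Schur function.
flagged : List ℕ → (ℕ → ℕ) → (ℕ → ℤ) → ℤ
flagged c lam x = Z l (strong c) lam x l (full lam l)
  where
  l : ℕ
  l = length c

flagged-indep : ∀ c {lam} R x → Vexcode c → Sorts lam c → (∀ k → weak c k ≤ R k × R k ≤ strong c k) →
                Z (length c) R lam x (length c) (full lam (length c)) ≡ flagged c lam x
flagged-indep c {lam} R x vex sorts between = Z-indep l l lam x (λ k _ → proj₂ (between k))
  (λ k k< q R≤q q<S → fill-conditions c vex sorts k k< q (ℕₚ.≤-trans (proj₁ (between k)) R≤q) q<S)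
  l ℕₚ.≤-refl (full lam l) (Agree-full (strong c l) lam l)
  where
  l : ℕ
  l = length c

module _ (A : List ℕ) (a b : ℕ) (C : List ℕ) (b≤a : b ≤ a)
         (vex : Vexcode (A ++ suc a ∷ b ∷ C)) (vex⁻ : Vexcode (A ++ b ∷ a ∷ C)) where
  open Exchange A a b C b≤a vex vex⁻

  flagged-step : ∀ {lam⁻} x x′ → Sorts lam⁻ c⁻ → (∀ q → raise lam⁻ q < length cᵥ) →
                 x′ i ≡ x (suc i) → x′ (suc i) ≡ x i → (∀ j → j ≢ i → j ≢ suc i → x′ j ≡ x j) →
                 flagged cᵥ (raise lam⁻) x - flagged cᵥ (raise lam⁻) x′
                 ≡ (x i - x (suc i)) ⊗ flagged c⁻ lam⁻ x
  flagged-step {lam⁻} x x′ sorts bound eq₀ eq₁ eq = begin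
    flagged cᵥ lam x - flagged cᵥ lam x′
      ≡⟨ cong₂ _-_ (flagged-indep cᵥ R x vex sortsᵥ between) (flagged-indep cᵥ R x′ vex sortsᵥ between) ⟨
    Z l R lam x l (full lam l) - Z l R lam x′ l (full lam l)
      ≡⟨ cong (λ k → Z l R lam x k (full lam l) - Z l R lam x′ k (full lam l)) l≡ ⟩
    Z l R lam x (suc (suc i) + length C) (full lam l) - Z l R lam x′ (suc (suc i) + length C) (full lam l)
      ≡⟨ Z-drop l r i descent (raise-lower lam⁻) eq₀ eq₁ eq (length C)
           (trunc-bound l lam l (λ q _ → bound q) (ℕₚ.≤-trans (s≤s z≤n) r<length))
           (Drop-full l (raise-lower lam⁻) (Sorts-antitone sortsᵥ) (Sorts-antitone sorts) r<length) ⟩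
    (x i - x (suc i)) ⊗ Z l R⁻ lam⁻ x (suc (suc i) + length C) (full lam⁻ l)
      ≡⟨ cong (λ k → (x i - x (suc i)) ⊗ Z l R⁻ lam⁻ x k (full lam⁻ l)) l≡ ⟨
    (x i - x (suc i)) ⊗ Z l R⁻ lam⁻ x l (full lam⁻ l)
      ≡⟨ cong (λ k → (x i - x (suc i)) ⊗ Z k R⁻ lam⁻ x k (full lam⁻ k)) l≡l⁻ ⟩
    (x i - x (suc i)) ⊗ Z (length c⁻) R⁻ lam⁻ x (length c⁻) (full lam⁻ (length c⁻))
      ≡⟨ cong ((x i - x (suc i)) ⊗_) (flagged-indep c⁻ R⁻ x vex⁻ sorts between⁻) ⟩
    _ ∎
    where
    open ≡-Reasoning
    l : ℕ
    l = length cᵥ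
    lam : ℕ → ℕ
    lam = raise lam⁻
    sortsᵥ : Sorts lam cᵥ
    sortsᵥ = raise-sorts sorts
    between : ∀ k → weak cᵥ k ≤ R k × R k ≤ strong cᵥ k
    between k = weak≤R k , R≤strong k
    l≡ : l ≡ suc (suc i) + length C
    l≡ = trans (Listₚ.length-++ A) (trans (ℕₚ.+-suc i _) (cong suc (ℕₚ.+-suc i _)))
    l≡l⁻ : l ≡ length c⁻
    l≡l⁻ = trans (Listₚ.length-++ A) (sym (Listₚ.length-++ A))

-- One-line notation and the longest permutation

toList-tabulate : ∀ {A : Set} {n} (g : Fin n → A) → Vec.toList (Vec.tabulate g) ≡ List.tabulate g
toList-tabulate {n = zero}  g = refl
toList-tabulate {n = suc n} g = cong (g zero ∷_) (toList-tabulate (g ∘ suc))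

line-distinct : ∀ {n} (w : Permutation′ n) → Distinct (Vec.toList (line w))
line-distinct w = subst Distinct (sym (toList-tabulate (toℕ ∘ (w ⟨$⟩ʳ_))))
  (Distinctₚ.tabulate⁺ (λ {i} {j} eq → trans (sym (Perm.inverseˡ w)) (trans (cong (Inverse.from w) (Finₚ.toℕ-injective eq)) (Perm.inverseˡ w))))

length-line : ∀ {n} (w : Permutation′ n) → length (Vec.toList (line w)) ≡ n
length-line w = Vecₚ.length-toList (line w)

-- s occurs in g at increasing positions, all at least lo.
Occurs : ∀ {m} → (Fin m → ℕ) → ℕ → List ℕ → Set
Occurs g lo []      = ⊤
Occurs g lo (x ∷ s) = ∃ λ i → lo ≤ toℕ i × g i ≡ x × Occurs g (suc (toℕ i)) s

Occurs-weaken : ∀ {m} {g : Fin m → ℕ} s {lo lo′} → lo ≤ lo′ → Occurs g lo′ s → Occurs g lo s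
Occurs-weaken []      le o = tt
Occurs-weaken (x ∷ s) le (i , le′ , eq , o) = i , ℕₚ.≤-trans le le′ , eq , o

Occurs-suc : ∀ {m} {g : Fin (suc m) → ℕ} s {lo} → Occurs (g ∘ suc) lo s → Occurs g (suc lo) s
Occurs-suc []      o = tt
Occurs-suc {g = g} (x ∷ s) (i , le , eq , o) = suc i , s≤s le , eq , Occurs-suc {g = g} s o

⊆⇒Occurs : ∀ {m} (g : Fin m → ℕ) {s} → s ⊆ List.tabulate g → Occurs g 0 s
⊆⇒Occurs {zero}  g []         = tt
⊆⇒Occurs {suc m} g {s} (_ ∷ʳ p)   = Occurs-weaken s z≤n (Occurs-suc {g = g} s (⊆⇒Occurs (g ∘ suc) p))
⊆⇒Occurs {suc m} g {x ∷ s} (eq ∷ p) = zero , z≤n , sym eq , Occurs-suc {g = g} s (⊆⇒Occurs (g ∘ suc) p)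

vexillary-line : ∀ {n} (w : Permutation′ n) → Vexillary w → Avoids2143 (Vec.toList (line w))
vexillary-line w vex {a} {b} {d} {c} sub (b<a , a<c , c<d)
  with ⊆⇒Occurs (toℕ ∘ (w ⟨$⟩ʳ_)) (subst ((a ∷ b ∷ d ∷ c ∷ []) ⊆_) (toList-tabulate (toℕ ∘ (w ⟨$⟩ʳ_))) sub)
... | i , _ , refl , j , i<j , refl , k , j<k , refl , l , k<l , refl , _ = vex i<j j<k k<l (b<a , a<c , c<d)

lehmer-downFrom : ∀ n → lehmer (downFrom n) ≡ downFrom n
lehmer-downFrom zero    = refl
lehmer-downFrom (suc n) = cong₂ _∷_
  (trans (cong length (Listₚ.filter-all (_<? n) (All.tabulate below))) (Listₚ.length-downFrom n)) (lehmer-downFrom n)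
  where
  below : ∀ {x} → x ∈ downFrom n → x < n
  below x∈ = go n x∈
    where
    go : ∀ n {x} → x ∈ downFrom n → x < n
    go (suc n) (here refl) = ℕₚ.≤-refl
    go (suc n) (there x∈)  = ℕₚ.m<n⇒m<1+n (go n x∈)

cge-downFrom : ∀ p n → cge p (downFrom n) ≡ n ∸ p
cge-downFrom p zero    = trans (cge-none p [] (λ ())) (sym (ℕₚ.0∸n≡0 p))
cge-downFrom p (suc n) with p ≤? n
... | yes p≤n = trans (cge-yes (downFrom n) p≤n) (trans (cong suc (cge-downFrom p n)) (sym (ℕₚ.+-∸-assoc 1 p≤n)))
... | no  p≰n = trans (cge-no (downFrom n) (ℕₚ.≰⇒> p≰n)) (trans (cge-downFrom p n)
  (trans (ℕₚ.m≤n⇒m∸n≡0 (ℕₚ.<⇒≤ (ℕₚ.≰⇒> p≰n))) (sym (ℕₚ.m≤n⇒m∸n≡0 (ℕₚ.≰⇒> p≰n)))))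

mx-downFrom : ∀ j n → mx (List.drop j (downFrom n)) ≤ n
mx-downFrom zero    zero    = z≤n
mx-downFrom zero    (suc n) = ℕₚ.⊔-lub (ℕₚ.n≤1+n n) (ℕₚ.m≤n⇒m≤1+n (mx-downFrom zero n))
mx-downFrom (suc j) zero    = z≤n
mx-downFrom (suc j) (suc n) = ℕₚ.m≤n⇒m≤1+n (mx-downFrom j n)

-- In the code n - 1, ..., 0 each entry exceeds all later ones, so `strong` counts all of the first
-- j entries. This is the situation of `Z-dominant`.
strong-downFrom : ∀ j n → j < n → strong (downFrom n) j ≡ j
strong-downFrom zero    n       _        = cge-none (mx (downFrom n)) [] (λ ())
strong-downFrom (suc j) (suc n) (s≤s lt) =
  trans (cge-yes (List.take j (downFrom n)) (mx-downFrom j n)) (cong suc (strong-downFrom j n lt))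

reverse-line : ∀ {n} (w : Permutation′ n) → w Perm.≈ Perm.reverse → Vec.toList (line w) ≡ downFrom n
reverse-line {n} w w≈ = trans (cong Vec.toList (Vecₚ.tabulate-cong (cong toℕ ∘ w≈))) (go n)
  where
  go : ∀ n → Vec.toList (Vec.tabulate {n = n} (toℕ ∘ opposite)) ≡ downFrom n
  go zero    = refl
  go (suc n) = cong₂ _∷_ (Finₚ.toℕ-fromℕ n)
    (trans (cong Vec.toList (Vecₚ.tabulate-cong (λ i → Finₚ.toℕ-inject₁ (opposite i)))) (go n))

monomial-∏ : ∀ {k} (ρ : Vec ℤ k) a → monomial ρ a ≡ ∏< k (λ j → at 0ℤ ρ j ^ at 0 a j)
monomial-∏ []      []      = refl
monomial-∏ (x ∷ ρ) (m ∷ a) = cong (x ^ m ⊗_) (monomial-∏ ρ a)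

∏<-cong : ∀ k {f g : ℕ → ℤ} → (∀ j → j < k → f j ≡ g j) → ∏< k f ≡ ∏< k g
∏<-cong zero    eq = refl
∏<-cong (suc k) eq = cong₂ _⊗_ (eq 0 (s≤s z≤n)) (∏<-cong k (λ j lt → eq (suc j) (s≤s lt)))

staircase-at : ∀ n j → j < suc n → at 0 (staircase {n}) j ≡ n ∸ j
staircase-at n j lt = begin
  at 0 (staircase {n}) j                    ≡⟨ cong (at 0 (staircase {n})) (Finₚ.toℕ-fromℕ< lt) ⟨
  at 0 (staircase {n}) (toℕ (fromℕ< lt))    ≡⟨ at-tabulate (toℕ ∘ opposite) (fromℕ< lt) ⟩
  toℕ (opposite (fromℕ< lt))                ≡⟨ Finₚ.opposite-prop (fromℕ< lt) ⟩
  n ∸ toℕ (fromℕ< lt)                       ≡⟨ cong (n ∸_) (Finₚ.toℕ-fromℕ< lt) ⟩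
  n ∸ j                                     ∎
  where open ≡-Reasoning

flagged-reverse : ∀ n {lam} (ρ : Vec ℤ (suc n)) → Sorts lam (downFrom (suc n)) →
                  flagged (downFrom (suc n)) lam (at 0ℤ ρ) ≡ eval ρ (mono staircase)
flagged-reverse n {lam} ρ sorts = begin
  flagged (downFrom (suc n)) lam (at 0ℤ ρ)
    ≡⟨ cong (λ l → Z l (strong c) lam (at 0ℤ ρ) l (full lam l)) (Listₚ.length-downFrom (suc n)) ⟩
  Z (suc n) (strong c) lam (at 0ℤ ρ) (suc n) (full lam (suc n))
    ≡⟨ Z-cong (suc n) {strong c} {id} {lam} {lam} {at 0ℤ ρ} {at 0ℤ ρ} (suc n) (full lam (suc n))
         (λ j lt → strong-downFrom j (suc n) lt) (λ _ _ _ _ → refl) (λ _ _ → refl) ⟩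
  Z (suc n) id lam (at 0ℤ ρ) (suc n) (full lam (suc n))
    ≡⟨ Z-dominant (suc n) lam (at 0ℤ ρ) (suc n)
         (λ q lt → ℕₚ.≤-<-trans (ℕₚ.≤-reflexive (lam-eq q lt)) (s≤s (ℕₚ.m∸n≤m n q)))
         (s≤s z≤n) (Sorts-antitone sorts) (suc n) ℕₚ.≤-refl ⟩
  ∏< (suc n) (λ j → at 0ℤ ρ j ^ lam j)
    ≡⟨ ∏<-cong (suc n) (λ j lt → cong (at 0ℤ ρ j ^_) (trans (lam-eq j lt) (sym (staircase-at n j lt)))) ⟩
  ∏< (suc n) (λ j → at 0ℤ ρ j ^ at 0 (staircase {n}) j)
    ≡⟨ monomial-∏ ρ staircase ⟨
  monomial ρ staircase
    ≡⟨ one (monomial ρ staircase) ⟨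
  eval ρ (mono staircase) ∎
  where
  open ≡-Reasoning
  c : List ℕ
  c = downFrom (suc n)
  one : ∀ x → 1ℤ ⊗ x ⊕ 0ℤ ≡ x
  one = solve-∀
  lam-eq : ∀ q → q < suc n → lam q ≡ n ∸ q
  lam-eq q (s≤s q≤n) = ℕₚ.≤-antisym
    (Sorts-≤ sorts (n ∸ q) (ℕₚ.≤-reflexive (trans (cge-downFrom (suc (n ∸ q)) (suc n)) (ℕₚ.m∸[m∸n]≡n q≤n))))
    (Sorts-≥ sorts (n ∸ q) (ℕₚ.≤-reflexive (sym (trans (cge-downFrom (n ∸ q) (suc n))
      (trans (ℕₚ.+-∸-assoc 1 (ℕₚ.m∸n≤m n q)) (cong suc (ℕₚ.m∸[m∸n]≡n q≤n)))))))

code-of : ∀ {n} → Permutation′ n → List ℕ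
code-of w = lehmer (Vec.toList (line w))

++-split : ∀ {A : Set} (xs xs′ : List A) {x y x′ y′ ys ys′} → length xs ≡ length xs′ →
           xs ++ x ∷ y ∷ ys ≡ xs′ ++ x′ ∷ y′ ∷ ys′ → xs ≡ xs′ × x ≡ x′ × y ≡ y′ × ys ≡ ys′
++-split []       []         len refl = refl , refl , refl , refl
++-split (z ∷ xs) (z′ ∷ xs′) len eq with ++-split xs xs′ (ℕₚ.suc-injective len) (Listₚ.∷-injectiveʳ eq)
... | e , e₁ , e₂ , e₃ = cong₂ _∷_ (Listₚ.∷-injectiveˡ eq) e , e₁ , e₂ , e₃

module Descend {n} (w v : Permutation′ (suc n)) (pre : List ℕ) (x y : ℕ) (post : List ℕ) (x<y : x < y)
               (line-w : Vec.toList (line w) ≡ pre ++ x ∷ y ∷ post) (line-v : Vec.toList (line v) ≡ pre ++ y ∷ x ∷ post)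
               (av-w : Avoids2143 (Vec.toList (line w))) (av-v : Avoids2143 (Vec.toList (line v)))
               {lam} (sorts : Sorts lam (code-of w)) where
  A C : List ℕ
  A = lehmer-prefix pre (x ∷ y ∷ post)
  C = lehmer post

  a b : ℕ
  a = # (_<? y) post
  b = # (_<? x) post

  b≤a : b ≤ a
  b≤a = #-mono (_<? x) (_<? y) post (λ _ z<x → ℕₚ.<-trans z<x x<y)

  code-w : code-of w ≡ A ++ b ∷ a ∷ C
  code-w = trans (cong lehmer line-w) (trans (lehmer-++ pre (x ∷ y ∷ post))
    (cong (λ m → A ++ m ∷ a ∷ C) (cong length (Listₚ.filter-reject (_<? x) (ℕₚ.<-asym x<y)))))

  code-v : code-of v ≡ A ++ suc a ∷ b ∷ C
  code-v = trans (cong lehmer line-v) (trans (lehmer-++ pre (y ∷ x ∷ post))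
    (cong₂ (λ B m → B ++ m ∷ b ∷ C) (lehmer-prefix-↭ pre (_↭_.swap y x ↭-refl)) (cong length (Listₚ.filter-accept (_<? y) x<y))))

  vexᵥ : Vexcode (A ++ suc a ∷ b ∷ C)
  vexᵥ = subst Vexcode code-v (vexillary⇒vexcode (Vec.toList (line v)) (line-distinct v) av-v)

  vex⁻ : Vexcode (A ++ b ∷ a ∷ C)
  vex⁻ = subst Vexcode code-w (vexillary⇒vexcode (Vec.toList (line w)) (line-distinct w) av-w)

  open Exchange A a b C b≤a vexᵥ vex⁻ using (raise; raise-sorts)

  sorts⁻ : Sorts lam (A ++ b ∷ a ∷ C)
  sorts⁻ = subst (Sorts lam) code-w sorts

  sortsᵥ : Sorts (raise lam) (code-of v)
  sortsᵥ = subst (Sorts (raise lam)) (sym code-v) (raise-sorts sorts⁻)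

  bound : ∀ q → raise lam q < length (A ++ suc a ∷ b ∷ C)
  bound = subst (λ c → ∀ q → raise lam q < length c) code-v (Sorts-bound sortsᵥ
    (subst (0 <_) (sym (trans (length-lehmer (Vec.toList (line v))) (length-line v))) (s≤s z≤n))
    (λ {q} x∈ → subst (q <_) (sym (length-lehmer (Vec.toList (line v)))) (lehmer-< (Vec.toList (line v)) x∈)))

  descend : ∀ (i : Fin n) → toℕ i ≡ length pre → (F′ F : Vec ℤ (suc n) → ℤ) → Divided (toℕ i) F′ F →
            (∀ ρ → Generic ρ → F′ ρ ≡ flagged (code-of v) (raise lam) (at 0ℤ ρ)) →
            ∀ ρ → Generic ρ → F ρ ≡ flagged (code-of w) lam (at 0ℤ ρ)
  descend i i≡ F′ F div IH ρ gen =
    cancel (at 0ℤ ρ (toℕ i)) (at 0ℤ ρ (suc (toℕ i))) (distinct ρ gen (toℕ i) (suc (toℕ i)) (ℕₚ.n<1+n _) (suc-toℕ< i)) (begin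
      (at 0ℤ ρ (toℕ i) - at 0ℤ ρ (suc (toℕ i))) ⊗ F ρ
        ≡⟨ Divided.quotient div ρ gen ⟩
      F′ ρ - F′ (swapV (toℕ i) ρ)
        ≡⟨ cong₂ _-_ (IH ρ gen) (IH (swapV (toℕ i) ρ) (Generic-swap (toℕ i) ρ (suc-toℕ< i) gen)) ⟩
      flagged (code-of v) (raise lam) (at 0ℤ ρ) - flagged (code-of v) (raise lam) (at 0ℤ (swapV (toℕ i) ρ))
        ≡⟨ cong (λ c → flagged c (raise lam) (at 0ℤ ρ) - flagged c (raise lam) (at 0ℤ (swapV (toℕ i) ρ))) code-v ⟩
      flagged (A ++ suc a ∷ b ∷ C) (raise lam) (at 0ℤ ρ) - flagged (A ++ suc a ∷ b ∷ C) (raise lam) (at 0ℤ (swapV (toℕ i) ρ))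
        ≡⟨ flagged-step A a b C b≤a vexᵥ vex⁻ (at 0ℤ ρ) (at 0ℤ (swapV (toℕ i) ρ)) sorts⁻ bound
             (swapped (length A) (trans (cong (λ j → σ j (length A)) i≡A) (σ-left (length A))))
             (swapped (suc (length A)) (trans (cong (λ j → σ j (suc (length A))) i≡A) (σ-right (length A))))
             (λ j p p′ → swapped j (σ-other (toℕ i) j (λ e → p (trans e i≡A)) (λ e → p′ (trans e (cong suc i≡A))))) ⟩
      (at 0ℤ ρ (length A) - at 0ℤ ρ (suc (length A))) ⊗ flagged (A ++ b ∷ a ∷ C) lam (at 0ℤ ρ)
        ≡⟨ cong₂ (λ j c → (at 0ℤ ρ j - at 0ℤ ρ (suc j)) ⊗ flagged c lam (at 0ℤ ρ)) i≡A code-w ⟨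
      (at 0ℤ ρ (toℕ i) - at 0ℤ ρ (suc (toℕ i))) ⊗ flagged (code-of w) lam (at 0ℤ ρ) ∎)
    where
    open ≡-Reasoning
    i≡A : toℕ i ≡ length A
    i≡A = trans i≡ (sym (length-lehmer-prefix pre (x ∷ y ∷ post)))
    swapped : ∀ j {k} → σ (toℕ i) j ≡ k → at 0ℤ (swapV (toℕ i) ρ) j ≡ at 0ℤ ρ k
    swapped j eq = trans (at-swap 0ℤ (toℕ i) ρ j (suc-toℕ< i)) (cong (at 0ℤ ρ) eq)

record Above {n} (w : Permutation′ (suc n)) (i : Fin n) (G : GoodAscent (Vec.toList (line w))) : Set where
  open GoodAscent G
  field
    i≡         : toℕ i ≡ length pre
    line-above : Vec.toList (line (w ·s i)) ≡ pre ++ y ∷ x ∷ post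
    descending-above : Descending (line (w ·s i)) (toℕ i)

above : ∀ {n} (w : Permutation′ (suc n)) (G : GoodAscent (Vec.toList (line w))) → ∃ λ i → Above w i G
above {n} w G = i , record
  { i≡ = Finₚ.toℕ-fromℕ< pre<
  ; line-above = proj₁ parts
  ; descending-above = proj₂ parts }
  where
  open GoodAscent G
  pre< : length pre < n
  pre< = ℕₚ.≤-pred (subst (suc (length pre) <_) (trans (trans (sym (trans (Listₚ.length-++ pre)
    (trans (ℕₚ.+-suc (length pre) _) (cong suc (ℕₚ.+-suc (length pre) _))))) (cong length (sym split))) (length-line w))
    (s≤s (s≤s (ℕₚ.m≤m+n (length pre) (length post)))))
  i : Fin n
  i = fromℕ< pre<
  parts : Vec.toList (line (w ·s i)) ≡ pre ++ y ∷ x ∷ post × Descending (line (w ·s i)) (toℕ i)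
  parts with toList-split 0 (toℕ i) (line w) (suc-toℕ< i)
  ... | P , Q , eq , len , eq′ with ++-split P pre (trans len (Finₚ.toℕ-fromℕ< pre<)) (trans (sym eq) split)
  ...   | refl , e₁ , e₂ , refl =
          trans (cong Vec.toList (line-·s w i)) (trans eq′ (cong₂ (λ s t → P ++ s ∷ t ∷ Q) e₂ e₁)) ,
          subst (λ u → Descending u (toℕ i)) (sym (line-·s w i)) (Ascending⇒Descending (toℕ i) (line w) (suc-toℕ< i) (subst₂ _<_ (sym e₁) (sym e₂) ascent))

Flagged : ∀ {n} → Permutation′ (suc n) → Poly (suc n) → Set
Flagged w f = ∀ {lam} → Sorts lam (code-of w) → ∀ ρ → Generic ρ → eval ρ f ≡ flagged (code-of w) lam (at 0ℤ ρ)

-- The polynomial f may have come down to w along other ascents. By uniqueness its values at generic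
-- points are those of `∂ i f′`, with f′ the polynomial of w sᵢ, and there the exchange applies.
flagged-above : ∀ {n} (w : Permutation′ (suc n)) (G : GoodAscent (Vec.toList (line w))) i → Above w i G →
                Avoids2143 (Vec.toList (line w)) →
                ∀ {f f′} → IsSchubert w f → IsSchubert (w ·s i) f′ → Flagged (w ·s i) f′ → Flagged w f
flagged-above w G i ab av {f} {f′} S S′ IH sorts ρ gen = trans
  (schubert-unique w {f} {∂ i f′} S (IsSchubert-resp (line-injective w ((w ·s i) ·s i) back) (IsSchubert-∂ i S′ descending-above)) ρ gen)
  (D.descend i i≡ (value f′) (value (∂ i f′)) (Divided-∂ i f′) (IH D.sortsᵥ) ρ gen)
  where
  open GoodAscent G
  open Above ab
  module D = Descend w (w ·s i) pre x y post ascent split line-above av (subst Avoids2143 (sym line-above) avoids) sorts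
  back : line w ≡ line ((w ·s i) ·s i)
  back = sym (trans (line-·s (w ·s i) i) (trans (cong (swapV (toℕ i)) (line-·s w i)) (swapV-involutive (toℕ i) (line w))))

-- Wachs's theorem, by induction on the number of non-inversions.
schubert-flagged-below : ∀ k {n} (w : Permutation′ (suc n)) → ninv (Vec.toList (line w)) < k →
                         Avoids2143 (Vec.toList (line w)) → ∀ {f} → IsSchubert w f → Flagged w f
schubert-flagged-below (suc k) {n} w lt av {f} (top w≈ f≈) {lam} sorts ρ gen =
  trans (eval-≈ ρ {f} {mono staircase} f≈)
    (trans (sym (flagged-reverse n ρ (subst (Sorts lam) code-eq sorts)))
      (cong (λ c → flagged c lam (at 0ℤ ρ)) (sym code-eq)))
  where
  code-eq : code-of w ≡ downFrom (suc n)
  code-eq = trans (cong lehmer (reverse-line w w≈)) (lehmer-downFrom (suc n))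
-- The ascent i₀ that produced f witnesses that w has an ascent at all; the induction then proceeds
-- along a good one.
schubert-flagged-below (suc k) {n} w (s≤s lt) av {f} S@(step {f = f₁} i₀ S₁ desc w≈ q) = continue (above w G) (schubert _)
  where
  has-ascent : HasAscent (Vec.toList (line w))
  has-ascent with toList-split 0 (toℕ i₀) (line w) (suc-toℕ< i₀)
  ... | P , Q , eq , _ , _ = subst HasAscent (sym eq) (HasAscent-++ P (Step.asc (toStep {w = w} {f₁} {f} i₀ S₁ desc w≈ q)))
  G : GoodAscent (Vec.toList (line w))
  G = good-ascent (Vec.toList (line w)) av has-ascent
  open GoodAscent G
  continue : (p : ∃ λ i → Above w i G) → ∃ (IsSchubert (w ·s proj₁ p)) → Flagged w f
  continue (i , ab) (f′ , S′) = flagged-above w G i ab av S S′ (schubert-flagged-below k (w ·s i)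
    (ℕₚ.<-≤-trans (subst₂ (λ l l′ → ninv l < ninv l′) (sym (Above.line-above ab)) (sym split) (ninv-swap pre x y post ascent)) lt)
    (subst Avoids2143 (sym (Above.line-above ab)) avoids) S′)

schubert-flagged : ∀ {n} (w : Permutation′ (suc n)) → Vexillary w → Flagged w (𝔖 w)
schubert-flagged w vex = schubert-flagged-below (suc (ninv (Vec.toList (line w)))) w ℕₚ.≤-refl
  (vexillary-line w vex) (proj₂ (schubert w))

-- From generic points to (1, ..., 1)

mod-sym : ∀ {t} a b → a ≡ b [mod t ] → b ≡ a [mod t ]
mod-sym {t} a b (divides q eq) = divides (ℤ.- q) (trans (flip a b) (trans (cong ℤ.-_ eq) (ℤₚ.neg-distribˡ-* q t)))
  where
  flip : ∀ a b → b - a ≡ ℤ.- (a - b)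
  flip = solve-∀

mod-trans : ∀ {t} a b c → a ≡ b [mod t ] → b ≡ c [mod t ] → a ≡ c [mod t ]
mod-trans {t} a b c p q = subst (t ∣_) (chain a b c) (Div.∣m∣n⇒∣m+n p q)
  where
  chain : ∀ a b c → (a - b) ⊕ (b - c) ≡ a - c
  chain = solve-∀

mod-monomial : ∀ {t k} (ρ ρ′ : Vec ℤ k) a → (∀ j → j < k → at 0ℤ ρ j ≡ at 0ℤ ρ′ j [mod t ]) →
               monomial ρ a ≡ monomial ρ′ a [mod t ]
mod-monomial []      []        []      p = mod-refl 1ℤ
mod-monomial (x ∷ ρ) (x′ ∷ ρ′) (m ∷ a) p = mod-⊗ (x ^ m) (x′ ^ m) (monomial ρ a) (monomial ρ′ a)
  (mod-^ x x′ m (p 0 (s≤s z≤n))) (mod-monomial ρ ρ′ a (λ j lt → p (suc j) (s≤s lt)))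

mod-eval : ∀ {t k} (ρ ρ′ : Vec ℤ k) f → (∀ j → j < k → at 0ℤ ρ j ≡ at 0ℤ ρ′ j [mod t ]) →
           eval ρ f ≡ eval ρ′ f [mod t ]
mod-eval ρ ρ′ []            p = mod-refl 0ℤ
mod-eval ρ ρ′ ((c , a) ∷ f) p = mod-⊕ (c ⊗ monomial ρ a) (c ⊗ monomial ρ′ a) (eval ρ f) (eval ρ′ f)
  (mod-⊗ c c (monomial ρ a) (monomial ρ′ a) (mod-refl c) (mod-monomial ρ ρ′ a p)) (mod-eval ρ ρ′ f p)

-- Schubert polynomials are evaluated at generic points only, and (1 , … , 1) is reached
-- through generic points congruent to it modulo arbitrarily large integers.
progression : ℕ → ℕ → ℤ
progression t j = 1ℤ ⊕ + j ⊗ + suc t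

progression-point : ℕ → ∀ k → Vec ℤ k
progression-point t k = Vec.tabulate (progression t ∘ toℕ)

at-tabulateℤ : ∀ {k} (g : ℕ → ℤ) j → j < k → at 0ℤ (Vec.tabulate {n = k} (g ∘ toℕ)) j ≡ g j
at-tabulateℤ g zero    (s≤s _)  = refl
at-tabulateℤ g (suc j) (s≤s lt) = at-tabulateℤ (g ∘ suc) j lt

at-replicate : ∀ k j → j < k → at 0ℤ (Vec.replicate k 1ℤ) j ≡ 1ℤ
at-replicate (suc k) zero    _        = refl
at-replicate (suc k) (suc j) (s≤s lt) = at-replicate k j lt

progression-generic : ∀ t k → Generic (progression-point t k)
progression-generic t k i j i<k j<k eq = ℤₚ.+-injective (ℤₚ.*-cancelʳ-≡ (+ i) (+ j) (+ suc t)
  (trans (sym (undo (+ i ⊗ + suc t))) (trans (cong (_- 1ℤ)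
    (trans (sym (at-tabulateℤ (progression t) i i<k)) (trans eq (at-tabulateℤ (progression t) j j<k)))) (undo (+ j ⊗ + suc t)))))
  where
  undo : ∀ x → (1ℤ ⊕ x) - 1ℤ ≡ x
  undo = solve-∀

progression-mod : ∀ t j → progression t j ≡ 1ℤ [mod + suc t ]
progression-mod t j = divides (+ j) (collapse (+ j ⊗ + suc t))
  where
  collapse : ∀ x → (1ℤ ⊕ x) - 1ℤ ≡ x
  collapse = solve-∀

ones : ℕ → ℤ
ones _ = 1ℤ

schubert-at-ones : ∀ {n} (w : Permutation′ (suc n)) → Vexillary w → ∀ {lam} → Sorts lam (code-of w) →
                   eval (Vec.replicate (suc n) 1ℤ) (𝔖 w) ≡ flagged (code-of w) lam ones
schubert-at-ones {n} w vex {lam} sorts = mod-all _ _ (λ t →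
  mod-trans (eval 𝟏 f) (eval (ρ t) f) (flagged c lam ones)
    (mod-eval 𝟏 (ρ t) f (λ j lt → subst₂ (_≡_[mod + suc t ]) (sym (at-replicate (suc n) j lt)) (sym (at-tabulateℤ (progression t) j lt))
      (mod-sym (progression t j) 1ℤ (progression-mod t j))))
    (subst (_≡ flagged c lam ones [mod + suc t ])
      (sym (trans (schubert-flagged w vex sorts (ρ t) (progression-generic t (suc n)))
        (Z-cong (length c) {strong c} {strong c} {lam} {lam} {at 0ℤ (ρ t)} {progression t} (length c) (full lam (length c)) (λ _ _ → refl) (λ _ _ _ _ → refl)
          (λ j lt → at-tabulateℤ (progression t) j (subst (j <_) len lt)))))
      (mod-Z (length c) (strong c) lam (progression t) ones (progression-mod t) (length c) (full lam (length c)))))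
  where
  f : Poly (suc n)
  f = 𝔖 w
  c : List ℕ
  c = code-of w
  𝟏 : Vec ℤ (suc n)
  𝟏 = Vec.replicate (suc n) 1ℤ
  ρ : ∀ t → Vec ℤ (suc n)
  ρ t = progression-point t (suc n)
  len : length c ≡ suc n
  len = trans (length-lehmer (Vec.toList (line w))) (length-line w)

-- Counting by bijections and thresholds

opaque
  unfolding ∑

  ∑-𝟙 : {A : Set} {P : Pred A 0ℓ} (P? : Decidable P) (xs : List A) → ∑ xs (λ x → 𝟙 (P? x)) ≡ + # P? xs
  ∑-𝟙 P? []       = refl
  ∑-𝟙 P? (x ∷ xs) with P? x
  ... | yes _ = cong (1ℤ ⊕_) (∑-𝟙 P? xs)
  ... | no  _ = trans (ℤₚ.+-identityˡ _) (∑-𝟙 P? xs)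

injection-length : {A B : Set} (f : A → B) (xs : List A) (ys : List B) → Distinct xs →
                   (∀ {x} → x ∈ xs → f x ∈ ys) → (∀ {x x′} → x ∈ xs → x′ ∈ xs → f x ≡ f x′ → x ≡ x′) →
                   length xs ≤ length ys
injection-length f []       ys _          into inj = z≤n
injection-length f (x ∷ xs) ys (x∉ ∷ d) into inj with ∈ₚ.∈-∃++ (into (here refl))
... | ys₁ , ys₂ , refl = ℕₚ.≤-trans (s≤s (injection-length f xs (ys₁ ++ ys₂) d into′ (λ p q → inj (there p) (there q))))
        (ℕₚ.≤-reflexive (sym (trans (Listₚ.length-++ ys₁) (trans (ℕₚ.+-suc (length ys₁) (length ys₂)) (cong suc (sym (Listₚ.length-++ ys₁)))))))
  where
  into′ : ∀ {x′} → x′ ∈ xs → f x′ ∈ ys₁ ++ ys₂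
  into′ x′∈ with ∈ₚ.∈-++⁻ ys₁ (into (there x′∈))
  ... | inj₁ p          = ∈ₚ.∈-++⁺ˡ p
  ... | inj₂ (here eq)  = contradiction (sym (inj (there x′∈) (here refl) eq)) (All.lookup x∉ x′∈)
  ... | inj₂ (there p)  = ∈ₚ.∈-++⁺ʳ ys₁ p

#-injection : {A B : Set} {P : Pred A 0ℓ} {Q : Pred B 0ℓ} (P? : Decidable P) (Q? : Decidable Q)
              (xs : List A) (ys : List B) (f : A → B) (g : B → A) → Distinct xs →
              (∀ {x} → x ∈ xs → P x → f x ∈ ys × Q (f x) × g (f x) ≡ x) → # P? xs ≤ # Q? ys
#-injection P? Q? xs ys f g d h = injection-length f (filter P? xs) (filter Q? ys) (Distinctₚ.filter⁺ P? d)
  (λ x∈ → let x∈xs , px = ∈ₚ.∈-filter⁻ P? x∈ ; f∈ , q , _ = h x∈xs px in ∈ₚ.∈-filter⁺ Q? f∈ q)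
  (λ x∈ x′∈ eq → let x∈xs , px = ∈ₚ.∈-filter⁻ P? x∈ ; x′∈xs , px′ = ∈ₚ.∈-filter⁻ P? x′∈ in
    trans (sym (proj₂ (proj₂ (h x∈xs px)))) (trans (cong g eq) (proj₂ (proj₂ (h x′∈xs px′)))))

#-bijection : {A B : Set} {P : Pred A 0ℓ} {Q : Pred B 0ℓ} (P? : Decidable P) (Q? : Decidable Q)
              (xs : List A) (ys : List B) (f : A → B) (g : B → A) → Distinct xs → Distinct ys →
              (∀ {x} → x ∈ xs → P x → f x ∈ ys × Q (f x) × g (f x) ≡ x) →
              (∀ {y} → y ∈ ys → Q y → g y ∈ xs × P (g y) × f (g y) ≡ y) → # P? xs ≡ # Q? ys
#-bijection P? Q? xs ys f g d d′ h h′ = ℕₚ.≤-antisym (#-injection P? Q? xs ys f g d h) (#-injection Q? P? ys xs g f d′ h′)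

allVecs-distinct : {A : Set} {xs : List A} → Distinct xs → ∀ k → Distinct (allVecs xs k)
allVecs-distinct d zero    = [] ∷ []
allVecs-distinct d (suc k) = Distinctₚ.cartesianProductWith⁺ _∷_ Vecₚ.∷-injective d (allVecs-distinct d k)

∈-allVecs⁺ : ∀ {A : Set} {xs : List A} {k} {v : Vec A k} → VAll.All (_∈ xs) v → v ∈ allVecs xs k
∈-allVecs⁺ []       = here refl
∈-allVecs⁺ (x∈ ∷ v∈) = ∈ₚ.∈-cartesianProductWith⁺ _∷_ x∈ (∈-allVecs⁺ v∈)

∈-allVecs⁻ : ∀ {A : Set} {xs : List A} {k} {v : Vec A k} → v ∈ allVecs xs k → VAll.All (_∈ xs) v
∈-allVecs⁻ {v = []}    _  = []
∈-allVecs⁻ {xs = xs} {v = x ∷ v} v∈ with ∈ₚ.∈-cartesianProductWith⁻ _∷_ xs (allVecs xs _) v∈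
... | _ , _ , x∈ , v∈′ , refl = x∈ ∷ ∈-allVecs⁻ v∈′

box-distinct : ∀ b l → Distinct (box b l)
box-distinct b l = allVecs-distinct (Distinctₚ.upTo⁺ b) l

#-map : {A B : Set} {P : Pred B 0ℓ} (P? : Decidable P) (f : A → B) (xs : List A) → # P? (map f xs) ≡ # (P? ∘ f) xs
#-map P? f []       = refl
#-map P? f (x ∷ xs) with P? (f x)
... | yes _ = cong suc (#-map P? f xs)
... | no  _ = #-map P? f xs

-- P holds on an initial segment, so the count below m is the length of that segment. Tableau
-- entries and rows of chains are both defined as such counts, and this threshold form converts one
-- into the other.
count-down : {P : Pred ℕ 0ℓ} (P? : Decidable P) → (∀ j → P (suc j) → P j) → ∀ m j →
             (j < # P? (upTo m) → j < m × P j) × (j < m → P j → j < # P? (upTo m))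
count-down P? down zero    j = (λ ()) , (λ ())
count-down {P} P? down (suc m) j with P? 0
... | no ¬p0 = (λ lt → contradiction (subst (j <_) none lt) ℕₚ.n≮0) , (λ _ pj → contradiction (to-zero j pj) ¬p0)
  where
  to-zero : ∀ j → P j → P 0
  to-zero zero    p = p
  to-zero (suc j) p = to-zero j (down j p)
  none : # P? (applyUpTo suc m) ≡ 0
  none = #-zero P? (applyUpTo suc m) (λ {x} _ px → ¬p0 (to-zero x px))
... | yes p0 = forth j , back j
  where
  shift : # P? (applyUpTo suc m) ≡ # (P? ∘ suc) (upTo m)
  shift = trans (cong (# P?) (sym (Listₚ.map-upTo suc m))) (#-map P? suc (upTo m))
  forth : ∀ j → j < suc (# P? (applyUpTo suc m)) → j < suc m × P j
  forth zero    _        = s≤s z≤n , p0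
  forth (suc j) (s≤s lt) with proj₁ (count-down (P? ∘ suc) (down ∘ suc) m j) (subst (j <_) shift lt)
  ... | j<m , pj = s≤s j<m , pj
  back : ∀ j → j < suc m → P j → j < suc (# P? (applyUpTo suc m))
  back zero    _        _ = s≤s z≤n
  back (suc j) (s≤s lt) p = s≤s (subst (j <_) (sym shift) (proj₂ (count-down (P? ∘ suc) (down ∘ suc) m j) lt p))

<-ext : ∀ a b → (∀ j → j < a → j < b) → (∀ j → j < b → j < a) → a ≡ b
<-ext a b f g = ℕₚ.≤-antisym (≤-ext a b f) (≤-ext b a g)
  where
  ≤-ext : ∀ a b → (∀ j → j < a → j < b) → a ≤ b
  ≤-ext zero    b f = z≤n
  ≤-ext (suc a) b f = f a ℕₚ.≤-refl

module _ (R lam : ℕ → ℕ) where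
  Chain : ∀ {l k} → Vec ℕ l → Vec (Vec ℕ l) k → Set
  Chain           μ []      = μ ≡ Vec.replicate _ 0
  Chain {k = suc k} μ (κ ∷ C) = (Agree (R k) lam κ × Strip μ κ) × Chain κ C

  Chain? : ∀ {l k} (μ : Vec ℕ l) (C : Vec (Vec ℕ l) k) → Dec (Chain μ C)
  Chain?             μ []      = μ ≟ᵐ Vec.replicate _ 0
  Chain? {k = suc k} μ (κ ∷ C) = (Agree? (R k) lam κ ×-dec Strip? μ κ) ×-dec Chain? κ C

  weight-ones : ∀ {l} (μ κ : Vec ℕ l) → weight 1ℤ μ κ ≡ 1ℤ
  weight-ones []      []      = refl
  weight-ones (a ∷ μ) (t ∷ κ) = cong₂ _⊗_ (ℤₚ.^-zeroˡ (a ∸ t)) (weight-ones μ κ)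

  Z-∑ : ∀ {l} b k (μ : Vec ℕ l) → Z b R lam ones k μ ≡ ∑ (allVecs (box b l) k) (λ C → 𝟙 (Chain? μ C))
  Z-∑ {l} b zero    μ = sym (trans (∑-∷ [] [] _) (trans (cong (𝟙 (μ ≟ᵐ Vec.replicate l 0) ⊕_) (∑-[] _)) (ℤₚ.+-identityʳ _)))
  Z-∑ {l} b (suc k) μ = sym (trans (∑-cartesian _∷_ (box b l) (allVecs (box b l) k) _)
    (∑-cong (box b l) (λ κ → begin
      ∑ (allVecs (box b l) k) (λ C → 𝟙 ((Agree? (R k) lam κ ×-dec Strip? μ κ) ×-dec Chain? κ C))
        ≡⟨ ∑-cong (allVecs (box b l) k) (λ C → 𝟙-× (Agree? (R k) lam κ ×-dec Strip? μ κ) (Chain? κ C)) ⟩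
      ∑ (allVecs (box b l) k) (λ C → 𝟙 (Agree? (R k) lam κ ×-dec Strip? μ κ) ⊗ 𝟙 (Chain? κ C))
        ≡⟨ ∑-⊗ (allVecs (box b l) k) (𝟙 (Agree? (R k) lam κ ×-dec Strip? μ κ)) (λ C → 𝟙 (Chain? κ C)) ⟩
      𝟙 (Agree? (R k) lam κ ×-dec Strip? μ κ) ⊗ ∑ (allVecs (box b l) k) (λ C → 𝟙 (Chain? κ C))
        ≡⟨ cong₂ _⊗_ (trans (𝟙-× (Agree? (R k) lam κ) (Strip? μ κ))
             (cong (𝟙 (Agree? (R k) lam κ) ⊗_) (trans (sym (ℤₚ.*-identityʳ (𝟙 (Strip? μ κ)))) (cong (𝟙 (Strip? μ κ) ⊗_) (sym (weight-ones μ κ))))))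
             (sym (Z-∑ b k κ)) ⟩
      𝟙 (Agree? (R k) lam κ) ⊗ strip 1ℤ μ κ ⊗ Z b R lam ones k κ ∎)))
    where open ≡-Reasoning

  Z-ones : ∀ {l} b k (μ : Vec ℕ l) → Z b R lam ones k μ ≡ + # (Chain? {k = k} μ) (allVecs (box b l) k)
  Z-ones b k μ = trans (Z-∑ b k μ) (∑-𝟙 (Chain? μ) (allVecs (box b _) k))

-- Flagged tableaux and (P, ω)-partitions

pred-< : ∀ {j p} → j < p → pred p < p
pred-< {p = suc p} _ = ℕₚ.≤-refl

module Tableaux (lam : ℕ → ℕ) (lam-dec : ∀ q → lam (suc q) ≤ lam q) (m : ℕ) (R φ : ℕ → ℕ)
                (flag⇒complete : ∀ q k → 0 < lam q → φ q ≤ k → q < R k)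
                (complete⇒flag : ∀ q k → q < R k → 0 < lam q × φ q ≤ k)
                (φ≤m : ∀ q → 0 < lam q → φ q ≤ m) where

  record IsChain (κ : ℕ → ℕ → ℕ) : Set where
    field
      bottom : ∀ q → κ 0 q ≡ 0
      ceiling    : ∀ q → κ m q ≡ lam q
      lower  : ∀ k q → k < m → κ (suc k) (suc q) ≤ κ k q
      upper  : ∀ k q → k < m → κ k q ≤ κ (suc k) q
      agree  : ∀ k q → k < m → q < R k → κ k q ≡ lam q

  record IsTableau (t : ℕ → ℕ → ℕ) : Set where
    field
      positive : ∀ q j → j < lam q → 1 ≤ t q j
      rows     : ∀ q j → suc j < lam q → t q j ≤ t q (suc j)
      columns  : ∀ q j → j < lam (suc q) → t q j < t (suc q) j
      flag-bounded  : ∀ q j → j < lam q → t q j ≤ φ q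

  -- The Gelfand-Tsetlin correspondence. The entry of a cell is the number of stages at which the
  -- cell is still missing, which is the letter that adds it, letters counting from 1; `chain`
  -- recovers stage k from the cells with entry at most k.
  tableau : (ℕ → ℕ → ℕ) → ℕ → ℕ → ℕ
  tableau κ q j = # (λ k → κ k q ≤? j) (upTo m)

  chain : (ℕ → ℕ → ℕ) → ℕ → ℕ → ℕ
  chain t k q = # (λ j → (j <? lam q) ×-dec (t q j ≤? k)) (upTo (lam q))

  module _ {κ : ℕ → ℕ → ℕ} (mono : ∀ k q → κ k q ≤ κ (suc k) q) where
    tableau-threshold : ∀ q j k → (k < tableau κ q j → k < m × κ k q ≤ j) × (k < m → κ k q ≤ j → k < tableau κ q j)
    tableau-threshold q j k = count-down (λ k → κ k q ≤? j) (λ k le → ℕₚ.≤-trans (mono k q) le) m k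

    tableau-isTableau : IsChain κ → IsTableau (tableau κ)
    tableau-isTableau C = record { positive = pos ; rows = row ; columns = col ; flag-bounded = flg }
      where
      open IsChain C
      T = tableau κ
      thr : ∀ q j k → (k < T q j → k < m × κ k q ≤ j) × (k < m → κ k q ≤ j → k < T q j)
      thr = tableau-threshold
      m>0 : ∀ q j → j < lam q → 0 < m
      m>0 q j lt = ℕₚ.n≢0⇒n>0 (λ m≡0 →
        ℕₚ.n≮0 (subst (j <_) (trans (sym (ceiling q)) (trans (cong (λ k → κ k q) m≡0) (bottom q))) lt))
      pos : ∀ q j → j < lam q → 1 ≤ T q j
      pos q j lt = proj₂ (thr q j 0) (m>0 q j lt) (ℕₚ.≤-trans (ℕₚ.≤-reflexive (bottom q)) z≤n)
      row : ∀ q j → suc j < lam q → T q j ≤ T q (suc j)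
      row q j _ = #-mono (λ k → κ k q ≤? j) (λ k → κ k q ≤? suc j) (upTo m) (λ _ → ℕₚ.m≤n⇒m≤1+n)
      col : ∀ q j → j < lam (suc q) → T q j < T (suc q) j
      col q j lt with T q j in eq
      ... | zero  = pos (suc q) j lt
      -- The cell above is missing at stage k, hence by the strip condition this cell is missing at
      -- stage k + 1; it is present at stage m, so k + 1 < m.
      ... | suc k with proj₁ (thr q j k) (ℕₚ.≤-reflexive (sym eq))
      ...   | k<m , κ≤j = proj₂ (thr (suc q) j (suc k)) (ℕₚ.≤∧≢⇒< k<m (λ { refl →
                  ℕₚ.<⇒≱ lt (ℕₚ.≤-trans (ℕₚ.≤-reflexive (sym (ceiling (suc q)))) (ℕₚ.≤-trans (lower k q k<m) κ≤j)) }))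
                  (ℕₚ.≤-trans (lower k q k<m) κ≤j)
      flg : ∀ q j → j < lam q → T q j ≤ φ q
      -- An entry above φ q would leave its cell missing at stage φ q, where row q is already
      -- complete.
      flg q j lt = ℕₚ.≮⇒≥ (λ φ<T → let φ<m , κ≤j = proj₁ (thr q j (φ q)) φ<T in
        ℕₚ.<⇒≱ lt (ℕₚ.≤-trans (ℕₚ.≤-reflexive (sym (agree (φ q) q φ<m
          (flag⇒complete q (φ q) (ℕₚ.≤-<-trans z≤n lt) ℕₚ.≤-refl)))) κ≤j))

    chain-tableau : IsChain κ → ∀ k q → k ≤ m → chain (tableau κ) k q ≡ κ k q
    chain-tableau C k q k≤m = <-ext _ _
      (λ j lt → let _ , j<lam , T≤k = thr₁ j lt in ℕₚ.≰⇒> (λ κ≤j → back j j<lam T≤k κ≤j))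
      (λ j lt → let j<lam = ℕₚ.<-≤-trans lt (bounded (m ∸ k) k q (ℕₚ.m+[n∸m]≡n k≤m)) in
         proj₂ (thr j) j<lam (j<lam , ℕₚ.≮⇒≥ (λ k<T → ℕₚ.<⇒≱ lt (proj₂ (proj₁ (tableau-threshold q j k) k<T)))))
      where
      open IsChain C
      TT : IsTableau (tableau κ)
      TT = tableau-isTableau C
      bounded : ∀ d k q → k + d ≡ m → κ k q ≤ lam q
      bounded zero    k q eq = ℕₚ.≤-reflexive (trans (cong (λ n → κ n q) (trans (sym (ℕₚ.+-identityʳ k)) eq)) (ceiling q))
      bounded (suc d) k q eq = ℕₚ.≤-trans (mono k q) (bounded d (suc k) q (trans (sym (ℕₚ.+-suc k d)) eq))
      thr : ∀ j → (j < chain (tableau κ) k q → j < lam q × (j < lam q × tableau κ q j ≤ k)) × (j < lam q → (j < lam q × tableau κ q j ≤ k) → j < chain (tableau κ) k q)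
      thr = count-down (λ j → (j <? lam q) ×-dec (tableau κ q j ≤? k))
        (λ j (lt , le) → ℕₚ.<-trans (ℕₚ.n<1+n j) lt , ℕₚ.≤-trans (IsTableau.rows TT q j lt) le) (lam q)
      thr₁ : ∀ j → j < chain (tableau κ) k q → j < lam q × (j < lam q × tableau κ q j ≤ k)
      thr₁ j = proj₁ (thr j)
      back : ∀ j → j < lam q → tableau κ q j ≤ k → ¬ (κ k q ≤ j)
      back j j<lam T≤k κ≤j with ℕₚ.m≤n⇒m<n∨m≡n k≤m
      ... | inj₁ k<m = ℕₚ.<⇒≱ (proj₂ (tableau-threshold q j k) k<m κ≤j) T≤k
      ... | inj₂ k≡m = ℕₚ.<⇒≱ j<lam (ℕₚ.≤-trans (ℕₚ.≤-reflexive (trans (sym (ceiling q)) (cong (λ n → κ n q) (sym k≡m)))) κ≤j)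

  module _ {t} (T : IsTableau t) where
    open IsTableau T

    chain-threshold : ∀ k q j → (j < chain t k q → j < lam q × t q j ≤ k) × (j < lam q → t q j ≤ k → j < chain t k q)
    chain-threshold k q j = (λ lt → proj₂ (proj₁ thr lt)) , (λ lt le → proj₂ thr lt (lt , le))
      where
      thr = count-down (λ j → (j <? lam q) ×-dec (t q j ≤? k))
        (λ j (lt , le) → ℕₚ.<-trans (ℕₚ.n<1+n j) lt , ℕₚ.≤-trans (rows q j lt) le) (lam q) j

    <-incl : ∀ {a b} → (∀ j → j < a → j < b) → a ≤ b
    <-incl {zero}  f = z≤n
    <-incl {suc a} f = f a ℕₚ.≤-refl

    chain-mono : ∀ k q → chain t k q ≤ chain t (suc k) q
    chain-mono k q = <-incl (λ j lt → let j<lam , le = proj₁ (chain-threshold k q j) lt in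
      proj₂ (chain-threshold (suc k) q j) j<lam (ℕₚ.m≤n⇒m≤1+n le))

    chain-≤ : ∀ k q → chain t k q ≤ lam q
    chain-≤ k q = <-incl (λ j lt → proj₁ (proj₁ (chain-threshold k q j) lt))

    chain-isChain : IsChain (chain t)
    chain-isChain = record
      { bottom = λ q → ℕₚ.n≤0⇒n≡0 (<-incl (λ j lt → let j<lam , le = proj₁ (chain-threshold 0 q j) lt in
                   contradiction (ℕₚ.≤-trans (positive q j j<lam) le) λ ()))
      ; ceiling    = λ q → ℕₚ.≤-antisym (chain-≤ m q) (<-incl (λ j lt → proj₂ (chain-threshold m q j) lt
                   (ℕₚ.≤-trans (flag-bounded q j lt) (φ≤m q (ℕₚ.≤-<-trans z≤n lt)))))
      ; lower  = λ k q _ → <-incl (λ j lt → let j<lam , le = proj₁ (chain-threshold (suc k) (suc q) j) lt in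
                   proj₂ (chain-threshold k q j) (ℕₚ.<-≤-trans j<lam (lam-dec q)) (ℕₚ.≤-pred (ℕₚ.<-≤-trans (columns q j j<lam) le)))
      ; upper  = λ k q _ → chain-mono k q
      ; agree  = λ k q _ q<R → ℕₚ.≤-antisym (chain-≤ k q) (<-incl (λ j lt → proj₂ (chain-threshold k q j) lt
                   (ℕₚ.≤-trans (flag-bounded q j lt) (proj₂ (complete⇒flag q k q<R)))))
      }

    tableau-chain : ∀ q j → j < lam q → tableau (chain t) q j ≡ t q j
    tableau-chain q j j<lam = <-ext _ _
      (λ k lt → ℕₚ.≰⇒> (λ t≤k → ℕₚ.<⇒≱ (proj₂ (chain-threshold k q j) j<lam t≤k) (proj₂ (proj₁ (tableau-threshold chain-mono q j k) lt))))
      (λ k lt → proj₂ (tableau-threshold chain-mono q j k)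
        (ℕₚ.<-≤-trans lt (ℕₚ.≤-trans (flag-bounded q j j<lam) (φ≤m q (ℕₚ.≤-<-trans z≤n j<lam))))
        (ℕₚ.≮⇒≥ (λ j<κ → ℕₚ.<⇒≱ lt (proj₂ (proj₁ (chain-threshold k q j) j<κ)))))

  -- Shifting by the partial sums of the signature turns flag-bounded tableaux into (P, ω)-partitions.
  module Shift (e f E F : ℕ → ℕ) (E-0 : E 0 ≡ 0) (F-0 : F 0 ≡ 0)
               (E-suc : ∀ q → E (suc q) ≡ E q + e q) (F-suc : ∀ j → F (suc j) ≡ F j + f j) (e≤1 : ∀ q → e q ≤ 1)
               (M : ℕ)
               (corner : ∀ q → 0 < lam q → ∃ λ q′ → q ≤ q′ × lam q′ ≡ lam q × φ q′ ≡ φ q ×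
                         φ q′ + (F (pred (lam q)) + E q′) ≡ M + q′) where

    record IsPartition (s : ℕ → ℕ → ℕ) : Set where
      field
        rows    : ∀ q j → suc j < lam q → s q j + f j ≤ s q (suc j)
        columns : ∀ q j → j < lam (suc q) → s q j + e q ≤ s (suc q) j
        bounded : ∀ q j → j < lam q → s q j < M

    -- The relation s = t + F + E - (q + 1), written additively so that nothing is truncated.
    Linked : (t s : ℕ → ℕ → ℕ) → Set
    Linked t s = ∀ q j → j < lam q → s q j + suc q ≡ t q j + (F j + E q)

    unshift shift : (ℕ → ℕ → ℕ) → ℕ → ℕ → ℕ
    shift   t q j = (t q j + (F j + E q)) ∸ suc q
    unshift s q j = (s q j + suc q) ∸ (F j + E q)

    -- A path to the right along row q and then down its last column ends at the last cell of row
    -- q′. So an upper bound needs to be checked only at the corners.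
    up : (t : ℕ → ℕ → ℕ) → (∀ q j → suc j < lam q → t q j ≤ t q (suc j)) → (∀ q j → j < lam (suc q) → t q j ≤ t (suc q) j) →
         ∀ q q′ j → q ≤ q′ → lam q′ ≡ lam q → j < lam q → t q j ≤ t q′ (pred (lam q))
    up t row col q q′ j q≤q′ eq j<lam = ℕₚ.≤-trans (along (pred (lam q) ∸ j) q j (reach j<lam))
      (down (q′ ∸ q) q (subst (λ r → lam r ≡ lam q) (sym (ℕₚ.m+[n∸m]≡n q≤q′)) eq) (ℕₚ.m+[n∸m]≡n q≤q′))
      where
      reach : ∀ {j p} → j < p → j + (pred p ∸ j) ≡ pred p
      reach {p = suc p} (s≤s le) = ℕₚ.m+[n∸m]≡n le
      along : ∀ d q j → j + d ≡ pred (lam q) → t q j ≤ t q (pred (lam q))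
      along zero    q j e = ℕₚ.≤-reflexive (cong (t q) (trans (sym (ℕₚ.+-identityʳ j)) e))
      along (suc d) q j e = ℕₚ.≤-trans (row q j (small (lam q) (trans (sym (ℕₚ.+-suc j d)) e))) (along d q (suc j) (trans (sym (ℕₚ.+-suc j d)) e))
        where
        small : ∀ p → suc j + d ≡ pred p → suc j < p
        small (suc p) e = s≤s (ℕₚ.≤-trans (ℕₚ.m≤m+n (suc j) d) (ℕₚ.≤-reflexive e))
      lam-anti : ∀ d q → lam (q + d) ≤ lam q
      lam-anti zero    q = ℕₚ.≤-reflexive (cong lam (ℕₚ.+-identityʳ q))
      lam-anti (suc d) q = ℕₚ.≤-trans (ℕₚ.≤-reflexive (cong lam (ℕₚ.+-suc q d))) (ℕₚ.≤-trans (lam-dec (q + d)) (lam-anti d q))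
      down : ∀ d r → lam (r + d) ≡ lam q → r + d ≡ q′ → t r (pred (lam q)) ≤ t q′ (pred (lam q))
      down zero    r e e′ = ℕₚ.≤-reflexive (cong (λ n → t n (pred (lam q))) (trans (sym (ℕₚ.+-identityʳ r)) e′))
      down (suc d) r e e′ = ℕₚ.≤-trans
        (col r (pred (lam q)) (ℕₚ.<-≤-trans (pred-< j<lam) (ℕₚ.≤-trans (ℕₚ.≤-reflexive (trans (sym e) (cong lam (ℕₚ.+-suc r d)))) (lam-anti d (suc r)))))
        (down d (suc r) (trans (cong lam (sym (ℕₚ.+-suc r d))) e) (trans (sym (ℕₚ.+-suc r d)) e′))

    module _ {t s} (L : Linked t s) where
      -- Going down one row costs s one unit and adds e q, which trades strict increase for increase
      -- by at least e q; going right adds f j. At a corner the equation between φ and M turns the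
      -- flag bound into s < M.
      partition : IsTableau t → IsPartition s
      partition T = record { rows = row ; columns = col ; bounded = bnd }
        where
        open IsTableau T renaming (rows to t-rows; columns to t-columns)
        row : ∀ q j → suc j < lam q → s q j + f j ≤ s q (suc j)
        row q j lt = ℕₚ.+-cancelʳ-≤ (suc q) _ _ (begin
          s q j + f j + suc q                   ≡⟨ swapʳ (s q j) (f j) (suc q) ⟩
          s q j + suc q + f j                   ≡⟨ cong (λ n → n + f j) (L q j (ℕₚ.<-trans (ℕₚ.n<1+n j) lt)) ⟩
          t q j + (F j + E q) + f j             ≤⟨ ℕₚ.+-monoˡ-≤ (f j) (ℕₚ.+-monoˡ-≤ (F j + E q) (t-rows q j lt)) ⟩
          t q (suc j) + (F j + E q) + f j       ≡⟨ trans (collect (t q (suc j)) (F j) (E q) (f j)) (cong (λ n → t q (suc j) + (n + E q)) (sym (F-suc j))) ⟩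
          t q (suc j) + (F (suc j) + E q)       ≡⟨ L q (suc j) lt ⟨
          s q (suc j) + suc q                   ∎)
          where
          open ℕₚ.≤-Reasoning
          swapʳ : ∀ a b c → a + b + c ≡ a + c + b
          swapʳ = solve-∀ℕ
          collect : ∀ a b c d → a + (b + c) + d ≡ a + (b + d + c)
          collect = solve-∀ℕ
        col : ∀ q j → j < lam (suc q) → s q j + e q ≤ s (suc q) j
        col q j lt = ℕₚ.+-cancelʳ-≤ (suc (suc q)) _ _ (begin
          s q j + e q + suc (suc q)             ≡⟨ swapʳ (s q j) (e q) (suc q) ⟩
          suc (s q j + suc q) + e q             ≡⟨ cong (λ n → suc n + e q) (L q j (ℕₚ.<-≤-trans lt (lam-dec q))) ⟩
          suc (t q j) + (F j + E q) + e q       ≤⟨ ℕₚ.+-monoˡ-≤ (e q) (ℕₚ.+-monoˡ-≤ (F j + E q) (t-columns q j lt)) ⟩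
          t (suc q) j + (F j + E q) + e q       ≡⟨ trans (collect (t (suc q) j) (F j) (E q) (e q)) (cong (λ n → t (suc q) j + (F j + n)) (sym (E-suc q))) ⟩
          t (suc q) j + (F j + E (suc q))       ≡⟨ L (suc q) j lt ⟨
          s (suc q) j + suc (suc q)             ∎)
          where
          open ℕₚ.≤-Reasoning
          swapʳ : ∀ a b c → a + b + suc c ≡ suc (a + c) + b
          swapʳ = solve-∀ℕ
          collect : ∀ a b c d → a + (b + c) + d ≡ a + (b + (c + d))
          collect = solve-∀ℕ
        bnd : ∀ q j → j < lam q → s q j < M
        bnd q j lt with corner q (ℕₚ.≤-<-trans z≤n lt)
        ... | q′ , q≤q′ , lam≡ , φ≡ , eq = ℕₚ.≤-<-trans
            (up s (λ q j lt → ℕₚ.≤-trans (ℕₚ.m≤m+n _ _) (row q j lt)) (λ q j lt → ℕₚ.≤-trans (ℕₚ.m≤m+n _ _) (col q j lt)) q q′ j q≤q′ lam≡ lt)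
            (ℕₚ.+-cancelʳ-≤ q′ _ _ (begin
              suc (s q′ p) + q′                   ≡⟨ ℕₚ.+-suc (s q′ p) q′ ⟨
              s q′ p + suc q′                     ≡⟨ L q′ p p<lam ⟩
              t q′ p + (F p + E q′)               ≤⟨ ℕₚ.+-monoˡ-≤ (F p + E q′) (flag-bounded q′ p p<lam) ⟩
              φ q′ + (F p + E q′)                 ≡⟨ eq ⟩
              M + q′                              ∎))
          where
          open ℕₚ.≤-Reasoning
          p : ℕ
          p = pred (lam q)
          p<lam : p < lam q′
          p<lam = subst (p <_) (sym lam≡) (pred-< lt)

      isTableau : (∀ q j → j < lam q → suc q ≤ t q j) → IsPartition s → IsTableau t
      isTableau t≥ S = record
        { positive = λ q j lt → ℕₚ.≤-trans (s≤s z≤n) (t≥ q j lt) ; rows = row ; columns = col ; flag-bounded = flg }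
        where
        open IsPartition S renaming (rows to s-rows; columns to s-columns)
        row : ∀ q j → suc j < lam q → t q j ≤ t q (suc j)
        row q j lt = ℕₚ.+-cancelʳ-≤ (F j + E q + f j) _ _ (begin
          t q j + (F j + E q + f j)             ≡⟨ ℕₚ.+-assoc (t q j) (F j + E q) (f j) ⟨
          t q j + (F j + E q) + f j             ≡⟨ cong (λ n → n + f j) (L q j (ℕₚ.<-trans (ℕₚ.n<1+n j) lt)) ⟨
          s q j + suc q + f j                   ≡⟨ swapʳ (s q j) (suc q) (f j) ⟩
          s q j + f j + suc q                   ≤⟨ ℕₚ.+-monoˡ-≤ (suc q) (s-rows q j lt) ⟩
          s q (suc j) + suc q                   ≡⟨ L q (suc j) lt ⟩
          t q (suc j) + (F (suc j) + E q)       ≡⟨ cong (λ n → t q (suc j) + (n + E q)) (F-suc j) ⟩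
          t q (suc j) + (F j + f j + E q)       ≡⟨ cong (λ n → t q (suc j) + n) (swapʳ (F j) (f j) (E q)) ⟩
          t q (suc j) + (F j + E q + f j)       ∎)
          where
          open ℕₚ.≤-Reasoning
          swapʳ : ∀ a b c → a + b + c ≡ a + c + b
          swapʳ = solve-∀ℕ
        col : ∀ q j → j < lam (suc q) → t q j < t (suc q) j
        col q j lt = ℕₚ.+-cancelʳ-≤ (F j + E q + e q) _ _ (begin
          suc (t q j) + (F j + E q + e q)       ≡⟨ expand (t q j) (F j + E q) (e q) ⟩
          suc (t q j + (F j + E q) + e q)       ≡⟨ cong (λ n → suc (n + e q)) (L q j (ℕₚ.<-≤-trans lt (lam-dec q))) ⟨
          suc (s q j + suc q + e q)             ≡⟨ swapʳ (s q j) q (e q) ⟩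
          s q j + e q + suc (suc q)             ≤⟨ ℕₚ.+-monoˡ-≤ (suc (suc q)) (s-columns q j lt) ⟩
          s (suc q) j + suc (suc q)             ≡⟨ L (suc q) j lt ⟩
          t (suc q) j + (F j + E (suc q))       ≡⟨ cong (λ n → t (suc q) j + (F j + n)) (E-suc q) ⟩
          t (suc q) j + (F j + (E q + e q))     ≡⟨ cong (λ n → t (suc q) j + n) (sym (ℕₚ.+-assoc (F j) (E q) (e q))) ⟩
          t (suc q) j + (F j + E q + e q)       ∎)
          where
          open ℕₚ.≤-Reasoning
          expand : ∀ a b c → suc a + (b + c) ≡ suc (a + b + c)
          expand = solve-∀ℕ
          swapʳ : ∀ a b c → suc (a + suc b + c) ≡ a + c + suc (suc b)
          swapʳ = solve-∀ℕ
        flg : ∀ q j → j < lam q → t q j ≤ φ q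
        flg q j lt with corner q (ℕₚ.≤-<-trans z≤n lt)
        ... | q′ , q≤q′ , lam≡ , φ≡ , eq = ℕₚ.≤-trans
            (up t row (λ q j lt → ℕₚ.<⇒≤ (col q j lt)) q q′ j q≤q′ lam≡ lt)
            (ℕₚ.+-cancelʳ-≤ (F p + E q′) _ _ (begin
              t q′ p + (F p + E q′)               ≡⟨ L q′ p p<lam ⟨
              s q′ p + suc q′                     ≡⟨ ℕₚ.+-suc (s q′ p) q′ ⟩
              suc (s q′ p) + q′                   ≤⟨ ℕₚ.+-monoˡ-≤ q′ (bounded q′ p p<lam) ⟩
              M + q′                              ≡⟨ eq ⟨
              φ q′ + (F p + E q′)                 ≡⟨ cong (λ n → n + (F p + E q′)) φ≡ ⟩
              φ q + (F p + E q′)                  ∎))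
          where
          open ℕₚ.≤-Reasoning
          p : ℕ
          p = pred (lam q)
          p<lam : p < lam q′
          p<lam = subst (p <_) (sym lam≡) (pred-< lt)

    E≤ : ∀ q → E q ≤ q
    E≤ zero    = ℕₚ.≤-reflexive E-0
    E≤ (suc q) = ℕₚ.≤-trans (ℕₚ.≤-reflexive (E-suc q)) (ℕₚ.≤-trans (ℕₚ.+-mono-≤ (E≤ q) (e≤1 q)) (ℕₚ.≤-reflexive (ℕₚ.+-comm q 1)))

    tableau-≥ : ∀ {t} → IsTableau t → ∀ q j → j < lam q → suc q ≤ t q j
    tableau-≥ T zero    j lt = IsTableau.positive T 0 j lt
    tableau-≥ T (suc q) j lt = ℕₚ.≤-trans (s≤s (tableau-≥ T q j (ℕₚ.<-≤-trans lt (lam-dec q)))) (IsTableau.columns T q j lt)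

    -- Along the first row and then down column j, each step adds at least its bit, and these bits
    -- sum to F j + E q. Thus `unshift` does not truncate.
    partition-≥ : ∀ {s} → IsPartition s → ∀ q j → j < lam q → F j + E q ≤ s q j
    partition-≥ S zero    zero    lt = ℕₚ.≤-trans (ℕₚ.≤-reflexive (cong₂ _+_ F-0 E-0)) z≤n
    partition-≥ {s} S zero (suc j) lt = begin
      F (suc j) + E 0       ≡⟨ cong (λ n → n + E 0) (F-suc j) ⟩
      F j + f j + E 0       ≡⟨ swapʳ (F j) (f j) (E 0) ⟩
      F j + E 0 + f j       ≤⟨ ℕₚ.+-monoˡ-≤ (f j) (partition-≥ S zero j (ℕₚ.<-trans (ℕₚ.n<1+n j) lt)) ⟩
      s 0 j + f j           ≤⟨ IsPartition.rows S 0 j lt ⟩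
      s 0 (suc j)           ∎
      where
      open ℕₚ.≤-Reasoning
      swapʳ : ∀ a b c → a + b + c ≡ a + c + b
      swapʳ = solve-∀ℕ
    partition-≥ {s} S (suc q) j lt = begin
      F j + E (suc q)       ≡⟨ cong (λ n → F j + n) (E-suc q) ⟩
      F j + (E q + e q)     ≡⟨ ℕₚ.+-assoc (F j) (E q) (e q) ⟨
      F j + E q + e q       ≤⟨ ℕₚ.+-monoˡ-≤ (e q) (partition-≥ S q j (ℕₚ.<-≤-trans lt (lam-dec q))) ⟩
      s q j + e q           ≤⟨ IsPartition.columns S q j lt ⟩
      s (suc q) j           ∎
      where open ℕₚ.≤-Reasoning

    shift-linked : ∀ {t} → IsTableau t → Linked t (shift t)
    shift-linked {t} T q j lt = ℕₚ.m∸n+n≡m (ℕₚ.≤-trans (tableau-≥ T q j lt) (ℕₚ.m≤m+n (t q j) (F j + E q)))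

    unshift-linked : ∀ {s} → IsPartition s → Linked (unshift s) s
    unshift-linked {s} S q j lt = sym (ℕₚ.m∸n+n≡m (ℕₚ.≤-trans (partition-≥ S q j lt) (ℕₚ.m≤m+n (s q j) (suc q))))

    unshift-isTableau : ∀ {s} → IsPartition s → IsTableau (unshift s)
    unshift-isTableau {s} S = isTableau (unshift-linked S)
      (λ q j lt → ℕₚ.+-cancelʳ-≤ (F j + E q) _ _ (ℕₚ.≤-trans (ℕₚ.≤-reflexive (ℕₚ.+-comm (suc q) (F j + E q)))
        (ℕₚ.≤-trans (ℕₚ.+-monoˡ-≤ (suc q) (partition-≥ S q j lt)) (ℕₚ.≤-reflexive (unshift-linked S q j lt))))) S

    linked-shift : ∀ {t s} → Linked t s → ∀ q j → j < lam q → shift t q j ≡ s q j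
    linked-shift {t} {s} L q j lt = trans (cong (_∸ suc q) (sym (L q j lt))) (ℕₚ.m+n∸n≡m (s q j) (suc q))

    linked-unshift : ∀ {t s} → Linked t s → ∀ q j → j < lam q → unshift s q j ≡ t q j
    linked-unshift {t} {s} L q j lt = trans (cong (_∸ (F j + E q)) (L q j lt)) (ℕₚ.m+n∸n≡m (t q j) (F j + E q))

-- Chains stored as vectors

hd-at : ∀ {l} (μ : Vec ℕ l) → hd μ ≡ at 0 μ 0
hd-at []      = refl
hd-at (a ∷ μ) = refl

Strip-at : ∀ {l} (μ κ : Vec ℕ l) → Strip μ κ → ∀ q → at 0 μ (suc q) ≤ at 0 κ q × at 0 κ q ≤ at 0 μ q
Strip-at []      []      _                q       = z≤n , z≤n
Strip-at (a ∷ μ) (t ∷ κ) ((lo , hi) , s) zero    = ℕₚ.≤-trans (ℕₚ.≤-reflexive (sym (hd-at μ))) lo , hi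
Strip-at (a ∷ μ) (t ∷ κ) (_ , s)         (suc q) = Strip-at μ κ s q

at-Strip : ∀ {l} (μ κ : Vec ℕ l) → (∀ q → at 0 μ (suc q) ≤ at 0 κ q × at 0 κ q ≤ at 0 μ q) → Strip μ κ
at-Strip []      []      h = tt
at-Strip (a ∷ μ) (t ∷ κ) h =
  (ℕₚ.≤-trans (ℕₚ.≤-reflexive (hd-at μ)) (proj₁ (h 0)) , proj₂ (h 0)) , at-Strip μ κ (h ∘ suc)

Agree-at : ∀ {l} R lam (κ : Vec ℕ l) → Agree R lam κ → ∀ q → q < R → q < l → at 0 κ q ≡ lam q
Agree-at (suc R) lam (t ∷ κ) (e , A) zero    _        _         = e
Agree-at (suc R) lam (t ∷ κ) (e , A) (suc q) (s≤s lt) (s≤s lt′) = Agree-at R (lam ∘ suc) κ A q lt lt′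

at-Agree : ∀ {l} R lam (κ : Vec ℕ l) → (∀ q → q < R → q < l → at 0 κ q ≡ lam q) → Agree R lam κ
at-Agree zero    lam κ       h = tt
at-Agree (suc R) lam []      h = tt
at-Agree (suc R) lam (t ∷ κ) h = h 0 (s≤s z≤n) (s≤s z≤n) ,
  at-Agree R (lam ∘ suc) κ (λ q lt lt′ → h (suc q) (s≤s lt) (s≤s lt′))

at-beyond : ∀ {l} (v : Vec ℕ l) q → l ≤ q → at 0 v q ≡ 0
at-beyond []      q       _        = refl
at-beyond (x ∷ v) (suc q) (s≤s le) = at-beyond v q le

at-ext : ∀ {l} (u v : Vec ℕ l) → (∀ q → q < l → at 0 u q ≡ at 0 v q) → u ≡ v
at-ext []      []      h = refl
at-ext (x ∷ u) (y ∷ v) h = cong₂ _∷_ (h 0 (s≤s z≤n)) (at-ext u v (λ q lt → h (suc q) (s≤s lt)))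

at-tabulate< : ∀ l (g : ℕ → ℕ) q → q < l → at 0 (Vec.tabulate {n = l} (g ∘ toℕ)) q ≡ g q
at-tabulate< (suc l) g zero    _        = refl
at-tabulate< (suc l) g (suc q) (s≤s lt) = at-tabulate< l (g ∘ suc) q lt

at-full : ∀ lam l q → q < l → at 0 (full lam l) q ≡ lam q
at-full lam (suc l) zero    _        = refl
at-full lam (suc l) (suc q) (s≤s lt) = at-full (lam ∘ suc) l q lt

at-replicate-0 : ∀ l q → at 0 (Vec.replicate l 0) q ≡ 0
at-replicate-0 zero    q       = refl
at-replicate-0 (suc l) zero    = refl
at-replicate-0 (suc l) (suc q) = at-replicate-0 l q

-- The vector lists the stages from k - 1 down to 0; every index from k on yields the top μ.
stageOf : ∀ {A : Set} {k} → A → Vec A k → ℕ → A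
stageOf μ []      j = μ
stageOf {k = suc k} μ (κ ∷ C) j with suc k ≤? j
... | yes _ = μ
... | no  _ = stageOf κ C j

stageOf-top : ∀ {A : Set} {k} (μ : A) (C : Vec A k) j → k ≤ j → stageOf μ C j ≡ μ
stageOf-top μ []      j le = refl
stageOf-top {k = suc k} μ (κ ∷ C) j le with suc k ≤? j
... | yes _ = refl
... | no gt = contradiction le gt

stageOf-below : ∀ {A : Set} {k} (μ κ : A) (C : Vec A k) j → j ≤ k → stageOf μ (κ ∷ C) j ≡ stageOf κ C j
stageOf-below {k = k} μ κ C j le with suc k ≤? j
... | yes gt = contradiction le (ℕₚ.<⇒≱ gt)
... | no _   = refl

build : ∀ {A : Set} k → (ℕ → A) → Vec A k
build zero    κ = []
build (suc k) κ = κ k ∷ build k κ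

build-cong : ∀ {A : Set} k {κ κ′ : ℕ → A} → (∀ j → j < k → κ j ≡ κ′ j) → build k κ ≡ build k κ′
build-cong zero    eq = refl
build-cong (suc k) eq = cong₂ _∷_ (eq k ℕₚ.≤-refl) (build-cong k (λ j lt → eq j (ℕₚ.m<n⇒m<1+n lt)))

build-stageOf : ∀ {A : Set} {k} (μ : A) (C : Vec A k) → build k (stageOf μ C) ≡ C
build-stageOf μ []      = refl
build-stageOf {k = suc k} μ (κ ∷ C) = cong₂ _∷_
  (trans (stageOf-below μ κ C k ℕₚ.≤-refl) (stageOf-top κ C k ℕₚ.≤-refl))
  (trans (build-cong k (λ j lt → stageOf-below μ κ C j (ℕₚ.<⇒≤ lt))) (build-stageOf κ C))

stageOf-build : ∀ {A : Set} k (κ : ℕ → A) j → j ≤ k → stageOf (κ k) (build k κ) j ≡ κ j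
stageOf-build zero    κ zero _ = refl
stageOf-build (suc k) κ j le with ℕₚ.m≤n⇒m<n∨m≡n le
... | inj₂ refl = stageOf-top (κ (suc k)) (build (suc k) κ) (suc k) ℕₚ.≤-refl
... | inj₁ lt   = trans (stageOf-below (κ (suc k)) (κ k) (build k κ) j (ℕₚ.≤-pred lt)) (stageOf-build k κ j (ℕₚ.≤-pred lt))

build-All : ∀ {A : Set} {P : A → Set} k (κ : ℕ → A) → (∀ j → P (κ j)) → VAll.All P (build k κ)
build-All zero    κ h = []
build-All (suc k) κ h = h k ∷ build-All k κ h

module _ (R lam : ℕ → ℕ) {l : ℕ} where
  Chain-stages : ∀ {k} (μ : Vec ℕ l) (C : Vec (Vec ℕ l) k) → Chain R lam μ C →
                 stageOf μ C 0 ≡ Vec.replicate l 0 ×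
                 (∀ j → j < k → Agree (R j) lam (stageOf μ C j) × Strip (stageOf μ C (suc j)) (stageOf μ C j))
  Chain-stages μ []      eq = eq , λ _ ()
  Chain-stages {suc k} μ (κ ∷ C) ((A , s) , ch) with Chain-stages κ C ch
  ... | bot , steps = trans (stageOf-below μ κ C 0 z≤n) bot , at-stage
    where
    at-stage : ∀ j → j < suc k → Agree (R j) lam (stageOf μ (κ ∷ C) j) × Strip (stageOf μ (κ ∷ C) (suc j)) (stageOf μ (κ ∷ C) j)
    at-stage j (s≤s le) with ℕₚ.m≤n⇒m<n∨m≡n le
    ... | inj₁ lt = subst₂ (λ a b → Agree (R j) lam b × Strip a b)
            (sym (stageOf-below μ κ C (suc j) lt)) (sym (stageOf-below μ κ C j le)) (steps j lt)
    ... | inj₂ refl = subst₂ (λ a b → Agree (R j) lam b × Strip a b)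
            (sym (stageOf-top μ (κ ∷ C) (suc j) ℕₚ.≤-refl)) (sym (trans (stageOf-below μ κ C j ℕₚ.≤-refl) (stageOf-top κ C j ℕₚ.≤-refl))) (A , s)

  build-Chain : ∀ k (κ : ℕ → Vec ℕ l) → κ 0 ≡ Vec.replicate l 0 →
                (∀ j → j < k → Agree (R j) lam (κ j) × Strip (κ (suc j)) (κ j)) → Chain R lam (κ k) (build k κ)
  build-Chain zero    κ bot steps = bot
  build-Chain (suc k) κ bot steps = steps k ℕₚ.≤-refl , build-Chain k κ bot (λ j lt → steps j (ℕₚ.m<n⇒m<1+n lt))

-- Cells, labels and lexicographic order

nth : List ℕ → ℕ → ℕ
nth []       q       = 0
nth (x ∷ xs) zero    = x
nth (x ∷ xs) (suc q) = nth xs q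

nth-lookup : ∀ xs i → nth xs (toℕ i) ≡ List.lookup xs i
nth-lookup (x ∷ xs) zero    = refl
nth-lookup (x ∷ xs) (suc i) = nth-lookup xs i

nth-length : ∀ xs q → 0 < nth xs q → q < length xs
nth-length (x ∷ xs) zero    _  = s≤s z≤n
nth-length (x ∷ xs) (suc q) lt = s≤s (nth-length xs q lt)

nth-beyond : ∀ xs q → length xs ≤ q → nth xs q ≡ 0
nth-beyond []       q       _        = refl
nth-beyond (x ∷ xs) (suc q) (s≤s le) = nth-beyond xs q le

sum-take : ∀ xs q → sum (List.take (suc q) xs) ≡ sum (List.take q xs) + nth xs q
sum-take []       zero    = refl
sum-take []       (suc q) = refl
sum-take (x ∷ xs) zero    = ℕₚ.+-comm x 0
sum-take (x ∷ xs) (suc q) = trans (cong (λ s → x + s) (sum-take xs q)) (sym (ℕₚ.+-assoc x _ _))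

bits : ∀ {k} → Vec (Fin 2) k → List ℕ
bits v = map toℕ (Vec.toList v)

nth-bits : ∀ {k} (v : Vec (Fin 2) k) i → nth (bits v) (toℕ i) ≡ toℕ (Vec.lookup v i)
nth-bits (x ∷ v) zero    = refl
nth-bits (x ∷ v) (suc i) = nth-bits v i

bits≤1 : ∀ {k} (v : Vec (Fin 2) k) q → nth (bits v) q ≤ 1
bits≤1 []      q       = z≤n
bits≤1 (x ∷ v) zero    = Finₚ.toℕ≤pred[n] x
bits≤1 (x ∷ v) (suc q) = bits≤1 v q

module Cells (shp : List ℕ) where
  lam : ℕ → ℕ
  lam = nth shp

  cell-in : (c : Cell shp) → Cell.col c < lam (Cell.row c)
  cell-in (cell i j) = subst (toℕ j <_) (sym (nth-lookup shp i)) (Finₚ.toℕ<n j)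

  cellAt : ∀ q j → j < lam q → Cell shp
  cellAt q j lt = cell i (fromℕ< (subst (j <_) (trans (cong lam (sym (Finₚ.toℕ-fromℕ< q<))) (nth-lookup shp i)) lt))
    where
    q< : q < length shp
    q< = nth-length shp q (ℕₚ.≤-<-trans z≤n lt)
    i : Fin (length shp)
    i = fromℕ< q<

  row-cellAt : ∀ q j lt → Cell.row (cellAt q j lt) ≡ q
  row-cellAt q j lt = Finₚ.toℕ-fromℕ< _

  col-cellAt : ∀ q j lt → Cell.col (cellAt q j lt) ≡ j
  col-cellAt q j lt = Finₚ.toℕ-fromℕ< _

  cell-ext : ∀ {c d : Cell shp} → Cell.row c ≡ Cell.row d → Cell.col c ≡ Cell.col d → c ≡ d
  cell-ext {cell i j} {cell i′ j′} eq eq′ with Finₚ.toℕ-injective eq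
  ... | refl = cong (cell i) (Finₚ.toℕ-injective eq′)

module Lex {shp : List ℕ} (ω : Labeling shp) where
  open Cells shp public

  n : ℕ
  n = sum shp

  val : Vec ℕ n → Cell shp → ℕ
  val σ c = Vec.lookup σ (Inverse.to ω c)

  Adjacent : Cell shp → Cell shp → Set
  Adjacent c d = (Cell.row c ≡ Cell.row d × Cell.col d ≡ suc (Cell.col c))
               ⊎ (Cell.row d ≡ suc (Cell.row c) × Cell.col c ≡ Cell.col d)

  Less : Vec ℕ n → Cell shp → Cell shp → Set
  Less σ c d = val σ c < val σ d ⊎ (val σ c ≡ val σ d × label ω c < label ω d)

  -- These are the (P, ω)-partitions: values increase weakly, and strictly where the label
  -- decreases. As labels are distinct, this is lexicographic increase of value and label. The
  -- vector σ lists the values by label.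
  Increasing : Vec ℕ n → Set
  Increasing σ = ∀ c d → Adjacent c d → Less σ c d

  less? : ∀ σ c d → Dec (Less σ c d)
  less? σ c d = (val σ c <? val σ d) ⊎-dec ((val σ c ℕₚ.≟ val σ d) ×-dec (label ω c <? label ω d))

  increasing? : ∀ σ → Dec (Increasing σ)
  increasing? σ = allCells? λ c → allCells? λ d →
    (((Cell.row c ℕₚ.≟ Cell.row d) ×-dec (Cell.col d ℕₚ.≟ suc (Cell.col c)))
      ⊎-dec ((Cell.row d ℕₚ.≟ suc (Cell.row c)) ×-dec (Cell.col c ℕₚ.≟ Cell.col d))) →-dec less? σ c d

  entryAt : Vec ℕ n → ℕ → ℕ → ℕ
  entryAt σ q j with j <? lam q
  ... | yes lt = val σ (cellAt q j lt)
  ... | no  _  = 0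

  entryAt-cellAt : ∀ σ q j (lt : j < lam q) → entryAt σ q j ≡ val σ (cellAt q j lt)
  entryAt-cellAt σ q j lt with j <? lam q
  ... | no gt   = contradiction lt gt
  ... | yes lt′ = cong (λ p → val σ (cellAt q j p)) (ℕₚ.<-irrelevant lt′ lt)

  entryAt-cell : ∀ σ c → entryAt σ (Cell.row c) (Cell.col c) ≡ val σ c
  entryAt-cell σ c = trans (entryAt-cellAt σ _ _ (cell-in c))
    (cong (val σ) (cell-ext (row-cellAt _ _ (cell-in c)) (col-cellAt _ _ (cell-in c))))

  fromEntries : (ℕ → ℕ → ℕ) → Vec ℕ n
  fromEntries s = Vec.tabulate (λ k → s (Cell.row (Inverse.from ω k)) (Cell.col (Inverse.from ω k)))

  val-fromEntries : ∀ s c → val (fromEntries s) c ≡ s (Cell.row c) (Cell.col c)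
  val-fromEntries s c = trans (Vecₚ.lookup∘tabulate _ (Inverse.to ω c))
    (cong (λ d → s (Cell.row d) (Cell.col d)) (Inverse.strictlyInverseʳ ω c))

  entryAt-fromEntries : ∀ s q j → j < lam q → entryAt (fromEntries s) q j ≡ s q j
  entryAt-fromEntries s q j lt = trans (entryAt-cellAt (fromEntries s) q j lt) (trans (val-fromEntries s (cellAt q j lt))
    (cong₂ s (row-cellAt q j lt) (col-cellAt q j lt)))

  fromEntries-entryAt : ∀ σ → fromEntries (entryAt σ) ≡ σ
  fromEntries-entryAt σ = trans (Vecₚ.tabulate-cong (λ k → trans (entryAt-cell σ (Inverse.from ω k))
    (cong (Vec.lookup σ) (Inverse.strictlyInverseˡ ω k)))) (Vecₚ.tabulate∘lookup σ)

  fromEntries-cong : ∀ {s s′} → (∀ q j → j < lam q → s q j ≡ s′ q j) → fromEntries s ≡ fromEntries s′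
  fromEntries-cong eq = Vecₚ.tabulate-cong (λ k → eq _ _ (cell-in (Inverse.from ω k)))

  label-distinct : ∀ {c d} → c ≢ d → label ω c ≢ label ω d
  label-distinct {c} {d} c≢d eq = c≢d (trans (sym (Inverse.strictlyInverseʳ ω c))
    (trans (cong (Inverse.from ω) (Finₚ.toℕ-injective eq)) (Inverse.strictlyInverseʳ ω d)))

  -- A bit recording a label descent is the strictness required of the values.
  Less⇔bit : ∀ σ c d b → b ≤ 1 → (label ω d < label ω c → b ≡ 1) → (b ≡ 1 → label ω d < label ω c) → c ≢ d →
             (Less σ c d → val σ c + b ≤ val σ d) × (val σ c + b ≤ val σ d → Less σ c d)
  Less⇔bit σ c d zero _ f g c≢d =
    (λ { (inj₁ lt) → ℕₚ.≤-trans (ℕₚ.≤-reflexive (ℕₚ.+-identityʳ _)) (ℕₚ.<⇒≤ lt)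
       ; (inj₂ (eq , _)) → ℕₚ.≤-reflexive (trans (ℕₚ.+-identityʳ _) eq) }) ,
    (λ le → close (ℕₚ.m≤n⇒m<n∨m≡n (ℕₚ.≤-trans (ℕₚ.≤-reflexive (sym (ℕₚ.+-identityʳ _))) le)))
    where
    close : val σ c < val σ d ⊎ val σ c ≡ val σ d → Less σ c d
    close (inj₁ lt) = inj₁ lt
    close (inj₂ eq) with ℕₚ.<-cmp (label ω c) (label ω d)
    ... | tri< lt _ _ = inj₂ (eq , lt)
    ... | tri≈ _ e _  = contradiction e (label-distinct c≢d)
    ... | tri> _ _ gt = contradiction (f gt) λ ()
  Less⇔bit σ c d (suc zero) _ f g c≢d =
    (λ { (inj₁ lt) → ℕₚ.≤-trans (ℕₚ.≤-reflexive (ℕₚ.+-comm _ 1)) lt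
       ; (inj₂ (_ , lt)) → contradiction (g refl) (ℕₚ.<-asym lt) }) ,
    (λ le → inj₁ (ℕₚ.≤-trans (ℕₚ.≤-reflexive (ℕₚ.+-comm 1 _)) le))
  Less⇔bit σ c d (suc (suc _)) (s≤s ()) f g c≢d

module Correspondence {shp : List ℕ} (ε : Signature shp) (ω : Labeling shp) (compat : Compatible ε ω)
  (dec : ∀ q → nth shp (suc q) ≤ nth shp q) (l b m : ℕ) (long : length shp ≤ l) (bound : ∀ q → nth shp q < b)
  (R φ : ℕ → ℕ)
  (flag⇒complete : ∀ q k → 0 < nth shp q → φ q ≤ k → q < R k)
  (complete⇒flag : ∀ q k → q < R k → 0 < nth shp q × φ q ≤ k)
  (φ≤m : ∀ q → 0 < nth shp q → φ q ≤ m) (M : ℕ)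
  (corner : ∀ q → 0 < nth shp q → ∃ λ q′ → q ≤ q′ × nth shp q′ ≡ nth shp q × φ q′ ≡ φ q ×
            φ q′ + (Signature.F ε (nth shp q) + Signature.E ε (suc q′)) ≡ M + q′) where
  open Lex ω
  open Signature ε using (e; f)

  -- Rows and columns count from 0 here, the arguments of `Signature.E` and `Signature.F` from 1.
  E′ F′ : ℕ → ℕ
  E′ q = Signature.E ε (suc q)
  F′ j = Signature.F ε (suc j)

  open Tableaux lam dec m R φ flag⇒complete complete⇒flag φ≤m

  corner′ : ∀ q → 0 < lam q → ∃ λ q′ → q ≤ q′ × lam q′ ≡ lam q × φ q′ ≡ φ q × φ q′ + (F′ (pred (lam q)) + E′ q′) ≡ M + q′
  corner′ q lt with corner q lt
  ... | q′ , le , eq , eq′ , eq″ = q′ , le , eq , eq′ ,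
    trans (cong (λ p → φ q′ + (Signature.F ε p + E′ q′)) (suc-pred lt)) eq″
    where
    suc-pred : ∀ {p} → 0 < p → suc (pred p) ≡ p
    suc-pred {suc p} _ = refl

  open Shift (nth (bits e)) (nth (bits f)) E′ F′ refl refl (sum-take (bits e)) (sum-take (bits f)) (bits≤1 e) M corner′

  lam-≤-first : ∀ q → lam q ≤ firstPart shp
  lam-≤-first zero    = go shp
    where
    go : ∀ xs → nth xs 0 ≤ firstPart xs
    go []      = z≤n
    go (x ∷ _) = ℕₚ.≤-refl
  lam-≤-first (suc q) = ℕₚ.≤-trans (dec q) (lam-≤-first q)

  bit⇔ : ∀ {k} (v : Vec (Fin 2) k) i → (nth (bits v) (toℕ i) ≡ 1 → Vec.lookup v i ≡ suc zero) × (Vec.lookup v i ≡ suc zero → nth (bits v) (toℕ i) ≡ 1)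
  bit⇔ v i = (λ eq → Finₚ.toℕ-injective (trans (sym (nth-bits v i)) eq)) , (λ eq → trans (nth-bits v i) (cong toℕ eq))

  module _ (σ : Vec ℕ n) where
    columns⇔ : ∀ c d → Cell.row d ≡ suc (Cell.row c) → Cell.col c ≡ Cell.col d →
               (Less σ c d → val σ c + nth (bits e) (Cell.row c) ≤ val σ d) × (val σ c + nth (bits e) (Cell.row c) ≤ val σ d → Less σ c d)
    columns⇔ c d r cc = Less⇔bit σ c d (nth (bits e) (Cell.row c)) (bits≤1 e (Cell.row c))
        (λ lt → subst (λ q → nth (bits e) q ≡ 1) i≡ (proj₂ (bit⇔ e i) (Equivalence.to iff lt)))
        (λ eq → Equivalence.from iff (proj₁ (bit⇔ e i) (subst (λ q → nth (bits e) q ≡ 1) (sym i≡) eq)))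
        (λ { refl → ℕₚ.1+n≢n (sym r) })
      where
      small : ∀ L → suc (Cell.row c) < L → Cell.row c < L ∸ 1
      small (suc L) (s≤s lt) = lt
      row< : Cell.row c < length shp ∸ 1
      row< = small (length shp) (subst (_< length shp) r (Finₚ.toℕ<n (Cell.i d)))
      i : Fin (length shp ∸ 1)
      i = fromℕ< row<
      i≡ : toℕ i ≡ Cell.row c
      i≡ = Finₚ.toℕ-fromℕ< row<
      iff = Compatible.vertical compat i c d (sym i≡) (trans r (cong suc (sym i≡))) cc

    rows⇔ : ∀ c d → Cell.row c ≡ Cell.row d → Cell.col d ≡ suc (Cell.col c) →
            (Less σ c d → val σ c + nth (bits f) (Cell.col c) ≤ val σ d) × (val σ c + nth (bits f) (Cell.col c) ≤ val σ d → Less σ c d)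
    rows⇔ c d r cc = Less⇔bit σ c d (nth (bits f) (Cell.col c)) (bits≤1 f (Cell.col c))
        (λ lt → subst (λ q → nth (bits f) q ≡ 1) i≡ (proj₂ (bit⇔ f i) (Equivalence.to iff lt)))
        (λ eq → Equivalence.from iff (proj₁ (bit⇔ f i) (subst (λ q → nth (bits f) q ≡ 1) (sym i≡) eq)))
        (λ { refl → ℕₚ.1+n≢n (sym cc) })
      where
      small : ∀ L → suc (Cell.col c) < L → Cell.col c < L ∸ 1
      small (suc L) (s≤s lt) = lt
      col< : Cell.col c < firstPart shp ∸ 1
      col< = small (firstPart shp) (ℕₚ.<-≤-trans (subst (_< lam (Cell.row d)) cc (cell-in d)) (lam-≤-first (Cell.row d)))
      i : Fin (firstPart shp ∸ 1)
      i = fromℕ< col<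
      i≡ : toℕ i ≡ Cell.col c
      i≡ = Finₚ.toℕ-fromℕ< col<
      iff = Compatible.horizontal compat i c d r (sym i≡) (trans cc (cong suc (sym i≡)))

    increasing⇒partition : VAll.All (_< M) σ → Increasing σ → IsPartition (entryAt σ)
    increasing⇒partition σ<M inc = record
      { rows    = λ q j lt → let lt₁ = ℕₚ.<-trans (ℕₚ.n<1+n j) lt ; c = cellAt q j lt₁ ; d = cellAt q (suc j) lt
                                 r = trans (row-cellAt q j lt₁) (sym (row-cellAt q (suc j) lt))
                                 cc = trans (col-cellAt q (suc j) lt) (cong suc (sym (col-cellAt q j lt₁))) in
          subst₂ _≤_ (cong₂ _+_ (sym (entryAt-cellAt σ q j lt₁)) (cong (nth (bits f)) (col-cellAt q j lt₁))) (sym (entryAt-cellAt σ q (suc j) lt))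
            (proj₁ (rows⇔ c d r cc) (inc c d (inj₁ (r , cc))))
      ; columns = λ q j lt → let lt₁ = ℕₚ.<-≤-trans lt (dec q) ; c = cellAt q j lt₁ ; d = cellAt (suc q) j lt
                                 r = trans (row-cellAt (suc q) j lt) (cong suc (sym (row-cellAt q j lt₁)))
                                 cc = trans (col-cellAt q j lt₁) (sym (col-cellAt (suc q) j lt)) in
          subst₂ _≤_ (cong₂ _+_ (sym (entryAt-cellAt σ q j lt₁)) (cong (nth (bits e)) (row-cellAt q j lt₁))) (sym (entryAt-cellAt σ (suc q) j lt))
            (proj₁ (columns⇔ c d r cc) (inc c d (inj₂ (r , cc))))
      ; bounded = λ q j lt → subst (_< M) (sym (entryAt-cellAt σ q j lt)) (VAllₚ.lookup⁺ σ<M (Inverse.to ω (cellAt q j lt)))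
      }

    partition⇒increasing : IsPartition (entryAt σ) → Increasing σ
    partition⇒increasing S c d (inj₁ (r , cc)) = proj₂ (rows⇔ c d r cc)
      (subst₂ _≤_ (cong (λ v → v + nth (bits f) (Cell.col c)) (entryAt-cell σ c))
        (trans (cong₂ (entryAt σ) r (sym cc)) (entryAt-cell σ d))
        (IsPartition.rows S (Cell.row c) (Cell.col c) (subst₂ _<_ cc (cong lam (sym r)) (cell-in d))))
    partition⇒increasing S c d (inj₂ (r , cc)) = proj₂ (columns⇔ c d r cc)
      (subst₂ _≤_ (cong (λ v → v + nth (bits e) (Cell.row c)) (entryAt-cell σ c))
        (trans (cong₂ (entryAt σ) (sym r) cc) (entryAt-cell σ d))
        (IsPartition.columns S (Cell.row c) (Cell.col c) (subst₂ _<_ (sym cc) (cong lam r) (cell-in d))))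

    partition⇒bounded : IsPartition (entryAt σ) → VAll.All (_< M) σ
    partition⇒bounded S = VAllₚ.lookup⁻ (λ k → subst (_< M)
      (trans (entryAt-cell σ (Inverse.from ω k)) (cong (Vec.lookup σ) (Inverse.strictlyInverseˡ ω k)))
      (IsPartition.bounded S _ _ (cell-in (Inverse.from ω k))))

  μ : Vec ℕ l
  μ = full lam l

  lam-beyond : ∀ q → l ≤ q → lam q ≡ 0
  lam-beyond q le = nth-beyond shp q (ℕₚ.≤-trans long le)

  at-μ : ∀ q → at 0 μ q ≡ lam q
  at-μ q with q <? l
  ... | yes lt = at-full lam l q lt
  ... | no ge  = trans (at-beyond μ q (ℕₚ.≮⇒≥ ge)) (sym (lam-beyond q (ℕₚ.≮⇒≥ ge)))

  stages : Vec (Vec ℕ l) m → ℕ → ℕ → ℕ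
  stages C k q = at 0 (stageOf μ C k) q

  module _ (C : Vec (Vec ℕ l) m) (ch : Chain R lam μ C) where
    stages-isChain : IsChain (stages C)
    stages-isChain = record
      { bottom = λ q → trans (cong (λ v → at 0 v q) (proj₁ (Chain-stages R lam μ C ch))) (at-replicate-0 l q)
      ; ceiling    = λ q → trans (cong (λ v → at 0 v q) (stageOf-top μ C m ℕₚ.≤-refl)) (at-μ q)
      ; lower  = λ k q lt → proj₁ (Strip-at _ _ (proj₂ (proj₂ (Chain-stages R lam μ C ch) k lt)) q)
      ; upper  = λ k q lt → proj₂ (Strip-at _ _ (proj₂ (proj₂ (Chain-stages R lam μ C ch) k lt)) q)
      ; agree  = λ k q lt q<R → Agree-at (R k) lam (stageOf μ C k) (proj₁ (proj₂ (Chain-stages R lam μ C ch) k lt)) q q<R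
                   (ℕₚ.<-≤-trans (nth-length shp q (proj₁ (complete⇒flag q k q<R))) long)
      }

    stages-mono : ∀ k q → stages C k q ≤ stages C (suc k) q
    stages-mono k q with k <? m
    ... | yes lt = IsChain.upper stages-isChain k q lt
    ... | no ge  = ℕₚ.≤-reflexive (cong (λ v → at 0 v q) (trans (stageOf-top μ C k (ℕₚ.≮⇒≥ ge)) (sym (stageOf-top μ C (suc k) (ℕₚ.m≤n⇒m≤1+n (ℕₚ.≮⇒≥ ge))))))

  toPartition : Vec (Vec ℕ l) m → Vec ℕ n
  toPartition C = fromEntries (shift (tableau (stages C)))

  rowsAt : (ℕ → ℕ → ℕ) → ℕ → Vec ℕ l
  rowsAt κ k = Vec.tabulate (κ k ∘ toℕ)

  toChain : Vec ℕ n → Vec (Vec ℕ l) m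
  toChain σ = build m (rowsAt (chain (unshift (entryAt σ))))

  chain-cong : ∀ {t t′} → (∀ q j → j < lam q → t q j ≡ t′ q j) → ∀ k q → chain t k q ≡ chain t′ k q
  chain-cong {t} {t′} eq k q = #-cong (λ j → (j <? lam q) ×-dec (t q j ≤? k)) (λ j → (j <? lam q) ×-dec (t′ q j ≤? k)) (upTo (lam q))
    (λ _ (lt , le) → lt , ℕₚ.≤-trans (ℕₚ.≤-reflexive (sym (eq q _ lt))) le)
    (λ _ (lt , le) → lt , ℕₚ.≤-trans (ℕₚ.≤-reflexive (eq q _ lt)) le)

  tableau-cong : ∀ {κ κ′} → (∀ k q → k < m → κ k q ≡ κ′ k q) → ∀ q j → tableau κ q j ≡ tableau κ′ q j
  tableau-cong {κ} {κ′} eq q j = #-cong (λ k → κ k q ≤? j) (λ k → κ′ k q ≤? j) (upTo m)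
    (λ k∈ le → ℕₚ.≤-trans (ℕₚ.≤-reflexive (sym (eq _ q (∈ₚ.∈-upTo⁻ k∈)))) le)
    (λ k∈ le → ℕₚ.≤-trans (ℕₚ.≤-reflexive (eq _ q (∈ₚ.∈-upTo⁻ k∈))) le)

  toPartition-correct : ∀ C → Chain R lam μ C → toPartition C ∈ box M n × Increasing (toPartition C) × toChain (toPartition C) ≡ C
  toPartition-correct C ch =
    ∈-allVecs⁺ (VAll.map ∈ₚ.∈-upTo⁺ (partition⇒bounded (toPartition C) S)) , partition⇒increasing (toPartition C) S ,
    trans (build-cong m (λ k lt → at-ext _ _ (λ q q<l → trans (at-tabulate< l _ q q<l)
      (trans (chain-cong {unshift (entryAt (toPartition C))} {tableau (stages C)} (linked-unshift {tableau (stages C)} {entryAt (toPartition C)} L) k q) (chain-tableau (stages-mono C ch) (stages-isChain C ch) k q (ℕₚ.<⇒≤ lt))))))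
      (build-stageOf μ C)
    where
    T : IsTableau (tableau (stages C))
    T = tableau-isTableau (stages-mono C ch) (stages-isChain C ch)
    L : Linked (tableau (stages C)) (entryAt (toPartition C))
    L q j lt = trans (cong (λ v → v + suc q) (entryAt-fromEntries (shift (tableau (stages C))) q j lt)) (shift-linked T q j lt)
    S : IsPartition (entryAt (toPartition C))
    S = partition L T

  toChain-correct : ∀ σ → σ ∈ box M n → Increasing σ → toChain σ ∈ allVecs (box b l) m × Chain R lam μ (toChain σ) × toPartition (toChain σ) ≡ σ
  toChain-correct σ σ∈ inc =
    ∈-allVecs⁺ (build-All m K (λ k → ∈-allVecs⁺ (VAll.map ∈ₚ.∈-upTo⁺ (tabulate-All k)))) ,
    subst (λ v → Chain R lam v (toChain σ)) K-top (build-Chain R lam m K bot steps) ,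
    trans (fromEntries-cong (λ q j lt → trans
      (cong (λ v → (v + (F′ j + E′ q)) ∸ suc q) (trans (tableau-cong {stages (toChain σ)} {κ} (λ k q k<m → stages-K k q (ℕₚ.<⇒≤ k<m)) q j) (tableau-chain T q j lt)))
      (linked-shift {unshift (entryAt σ)} {entryAt σ} (unshift-linked S) q j lt))) (fromEntries-entryAt σ)
    where
    S : IsPartition (entryAt σ)
    S = increasing⇒partition σ (VAll.map ∈ₚ.∈-upTo⁻ (∈-allVecs⁻ σ∈)) inc
    T : IsTableau (unshift (entryAt σ))
    T = unshift-isTableau S
    κ : ℕ → ℕ → ℕ
    κ = chain (unshift (entryAt σ))
    K : ℕ → Vec ℕ l
    K = rowsAt κ
    KC : IsChain κ
    KC = chain-isChain T
    at-K : ∀ k q → at 0 (K k) q ≡ κ k q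
    at-K k q with q <? l
    ... | yes lt = at-tabulate< l (κ k) q lt
    ... | no ge  = trans (at-beyond (K k) q (ℕₚ.≮⇒≥ ge)) (sym (ℕₚ.n≤0⇒n≡0 (ℕₚ.≤-trans (chain-≤ T k q) (ℕₚ.≤-reflexive (lam-beyond q (ℕₚ.≮⇒≥ ge))))))
    tabulate-All : ∀ k → VAll.All (_< b) (K k)
    tabulate-All k = tabulate-All′ (λ i → ℕₚ.≤-<-trans (chain-≤ T k (toℕ i)) (bound (toℕ i)))
      where
      tabulate-All′ : ∀ {l} {g : Fin l → ℕ} → (∀ i → g i < b) → VAll.All (_< b) (Vec.tabulate g)
      tabulate-All′ {zero}  h = []
      tabulate-All′ {suc l} h = h zero ∷ tabulate-All′ (h ∘ suc)
    K-top : K m ≡ μ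
    K-top = at-ext (K m) μ (λ q _ → trans (at-K m q) (trans (IsChain.ceiling KC q) (sym (at-μ q))))
    bot : K 0 ≡ Vec.replicate l 0
    bot = at-ext (K 0) _ (λ q _ → trans (at-K 0 q) (trans (IsChain.bottom KC q) (sym (at-replicate-0 l q))))
    steps : ∀ j → j < m → Agree (R j) lam (K j) × Strip (K (suc j)) (K j)
    steps j lt = at-Agree (R j) lam (K j) (λ q q<R _ → trans (at-K j q) (IsChain.agree KC j q lt q<R)) ,
      at-Strip (K (suc j)) (K j) (λ q → subst₂ _≤_ (sym (at-K (suc j) (suc q))) (sym (at-K j q)) (IsChain.lower KC j q lt) ,
                                         subst₂ _≤_ (sym (at-K j q)) (sym (at-K (suc j) q)) (IsChain.upper KC j q lt))
    stages-K : ∀ k q → k ≤ m → stages (toChain σ) k q ≡ κ k q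
    stages-K k q le = trans (cong (λ v → at 0 v q) (trans (cong (λ v → stageOf v (toChain σ) k) (sym K-top)) (stageOf-build m K k le))) (at-K k q)

  chains≡partitions : # (Chain? R lam μ) (allVecs (box b l) m) ≡ # increasing? (box M n)
  chains≡partitions = #-bijection (Chain? R lam μ) increasing? (allVecs (box b l) m) (box M n) toPartition toChain
    (allVecs-distinct (box-distinct b l) m) (box-distinct M n)
    (λ {C} _ ch → toPartition-correct C ch) (λ {σ} σ∈ inc → toChain-correct σ σ∈ inc)

  -- Values below M′ are below M, so `partition-≥` applies and gives the cell (q , j) a value of at
  -- least F + E, hence at least M′.
  no-partitions : ∀ M′ q j → M′ ≤ M → j < lam q → M′ ≤ F′ j + E′ q → # increasing? (box M′ n) ≡ 0
  no-partitions M′ q j M′≤M lt le = #-zero increasing? (box M′ n) (λ {σ} σ∈ inc →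
    let σ<M′ = VAll.map ∈ₚ.∈-upTo⁻ (∈-allVecs⁻ σ∈) in
    ℕₚ.<⇒≱ (VAllₚ.lookup⁺ σ<M′ (Inverse.to ω (cellAt q j lt)))
      (ℕₚ.≤-trans le (ℕₚ.≤-trans (partition-≥ (increasing⇒partition σ (VAll.map (λ v< → ℕₚ.<-≤-trans v< M′≤M) σ<M′) inc) q j lt)
        (ℕₚ.≤-reflexive (entryAt-cellAt σ q j lt)))))

-- Standardization

push-down : ∀ {x shp} → Cell shp → Cell (x ∷ shp)
push-down (cell i j) = cell (suc i) j

module _ {N : ℕ} where
  filling : ∀ {shp} → (Cell shp → Fin N) → Filling N shp
  filling {[]}      g = []
  filling {x ∷ shp} g = Vec.tabulate (λ j → g (cell zero j)) ∷ filling (g ∘ push-down)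

  entry-filling : ∀ {shp} (g : Cell shp → Fin N) c → entry (filling g) c ≡ g c
  entry-filling {x ∷ shp} g (cell zero j)    = Vecₚ.lookup∘tabulate _ j
  entry-filling {x ∷ shp} g (cell (suc i) j) = entry-filling {shp} (g ∘ push-down) (cell i j)

  filling-ext : ∀ {shp} (T U : Filling N shp) → (∀ c → entry T c ≡ entry U c) → T ≡ U
  filling-ext []       []       h = refl
  filling-ext {x ∷ shp} (xs ∷ T) (ys ∷ U) h = cong₂ _∷_
    (trans (sym (Vecₚ.tabulate∘lookup xs)) (trans (Vecₚ.tabulate-cong (λ j → h (cell zero j))) (Vecₚ.tabulate∘lookup ys)))
    (filling-ext {shp} T U (λ c → h (push-down c)))

  ∈-allFillings : ∀ {shp} (T : Filling N shp) → T ∈ allFillings N shp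
  ∈-allFillings []       = here refl
  ∈-allFillings (xs ∷ T) = ∈ₚ.∈-cartesianProductWith⁺ _∷_ (∈-allVecs⁺ (VAll.universal ∈ₚ.∈-allFin xs)) (∈-allFillings T)

  allFillings-distinct : ∀ shp → Distinct (allFillings N shp)
  allFillings-distinct []        = [] ∷ []
  allFillings-distinct (x ∷ shp) = Distinctₚ.cartesianProductWith⁺ _∷_ (λ { refl → refl , refl })
    (allVecs-distinct (Distinctₚ.allFin⁺ N) x) (allFillings-distinct shp)

-- Names the function local to the definition of allSYT.
module Selector {A B : Set} {select : A → List B} {xs : List A} {ys : List B} (eq : concatMap select xs ≡ ys) where
  selector : A → List B
  selector = select

select : ∀ shp → Filling (sum shp) shp → List (SYT shp)
select shp = Selector.selector {xs = allFillings (sum shp) shp} {ys = allSYT shp} refl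

fillings-allSYT : ∀ shp → map SYT.filling (allSYT shp) ≡ filter isStandard? (allFillings (sum shp) shp)
fillings-allSYT shp = go (allFillings (sum shp) shp)
  where
  go : ∀ Ts → map SYT.filling (concatMap (select shp) Ts) ≡ filter isStandard? Ts
  go []       = refl
  go (T ∷ Ts) with isStandard? T
  ... | yes S = trans (cong (T ∷_) (go Ts)) (sym (Listₚ.filter-accept isStandard? S))
  ... | no ¬S = trans (go Ts) (sym (Listₚ.filter-reject isStandard? ¬S))

#-strict : {A : Set} {P Q : Pred A 0ℓ} (P? : Decidable P) (Q? : Decidable Q) (x : A) → ¬ P x → Q x → (∀ {y} → P y → Q y) →
           (ys : List A) → x ∈ ys → # P? ys < # Q? ys
#-strict P? Q? x ¬p q h (y ∷ ys) (here refl) with P? x | Q? x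
... | yes p | _    = contradiction p ¬p
... | no _ | no ¬q = contradiction q ¬q
... | no _ | yes _ = s≤s (#-mono P? Q? ys (λ _ → h))
#-strict P? Q? x ¬p q h (y ∷ ys) (there x∈) with P? y | Q? y
... | yes p | yes _  = s≤s (#-strict P? Q? x ¬p q h ys x∈)
... | yes p | no ¬q′ = contradiction (h p) ¬q′
... | no _  | yes _  = ℕₚ.m<n⇒m<1+n (#-strict P? Q? x ¬p q h ys x∈)
... | no _  | no _   = #-strict P? Q? x ¬p q h ys x∈

count-one : {A B : Set} {Q : Pred A 0ℓ} (Q? : Decidable Q) (f : A → B) (b : B) (xs : List A) → Distinct (map f xs) →
            (∀ {x} → x ∈ xs → Q x → f x ≡ b) → (∃ λ x → x ∈ xs × Q x) → # Q? xs ≡ 1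
count-one Q? f b (x ∷ xs) (x∉ ∷ d) h (y , y∈ , qy) with Q? x
... | yes q = cong suc (#-zero Q? xs (λ z∈ qz → All.lookup x∉ (∈ₚ.∈-map⁺ f z∈) (trans (h (here refl) q) (sym (h (there z∈) qz)))))
count-one Q? f b (x ∷ xs) (x∉ ∷ d) h (y , here refl , qy) | no ¬q = contradiction qy ¬q
count-one Q? f b (x ∷ xs) (x∉ ∷ d) h (y , there y∈ , qy)  | no ¬q = count-one Q? f b xs d (h ∘ there) (y , y∈ , qy)

injective⇒surjective : ∀ {n} (f : Fin n → Fin n) → Injective _≡_ _≡_ f → ∀ y → ∃ λ x → f x ≡ y
injective⇒surjective {suc n} f inj y with Finₚ.any? (λ x → f x Finₚ.≟ y)
... | yes p = p
... | no none = contradiction (Finₚ.injective⇒≤ {f = λ x → Fin.punchOut (λ eq → none (x , sym eq))}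
        (λ {x} {x′} eq → inj (Finₚ.punchOut-injective (λ e → none (x , sym e)) (λ e → none (x′ , sym e)) eq))) ℕₚ.1+n≰n

-- The comparison of labels is weak, so that for equal values its failure is a descent of labels;
-- between different cells it is strict all the same.
LexStep : ℕ → ℕ → ℕ → ℕ → Set
LexStep l v l′ v′ = v < v′ ⊎ (v ≡ v′ × l ≤ l′)

lexStep? : ∀ l v l′ v′ → Dec (LexStep l v l′ v′)
lexStep? l v l′ v′ = (v <? v′) ⊎-dec ((v ℕₚ.≟ v′) ×-dec (l ≤? l′))

LexStep-trans : ∀ {l v l′ v′ l″ v″} → LexStep l v l′ v′ → LexStep l′ v′ l″ v″ → LexStep l v l″ v″
LexStep-trans (inj₁ p)          (inj₁ q)          = inj₁ (ℕₚ.<-trans p q)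
LexStep-trans (inj₁ p)          (inj₂ (refl , _)) = inj₁ p
LexStep-trans (inj₂ (refl , _)) (inj₁ q)          = inj₁ q
LexStep-trans (inj₂ (refl , p)) (inj₂ (refl , q)) = inj₂ (refl , ℕₚ.≤-trans p q)

-- The values v, breaking ties by the labels ℓ, increase along the positions.
SortedBy : ∀ {k} → Vec ℕ k → Vec ℕ k → Set
SortedBy []           []           = ⊤
SortedBy (l ∷ [])     (v ∷ [])     = ⊤
SortedBy (l ∷ l′ ∷ ℓ) (v ∷ v′ ∷ w) = LexStep l v l′ v′ × SortedBy (l′ ∷ ℓ) (v′ ∷ w)

sortedBy? : ∀ {k} (ℓ v : Vec ℕ k) → Dec (SortedBy ℓ v)
sortedBy? []           []           = yes tt
sortedBy? (l ∷ [])     (v ∷ [])     = yes tt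
sortedBy? (l ∷ l′ ∷ ℓ) (v ∷ v′ ∷ w) = lexStep? l v l′ v′ ×-dec sortedBy? (l′ ∷ ℓ) (v′ ∷ w)

SortedBy-pairs : ∀ {k} (ℓ v : Vec ℕ k) → SortedBy ℓ v → ∀ i j → toℕ i < toℕ j →
                 LexStep (Vec.lookup ℓ i) (Vec.lookup v i) (Vec.lookup ℓ j) (Vec.lookup v j)
SortedBy-pairs (l ∷ l′ ∷ ℓ) (v ∷ v′ ∷ w) (s , S) zero    (suc zero)    _        = s
SortedBy-pairs (l ∷ l′ ∷ ℓ) (v ∷ v′ ∷ w) (s , S) zero    (suc (suc j)) _        =
  LexStep-trans s (SortedBy-pairs (l′ ∷ ℓ) (v′ ∷ w) S zero (suc j) (s≤s z≤n))
SortedBy-pairs (l ∷ l′ ∷ ℓ) (v ∷ v′ ∷ w) (s , S) (suc i) (suc j)       (s≤s lt) = SortedBy-pairs (l′ ∷ ℓ) (v′ ∷ w) S i j lt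

pairs-SortedBy : ∀ {k} (ℓ v : Vec ℕ k) → (∀ i j → toℕ i < toℕ j →
                 LexStep (Vec.lookup ℓ i) (Vec.lookup v i) (Vec.lookup ℓ j) (Vec.lookup v j)) → SortedBy ℓ v
pairs-SortedBy []           []           h = tt
pairs-SortedBy (l ∷ [])     (v ∷ [])     h = tt
pairs-SortedBy (l ∷ l′ ∷ ℓ) (v ∷ v′ ∷ w) h = h zero (suc zero) (s≤s z≤n) ,
  pairs-SortedBy (l′ ∷ ℓ) (v′ ∷ w) (λ i j lt → h (suc i) (suc j) (s≤s lt))

-- Each (P, ω)-partition is sorted by exactly one standard tableau.
module Standardization {shp : List ℕ} (ω : Labeling shp) (dec : ∀ q → nth shp (suc q) ≤ nth shp q) where
  open Lex ω

  labels : SYT shp → Vec ℕ n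
  labels T = Vec.tabulate (λ k → label ω (SYT.T⁻¹ T k))

  reading : SYT shp → Vec ℕ n → Vec ℕ n
  reading T σ = Vec.tabulate (λ k → val σ (SYT.T⁻¹ T k))

  unreading : SYT shp → Vec ℕ n → Vec ℕ n
  unreading T v = Vec.tabulate (λ k → Vec.lookup v (entry (SYT.filling T) (Inverse.from ω k)))

  module _ (T : SYT shp) where
    open SYT T using (T⁻¹) renaming (filling to T₀; isStandard to std)
    entry-T⁻¹ : ∀ k → entry T₀ (T⁻¹ k) ≡ k
    entry-T⁻¹ k = proj₂ (IsStandard.surjective std k)

    T⁻¹-entry : ∀ c → T⁻¹ (entry T₀ c) ≡ c
    T⁻¹-entry c = IsStandard.injective std (entry-T⁻¹ (entry T₀ c))

    reading-unreading : ∀ v → reading T (unreading T v) ≡ v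
    reading-unreading v = trans (Vecₚ.tabulate-cong (λ k → trans (Vecₚ.lookup∘tabulate _ (Inverse.to ω (T⁻¹ k)))
      (cong (Vec.lookup v) (trans (cong (entry T₀) (Inverse.strictlyInverseʳ ω (T⁻¹ k))) (entry-T⁻¹ k))))) (Vecₚ.tabulate∘lookup v)

    unreading-reading : ∀ σ → unreading T (reading T σ) ≡ σ
    unreading-reading σ = trans (Vecₚ.tabulate-cong (λ k → trans (Vecₚ.lookup∘tabulate _ (entry T₀ (Inverse.from ω k)))
      (trans (cong (val σ) (T⁻¹-entry (Inverse.from ω k))) (cong (Vec.lookup σ) (Inverse.strictlyInverseˡ ω k))))) (Vecₚ.tabulate∘lookup σ)

    box-reading : ∀ {M σ} → σ ∈ box M n → reading T σ ∈ box M n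
    box-reading σ∈ = ∈-allVecs⁺ (VAllₚ.tabulate⁺ (λ k → VAllₚ.lookup⁺ (∈-allVecs⁻ σ∈) (Inverse.to ω (T⁻¹ k))))

    box-unreading : ∀ {M v} → v ∈ box M n → unreading T v ∈ box M n
    box-unreading v∈ = ∈-allVecs⁺ (VAllₚ.tabulate⁺ (λ k → VAllₚ.lookup⁺ (∈-allVecs⁻ v∈) (entry T₀ (Inverse.from ω k))))

    sorted-count : ∀ M → # (λ σ → sortedBy? (labels T) (reading T σ)) (box M n) ≡ # (sortedBy? (labels T)) (box M n)
    sorted-count M = #-bijection _ (sortedBy? (labels T)) (box M n) (box M n) (reading T) (unreading T)
      (box-distinct M n) (box-distinct M n)
      (λ {σ} σ∈ s → box-reading σ∈ , s , unreading-reading σ)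
      (λ {v} v∈ s → box-unreading v∈ , subst (SortedBy (labels T)) (sym (reading-unreading v)) s , reading-unreading v)

  module _ (σ : Vec ℕ n) where
    less-trans : ∀ {c d e} → Less σ c d → Less σ d e → Less σ c e
    less-trans (inj₁ p)       (inj₁ q)       = inj₁ (ℕₚ.<-trans p q)
    less-trans (inj₁ p)       (inj₂ (e , _)) = inj₁ (ℕₚ.<-≤-trans p (ℕₚ.≤-reflexive e))
    less-trans (inj₂ (e , _)) (inj₁ q)       = inj₁ (ℕₚ.≤-<-trans (ℕₚ.≤-reflexive e) q)
    less-trans (inj₂ (e , p)) (inj₂ (e′ , q)) = inj₂ (trans e e′ , ℕₚ.<-trans p q)

    less-irrefl : ∀ {c} → ¬ Less σ c c
    less-irrefl (inj₁ p)       = ℕₚ.<-irrefl refl p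
    less-irrefl (inj₂ (_ , p)) = ℕₚ.<-irrefl refl p

    less-total : ∀ c d → c ≢ d → Less σ c d ⊎ Less σ d c
    less-total c d c≢d with ℕₚ.<-cmp (val σ c) (val σ d) | ℕₚ.<-cmp (label ω c) (label ω d)
    ... | tri< p _ _ | _          = inj₁ (inj₁ p)
    ... | tri> _ _ p | _          = inj₂ (inj₁ p)
    ... | tri≈ _ e _ | tri< p _ _ = inj₁ (inj₂ (e , p))
    ... | tri≈ _ e _ | tri> _ _ p = inj₂ (inj₂ (sym e , p))
    ... | tri≈ _ e _ | tri≈ _ p _ = contradiction p (label-distinct c≢d)

    less⇒step : ∀ {c d} → Less σ c d → LexStep (label ω c) (val σ c) (label ω d) (val σ d)
    less⇒step (inj₁ p)       = inj₁ p
    less⇒step (inj₂ (e , p)) = inj₂ (e , ℕₚ.<⇒≤ p)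

    step⇒less : ∀ {c d} → c ≢ d → LexStep (label ω c) (val σ c) (label ω d) (val σ d) → Less σ c d
    step⇒less c≢d (inj₁ p)       = inj₁ p
    step⇒less c≢d (inj₂ (e , p)) = inj₂ (e , ℕₚ.≤∧≢⇒< p (label-distinct c≢d))

    module _ (T : SYT shp) where
      open SYT T using (T⁻¹) renaming (filling to T₀; isStandard to std)
      sorted⇒less : SortedBy (labels T) (reading T σ) → ∀ c d → toℕ (entry T₀ c) < toℕ (entry T₀ d) → Less σ c d
      sorted⇒less S c d lt = step⇒less (λ { refl → ℕₚ.<-irrefl refl lt })
        (subst₂ (λ a b → LexStep (label ω a) (val σ a) (label ω b) (val σ b)) (T⁻¹-entry T c) (T⁻¹-entry T d)
          (subst₂ (λ (l , v) (l′ , v′) → LexStep l v l′ v′)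
            (cong₂ _,_ (Vecₚ.lookup∘tabulate _ (entry T₀ c)) (Vecₚ.lookup∘tabulate _ (entry T₀ c)))
            (cong₂ _,_ (Vecₚ.lookup∘tabulate _ (entry T₀ d)) (Vecₚ.lookup∘tabulate _ (entry T₀ d)))
            (SortedBy-pairs (labels T) (reading T σ) S (entry T₀ c) (entry T₀ d) lt)))

      sorted⇒increasing : SortedBy (labels T) (reading T σ) → Increasing σ
      sorted⇒increasing S c d (inj₁ (r , cc)) = sorted⇒less S c d (IsStandard.rows std c d r (ℕₚ.≤-reflexive (sym cc)))
      sorted⇒increasing S c d (inj₂ (r , cc)) = sorted⇒less S c d (IsStandard.columns std c d cc (ℕₚ.≤-reflexive (sym r)))

      less⇒sorted : (∀ c d → toℕ (entry T₀ c) < toℕ (entry T₀ d) → Less σ c d) → SortedBy (labels T) (reading T σ)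
      less⇒sorted h = pairs-SortedBy (labels T) (reading T σ) (λ i j lt →
        subst₂ (λ (l , v) (l′ , v′) → LexStep l v l′ v′)
          (cong₂ _,_ (sym (Vecₚ.lookup∘tabulate _ i)) (sym (Vecₚ.lookup∘tabulate _ i)))
          (cong₂ _,_ (sym (Vecₚ.lookup∘tabulate _ j)) (sym (Vecₚ.lookup∘tabulate _ j)))
          (less⇒step (h (T⁻¹ i) (T⁻¹ j) (subst₂ (λ a b → toℕ a < toℕ b) (sym (entry-T⁻¹ T i)) (sym (entry-T⁻¹ T j)) lt))))

    -- The place of c in the total order `Less σ`. Filled into the cells, the ranks form the
    -- standardization of σ.
    rank : Cell shp → ℕ
    rank c = # (λ k → less? σ (Inverse.from ω k) c) (allFin n)

    rank-mono : ∀ {c d} → Less σ c d → rank c < rank d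
    rank-mono {c} {d} c<d = #-strict (λ k → less? σ (Inverse.from ω k) c) (λ k → less? σ (Inverse.from ω k) d) (Inverse.to ω c)
      (λ lt → less-irrefl (subst (λ e → Less σ e c) (Inverse.strictlyInverseʳ ω c) lt))
      (subst (λ e → Less σ e d) (sym (Inverse.strictlyInverseʳ ω c)) c<d)
      (λ lt → less-trans lt c<d) (allFin n) (∈ₚ.∈-allFin _)

    rank< : ∀ c → rank c < n
    rank< c = ℕₚ.≤-trans (Listₚ.filter-notAll (λ k → less? σ (Inverse.from ω k) c) (allFin n)
      (Any.map (λ { refl lt → less-irrefl (subst (λ e → Less σ e c) (Inverse.strictlyInverseʳ ω c) lt) }) (∈ₚ.∈-allFin (Inverse.to ω c))))
      (ℕₚ.≤-reflexive (Listₚ.length-tabulate {n = n} id))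

    less⇐rank : ∀ c d → rank c < rank d → Less σ c d
    less⇐rank c d lt with c ≟ᶜ d
    ... | yes refl = contradiction lt (ℕₚ.<-irrefl refl)
    ... | no c≢d with less-total c d c≢d
    ...   | inj₁ p = p
    ...   | inj₂ p = contradiction (rank-mono p) (ℕₚ.<-asym lt)

    module _ (inc : Increasing σ) where
      less-along : ∀ d q j (lt : j < lam q) (lt′ : suc (j + d) < lam q) → Less σ (cellAt q j lt) (cellAt q (suc (j + d)) lt′)
      less-along zero q j lt lt′ = inc _ _ (inj₁ (trans (row-cellAt q j lt) (sym (row-cellAt q _ lt′)) ,
        trans (col-cellAt q _ lt′) (cong suc (trans (ℕₚ.+-identityʳ j) (sym (col-cellAt q j lt))))))
      less-along (suc d) q j lt lt′ = less-trans (less-along d q j lt lt″) (inc _ _ (inj₁ (trans (row-cellAt q _ lt″) (sym (row-cellAt q _ lt′)) ,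
        trans (col-cellAt q _ lt′) (cong suc (trans (ℕₚ.+-suc j d) (sym (col-cellAt q _ lt″)))))))
        where
        lt″ : suc (j + d) < lam q
        lt″ = ℕₚ.<-trans (ℕₚ.≤-reflexive (cong suc (sym (ℕₚ.+-suc j d)))) lt′

      less-down : ∀ d q j (lt : j < lam q) (lt′ : j < lam (suc (q + d))) → Less σ (cellAt q j lt) (cellAt (suc (q + d)) j lt′)
      less-down zero q j lt lt′ = inc _ _ (inj₂ (trans (row-cellAt _ j lt′) (cong suc (trans (ℕₚ.+-identityʳ q) (sym (row-cellAt q j lt)))) ,
        trans (col-cellAt q j lt) (sym (col-cellAt _ j lt′))))
      less-down (suc d) q j lt lt′ = less-trans (less-down d q j lt lt″) (inc _ _ (inj₂
        (trans (row-cellAt _ j lt′) (cong suc (trans (ℕₚ.+-suc q d) (sym (row-cellAt _ j lt″)))) ,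
         trans (col-cellAt _ j lt″) (sym (col-cellAt _ j lt′)))))
        where
        lt″ : j < lam (suc (q + d))
        lt″ = ℕₚ.<-≤-trans (subst (λ r → j < lam (suc r)) (ℕₚ.+-suc q d) lt′) (dec (suc (q + d)))

      at-cellAt : ∀ c → cellAt (Cell.row c) (Cell.col c) (cell-in c) ≡ c
      at-cellAt c = cell-ext (row-cellAt _ _ (cell-in c)) (col-cellAt _ _ (cell-in c))

      less-row : ∀ c d → Cell.row c ≡ Cell.row d → Cell.col c < Cell.col d → Less σ c d
      less-row c d r lt = subst₂ (Less σ) (at-cellAt c)
        (cell-ext (trans (row-cellAt _ _ lt′) r) (trans (col-cellAt _ _ lt′) gap))
        (less-along (Cell.col d ∸ suc (Cell.col c)) (Cell.row c) (Cell.col c) (cell-in c) lt′)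
        where
        gap : suc (Cell.col c + (Cell.col d ∸ suc (Cell.col c))) ≡ Cell.col d
        gap = ℕₚ.m+[n∸m]≡n lt
        lt′ : suc (Cell.col c + (Cell.col d ∸ suc (Cell.col c))) < lam (Cell.row c)
        lt′ = subst₂ (λ j q → j < lam q) (sym gap) (sym r) (cell-in d)

      less-column : ∀ c d → Cell.col c ≡ Cell.col d → Cell.row c < Cell.row d → Less σ c d
      less-column c d r lt = subst₂ (Less σ) (at-cellAt c)
        (cell-ext (trans (row-cellAt _ _ lt′) gap) (trans (col-cellAt _ _ lt′) r))
        (less-down (Cell.row d ∸ suc (Cell.row c)) (Cell.row c) (Cell.col c) (cell-in c) lt′)
        where
        gap : suc (Cell.row c + (Cell.row d ∸ suc (Cell.row c))) ≡ Cell.row d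
        gap = ℕₚ.m+[n∸m]≡n lt
        lt′ : Cell.col c < lam (suc (Cell.row c + (Cell.row d ∸ suc (Cell.row c))))
        lt′ = subst₂ (λ j q → j < lam q) (sym r) (sym gap) (cell-in d)

      ranking : Filling n shp
      ranking = filling (λ c → fromℕ< (rank< c))

      entry-ranking : ∀ c → toℕ (entry ranking c) ≡ rank c
      entry-ranking c = trans (cong toℕ (entry-filling _ c)) (Finₚ.toℕ-fromℕ< (rank< c))

      ranking-mono : ∀ {c d} → Less σ c d → toℕ (entry ranking c) < toℕ (entry ranking d)
      ranking-mono {c} {d} lt = subst₂ _<_ (sym (entry-ranking c)) (sym (entry-ranking d)) (rank-mono lt)

      ranking-injective : Injective _≡_ _≡_ (entry ranking)
      ranking-injective {c} {d} eq with c ≟ᶜ d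
      ... | yes c≡d = c≡d
      ... | no c≢d with less-total c d c≢d
      ...   | inj₁ p = contradiction (cong toℕ eq) (ℕₚ.<⇒≢ (ranking-mono p))
      ...   | inj₂ p = contradiction (cong toℕ (sym eq)) (ℕₚ.<⇒≢ (ranking-mono p))

      ranking-standard : IsStandard ranking
      ranking-standard = record
        { injective  = ranking-injective
        ; surjective = λ k → let k′ , eq = injective⇒surjective (entry ranking ∘ Inverse.from ω)
                                   (λ {a} {b} e → trans (sym (Inverse.strictlyInverseˡ ω a)) (trans (cong (Inverse.to ω) (ranking-injective e)) (Inverse.strictlyInverseˡ ω b))) k
                             in Inverse.from ω k′ , eq
        ; rows       = λ c d r lt → ranking-mono (less-row c d r lt)
        ; columns    = λ c d r lt → ranking-mono (less-column c d r lt)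
        }

    -- When T sorts σ, the cells less than c are those with smaller entries; as entries run through
    -- all numbers from 0, their number is the entry of c.
    sorted-unique : (T : SYT shp) → SortedBy (labels T) (reading T σ) → ∀ c → toℕ (entry (SYT.filling T) c) ≡ rank c
    sorted-unique T S c = sym (trans (#-bijection (λ k → less? σ (Inverse.from ω k) c) (λ k → toℕ k <? toℕ (entry T₀ c)) (allFin n) (allFin n)
        (λ k → entry T₀ (Inverse.from ω k)) (λ k → Inverse.to ω (T⁻¹ k)) (Distinctₚ.allFin⁺ n) (Distinctₚ.allFin⁺ n)
        (λ {k} _ lt → ∈ₚ.∈-allFin _ , smaller (Inverse.from ω k) lt , trans (cong (Inverse.to ω) (T⁻¹-entry T (Inverse.from ω k))) (Inverse.strictlyInverseˡ ω k))
        (λ {k} _ lt → ∈ₚ.∈-allFin _ ,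
          subst (λ d → Less σ d c) (sym (Inverse.strictlyInverseʳ ω (T⁻¹ k)))
            (sorted⇒less T S (T⁻¹ k) c (subst (λ e → toℕ e < toℕ (entry T₀ c)) (sym (entry-T⁻¹ T k)) lt)) ,
          trans (cong (entry T₀) (Inverse.strictlyInverseʳ ω (T⁻¹ k))) (entry-T⁻¹ T k)))
        (count-below n (toℕ (entry T₀ c)) (ℕₚ.<⇒≤ (Finₚ.toℕ<n (entry T₀ c)))))
      where
      open SYT T using (T⁻¹) renaming (filling to T₀)
      smaller : ∀ d → Less σ d c → toℕ (entry T₀ d) < toℕ (entry T₀ c)
      smaller d lt with ℕₚ.<-cmp (toℕ (entry T₀ d)) (toℕ (entry T₀ c))
      ... | tri< p _ _ = p
      ... | tri≈ _ e _ = contradiction (subst (λ d → Less σ d c) (IsStandard.injective (SYT.isStandard T) (Finₚ.toℕ-injective e)) lt) less-irrefl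
      ... | tri> _ _ p = contradiction (less-trans lt (sorted⇒less T S c d p)) less-irrefl
      count-below : ∀ n m → m ≤ n → # (λ (k : Fin n) → toℕ k <? m) (allFin n) ≡ m
      count-below zero    zero    _ = refl
      count-below (suc n) zero    _ = #-zero (λ (k : Fin (suc n)) → toℕ k <? 0) (allFin (suc n)) (λ _ ())
      count-below (suc n) (suc m) (s≤s m≤n) = cong suc (trans
        (cong (# (λ (k : Fin (suc n)) → toℕ k <? suc m)) (sym (Listₚ.map-tabulate {n = n} id suc)))
        (trans (#-map (λ (k : Fin (suc n)) → toℕ k <? suc m) suc (allFin n))
          (trans (#-cong (λ k → suc (toℕ k) <? suc m) (λ k → toℕ k <? m) (allFin n) (λ _ → ℕₚ.≤-pred) (λ _ → s≤s))
            (count-below n m m≤n))))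

    standardizations : + # (λ T → sortedBy? (labels T) (reading T σ)) (allSYT shp) ≡ 𝟙 (increasing? σ)
    standardizations = decide (increasing? σ)
      where
      exists : (inc : Increasing σ) → ∃ λ T → T ∈ allSYT shp × SortedBy (labels T) (reading T σ)
      exists inc with ∈ₚ.∈-map⁻ SYT.filling (subst (ranking inc ∈_) (sym (fillings-allSYT shp))
                    (∈ₚ.∈-filter⁺ isStandard? (∈-allFillings (ranking inc)) (ranking-standard inc)))
      ... | T , T∈ , eq = T , T∈ , less⇒sorted T (λ c d lt → less⇐rank c d
              (subst₂ _<_ (trans (cong (λ U → toℕ (entry U c)) (sym eq)) (entry-ranking inc c))
                          (trans (cong (λ U → toℕ (entry U d)) (sym eq)) (entry-ranking inc d)) lt))
      decide : (d : Dec (Increasing σ)) → + # (λ T → sortedBy? (labels T) (reading T σ)) (allSYT shp) ≡ 𝟙 d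
      decide (no ¬inc) = cong +_ (#-zero (λ T → sortedBy? (labels T) (reading T σ)) (allSYT shp) (λ {T} _ S → ¬inc (sorted⇒increasing T S)))
      decide (yes inc) = cong +_ (count-one (λ T → sortedBy? (labels T) (reading T σ)) SYT.filling (ranking inc) (allSYT shp)
        (subst Distinct (sym (fillings-allSYT shp)) (Distinctₚ.filter⁺ isStandard? (allFillings-distinct shp)))
        (λ {T} _ S → filling-ext (SYT.filling T) (ranking inc) (λ c → Finₚ.toℕ-injective (trans (sorted-unique T S c) (sym (entry-ranking inc c)))))
        (exists inc))

  -- The fundamental lemma of (P, ω)-partitions, by counting the pairs of σ and T such that T sorts
  -- σ. Each (P, ω)-partition has one such T and other σ have none; for fixed T, `reading T` is a
  -- bijection onto the sorted words.
  partitions-∑ : ∀ M → + # increasing? (box M n) ≡ ∑ (allSYT shp) (λ T → + # (sortedBy? (labels T)) (box M n))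
  partitions-∑ M = begin
    + # increasing? (box M n)
      ≡⟨ ∑-𝟙 increasing? (box M n) ⟨
    ∑ (box M n) (λ σ → 𝟙 (increasing? σ))
      ≡⟨ ∑-cong (box M n) (λ σ → trans (sym (standardizations σ)) (sym (∑-𝟙 (λ T → sortedBy? (labels T) (reading T σ)) (allSYT shp)))) ⟩
    ∑ (box M n) (λ σ → ∑ (allSYT shp) (λ T → 𝟙 (sortedBy? (labels T) (reading T σ))))
      ≡⟨ ∑-swap (box M n) (allSYT shp) (λ σ T → 𝟙 (sortedBy? (labels T) (reading T σ))) ⟩
    ∑ (allSYT shp) (λ T → ∑ (box M n) (λ σ → 𝟙 (sortedBy? (labels T) (reading T σ))))
      ≡⟨ ∑-cong (allSYT shp) (λ T → trans (∑-𝟙 (λ σ → sortedBy? (labels T) (reading T σ)) (box M n)) (cong +_ (sorted-count T M))) ⟩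
    ∑ (allSYT shp) (λ T → + # (sortedBy? (labels T)) (box M n)) ∎
    where open ≡-Reasoning

-- Generating functions

-- The sum starts at 1: the argument of f will be a number of available values that includes the
-- current one.
psum : (ℕ → ℤ) → ℕ → ℤ
psum f zero    = 0ℤ
psum f (suc d) = psum f d ⊕ f (suc d)

∑-from : ∀ F M lo → ∑ (upTo M) (λ v → 𝟙 (lo ≤? v) ⊗ F (M ∸ v)) ≡ psum F (M ∸ lo)
∑-from F zero    lo = trans (∑-[] (λ v → 𝟙 (lo ≤? v) ⊗ F (0 ∸ v))) (cong (psum F) (sym (ℕₚ.0∸n≡0 lo)))
∑-from F (suc M) zero = begin
  ∑ (upTo (suc M)) (λ v → 𝟙 (0 ≤? v) ⊗ F (suc M ∸ v))
    ≡⟨ ∑-upTo M (λ v → 𝟙 (0 ≤? v) ⊗ F (suc M ∸ v)) ⟩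
  1ℤ ⊗ F (suc M) ⊕ ∑ (upTo M) (λ v → 𝟙 (0 ≤? suc v) ⊗ F (M ∸ v))
    ≡⟨ cong₂ _⊕_ (ℤₚ.*-identityˡ (F (suc M))) (∑-from F M 0) ⟩
  F (suc M) ⊕ psum F M
    ≡⟨ ℤₚ.+-comm (F (suc M)) (psum F M) ⟩
  psum F M ⊕ F (suc M) ∎
  where open ≡-Reasoning
∑-from F (suc M) (suc lo) = begin
  ∑ (upTo (suc M)) (λ v → 𝟙 (suc lo ≤? v) ⊗ F (suc M ∸ v))
    ≡⟨ ∑-upTo M (λ v → 𝟙 (suc lo ≤? v) ⊗ F (suc M ∸ v)) ⟩
  0ℤ ⊕ ∑ (upTo M) (λ v → 𝟙 (suc lo ≤? suc v) ⊗ F (M ∸ v))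
    ≡⟨ ℤₚ.+-identityˡ _ ⟩
  ∑ (upTo M) (λ v → 𝟙 (suc lo ≤? suc v) ⊗ F (M ∸ v))
    ≡⟨ ∑-cong (upTo M) (λ v → cong (_⊗ F (M ∸ v)) (𝟙-⇔ (suc lo ≤? suc v) (lo ≤? v) ℕₚ.≤-pred s≤s)) ⟩
  ∑ (upTo M) (λ v → 𝟙 (lo ≤? v) ⊗ F (M ∸ v))
    ≡⟨ ∑-from F M lo ⟩
  psum F (M ∸ lo) ∎
  where open ≡-Reasoning

-- The number of ways to continue a sorted sequence whose current label is l, if d
-- values (the current one included) remain available.
completions : ∀ {k} → ℕ → Vec ℕ k → ℕ → ℤ
completions l []       d = 1ℤ
completions l (l′ ∷ ℓ) d = psum (completions l′ ℓ) (if does (l ≤? l′) then d else pred d)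

-- If the label does not decrease, the next value may repeat v and all M - v values remain; at a
-- descent it must exceed v, and one value fewer remains.
sorted-completions : ∀ {k} M l v (ℓ : Vec ℕ k) →
                     ∑ (box M k) (λ w → 𝟙 (sortedBy? (l ∷ ℓ) (v ∷ w))) ≡ completions l ℓ (M ∸ v)
sorted-completions M l v [] = trans (∑-∷ [] [] (λ w → 𝟙 (sortedBy? (l ∷ []) (v ∷ w)))) (trans (cong (1ℤ ⊕_) (∑-[] (λ w → 𝟙 (sortedBy? (l ∷ []) (v ∷ w))))) refl)
sorted-completions {suc k} M l v (l′ ∷ ℓ) = begin
  ∑ (box M (suc k)) (λ w → 𝟙 (sortedBy? (l ∷ l′ ∷ ℓ) (v ∷ w)))
    ≡⟨ ∑-box M k (λ w → 𝟙 (sortedBy? (l ∷ l′ ∷ ℓ) (v ∷ w))) ⟩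
  ∑ (upTo M) (λ v′ → ∑ (box M k) (λ w → 𝟙 (lexStep? l v l′ v′ ×-dec sortedBy? (l′ ∷ ℓ) (v′ ∷ w))))
    ≡⟨ ∑-cong (upTo M) (λ v′ → trans (∑-cong (box M k) (λ w → 𝟙-× (lexStep? l v l′ v′) (sortedBy? (l′ ∷ ℓ) (v′ ∷ w))))
         (trans (∑-⊗ (box M k) (𝟙 (lexStep? l v l′ v′)) (λ w → 𝟙 (sortedBy? (l′ ∷ ℓ) (v′ ∷ w))))
           (cong (𝟙 (lexStep? l v l′ v′) ⊗_) (sorted-completions M l′ v′ ℓ)))) ⟩
  ∑ (upTo M) (λ v′ → 𝟙 (lexStep? l v l′ v′) ⊗ completions l′ ℓ (M ∸ v′))
    ≡⟨ by-label (l ≤? l′) ⟩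
  psum (completions l′ ℓ) (if does (l ≤? l′) then M ∸ v else pred (M ∸ v)) ∎
  where
  open ≡-Reasoning
  by-label : (d : Dec (l ≤ l′)) → ∑ (upTo M) (λ v′ → 𝟙 (lexStep? l v l′ v′) ⊗ completions l′ ℓ (M ∸ v′))
             ≡ psum (completions l′ ℓ) (if does d then M ∸ v else pred (M ∸ v))
  by-label (yes le) = trans (∑-cong (upTo M) (λ v′ → cong (_⊗ completions l′ ℓ (M ∸ v′))
    (𝟙-⇔ (lexStep? l v l′ v′) (v ≤? v′) (λ { (inj₁ lt) → ℕₚ.<⇒≤ lt ; (inj₂ (e , _)) → ℕₚ.≤-reflexive e })
      (λ v≤v′ → close (ℕₚ.m≤n⇒m<n∨m≡n v≤v′))))) (∑-from (completions l′ ℓ) M v)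
    where
    close : ∀ {v′} → v < v′ ⊎ v ≡ v′ → LexStep l v l′ v′
    close (inj₁ lt) = inj₁ lt
    close (inj₂ e)  = inj₂ (e , le)
  by-label (no gt) = trans (∑-cong (upTo M) (λ v′ → cong (_⊗ completions l′ ℓ (M ∸ v′))
    (𝟙-⇔ (lexStep? l v l′ v′) (suc v ≤? v′) (λ { (inj₁ lt) → lt ; (inj₂ (_ , le)) → contradiction le gt }) inj₁)))
    (trans (∑-from (completions l′ ℓ) M (suc v)) (cong (psum (completions l′ ℓ)) (sym (ℕₚ.pred[m∸n]≡m∸[1+n] M v))))

sorted-psum : ∀ {k} M l (ℓ : Vec ℕ k) → + # (sortedBy? (l ∷ ℓ)) (box M (suc k)) ≡ psum (completions l ℓ) M
sorted-psum {k} M l ℓ = begin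
  + # (sortedBy? (l ∷ ℓ)) (box M (suc k))
    ≡⟨ ∑-𝟙 (sortedBy? (l ∷ ℓ)) (box M (suc k)) ⟨
  ∑ (box M (suc k)) (λ w → 𝟙 (sortedBy? (l ∷ ℓ) w))
    ≡⟨ ∑-box M k (λ w → 𝟙 (sortedBy? (l ∷ ℓ) w)) ⟩
  ∑ (upTo M) (λ v → ∑ (box M k) (λ w → 𝟙 (sortedBy? (l ∷ ℓ) (v ∷ w))))
    ≡⟨ ∑-cong (upTo M) (λ v → trans (sorted-completions M l v ℓ) (sym (ℤₚ.*-identityˡ (completions l ℓ (M ∸ v))))) ⟩
  ∑ (upTo M) (λ v → 𝟙 (0 ≤? v) ⊗ completions l ℓ (M ∸ v))
    ≡⟨ ∑-from (completions l ℓ) M 0 ⟩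
  psum (completions l ℓ) M ∎
  where open ≡-Reasoning

descents : ∀ {k} → Vec ℕ k → ℕ
descents []           = 0
descents (l ∷ [])     = 0
descents (l ∷ l′ ∷ ℓ) = (if does (l ≤? l′) then 0 else 1) + descents (l′ ∷ ℓ)

infix 4 _≐_
_≐_ : Laurent → Laurent → Set
a ≐ b = ∀ k → a k ≡ b k

[1-t]-cong : ∀ {a b} → a ≐ b → ([1-t]· a) ≐ ([1-t]· b)
[1-t]-cong eq k = cong₂ _-_ (eq k) (eq (k - 1ℤ))

[1-t]^-cong : ∀ n {a b} → a ≐ b → ([1-t]^ n · a) ≐ ([1-t]^ n · b)
[1-t]^-cong zero    eq = eq
[1-t]^-cong (suc n) eq = [1-t]-cong ([1-t]^-cong n eq)

[1-t]^-suc : ∀ n a → ([1-t]^ suc n · a) ≐ ([1-t]^ n · ([1-t]· a))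
[1-t]^-suc zero    a k = refl
[1-t]^-suc (suc n) a = [1-t]-cong ([1-t]^-suc n a)

[1-t]^-shift : ∀ n a s → ([1-t]^ n · (λ k → a (k ⊕ s))) ≐ (λ k → ([1-t]^ n · a) (k ⊕ s))
[1-t]^-shift zero    a s k = refl
[1-t]^-shift (suc n) a s k = trans ([1-t]-cong ([1-t]^-shift n a s) k)
  (cong (λ j → ([1-t]^ n · a) (k ⊕ s) - ([1-t]^ n · a) j) (move k s))
  where
  move : ∀ k s → (k - 1ℤ) ⊕ s ≡ (k ⊕ s) - 1ℤ
  move = solve-∀

[1-t]^-∑ : ∀ {A : Set} n (xs : List A) (a : A → Laurent) →
           ([1-t]^ n · (λ k → ∑ xs (λ x → a x k))) ≐ (λ k → ∑ xs (λ x → ([1-t]^ n · a x) k))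
[1-t]^-∑ zero    xs a k = refl
[1-t]^-∑ (suc n) xs a k = trans ([1-t]-cong ([1-t]^-∑ n xs a) k)
  (sym (∑-minus xs (λ x → ([1-t]^ n · a x) k) (λ x → ([1-t]^ n · a x) (k - 1ℤ))))

-- Σ_{d ≥ 1} f(d) t^d
positive : (ℕ → ℤ) → Laurent
positive f (+ zero)   = 0ℤ
positive f (+ suc d)  = f (suc d)
positive f -[1+ _ ]   = 0ℤ

monomialAt : ℤ → Laurent
monomialAt m k = 𝟙 (k ℤ.≟ m)

cancel-psum : ∀ p x → (p ⊕ x) - p ≡ x
cancel-psum = solve-∀

[1-t]-psum : ∀ f → ([1-t]· powerSeries (psum f)) ≐ positive f
[1-t]-psum f (+ zero)  = refl
[1-t]-psum f (+ suc d) = cancel-psum (psum f d) (f (suc d))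
[1-t]-psum f -[1+ _ ]  = refl

[1-t]-positive-psum : ∀ f → ([1-t]· positive (psum f)) ≐ positive f
[1-t]-positive-psum f (+ zero)        = refl
[1-t]-positive-psum f (+ suc zero)    = cancel-psum 0ℤ (f 1)
[1-t]-positive-psum f (+ suc (suc d)) = cancel-psum (psum f (suc d)) (f (suc (suc d)))
[1-t]-positive-psum f -[1+ _ ]        = refl

[1-t]-positive-pred : ∀ f → ([1-t]· positive (psum f ∘ pred)) ≐ (λ k → positive f (k - 1ℤ))
[1-t]-positive-pred f (+ zero)              = refl
[1-t]-positive-pred f (+ suc zero)          = refl
[1-t]-positive-pred f (+ suc (suc zero))    = cancel-psum 0ℤ (f 1)
[1-t]-positive-pred f (+ suc (suc (suc d))) = cancel-psum (psum f (suc d)) (f (suc (suc d)))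
[1-t]-positive-pred f -[1+ _ ]              = refl

[1-t]-positive-one : ([1-t]· positive (λ _ → 1ℤ)) ≐ monomialAt 1ℤ
[1-t]-positive-one (+ zero)        = refl
[1-t]-positive-one (+ suc zero)    = refl
[1-t]-positive-one (+ suc (suc d)) = refl
[1-t]-positive-one -[1+ _ ]        = refl

-- The last letter contributes t / (1 - t). Each earlier letter brings a partial sum, hence a factor
-- 1 / (1 - t), and one more factor t if a descent follows it.
completions-series : ∀ {k} l (ℓ : Vec ℕ k) →
                     ([1-t]^ suc k · positive (completions l ℓ)) ≐ monomialAt (+ suc (descents (l ∷ ℓ)))
completions-series l [] = [1-t]-positive-one
completions-series {suc k} l (l′ ∷ ℓ) = by-label (l ≤? l′)
  where
  f = completions l′ ℓ
  restore : ∀ j → j ≡ (j - 1ℤ) ⊕ 1ℤ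
  restore = solve-∀
  by-label : (d : Dec (l ≤ l′)) → ([1-t]^ suc (suc k) · positive (λ e → psum f (if does d then e else pred e)))
             ≐ monomialAt (+ suc ((if does d then 0 else 1) + descents (l′ ∷ ℓ)))
  by-label (yes _) j = trans ([1-t]^-suc (suc k) (positive (psum f)) j)
    (trans ([1-t]^-cong (suc k) ([1-t]-positive-psum f) j) (completions-series l′ ℓ j))
  by-label (no _) j = trans ([1-t]^-suc (suc k) (positive (psum f ∘ pred)) j)
    (trans ([1-t]^-cong (suc k) ([1-t]-positive-pred f) j)
      (trans ([1-t]^-shift (suc k) (positive f) (ℤ.- 1ℤ) j)
        (trans (completions-series l′ ℓ (j - 1ℤ))
          (𝟙-⇔ (j - 1ℤ ℤ.≟ + suc (descents (l′ ∷ ℓ))) (j ℤ.≟ + suc (suc (descents (l′ ∷ ℓ))))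
            (λ e → trans (restore j) (trans (cong (_⊕ 1ℤ) e) (cong +_ (ℕₚ.+-comm (suc (descents (l′ ∷ ℓ))) 1))))
            (λ { refl → refl })))))

-- The choice of the first value is one more partial sum, hence one more factor 1 / (1 - t) than in
-- `completions-series`.
sorted-series : ∀ {k} (ℓ : Vec ℕ k) → 0 < k →
                ([1-t]^ suc k · powerSeries (λ M → + # (sortedBy? ℓ) (box M k))) ≐ monomialAt (+ suc (descents ℓ))
sorted-series {suc k} (l ∷ ℓ) _ j = trans ([1-t]^-suc (suc k) (powerSeries (λ M → + # (sortedBy? (l ∷ ℓ)) (box M (suc k)))) j)
  (trans ([1-t]^-cong (suc k) (λ i → trans ([1-t]-cong series i) ([1-t]-psum (completions l ℓ) i)) j) (completions-series l ℓ j))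
  where
  series : powerSeries (λ M → + # (sortedBy? (l ∷ ℓ)) (box M (suc k))) ≐ powerSeries (psum (completions l ℓ))
  series (+ M)    = sorted-psum M l ℓ
  series -[1+ _ ] = refl

∑-allFin : ∀ n (f : Fin (suc n) → ℤ) → ∑ (allFin (suc n)) f ≡ f zero ⊕ ∑ (allFin n) (f ∘ suc)
∑-allFin n f = trans (∑-∷ zero (List.tabulate suc) f) (cong (f zero ⊕_)
  (trans (cong (λ xs → ∑ xs f) (sym (Listₚ.map-tabulate {n = n} id suc))) (∑-map suc (allFin n) f)))

descent? : ∀ {n} (g : Fin n → ℕ) (kk : Fin n × Fin n) → Dec (toℕ (proj₂ kk) ≡ suc (toℕ (proj₁ kk)) × g (proj₂ kk) < g (proj₁ kk))
descent? g (k , k′) = (toℕ k′ ℕₚ.≟ suc (toℕ k)) ×-dec (g k′ <? g k)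

-- For each k only k′ = k + 1 survives, which turns the count over pairs in `des` into the recursion
-- of `descents`.
descents-∑ : ∀ n (g : Fin n → ℕ) →
             ∑ (allFin n) (λ k → ∑ (allFin n) (λ k′ → 𝟙 (descent? g (k , k′)))) ≡ + descents (Vec.tabulate g)
descents-∑ zero          g = ∑-[] _
descents-∑ (suc zero)    g = trans (∑-∷ zero [] _) (trans (cong₂ _⊕_ (trans (∑-∷ zero [] _) (cong (0ℤ ⊕_) (∑-[] _))) (∑-[] _)) refl)
descents-∑ (suc (suc n)) g = begin
  ∑ (allFin (suc (suc n))) (λ k → ∑ (allFin (suc (suc n))) (λ k′ → 𝟙 (descent? g (k , k′))))
    ≡⟨ ∑-allFin (suc n) (λ k → ∑ (allFin (suc (suc n))) (λ k′ → 𝟙 (descent? g (k , k′)))) ⟩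
  ∑ (allFin (suc (suc n))) (λ k′ → 𝟙 (descent? g (zero , k′)))
  ⊕ ∑ (allFin (suc n)) (λ k → ∑ (allFin (suc (suc n))) (λ k′ → 𝟙 (descent? g (suc k , k′))))
    ≡⟨ cong₂ _⊕_ first-row (trans (∑-cong (allFin (suc n)) later-row) (descents-∑ (suc n) (g ∘ suc))) ⟩
  + (if does (g zero ≤? g (suc zero)) then 0 else 1) ⊕ + descents (Vec.tabulate (g ∘ suc))
    ≡⟨⟩
  + descents (Vec.tabulate g) ∎
  where
  open ≡-Reasoning
  first-row : ∑ (allFin (suc (suc n))) (λ k′ → 𝟙 (descent? g (zero , k′))) ≡ + (if does (g zero ≤? g (suc zero)) then 0 else 1)
  first-row = begin
    ∑ (allFin (suc (suc n))) (λ k′ → 𝟙 (descent? g (zero , k′)))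
      ≡⟨ ∑-allFin (suc n) (λ k′ → 𝟙 (descent? g (zero , k′))) ⟩
    0ℤ ⊕ ∑ (allFin (suc n)) (λ k′ → 𝟙 (descent? g (zero , suc k′)))
      ≡⟨ cong (0ℤ ⊕_) (∑-allFin n (λ k′ → 𝟙 (descent? g (zero , suc k′)))) ⟩
    0ℤ ⊕ (𝟙 (descent? g (zero , suc zero)) ⊕ ∑ (allFin n) (λ k′ → 𝟙 (descent? g (zero , suc (suc k′)))))
      ≡⟨ cong (λ s → 0ℤ ⊕ (𝟙 (descent? g (zero , suc zero)) ⊕ s))
           (∑-zero (allFin n) (λ k′ → 𝟙-no (descent? g (zero , suc (suc k′))) λ { (() , _) })) ⟩
    0ℤ ⊕ (𝟙 (descent? g (zero , suc zero)) ⊕ 0ℤ)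
      ≡⟨ trans (ℤₚ.+-identityˡ _) (ℤₚ.+-identityʳ _) ⟩
    𝟙 (descent? g (zero , suc zero))
      ≡⟨ indicator (descent? g (zero , suc zero)) (g zero ≤? g (suc zero)) (λ (_ , lt) → ℕₚ.<⇒≱ lt) (λ gt → refl , ℕₚ.≰⇒> gt) ⟩
    + (if does (g zero ≤? g (suc zero)) then 0 else 1) ∎
    where
    indicator : ∀ {P Q : Set} (d : Dec P) (e : Dec Q) → (P → ¬ Q) → (¬ Q → P) → 𝟙 d ≡ + (if does e then 0 else 1)
    indicator d (yes q) f h = 𝟙-no d (λ p → f p q)
    indicator d (no ¬q) f h = 𝟙-yes d (h ¬q)
  later-row : ∀ k → ∑ (allFin (suc (suc n))) (λ k′ → 𝟙 (descent? g (suc k , k′)))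
              ≡ ∑ (allFin (suc n)) (λ k′ → 𝟙 (descent? (g ∘ suc) (k , k′)))
  later-row k = trans (∑-allFin (suc n) (λ k′ → 𝟙 (descent? g (suc k , k′)))) (trans (ℤₚ.+-identityˡ _)
    (∑-cong (allFin (suc n)) (λ k′ → 𝟙-⇔ (descent? g (suc k , suc k′)) (descent? (g ∘ suc) (k , k′))
      (λ (e , lt) → ℕₚ.suc-injective e , lt) (λ (e , lt) → cong suc e , lt))))

module _ {shp : List ℕ} (ω : Labeling shp) (dec : ∀ q → nth shp (suc q) ≤ nth shp q) where
  open Standardization ω dec

  des-descents : ∀ T → des T ω ≡ descents (labels T)
  des-descents T = ℤₚ.+-injective (begin
    + des T ω
      ≡⟨ ∑-𝟙 (descent? g) (cartesianProduct (allFin (sum shp)) (allFin (sum shp))) ⟨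
    ∑ (cartesianProduct (allFin (sum shp)) (allFin (sum shp))) (λ kk → 𝟙 (descent? g kk))
      ≡⟨ ∑-cartesian _,_ (allFin (sum shp)) (allFin (sum shp)) (λ kk → 𝟙 (descent? g kk)) ⟩
    ∑ (allFin (sum shp)) (λ k → ∑ (allFin (sum shp)) (λ k′ → 𝟙 (descent? g (k , k′))))
      ≡⟨ descents-∑ (sum shp) g ⟩
    + descents (labels T) ∎)
    where
    open ≡-Reasoning
    g : Fin (sum shp) → ℕ
    g k = label ω (SYT.T⁻¹ T k)

  -- Ω counts (P, ω)-partitions with values in {0, …, M - 1}.
  order-series : (N : ℕ) (a Ω : ℕ → ℤ) → 0 < sum shp →
                 (∀ M → Ω M ≡ ∑ (allSYT shp) (λ T → + # (sortedBy? (labels T)) (box M (sum shp)))) →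
                 (∀ j → a j ≡ Ω (suc N + j)) → (∀ M → M ≤ N → Ω M ≡ 0ℤ) →
                 powerSeries a ≗ sumOfPowers (map (λ T → + des T ω - + N) (allSYT shp)) /[1-t]^ suc (sum shp)
  order-series N a Ω pos Ω-∑ a-Ω Ω-0 k = begin
    ([1-t]^ suc n · powerSeries a) k
      ≡⟨ [1-t]^-cong (suc n) unfold k ⟩
    ([1-t]^ suc n · (λ k → ∑ (allSYT shp) (λ T → series T (k ⊕ + suc N)))) k
      ≡⟨ [1-t]^-∑ (suc n) (allSYT shp) (λ T k → series T (k ⊕ + suc N)) k ⟩
    ∑ (allSYT shp) (λ T → ([1-t]^ suc n · (λ k → series T (k ⊕ + suc N))) k)
      ≡⟨ ∑-cong (allSYT shp) (λ T → trans ([1-t]^-shift (suc n) (series T) (+ suc N) k) (trans (sorted-series (labels T) pos (k ⊕ + suc N))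
           (𝟙-⇔ (k ⊕ + suc N ℤ.≟ + suc (descents (labels T))) (k ℤ.≟ (+ des T ω - + N)) (to T) (from T)))) ⟩
    ∑ (allSYT shp) (λ T → 𝟙 (k ℤ.≟ (+ des T ω - + N)))
      ≡⟨ ∑-𝟙 (λ T → k ℤ.≟ (+ des T ω - + N)) (allSYT shp) ⟩
    + # (λ T → k ℤ.≟ (+ des T ω - + N)) (allSYT shp)
      ≡⟨ cong +_ (#-map (k ℤ.≟_) (λ T → + des T ω - + N) (allSYT shp)) ⟨
    sumOfPowers (map (λ T → + des T ω - + N) (allSYT shp)) k ∎
    where
    open ≡-Reasoning
    n : ℕ
    n = sum shp
    series : SYT shp → Laurent
    series T = powerSeries (λ M → + # (sortedBy? (labels T)) (box M n))
    shift-back : ∀ k N → k ≡ ((k ⊕ (1ℤ ⊕ N)) - 1ℤ) - N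
    shift-back = solve-∀
    shift-forth : ∀ d N → (d - N) ⊕ (1ℤ ⊕ N) ≡ 1ℤ ⊕ d
    shift-forth = solve-∀
    to : ∀ T → k ⊕ + suc N ≡ + suc (descents (labels T)) → k ≡ + des T ω - + N
    to T e = trans (shift-back k (+ N)) (trans (cong (λ z → (z - 1ℤ) - + N) e) (cong (λ z → + z - + N) (sym (des-descents T))))
    from : ∀ T → k ≡ + des T ω - + N → k ⊕ + suc N ≡ + suc (descents (labels T))
    from T e = trans (cong (_⊕ + suc N) e) (trans (shift-forth (+ des T ω) (+ N)) (cong (λ z → + suc z) (des-descents T)))
    sum-series : ∀ M → Ω M ≡ ∑ (allSYT shp) (λ T → series T (+ M))
    sum-series = Ω-∑
    -- Under the shift by N + 1 the coefficient of t^-(i + 1) comes from the index N - i. For i ≤ N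
    -- the value of Ω there vanishes, and for i > N the index is negative.
    unfold : powerSeries a ≐ (λ k → ∑ (allSYT shp) (λ T → series T (k ⊕ + suc N)))
    unfold (+ j) = trans (a-Ω j) (trans (cong Ω (ℕₚ.+-comm (suc N) j)) (sum-series (j + suc N)))
    unfold -[1+ i ] with N ℕₚ.<? i
    ... | yes N<i = sym (∑-zero (allSYT shp) (λ T → cong (series T) (trans (ℤₚ.⊖-< (s≤s N<i)) (cong (λ z → ℤ.- (+ z)) (gap N<i)))))
      where
      gap : N < i → suc i ∸ suc N ≡ suc (i ∸ suc N)
      gap (s≤s {n = i′} le) = ℕₚ.+-∸-assoc 1 le
    ... | no N≮i = sym (trans (∑-cong (allSYT shp) (λ T → cong (series T) (ℤₚ.⊖-≥ (s≤s (ℕₚ.≮⇒≥ N≮i)))))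
        (trans (sym (sum-series (N ∸ i))) (Ω-0 (N ∸ i) (ℕₚ.m∸n≤m N i))))

-- Decreasing lists, their conjugates and their runs

Decreasing : List ℕ → Set
Decreasing = AllPairs _≥_

sort-increasing : ∀ xs → AllPairs _≤_ (sort xs)
sort-increasing xs = Linked⇒AllPairs ℕₚ.≤-trans (sort-↗ xs)

reverse-decreasing : ∀ {xs} → AllPairs _≤_ xs → Decreasing (reverse xs)
reverse-decreasing []                    = []
reverse-decreasing {x ∷ xs} (x≤ ∷ inc) = subst Decreasing (sym (Listₚ.unfold-reverse x xs))
  (AllPairsₚ.++⁺ (reverse-decreasing inc) ([] ∷ []) (All.tabulate (λ y∈ → All.lookup x≤ (↭ₚ.∈-resp-↭ (↭ₚ.↭-reverse xs) y∈) ∷ [])))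

cge-nth : ∀ {L} → Decreasing L → ∀ p q → (suc p ≤ nth L q → q < cge (suc p) L) × (q < cge (suc p) L → suc p ≤ nth L q)
cge-nth {[]} [] p q = (λ ()) , (λ lt → contradiction (subst (q <_) (cge-none (suc p) [] (λ ())) lt) ℕₚ.n≮0)
cge-nth {x ∷ L} (x≥ ∷ dec) p q with suc p ≤? x
... | no gt = (λ le → contradiction (ℕₚ.≤-trans le (small q)) gt) ,
    (λ lt → contradiction (subst (q <_) (cge-none (suc p) (x ∷ L)
      (λ { (here refl) → ℕₚ.≰⇒> gt ; (there y∈) → ℕₚ.≤-<-trans (All.lookup x≥ y∈) (ℕₚ.≰⇒> gt) })) lt) ℕₚ.n≮0)
  where
  small : ∀ q → nth (x ∷ L) q ≤ x
  small zero    = ℕₚ.≤-refl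
  small (suc q) = go L x≥ q
    where
    go : ∀ L → All (x ≥_) L → ∀ q → nth L q ≤ x
    go []      _         q       = z≤n
    go (y ∷ L) (le ∷ _)  zero    = le
    go (y ∷ L) (_ ∷ les) (suc q) = go L les q
cge-nth {x ∷ L} (x≥ ∷ dec) p zero    | yes le = (λ _ → subst (0 <_) (sym (cge-yes L le)) (s≤s z≤n)) , (λ _ → le)
cge-nth {x ∷ L} (x≥ ∷ dec) p (suc q) | yes le =
  (λ l → subst (suc q <_) (sym (cge-yes L le)) (s≤s (proj₁ (cge-nth dec p q) l))) ,
  (λ lt → proj₂ (cge-nth dec p q) (ℕₚ.≤-pred (subst (suc q <_) (cge-yes L le) lt)))

nth-decreasing : ∀ {L} → Decreasing L → ∀ q → nth L (suc q) ≤ nth L q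
nth-decreasing {L} dec q = Sorts-antitone {nth L} {L} (λ p q → cge-nth dec p q) q

nth-threshold : ∀ {L} → AllPairs _≤_ L → ∀ k q → q < length L →
                (nth L q ≤ k → q < # (_≤? k) L) × (q < # (_≤? k) L → nth L q ≤ k)
nth-threshold {x ∷ L} (x≤ ∷ inc) k q q< with x ≤? k
... | no gt = (λ le → contradiction (ℕₚ.≤-trans (large q q<) le) gt) ,
    (λ lt → contradiction (subst (q <_) (trans (cong length (Listₚ.filter-reject (_≤? k) gt)) (#-zero (_≤? k) L (λ y∈ y≤k → gt (ℕₚ.≤-trans (All.lookup x≤ y∈) y≤k)))) lt) ℕₚ.n≮0)
  where
  large : ∀ q → q < suc (length L) → x ≤ nth (x ∷ L) q
  large zero    _        = ℕₚ.≤-refl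
  large (suc q) (s≤s lt) = go L x≤ q lt
    where
    go : ∀ L → All (x ≤_) L → ∀ q → q < length L → x ≤ nth L q
    go (y ∷ L) (le ∷ _)  zero    _        = le
    go (y ∷ L) (_ ∷ les) (suc q) (s≤s lt) = go L les q lt
nth-threshold {x ∷ L} (x≤ ∷ inc) k zero    _        | yes le = (λ _ → subst (0 <_) (sym (cong length (Listₚ.filter-accept (_≤? k) le))) (s≤s z≤n)) , (λ _ → le)
nth-threshold {x ∷ L} (x≤ ∷ inc) k (suc q) (s≤s q<) | yes le =
  (λ l → subst (suc q <_) (sym (cong length (Listₚ.filter-accept (_≤? k) le))) (s≤s (proj₁ (nth-threshold inc k q q<) l))) ,
  (λ lt → proj₂ (nth-threshold inc k q q<) (ℕₚ.≤-pred (subst (suc q <_) (cong length (Listₚ.filter-accept (_≤? k) le)) lt)))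

map-nth : ∀ {A : Set} (f : ℕ → A) (g : ℕ → A) xs ys → map f xs ≡ map g ys → ∀ q → q < length ys → f (nth xs q) ≡ g (nth ys q)
map-nth f g (x ∷ xs) (y ∷ ys) eq zero    _        = Listₚ.∷-injectiveˡ eq
map-nth f g (x ∷ xs) (y ∷ ys) eq (suc q) (s≤s lt) = map-nth f g xs ys (Listₚ.∷-injectiveʳ eq) q lt

#-split : ∀ x xs → # (x ℕₚ.≟_) xs + # (x <?_) xs ≡ cge x xs
#-split x []       = sym (cge-none x [] (λ ()))
#-split x (y ∷ xs) with x ≤? y
... | no x≰y = trans (cong₂ _+_ (cong length (Listₚ.filter-reject (x ℕₚ.≟_) (x≰y ∘ ℕₚ.≤-reflexive))) (cong length (Listₚ.filter-reject (x <?_) (x≰y ∘ ℕₚ.<⇒≤))))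
    (trans (#-split x xs) (sym (cge-no xs (ℕₚ.≰⇒> x≰y))))
... | yes x≤y with ℕₚ.m≤n⇒m<n∨m≡n x≤y
...   | inj₁ x<y = trans (cong₂ _+_ (cong length (Listₚ.filter-reject (x ℕₚ.≟_) (ℕₚ.<⇒≢ x<y))) (cong length (Listₚ.filter-accept (x <?_) x<y)))
    (trans (ℕₚ.+-suc _ _) (trans (cong suc (#-split x xs)) (sym (cge-yes xs x≤y))))
...   | inj₂ refl = trans (cong₂ _+_ (cong length (Listₚ.filter-accept (x ℕₚ.≟_) refl)) (cong length (Listₚ.filter-reject (x <?_) (ℕₚ.<-irrefl refl))))
    (trans (cong suc (#-split x xs)) (sym (cge-yes xs x≤y)))

-- There are `cge p L` rows of length at least p, and fewer of length above p because p occurs; so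
-- the last of them has length exactly p.
corner-row : ∀ {L} → Decreasing L → ∀ {p} → p ∈ L → 0 < p → suc (pred (cge p L)) ≡ cge p L × nth L (pred (cge p L)) ≡ p
corner-row {L} dec {suc p} p∈ _ = suc-pred , ℕₚ.≤-antisym
    (ℕₚ.≮⇒≥ (λ lt → ℕₚ.<⇒≱ (proj₁ (cge-nth dec (suc p) (pred (cge (suc p) L))) lt) (ℕₚ.≤-pred (subst (suc (cge (suc (suc p)) L) ≤_) (sym suc-pred) more))))
    (proj₂ (cge-nth dec p (pred (cge (suc p) L))) (ℕₚ.≤-reflexive suc-pred))
  where
  suc-pred : suc (pred (cge (suc p) L)) ≡ cge (suc p) L
  suc-pred with cge (suc p) L | cge-pos (suc p) p∈ ℕₚ.≤-refl
  ... | suc n | _ = refl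
  more : suc (cge (suc (suc p)) L) ≤ cge (suc p) L
  more = ℕₚ.≤-trans (ℕₚ.+-mono-≤ (#-pos (suc p ℕₚ.≟_) p∈ refl) (ℕₚ.≤-reflexive (cge-# (suc (suc p)) L)))
    (ℕₚ.≤-reflexive (#-split (suc p) L))

module Runs (L : List ℕ) where
  multiplicity : ℕ → ℕ
  multiplicity p = # (p ℕₚ.≟_) L

  module _ (P : List ℕ) (x : ℕ) (xs : List ℕ) (L≡ : L ≡ P ++ x ∷ xs) (P≥ : All (x ≤_) P) (x≥ : All (x ≥_) xs) where
    above-x : multiplicity x + # (x <?_) P ≡ cge x L
    above-x = trans (cong (λ n → multiplicity x + n) (sym (trans (cong (# (x <?_)) L≡) (trans (#-++ (x <?_) P (x ∷ xs))
      (trans (cong (λ n → # (x <?_) P + n) (#-zero (x <?_) (x ∷ xs) (λ { (here refl) → ℕₚ.<-irrefl refl ; (there y∈) → ℕₚ.≤⇒≯ (All.lookup x≥ y∈) })))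
        (ℕₚ.+-identityʳ _)))))) (#-split x L)

    next : ∀ {y} → y < x → (∀ {z} → z ∈ xs → z ≤ y) → # (y <?_) (P ++ x ∷ []) ≡ cge x L
    next {y} y<x xs≤y = sym (trans (cong (cge x) (trans L≡ (sym (Listₚ.++-assoc P (x ∷ []) xs)))) (trans (cge-++ x (P ++ x ∷ []) xs)
      (trans (cong (λ n → cge x (P ++ x ∷ []) + n) (cge-none x xs (λ z∈ → ℕₚ.≤-<-trans (xs≤y z∈) y<x))) (trans (ℕₚ.+-identityʳ _)
        (trans (cge-# x (P ++ x ∷ [])) (#-cong (x ≤?_) (y <?_) (P ++ x ∷ []) (λ _ → ℕₚ.<-≤-trans y<x) (λ z∈ _ → All.lookup (Allₚ.++⁺ P≥ (ℕₚ.≤-refl ∷ [])) z∈)))))))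

  -- P is the part of the list already read. Multiplicities refer to the whole list, and the run of
  -- x may have begun inside P, so only the entries of P above x belong to finished runs.
  runs-sum : ∀ P x xs → L ≡ P ++ x ∷ xs → All (x ≤_) P → Decreasing (x ∷ xs) → ∀ q → q < length (derun ℕₚ._≟_ (x ∷ xs)) →
             sum (map multiplicity (List.take (suc q) (derun ℕₚ._≟_ (x ∷ xs)))) + # (x <?_) P ≡ cge (nth (derun ℕₚ._≟_ (x ∷ xs)) q) L
  runs-sum P x [] L≡ P≥ (x≥ ∷ _) zero _ = trans (cong (λ n → n + # (x <?_) P) (ℕₚ.+-identityʳ _)) (above-x P x [] L≡ P≥ x≥)
  runs-sum P x [] L≡ P≥ (x≥ ∷ _) (suc q) (s≤s ())
  runs-sum P x (y ∷ ys) L≡ P≥ (x≥@(y≤x ∷ _) ∷ dec) q q< with x ℕₚ.≟ y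
  ... | yes refl rewrite Listₚ.derun-reject ℕₚ._≟_ {x} {x} ys refl =
      trans (cong (λ n → sum (map multiplicity (List.take (suc q) (derun ℕₚ._≟_ (x ∷ ys)))) + n)
        (sym (trans (#-++ (x <?_) P (x ∷ [])) (trans (cong (λ n → # (x <?_) P + n) (#-zero (x <?_) (x ∷ []) (λ { (here refl) → ℕₚ.<-irrefl refl }))) (ℕₚ.+-identityʳ _)))))
      (runs-sum (P ++ x ∷ []) x ys (trans L≡ (sym (Listₚ.++-assoc P (x ∷ []) (x ∷ ys)))) (Allₚ.++⁺ P≥ (ℕₚ.≤-refl ∷ [])) dec q q<)
  ... | no x≢y rewrite Listₚ.derun-accept ℕₚ._≟_ {x} {y} ys x≢y = by-index q q<
    where
    y<x : y < x
    y<x = ℕₚ.≤∧≢⇒< y≤x (x≢y ∘ sym)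
    by-index : ∀ q → q < suc (length (derun ℕₚ._≟_ (y ∷ ys))) →
               sum (map multiplicity (List.take (suc q) (x ∷ derun ℕₚ._≟_ (y ∷ ys)))) + # (x <?_) P ≡ cge (nth (x ∷ derun ℕₚ._≟_ (y ∷ ys)) q) L
    by-index zero _ = trans (cong (λ n → n + # (x <?_) P) (ℕₚ.+-identityʳ _)) (above-x P x (y ∷ ys) L≡ P≥ x≥)
    by-index (suc q) (s≤s q<) = begin
      multiplicity x + s + # (x <?_) P        ≡⟨ rearrange (multiplicity x) s (# (x <?_) P) ⟩
      s + (multiplicity x + # (x <?_) P)      ≡⟨ cong (λ n → s + n) (above-x P x (y ∷ ys) L≡ P≥ x≥) ⟩
      s + cge x L                             ≡⟨ cong (λ n → s + n) (next P x (y ∷ ys) L≡ P≥ x≥ y<x (λ { (here refl) → ℕₚ.≤-refl ; (there z∈) → All.lookup (AllPairs.head dec) z∈ })) ⟨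
      s + # (y <?_) (P ++ x ∷ [])             ≡⟨ runs-sum (P ++ x ∷ []) y ys (trans L≡ (sym (Listₚ.++-assoc P (x ∷ []) (y ∷ ys))))
                                                   (Allₚ.++⁺ (All.map (ℕₚ.≤-trans y≤x) P≥) (y≤x ∷ [])) dec q q< ⟩
      cge (nth (derun ℕₚ._≟_ (y ∷ ys)) q) L   ∎
      where
      open ≡-Reasoning
      s : ℕ
      s = sum (map multiplicity (List.take (suc q) (derun ℕₚ._≟_ (y ∷ ys))))
      rearrange : ∀ a b c → a + b + c ≡ b + (a + c)
      rearrange a b c = trans (cong (λ n → n + c) (ℕₚ.+-comm a b)) (ℕₚ.+-assoc b a c)

  -- The copies of x that already stand in P account for the initial `replicate` on the right.
  runs-map : ∀ {A : Set} (h : ℕ → A) P x xs → L ≡ P ++ x ∷ xs → All (x ≤_) P → Decreasing (x ∷ xs) →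
             concatMap (λ p → replicate (multiplicity p) (h p)) (derun ℕₚ._≟_ (x ∷ xs)) ≡ replicate (# (x ℕₚ.≟_) P) (h x) ++ map h (x ∷ xs)
  runs-map h P x [] L≡ P≥ _ = trans (Listₚ.++-identityʳ _) (replicate-snoc (multiplicity x) (# (x ℕₚ.≟_) P)
      (trans (cong (# (x ℕₚ.≟_)) L≡) (trans (#-++ (x ℕₚ.≟_) P (x ∷ [])) (trans (cong (λ n → # (x ℕₚ.≟_) P + n) (cong length (Listₚ.filter-accept (x ℕₚ.≟_) {xs = []} refl))) (ℕₚ.+-comm _ 1)))))
    where
    replicate-snoc : ∀ m n → m ≡ suc n → replicate m (h x) ≡ replicate n (h x) ++ h x ∷ []
    replicate-snoc _ zero    refl = refl
    replicate-snoc _ (suc n) refl = cong (h x ∷_) (replicate-snoc _ n refl)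
  runs-map h P x (y ∷ ys) L≡ P≥ (x≥@(y≤x ∷ _) ∷ dec) with x ℕₚ.≟ y
  ... | yes refl rewrite Listₚ.derun-reject ℕₚ._≟_ {x} {x} ys refl =
      trans (runs-map h (P ++ x ∷ []) x ys (trans L≡ (sym (Listₚ.++-assoc P (x ∷ []) (x ∷ ys)))) (Allₚ.++⁺ P≥ (ℕₚ.≤-refl ∷ [])) dec)
        (move (# (x ℕₚ.≟_) (P ++ x ∷ [])) (# (x ℕₚ.≟_) P) (trans (#-++ (x ℕₚ.≟_) P (x ∷ [])) (trans (cong (λ n → # (x ℕₚ.≟_) P + n) (cong length (Listₚ.filter-accept (x ℕₚ.≟_) {xs = []} refl))) (ℕₚ.+-comm _ 1))))
    where
    move : ∀ m n → m ≡ suc n → ∀ {zs} → replicate m (h x) ++ zs ≡ replicate n (h x) ++ h x ∷ zs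
    move _ zero    refl = refl
    move _ (suc n) refl = cong (h x ∷_) (move _ n refl)
  ... | no x≢y rewrite Listₚ.derun-accept ℕₚ._≟_ {x} {y} ys x≢y =
      trans (cong₂ _++_ (cong (λ n → replicate n (h x)) count-x)
        (trans (runs-map h (P ++ x ∷ []) y ys (trans L≡ (sym (Listₚ.++-assoc P (x ∷ []) (y ∷ ys)))) (Allₚ.++⁺ (All.map (ℕₚ.≤-trans y≤x) P≥) (y≤x ∷ [])) dec)
          (cong (λ n → replicate n (h y) ++ map h (y ∷ ys)) (#-zero (y ℕₚ.≟_) (P ++ x ∷ []) (λ z∈ → ℕₚ.<⇒≢ (ℕₚ.<-≤-trans y<x (All.lookup (Allₚ.++⁺ P≥ (ℕₚ.≤-refl ∷ [])) z∈)))))))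
        (move (# (x ℕₚ.≟_) P))
    where
    y<x : y < x
    y<x = ℕₚ.≤∧≢⇒< y≤x (x≢y ∘ sym)
    count-x : multiplicity x ≡ suc (# (x ℕₚ.≟_) P)
    count-x = trans (cong (# (x ℕₚ.≟_)) L≡) (trans (#-++ (x ℕₚ.≟_) P (x ∷ y ∷ ys)) (trans (cong (λ n → # (x ℕₚ.≟_) P + n)
      (trans (cong length (Listₚ.filter-accept (x ℕₚ.≟_) {xs = y ∷ ys} refl)) (cong suc (#-zero (x ℕₚ.≟_) (y ∷ ys)
        (λ { (here refl) → x≢y ; (there z∈) → ℕₚ.<⇒≢ (ℕₚ.≤-<-trans (All.lookup (AllPairs.head dec) z∈) y<x) ∘ sym })))))
      (ℕₚ.+-comm _ 1)))
    move : ∀ n {zs} → replicate (suc n) (h x) ++ zs ≡ replicate n (h x) ++ h x ∷ zs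
    move zero    = refl
    move (suc n) = cong (h x ∷_) (move n)

runs-cge : ∀ {L} → Decreasing L → ∀ q → Blocks.M L q ≡ cge (Blocks.part L q) L
runs-cge {x ∷ xs} dec q = trans (sym (ℕₚ.+-identityʳ _)) (trans (Runs.runs-sum (x ∷ xs) [] x xs refl [] dec (toℕ q) (Finₚ.toℕ<n q))
  (cong (λ p → cge p (x ∷ xs)) (nth-lookup (Blocks.parts (x ∷ xs)) q)))

module _ {shp : List ℕ} (dec : Decreasing shp) where
  open Blocks shp

  M-cge : ∀ q → M q ≡ cge (part q) shp
  M-cge = runs-cge dec

  signature-map : ∀ (ε : Signature shp) N → signatureFlag ε N ≡
                  map (λ p → N ⊕ 1ℤ - + Signature.F ε p ⊕ Signature.Ē ε (cge p shp)) shp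
  signature-map ε N = trans (Listₚ.concatMap-cong (λ q → cong (λ m → replicate (mult (part q)) (N ⊕ 1ℤ - + Signature.F ε (part q) ⊕ Signature.Ē ε m)) (M-cge q)) (allFin r))
    (trans (sym (Listₚ.concatMap-map (λ p → replicate (mult p) (h p)) part (allFin r)))
      (trans (cong (concatMap (λ p → replicate (mult p) (h p))) (trans (Listₚ.map-tabulate id part) (Listₚ.tabulate-lookup parts))) (by-cases shp refl)))
    where
    h : ℕ → ℤ
    h p = N ⊕ 1ℤ - + Signature.F ε p ⊕ Signature.Ē ε (cge p shp)
    by-cases : ∀ L → shp ≡ L → concatMap (λ p → replicate (mult p) (h p)) (derun ℕₚ._≟_ L) ≡ map h L
    by-cases []       eq   = refl
    by-cases (x ∷ xs) refl = Runs.runs-map shp h [] x xs refl [] dec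

  part∈ : ∀ q → part q ∈ shp
  part∈ q = ∈ₚ.∈-derun⁻ ℕₚ._≟_ shp (∈ₚ.∈-lookup q)

  maxFE-attained : ∀ (ε : Signature shp) → maxFE ε ≡ 0 ⊎ ∃ λ p → p ∈ shp × maxFE ε ≡ Signature.F ε p + Signature.E ε (cge p shp)
  maxFE-attained ε with Extrema.argmax-sel id 0 (map (λ q → Signature.F ε (part q) + Signature.E ε (M q)) (allFin r))
  ... | inj₁ eq = inj₁ eq
  ... | inj₂ m∈ with ∈ₚ.∈-map⁻ _ m∈
  ...   | q , _ , eq = inj₂ (part q , part∈ q , trans eq (cong (λ m → Signature.F ε (part q) + Signature.E ε m) (M-cge q)))

-- Shapes and flags of permutations

later-smaller? : ∀ {m} (g : Fin m → ℕ) i (j : Fin m) → Dec (toℕ i < toℕ j × g j < g i)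
later-smaller? g i j = (toℕ i <? toℕ j) ×-dec (g j <? g i)

#-filter : {A : Set} {P Q : Pred A 0ℓ} (P? : Decidable P) (Q? : Decidable Q) (xs : List A) →
           # Q? (filter P? xs) ≡ # (λ x → P? x ×-dec Q? x) xs
#-filter P? Q? []       = refl
#-filter P? Q? (x ∷ xs) with P? x
... | no _  = #-filter P? Q? xs
... | yes _ with Q? x
...   | yes _ = cong suc (#-filter P? Q? xs)
...   | no _  = #-filter P? Q? xs

tabulate-lehmer : ∀ {m} (g : Fin m → ℕ) → List.tabulate (λ i → # (later-smaller? g i) (allFin m)) ≡ lehmer (List.tabulate g)
tabulate-lehmer {zero}  g = refl
tabulate-lehmer {suc m} g = cong₂ _∷_ head-count
  (trans (Listₚ.tabulate-cong tail-count) (tabulate-lehmer (g ∘ suc)))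
  where
  suc-list : List.tabulate {n = m} suc ≡ map suc (allFin m)
  suc-list = sym (Listₚ.map-tabulate id suc)
  head-count : # (later-smaller? g zero) (allFin (suc m)) ≡ # (_<? g zero) (List.tabulate (g ∘ suc))
  head-count = begin
    # (later-smaller? g zero) (zero ∷ List.tabulate suc)
      ≡⟨ cong length (Listₚ.filter-reject (later-smaller? g zero) {x = zero} {xs = List.tabulate suc} (λ (lt , _) → ℕₚ.<-irrefl refl lt)) ⟩
    # (later-smaller? g zero) (List.tabulate suc)
      ≡⟨ cong (# (later-smaller? g zero)) suc-list ⟩
    # (later-smaller? g zero) (map suc (allFin m))
      ≡⟨ #-map (later-smaller? g zero) suc (allFin m) ⟩
    # (λ j → later-smaller? g zero (suc j)) (allFin m)
      ≡⟨ #-cong (λ j → later-smaller? g zero (suc j)) (λ j → g (suc j) <? g zero) (allFin m) (λ _ → proj₂) (λ _ lt → s≤s z≤n , lt) ⟩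
    # (λ j → g (suc j) <? g zero) (allFin m)
      ≡⟨ #-map (_<? g zero) (g ∘ suc) (allFin m) ⟨
    # (_<? g zero) (map (g ∘ suc) (allFin m))
      ≡⟨ cong (# (_<? g zero)) (Listₚ.map-tabulate id (g ∘ suc)) ⟩
    # (_<? g zero) (List.tabulate (g ∘ suc)) ∎
    where open ≡-Reasoning
  tail-count : ∀ i → # (later-smaller? g (suc i)) (allFin (suc m)) ≡ # (later-smaller? (g ∘ suc) i) (allFin m)
  tail-count i = begin
    # (later-smaller? g (suc i)) (zero ∷ List.tabulate suc)
      ≡⟨ cong length (Listₚ.filter-reject (later-smaller? g (suc i)) {x = zero} {xs = List.tabulate suc} (λ { (() , _) })) ⟩
    # (later-smaller? g (suc i)) (List.tabulate suc)
      ≡⟨ cong (# (later-smaller? g (suc i))) suc-list ⟩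
    # (later-smaller? g (suc i)) (map suc (allFin m))
      ≡⟨ #-map (later-smaller? g (suc i)) suc (allFin m) ⟩
    # (λ j → later-smaller? g (suc i) (suc j)) (allFin m)
      ≡⟨ #-cong (λ j → later-smaller? g (suc i) (suc j)) (later-smaller? (g ∘ suc) i) (allFin m)
           (λ _ (lt , lt′) → ℕₚ.≤-pred lt , lt′) (λ _ (lt , lt′) → s≤s lt , lt′) ⟩
    # (later-smaller? (g ∘ suc) i) (allFin m) ∎
    where open ≡-Reasoning

∈-drop-tabulate⁺ : ∀ {m} (f : Fin m → ℕ) k j → k ≤ toℕ j → f j ∈ List.drop k (List.tabulate f)
∈-drop-tabulate⁺ f zero    j       _        = ∈ₚ.∈-tabulate⁺ j
∈-drop-tabulate⁺ f (suc k) (suc j) (s≤s le) = ∈-drop-tabulate⁺ (f ∘ suc) k j le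

∈-drop-tabulate⁻ : ∀ {m} (f : Fin m → ℕ) k {y} → y ∈ List.drop k (List.tabulate f) → ∃ λ j → k ≤ toℕ j × y ≡ f j
∈-drop-tabulate⁻         f zero    y∈ with ∈ₚ.∈-tabulate⁻ y∈
... | j , eq = j , z≤n , eq
∈-drop-tabulate⁻ {suc m} f (suc k) y∈ with ∈-drop-tabulate⁻ (f ∘ suc) k y∈
... | j , le , eq = suc j , s≤s le , eq

mx-< : ∀ xs {b} → 0 < b → (∀ {y} → y ∈ xs → y < b) → mx xs < b
mx-< xs {suc b} _ below-b = s≤s (mx-lub xs (λ y∈ → ℕₚ.≤-pred (below-b y∈)))

module _ {m} (u : Permutation′ m) where
  tabulate-code : List.tabulate (code u) ≡ code-of u
  tabulate-code = trans (tabulate-lehmer (toℕ ∘ (u ⟨$⟩ʳ_))) (cong lehmer (sym (toList-tabulate (toℕ ∘ (u ⟨$⟩ʳ_)))))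

  map-code : map (code u) (allFin m) ≡ code-of u
  map-code = trans (Listₚ.map-tabulate id (code u)) tabulate-code

  last≤⇒ : ∀ i k → lastAtLeast u i ≤ k → 0 < code u i → mx (List.drop k (code-of u)) < code u i
  last≤⇒ i k last≤k pos = mx-< (List.drop k (code-of u)) pos
    (λ y∈ → ℕₚ.≰⇒> (bad (∈-drop-tabulate⁻ (code u) k (subst (λ c → _ ∈ List.drop k c) (sym tabulate-code) y∈))))
    where
    bad : ∀ {y} → (∃ λ j → k ≤ toℕ j × y ≡ code u j) → ¬ (code u i ≤ y)
    bad (j , k≤j , refl) le = ℕₚ.<⇒≱ (s≤s k≤j) (ℕₚ.≤-trans (All.lookup (Extrema.xs≤max 0 (map (suc ∘ toℕ) (filter (λ j → code u i ≤? code u j) (allFin m))))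
      (∈ₚ.∈-map⁺ (suc ∘ toℕ) (∈ₚ.∈-filter⁺ (λ j → code u i ≤? code u j) (∈ₚ.∈-allFin j) le))) last≤k)

  last≤⇐ : ∀ i k → mx (List.drop k (code-of u)) < code u i → lastAtLeast u i ≤ k
  last≤⇐ i k lt = Extrema.max≤v⁺ z≤n (All.tabulate (λ x∈ → bound (∈ₚ.∈-map⁻ (suc ∘ toℕ) x∈)))
    where
    bound : ∀ {x} → (∃ λ j → j ∈ filter (λ j → code u i ≤? code u j) (allFin m) × x ≡ suc (toℕ j)) → x ≤ k
    bound (j , j∈ , refl) = ℕₚ.≰⇒> (λ k≤j → ℕₚ.<⇒≱ lt (ℕₚ.≤-trans (proj₂ (∈ₚ.∈-filter⁻ (λ j → code u i ≤? code u j) {xs = allFin m} j∈))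
      (∈⇒≤mx (List.drop k (code-of u)) (subst (λ c → code u j ∈ List.drop k c) tabulate-code (∈-drop-tabulate⁺ (code u) k j k≤j)))))

  -- For a positive code entry at i, the flag entry of i is at most k exactly when no code entry
  -- from k on reaches it. These i are the ones that `weak` counts at k, so demanding `weak` rows
  -- means imposing the flag.
  flag-count : ∀ k → # (_≤? k) (flag u) ≡ weak (code-of u) k
  flag-count k = begin
    # (_≤? k) (flag u)
      ≡⟨ #-↭ (_≤? k) (sort-↭ (map (lastAtLeast u) (filter (λ i → 0 <? code u i) (allFin m)))) ⟩
    # (_≤? k) (map (lastAtLeast u) (filter (λ i → 0 <? code u i) (allFin m)))
      ≡⟨ #-map (_≤? k) (lastAtLeast u) (filter (λ i → 0 <? code u i) (allFin m)) ⟩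
    # (λ i → lastAtLeast u i ≤? k) (filter (λ i → 0 <? code u i) (allFin m))
      ≡⟨ #-filter (λ i → 0 <? code u i) (λ i → lastAtLeast u i ≤? k) (allFin m) ⟩
    # (λ i → (0 <? code u i) ×-dec (lastAtLeast u i ≤? k)) (allFin m)
      ≡⟨ #-cong (λ i → (0 <? code u i) ×-dec (lastAtLeast u i ≤? k)) (λ i → a ≤? code u i) (allFin m)
           (λ {i} _ (pos , le) → last≤⇒ i k le pos) (λ {i} _ lt → ℕₚ.≤-trans (s≤s z≤n) lt , last≤⇐ i k lt) ⟩
    # (λ i → a ≤? code u i) (allFin m)
      ≡⟨ #-map (a ≤?_) (code u) (allFin m) ⟨
    # (a ≤?_) (map (code u) (allFin m))
      ≡⟨ trans (cong (# (a ≤?_)) map-code) (sym (cge-# a (code-of u))) ⟩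
    weak (code-of u) k ∎
    where
    open ≡-Reasoning
    a : ℕ
    a = suc (mx (List.drop k (code-of u)))

  length-flag : length (flag u) ≡ cge 1 (code-of u)
  length-flag = trans (↭ₚ.↭-length (sort-↭ (map (lastAtLeast u) (filter (λ i → 0 <? code u i) (allFin m)))))
    (trans (Listₚ.length-map (lastAtLeast u) (filter (λ i → 0 <? code u i) (allFin m)))
      (trans (sym (#-map (0 <?_) (code u) (allFin m))) (trans (cong (# (0 <?_)) map-code) (sym (cge-# 1 (code-of u))))))

  shape-↭ : shape u ↭ filter (0 <?_) (code-of u)
  shape-↭ = subst (λ c → shape u ↭ filter (0 <?_) c) map-code
    (↭-trans (↭ₚ.↭-reverse (sort (filter (0 <?_) (map (code u) (allFin m))))) (sort-↭ (filter (0 <?_) (map (code u) (allFin m)))))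

  shape-decreasing : Decreasing (shape u)
  shape-decreasing = reverse-decreasing (sort-increasing (filter (0 <?_) (map (code u) (allFin m))))

  shape-positive : ∀ {p} → p ∈ shape u → 0 < p
  shape-positive p∈ = proj₂ (∈ₚ.∈-filter⁻ (0 <?_) {xs = code-of u} (↭ₚ.∈-resp-↭ shape-↭ p∈))

  cge-shape : ∀ p → cge (suc p) (shape u) ≡ cge (suc p) (code-of u)
  cge-shape p = trans (cge-↭ (suc p) shape-↭) (trans (cge-# (suc p) _) (trans (#-filter (0 <?_) (suc p ≤?_) (code-of u))
    (trans (#-cong (λ x → (0 <? x) ×-dec (suc p ≤? x)) (suc p ≤?_) (code-of u) (λ _ → proj₂) (λ _ le → ℕₚ.≤-trans (s≤s z≤n) le , le))
      (sym (cge-# (suc p) (code-of u))))))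

  length-shape : length (shape u) ≡ cge 1 (code-of u)
  length-shape = trans (↭ₚ.↭-length shape-↭) (sym (cge-# 1 (code-of u)))

  shape-sorts : Sorts (nth (shape u)) (code-of u)
  shape-sorts p q = (λ le → subst (q <_) (cge-shape p) (proj₁ (cge-nth shape-decreasing p q) le)) ,
    (λ lt → proj₂ (cge-nth shape-decreasing p q) (subst (q <_) (sym (cge-shape p)) lt))

  flag-threshold : ∀ k q → 0 < nth (shape u) q → (nth (flag u) q ≤ k → q < weak (code-of u) k) × (q < weak (code-of u) k → nth (flag u) q ≤ k)
  flag-threshold k q pos = (λ le → subst (q <_) (flag-count k) (proj₁ thr le)) , (λ lt → proj₂ thr (subst (q <_) (sym (flag-count k)) lt))
    where
    thr = nth-threshold (sort-increasing (map (lastAtLeast u) (filter (λ i → 0 <? code u i) (allFin m)))) k q (subst (q <_) (sym length-flag) (proj₁ (shape-sorts 0 q) pos))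

  weak-positive : ∀ k q → q < weak (code-of u) k → 0 < nth (shape u) q
  weak-positive k q lt = proj₂ (shape-sorts 0 q) (ℕₚ.<-≤-trans lt (cge-antitone (code-of u) (s≤s z≤n)))

-- The permutations 1^j × u

map-suc-lehmer : ∀ xs → lehmer (map suc xs) ≡ lehmer xs
map-suc-lehmer []       = refl
map-suc-lehmer (x ∷ xs) = cong₂ _∷_ (trans (#-map (_<? suc x) suc xs) (#-cong (λ y → suc y <? suc x) (_<? x) xs (λ _ → ℕₚ.≤-pred) (λ _ → s≤s)))
  (map-suc-lehmer xs)

code-lift : ∀ {m} (w : Permutation′ m) → code-of (lift₀ w) ≡ 0 ∷ code-of w
code-lift {m} w = trans (cong lehmer list) (cong₂ _∷_ (#-zero (_<? 0) (map suc (Vec.toList (line w))) (λ _ ())) (map-suc-lehmer (Vec.toList (line w))))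
  where
  list : Vec.toList (line (lift₀ w)) ≡ 0 ∷ map suc (Vec.toList (line w))
  list = cong (0 ∷_) (trans (cong Vec.toList (Vecₚ.tabulate-∘ suc (toℕ ∘ (w ⟨$⟩ʳ_)))) (Vecₚ.toList-map suc (line w)))

vexillary-lift : ∀ {m} (w : Permutation′ m) → Vexillary w → Vexillary (lift₀ w)
vexillary-lift w vex {zero}  {b}     {c}     {d}     a<b b<c c<d (() , _)
vexillary-lift w vex {suc a} {suc b} {suc c} {suc d} (s≤s a<b) (s≤s b<c) (s≤s c<d) (s≤s p , s≤s q , s≤s r) = vex a<b b<c c<d (p , q , r)

weak-lift : ∀ c k → weak (0 ∷ c) k ≡ weak c (k ∸ 1)
weak-lift c zero    = cge-no c (s≤s z≤n)
weak-lift c (suc k) = cge-no c (s≤s z≤n)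

vexillary-lifts : ∀ j {p} (u : Permutation′ (suc p)) → Vexillary u → Vexillary (1^ j × u)
vexillary-lifts zero    u vex = vex
vexillary-lifts (suc j) u vex = vexillary-lift (1^ j × u) (vexillary-lifts j u vex)

-- The j zeros in front of the code delay every stage by j and never count as complete rows.
weak-lifts : ∀ j {p} (u : Permutation′ (suc p)) k → weak (code-of (1^ j × u)) k ≡ weak (code-of u) (k ∸ j)
weak-lifts zero    u k = refl
weak-lifts (suc j) u k = trans (cong (λ c → weak c k) (code-lift (1^ j × u))) (trans (weak-lift (code-of (1^ j × u)) k)
  (trans (weak-lifts j u (k ∸ 1)) (cong (weak (code-of u)) (ℕₚ.∸-+-assoc k 1 j))))

sorts-lifts : ∀ j {p} (u : Permutation′ (suc p)) {lam} → Sorts lam (code-of u) → Sorts lam (code-of (1^ j × u))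
sorts-lifts zero    u sorts = sorts
sorts-lifts (suc j) u {lam} sorts p q = subst (λ n → (suc p ≤ lam q → q < n) × (q < n → suc p ≤ lam q))
  (sym (trans (cong (cge (suc p)) (code-lift (1^ j × u))) (cge-no (code-of (1^ j × u)) (s≤s z≤n)))) (sorts-lifts j u sorts p q)

-- A zero code at the first position means that u fixes 1, against indecomposability at i = 1. Hence
-- the shape is not empty.
indecomposable-moves-0 : ∀ {p} (u : Permutation′ (suc p)) → 1 ≤ p → Indecomposable u → 0 < code u zero
indecomposable-moves-0 {p} u 1≤p ind with code u zero in eq
... | suc _ = s≤s z≤n
... | zero  = ⊥-elim (ind 1 ℕₚ.≤-refl 1≤p (λ k → mk⇔
        (λ { (zero , _ , e) → subst (λ k → toℕ k < 1) e (s≤s (ℕₚ.≤-reflexive (cong toℕ fixed))) ; (suc _ , s≤s () , _) })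
        (λ k<1 → zero , s≤s z≤n , trans fixed (sym (Finₚ.toℕ-injective (ℕₚ.n<1⇒n≡0 k<1))))))
  where
  fixed : u ⟨$⟩ʳ zero ≡ zero
  fixed = by-cases ((u ⟨$⟩ʳ zero) Finₚ.≟ zero)
    where
    j : Fin (suc p)
    j = Inverse.from u zero
    u-j : u ⟨$⟩ʳ j ≡ zero
    u-j = Perm.inverseʳ u
    by-cases : Dec (u ⟨$⟩ʳ zero ≡ zero) → u ⟨$⟩ʳ zero ≡ zero
    by-cases (yes eq′) = eq′
    by-cases (no ne)   = contradiction (subst (1 ≤_) eq (#-pos (later-smaller? (toℕ ∘ (u ⟨$⟩ʳ_)) zero) (∈ₚ.∈-allFin j)
      ( ℕₚ.n≢0⇒n>0 (λ j≡0 → ne (trans (cong (u ⟨$⟩ʳ_) (sym (Finₚ.toℕ-injective {i = j} {zero} j≡0))) u-j))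
      , subst (_< toℕ (u ⟨$⟩ʳ zero)) (sym (cong toℕ u-j)) (ℕₚ.n≢0⇒n>0 (λ e → ne (Finₚ.toℕ-injective e)))))) λ ()

-- The generating function of the values ν

theorem7p10 : ∀ (p n : ℕ) → 1 ≤ p →
    (u : Permutation′ (suc p)) → Indecomposable u → Vexillary u →
    (lam : List ℕ) → shape u ≡ lam → sum lam + 1 ≡ n →
    (ε : Signature lam) (N : ℕ) →
    map +_ (flag u) ≡ signatureFlag ε (+ N) → N ≡ maxFE ε →
    (ω : Labeling lam) → Compatible ε ω →
    powerSeries (ν u) ≗ sumOfPowers (map (λ T → + des T ω - + N) (allSYT lam)) /[1-t]^ n
theorem7p10 p n 1≤p u ind vex lam refl refl ε N flag≡ N≡ ω compat =
  subst (λ n → powerSeries (ν u) ≗ sumOfPowers (map (λ T → + des T ω - + N) (allSYT lam)) /[1-t]^ n) (ℕₚ.+-comm 1 (sum lam))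
    (order-series ω lam-dec N (ν u) Ω sum-pos (Standardization.partitions-∑ ω lam-dec) ν-count Ω-vanishes)
  where
  parts : ℕ → ℕ
  parts = nth lam
  lam-dec : ∀ q → parts (suc q) ≤ parts q
  lam-dec = nth-decreasing (shape-decreasing u)
  open Lex ω using (increasing?)
  Ω : ℕ → ℤ
  Ω M = + # increasing? (box M (sum lam))

  first-pos : 0 < parts 0
  first-pos = proj₂ (shape-sorts u 0 0) (cge-pos 1 (subst (code u zero ∈_) (tabulate-code u) (∈ₚ.∈-tabulate⁺ {f = code u} zero)) (indecomposable-moves-0 u 1≤p ind))

  sum-pos : 0 < sum lam
  sum-pos = go lam first-pos
    where
    go : ∀ L → 0 < nth L 0 → 0 < sum L
    go (x ∷ L) lt = ℕₚ.<-≤-trans lt (ℕₚ.m≤m+n x (sum L))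

  φ : ℕ → ℕ
  φ = nth (flag u)

  -- Adding F + E + 1 clears the subtractions in the signature flag and in `Ē`. The number M_q is
  -- `cge (parts q) lam`, the number of rows at least as long as row q.
  flag-formula : ∀ q → 0 < parts q → φ q + (Signature.F ε (parts q) + Signature.E ε (cge (parts q) lam)) + 1 ≡ N + 1 + cge (parts q) lam
  flag-formula q pos = ℤₚ.+-injective (trans (cong (λ z → z ⊕ (+ F ⊕ + E) ⊕ 1ℤ) formula) (clear (+ N) (+ F) (+ E) (+ M)))
    where
    F E M : ℕ
    F = Signature.F ε (parts q)
    E = Signature.E ε (cge (parts q) lam)
    M = cge (parts q) lam
    formula : + φ q ≡ + N ⊕ 1ℤ - + F ⊕ (+ M - 1ℤ - + E)
    formula = map-nth +_ (λ p → + N ⊕ 1ℤ - + Signature.F ε p ⊕ Signature.Ē ε (cge p lam)) (flag u) lam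
      (trans flag≡ (signature-map (shape-decreasing u) ε (+ N))) q
      (subst (q <_) (sym (length-shape u)) (proj₁ (shape-sorts u 0 q) pos))
    clear : ∀ N F E M → (N ⊕ 1ℤ - F ⊕ (M - 1ℤ - E)) ⊕ (F ⊕ E) ⊕ 1ℤ ≡ N ⊕ 1ℤ ⊕ M
    clear = solve-∀

  module AtLevel (j : ℕ) where
    w : Permutation′ (suc (j + p))
    w = 1^ j × u
    c : List ℕ
    c = code-of w
    l : ℕ
    l = length c
    sorts : Sorts parts c
    sorts = sorts-lifts j u (shape-sorts u)
    l≡ : l ≡ suc (j + p)
    l≡ = trans (length-lehmer (Vec.toList (line w))) (length-line w)
    long : length lam ≤ l
    long = ℕₚ.≤-trans (ℕₚ.≤-reflexive (length-shape u)) (ℕₚ.≤-trans (cge-≤-length 1 (code-of u))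
      (ℕₚ.≤-trans (ℕₚ.≤-reflexive (trans (length-lehmer (Vec.toList (line u))) (length-line u)))
        (ℕₚ.≤-trans (s≤s (ℕₚ.m≤n+m p j)) (ℕₚ.≤-reflexive (sym l≡)))))
    bound : ∀ q → parts q < l
    bound = Sorts-bound sorts (subst (0 <_) (sym l≡) (s≤s z≤n)) (λ {x} x∈ → subst (x <_) (sym (length-lehmer (Vec.toList (line w)))) (lehmer-< (Vec.toList (line w)) x∈))
    φ⁺ : ℕ → ℕ
    φ⁺ q = φ q + j
    flag⇒complete : ∀ q k → 0 < parts q → φ⁺ q ≤ k → q < weak c k
    flag⇒complete q k pos le = subst (q <_) (sym (weak-lifts j u k)) (proj₁ (flag-threshold u (k ∸ j) q pos) (ℕₚ.m+n≤o⇒m≤o∸n (φ q) le))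
    complete⇒flag : ∀ q k → q < weak c k → 0 < parts q × φ⁺ q ≤ k
    complete⇒flag q k lt = pos , by-level (j ≤? k)
      where
      lt′ : q < weak (code-of u) (k ∸ j)
      lt′ = subst (q <_) (weak-lifts j u k) lt
      pos : 0 < parts q
      pos = weak-positive u (k ∸ j) q lt′
      by-level : Dec (j ≤ k) → φ⁺ q ≤ k
      by-level (yes j≤k) = ℕₚ.≤-trans (ℕₚ.+-monoˡ-≤ j (proj₂ (flag-threshold u (k ∸ j) q pos) lt′)) (ℕₚ.≤-reflexive (ℕₚ.m∸n+n≡m j≤k))
      -- Before stage j no row is demanded: k ∸ j = 0, and no code entry exceeds the maximum of all
      -- of them.
      by-level (no j≰k)  = contradiction (subst (q <_) (trans (cong (weak (code-of u)) (ℕₚ.m≤n⇒m∸n≡0 (ℕₚ.<⇒≤ (ℕₚ.≰⇒> j≰k))))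
        (cge-none (suc (mx (code-of u))) (code-of u) (λ x∈ → s≤s (∈⇒≤mx (code-of u) x∈)))) lt′) ℕₚ.n≮0
    φ≤l : ∀ q → 0 < parts q → φ⁺ q ≤ l
    φ≤l q pos = ℕₚ.≤-trans (ℕₚ.+-monoˡ-≤ j (proj₂ (flag-threshold u (suc p) q pos) all-complete))
      (ℕₚ.≤-reflexive (trans (cong suc (ℕₚ.+-comm p j)) (sym l≡)))
      where
      all-complete : q < weak (code-of u) (suc p)
      all-complete = subst (λ d → q < cge (suc (mx d)) (code-of u))
        (sym (Listₚ.drop-all (suc p) (code-of u) (ℕₚ.≤-reflexive (trans (length-lehmer (Vec.toList (line u))) (length-line u)))))
        (proj₁ (shape-sorts u 0 q) pos)
    corner : ∀ q → 0 < parts q → ∃ λ q′ → q ≤ q′ × parts q′ ≡ parts q × φ⁺ q′ ≡ φ⁺ q ×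
             φ⁺ q′ + (Signature.F ε (parts q) + Signature.E ε (suc q′)) ≡ suc N + j + q′
    -- The witness is the last row of length `parts q`. As suc q′ is M_q, the flag formula becomes
    -- the corner equation with N + 1 + j admissible values.
    corner q pos = q′ , q≤q′ , parts≡ , cong (λ n → n + j) φ≡ , (begin
      φ q′ + j + (F + Signature.E ε (suc q′))     ≡⟨ cong₂ (λ a b → a + j + (F + Signature.E ε b)) φ≡ suc-q′ ⟩
      φ q + j + (F + E)                           ≡⟨ shuffle (φ q) j (F + E) ⟩
      φ q + (F + E) + j                           ≡⟨ cong (λ n → n + j) cleared ⟩
      N + suc q′ + j                              ≡⟨ shuffle′ N q′ j ⟩
      suc N + j + q′                              ∎)
      where
      open ≡-Reasoning
      shuffle : ∀ a b c → a + b + c ≡ a + c + b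
      shuffle a b c = trans (ℕₚ.+-assoc a b c) (trans (cong (λ n → a + n) (ℕₚ.+-comm b c)) (sym (ℕₚ.+-assoc a c b)))
      shuffle′ : ∀ a b c → a + suc b + c ≡ suc a + c + b
      shuffle′ a b c = trans (cong (λ n → n + c) (ℕₚ.+-suc a b)) (cong suc (shuffle a b c))
      P F E q′ : ℕ
      P = parts q
      F = Signature.F ε P
      E = Signature.E ε (cge P lam)
      q′ = pred (cge P lam)
      P∈ : P ∈ lam
      P∈ = subst (_∈ lam) (trans (sym (nth-lookup lam (fromℕ< q<))) (cong parts (Finₚ.toℕ-fromℕ< q<))) (∈ₚ.∈-lookup (fromℕ< q<))
        where
        q< : q < length lam
        q< = nth-length lam q pos
      suc-q′ : suc q′ ≡ cge P lam
      suc-q′ = proj₁ (corner-row (shape-decreasing u) P∈ pos)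
      parts≡ : parts q′ ≡ P
      parts≡ = proj₂ (corner-row (shape-decreasing u) P∈ pos)
      q≤q′ : q ≤ q′
      q≤q′ = ℕₚ.≤-pred (subst (q <_) (sym suc-q′) (below P pos ℕₚ.≤-refl))
        where
        below : ∀ r → 0 < r → r ≤ parts q → q < cge r lam
        below (suc r) _ le = proj₁ (cge-nth (shape-decreasing u) r q) le
      -- Apart from φ, the flag formula depends on the row only through its length.
      φ≡ : φ q′ ≡ φ q
      φ≡ = ℕₚ.+-cancelʳ-≡ (F + E) _ _ (ℕₚ.+-cancelʳ-≡ 1 _ _ (trans (subst (λ r → φ q′ + (Signature.F ε r + Signature.E ε (cge r lam)) + 1 ≡ N + 1 + cge r lam) parts≡
        (flag-formula q′ (subst (0 <_) (sym parts≡) pos))) (sym (flag-formula q pos))))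
      cleared : φ q + (F + E) ≡ N + suc q′
      cleared = ℕₚ.+-cancelʳ-≡ 1 _ _ (trans (flag-formula q pos) (trans (cong (λ n → N + 1 + n) (sym suc-q′)) (shuffle N 1 (suc q′))))
    -- The size of w serves as the length of the vectors, as the bound for their entries, since code
    -- entries are smaller than it, and as the number of letters.
    module C = Correspondence ε ω compat lam-dec l l l long bound (weak c) φ⁺ flag⇒complete complete⇒flag φ≤l (suc N + j) corner

    count : ν u j ≡ Ω (suc N + j)
    count = begin
      ν u j
        ≡⟨ schubert-at-ones w (vexillary-lifts j u vex) sorts ⟩
      flagged c parts ones
        ≡⟨ flagged-indep c (weak c) ones (vexillary⇒vexcode (Vec.toList (line w)) (line-distinct w) (vexillary-line w (vexillary-lifts j u vex))) sorts
             (λ k → ℕₚ.≤-refl , weak≤strong c k) ⟨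
      Z l (weak c) parts ones l (full parts l)
        ≡⟨ Z-ones (weak c) parts l l (full parts l) ⟩
      + # (Chain? (weak c) parts (full parts l)) (allVecs (box l l) l)
        ≡⟨ cong +_ C.chains≡partitions ⟩
      Ω (suc N + j) ∎
      where open ≡-Reasoning

    vanishing : ∀ M q x → M ≤ suc N + j → x < parts q → M ≤ Signature.F ε (suc x) + Signature.E ε (suc q) → Ω M ≡ 0ℤ
    vanishing M q x M≤ x< M≤FE = cong +_ (C.no-partitions M q x M≤ x< M≤FE)

  ν-count : ∀ j → ν u j ≡ Ω (suc N + j)
  ν-count j = AtLevel.count j

  Ω-vanishes : ∀ M → M ≤ N → Ω M ≡ 0ℤ
  Ω-vanishes M M≤N = by-corner (maxFE-attained (shape-decreasing u) ε)
    where
    -- Ω does not depend on the level j, so level 0 provides the vanishing.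
    M≤1+N : M ≤ suc N + 0
    M≤1+N = ℕₚ.≤-trans M≤N (ℕₚ.≤-trans (ℕₚ.n≤1+n N) (ℕₚ.m≤m+n (suc N) 0))
    at-corner : ∀ x → suc x ∈ lam → maxFE ε ≡ Signature.F ε (suc x) + Signature.E ε (cge (suc x) lam) → Ω M ≡ 0ℤ
    at-corner x x∈ eq = AtLevel.vanishing 0 M (pred (cge (suc x) lam)) x M≤1+N
      (ℕₚ.≤-reflexive (sym (proj₂ last-row)))
      (ℕₚ.≤-trans M≤N (ℕₚ.≤-reflexive (trans N≡ (trans eq (cong (λ b → Signature.F ε (suc x) + Signature.E ε b) (sym (proj₁ last-row)))))))
      where
      last-row : suc (pred (cge (suc x) lam)) ≡ cge (suc x) lam × parts (pred (cge (suc x) lam)) ≡ suc x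
      last-row = corner-row (shape-decreasing u) x∈ (s≤s z≤n)
    by-corner : maxFE ε ≡ 0 ⊎ (∃ λ p → p ∈ lam × maxFE ε ≡ Signature.F ε p + Signature.E ε (cge p lam)) → Ω M ≡ 0ℤ
    -- A maximum of 0 leaves M = 0, and the cell (0 , 0) cannot take a value below 0.
    by-corner (inj₁ eq)                = AtLevel.vanishing 0 M 0 0 M≤1+N first-pos (ℕₚ.≤-trans M≤N (ℕₚ.≤-trans (ℕₚ.≤-reflexive (trans N≡ eq)) z≤n))
    by-corner (inj₂ (zero  , p∈ , _))  = contradiction (shape-positive u p∈) ℕₚ.n≮0
    by-corner (inj₂ (suc x , x∈ , eq)) = at-corner x x∈ eq
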